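{- Let $N$ be a 3-connected matroid, let $L\subseteq E(N)$, and suppose that $M=N\oplus_2U_{2,4}^{L}$ is an excluded minor for the class of frame matroids. If $|L|\ge3$ then $M\cong N_9$.
   Context: Frame matroids are matroids of biased graphs (finite graph with balanced cycles such that no theta has exactly two balanced cycles; circuits: balanced cycles, two edge-disjoint unbalanced cycles sharing one vertex, two vertex-disjoint unbalanced cycles joined by a path, thetas with all cycles unbalanced). An excluded minor is a non-frame matroid all of whose proper minors are frame. For a matroid $N$ and $L\subseteq E(N)$, $N\oplus_2U_{2,4}^{L}$ is obtained by taking a 2-sum of a separate copy of $U_{2,4}$ on each element of $L$. $N_9=U_{2,3}\oplus_2U_{2,4}^{E(U_{2,3})}$. -}

module Defs where

open import Data.Nat using (ℕ; zero; suc; _+_; _≤_; _<_)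
open import Data.Bool using (Bool; true; false; if_then_else_)
open import Data.Fin using (Fin; _≟_)
open import Data.Fin.Subset public
  using (Subset; _∈_; _∉_; _⊆_; _∪_; _∩_; _─_; _-_; ∁; ⊤; ⊥; ∣_∣; Nonempty)
open import Data.Vec using (lookup; tabulate)
open import Data.List using (map; allFin)
open import Data.Nat.ListAction using (sum)
open import Data.Product using (Σ; ∃; ∃-syntax; _×_; _,_; proj₁; proj₂)
open import Data.Sum using (_⊎_)
open import Relation.Nullary using (¬_; does)
open import Relation.Binary.PropositionalEquality using (_≡_; _≢_)

infix 3 _⇔_
_⇔_ : Set → Set → Set
A ⇔ B = (A → B) × (B → A)

record Matroid (n : ℕ) : Set₁ where
  field
    Circuit   : Subset n → Set
    empty-not : ¬ Circuit ⊥
    incomp    : ∀ C D → Circuit C → Circuit D → C ⊆ D → C ≡ D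
    elim      : ∀ C D (e : Fin n) → Circuit C → Circuit D → C ≢ D →
                e ∈ C → e ∈ D → ∃[ F ] (Circuit F × F ⊆ ((C ∪ D) - e))

open Matroid public

UniformCircuit : {n : ℕ} (r : ℕ) → Subset n → Set
UniformCircuit r X = ∣ X ∣ ≡ suc r

Independent : {n : ℕ} → Matroid n → Subset n → Set
Independent M I = ∀ C → Circuit M C → ¬ (C ⊆ I)

IsRank : {n : ℕ} → Matroid n → Subset n → ℕ → Set
IsRank M X r =
  (∃[ I ] (I ⊆ X × Independent M I × ∣ I ∣ ≡ r)) ×
  (∀ I → I ⊆ X → Independent M I → ∣ I ∣ ≤ r)

-- M has a k-separation (X, E - X): |X|, |E - X| ≥ k and
-- λ(X) = r(X) + r(E - X) - r(M) < k
HasSeparation : {n : ℕ} → Matroid n → ℕ → Set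
HasSeparation M k = ∃[ X ] ∃[ rX ] ∃[ rY ] ∃[ rE ]
  (IsRank M X rX × IsRank M (∁ X) rY × IsRank M ⊤ rE ×
   k ≤ ∣ X ∣ × k ≤ ∣ ∁ X ∣ × rX + rY < rE + k)

ThreeConnected : {n : ℕ} → Matroid n → Set
ThreeConnected M = ¬ HasSeparation M 1 × ¬ HasSeparation M 2

-- Minors.  N (on Fin k) is (isomorphic to) a minor M \ D / T of M:
-- ι embeds E(N) into E(M), T (the contracted set) is disjoint from the
-- image, D is the rest; the circuits of M \ D / T are the minimal
-- nonempty sets of the form C - T with C a circuit of M avoiding D.

preimage : {k n : ℕ} → (Fin k → Fin n) → Subset n → Subset k
preimage ι Y = tabulate (λ i → lookup Y (ι i))

IsMinorOf : {k n : ℕ} → Matroid k → Matroid n → Set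
IsMinorOf {k} {n} N M =
  Σ (Fin k → Fin n) λ ι → Σ (Subset n) λ T →
    (∀ i j → ι i ≡ ι j → i ≡ j) ×
    (∀ i → ι i ∉ T) ×
    (∀ X → Circuit N X ⇔ MinNonempty ι T X)
  where
  Fam : (Fin k → Fin n) → Subset n → Subset k → Set
  Fam ι T X = ∃[ C ] (Circuit M C ×
                      (∀ j → j ∈ C → j ∈ T ⊎ ∃[ i ] (ι i ≡ j)) ×
                      X ≡ preimage ι (C ─ T))
  MinNonempty : (Fin k → Fin n) → Subset n → Subset k → Set
  MinNonempty ι T X = Nonempty X × Fam ι T X ×
                      (∀ Y → Fam ι T Y → Nonempty Y → Y ⊆ X → Y ≡ X)

Graph : ℕ → ℕ → Set
Graph v n = Fin n → Fin v × Fin v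

module _ {v n : ℕ} (G : Graph v n) where

  VertexOf : Subset n → Fin v → Set
  VertexOf S x = ∃[ e ] (e ∈ S × (proj₁ (G e) ≡ x ⊎ proj₂ (G e) ≡ x))

  private
    ind : Bool → ℕ
    ind true  = 1
    ind false = 0

  deg : Subset n → Fin v → ℕ
  deg S x = sum (map (λ e → if lookup S e
                             then ind (does (proj₁ (G e) ≟ x)) + ind (does (proj₂ (G e) ≟ x))
                             else 0)
                     (allFin n))

  Connected : Subset n → Set
  Connected S = ∀ S₁ S₂ → S₁ ∪ S₂ ≡ S → S₁ ∩ S₂ ≡ ⊥ → Nonempty S₁ → Nonempty S₂ →
                ∃[ x ] (VertexOf S₁ x × VertexOf S₂ x)

  IsCycle : Subset n → Set
  IsCycle S = Nonempty S × Connected S × (∀ x → deg S x ≡ 0 ⊎ deg S x ≡ 2)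

  IsPath : Fin v → Fin v → Subset n → Set
  IsPath u w S = u ≢ w × Nonempty S × Connected S × deg S u ≡ 1 × deg S w ≡ 1 ×
                 (∀ x → x ≢ u → x ≢ w → deg S x ≡ 0 ⊎ deg S x ≡ 2)

  InternallyDisjoint : Fin v → Fin v → Subset n → Subset n → Set
  InternallyDisjoint u w P Q = P ∩ Q ≡ ⊥ ×
    (∀ x → VertexOf P x → VertexOf Q x → x ≡ u ⊎ x ≡ w)

  -- theta: three internally disjoint u-w paths (u ≠ w); its cycles are
  -- P₁ ∪ P₂, P₁ ∪ P₃, P₂ ∪ P₃
  IsTheta : Fin v → Fin v → Subset n → Subset n → Subset n → Set
  IsTheta u w P₁ P₂ P₃ = IsPath u w P₁ × IsPath u w P₂ × IsPath u w P₃ ×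
    InternallyDisjoint u w P₁ P₂ × InternallyDisjoint u w P₁ P₃ ×
    InternallyDisjoint u w P₂ P₃

  IsBiased : (Subset n → Set) → Set
  IsBiased B = (∀ C → B C → IsCycle C) ×
    (∀ u w P₁ P₂ P₃ → IsTheta u w P₁ P₂ P₃ →
       B (P₁ ∪ P₂) → B (P₁ ∪ P₃) → ¬ B (P₂ ∪ P₃) → Data.Empty.⊥)
    where import Data.Empty

  FrameCircuit : (Subset n → Set) → Subset n → Set
  FrameCircuit B X =
      (IsCycle X × B X)
    ⊎ (∃[ C₁ ] ∃[ C₂ ] (IsCycle C₁ × IsCycle C₂ × ¬ B C₁ × ¬ B C₂ ×
         C₁ ∩ C₂ ≡ ⊥ ×
         (∃[ x ] (VertexOf C₁ x × VertexOf C₂ x ×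
                  (∀ y → VertexOf C₁ y → VertexOf C₂ y → y ≡ x))) ×
         X ≡ C₁ ∪ C₂))
    ⊎ (∃[ C₁ ] ∃[ C₂ ] ∃[ u ] ∃[ w ] ∃[ P ] (IsCycle C₁ × IsCycle C₂ × ¬ B C₁ × ¬ B C₂ ×
         (∀ y → VertexOf C₁ y → VertexOf C₂ y → Data.Empty.⊥) ×
         IsPath u w P × VertexOf C₁ u × VertexOf C₂ w ×
         (∀ y → VertexOf P y → VertexOf C₁ y → y ≡ u) ×
         (∀ y → VertexOf P y → VertexOf C₂ y → y ≡ w) ×
         X ≡ C₁ ∪ C₂ ∪ P))
    ⊎ (∃[ u ] ∃[ w ] ∃[ P₁ ] ∃[ P₂ ] ∃[ P₃ ] (IsTheta u w P₁ P₂ P₃ ×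
         ¬ B (P₁ ∪ P₂) × ¬ B (P₁ ∪ P₃) × ¬ B (P₂ ∪ P₃) ×
         X ≡ P₁ ∪ P₂ ∪ P₃))
    where import Data.Empty

IsFrame : {n : ℕ} → Matroid n → Set₁
IsFrame {n} M = Σ ℕ λ v → Σ (Graph v n) λ G → Σ (Subset n → Set) λ B →
  IsBiased G B × (∀ X → Circuit M X ⇔ FrameCircuit G B X)

ExcludedMinorFrame : {n : ℕ} → Matroid n → Set₁
ExcludedMinorFrame {n} M = ¬ IsFrame M ×
  (∀ k (N : Matroid k) → IsMinorOf N M → k < n → IsFrame N)

-- M ≅ N ⊕₂ U_{2,4}^L, where N has circuits CN on Fin k and M has
-- circuits CM on Fin m.  The ground set of N ⊕₂ U_{2,4}^L is
-- (E(N) - L) ⊔ (L × Fin 3): for e ∈ L the basepoint of the copy of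
-- U_{2,4} is identified with e, and the three remaining elements of
-- that copy are (e, 0), (e, 1), (e, 2).  The bijection with Fin m is
-- given by f₁ (on E(N) - L) and f₂ (on L × Fin 3).
-- Circuits of the iterated 2-sum: the triple {(e,0),(e,1),(e,2)} for
-- e ∈ L (circuit of U_{2,4} \ basepoint), and the sets obtained from a
-- circuit C of N by replacing each e ∈ C ∩ L by a 2-subset of its triple.

IsTwoSumU24 : {k m : ℕ} → (Subset k → Set) → Subset k → (Subset m → Set) → Set
IsTwoSumU24 {k} {m} CN L CM =
  Σ (Fin k → Fin m) λ f₁ → Σ (Fin k → Fin 3 → Fin m) λ f₂ →
    (∀ e e' → e ∉ L → e' ∉ L → f₁ e ≡ f₁ e' → e ≡ e') ×
    (∀ e e' i i' → e ∈ L → e' ∈ L → f₂ e i ≡ f₂ e' i' → e ≡ e' × i ≡ i') ×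
    (∀ e e' i → e ∉ L → e' ∈ L → f₁ e ≢ f₂ e' i) ×
    (∀ j → (∃[ e ] (e ∉ L × f₁ e ≡ j)) ⊎ (∃[ e ] ∃[ i ] (e ∈ L × f₂ e i ≡ j))) ×
    (∀ X → CM X ⇔
      ((∃[ e ] (e ∈ L × (∀ j → j ∈ X ⇔ (∃[ i ] (f₂ e i ≡ j)))))
       ⊎ (∃[ C ] (CN C ×
            (∀ e → e ∉ L → (f₁ e ∈ X ⇔ e ∈ C)) ×
            (∀ e → e ∈ L → e ∉ C → ∀ i → f₂ e i ∉ X) ×
            (∀ e → e ∈ L → e ∈ C →
               ∣ tabulate (λ i → lookup X (f₂ e i)) ∣ ≡ 2)))))

module Submission where

-- In a biased graph, the circuits are the balanced cycles together with the bicycles without balanced cycles, where a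
-- bicycle is a connected leafless edge set with one more edge than vertices.  Deleting a single element of one of the
-- copies of U₂,₄ from M leaves a frame matroid, and its representation constrains the triple left by each other copy.
-- If a circuit of N contains three elements of L and |E(N)| ≥ 4, then three such triples each demand extra degree in a
-- bicycle, whose excess degree is only two.  If no circuit contains three elements of L, delete one element over e ∈ L:
-- by 3-connectivity every other element of L gets a vertex of its own, and then Menger's theorem for two paths shows that
-- the two elements left over e span two vertices, one of which meets no other element.  Putting the deleted element back
-- on these two vertices represents M, a contradiction.  Hence |E(N)| = 3, and a six-element circuit of M gives N ≅ U₂,₃.

open import Defs
open import Data.Nat
open import Data.Nat.Properties
open import Data.Bool using (Bool; true; false; if_then_else_)
import Data.Bool.Properties as Bool
open import Data.Fin using (Fin; zero; suc; punchIn; punchOut) renaming (_≟_ to _≟F_)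
open import Data.Fin.Patterns using (0F; 1F; 2F)
open import Data.Fin.Properties using (any?; all?; punchIn-injective; punchInᵢ≢i; punchIn-punchOut)
open import Data.Fin.Subset using (⁅_⁆)
open import Data.Fin.Subset.Properties
  using (_∈?_; _⊆?_; ⊆-antisym; ⊆-refl; ⊆-trans; anySubset?; x∈p∪q⁺; x∈p∪q⁻; x∈p∩q⁺; x∈p∩q⁻;
         p⊆q⇒∣p∣≤∣q∣; p⊂q⇒∣p∣<∣q∣; nonempty?; ∉⊥; ∈⊤; ⊆⊤; x∈⁅x⁆; x∈⁅y⁆⇒x≡y; ∣⊥∣≡0; ∣⊤∣≡n;
         p─q⊆p; x∈p∧x∉q⇒x∈p─q; ∣p∣≤n; ∪-assoc; ∣∁p∣≡n∸∣p∣; x∈∁p⇒x∉p; x∉p⇒x∈∁p; ∣⁅x⁆∣≡1; ∣p∣≡n⇒p≡⊤)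
open import Data.Vec using (lookup; tabulate; insertAt; []; _∷_)
open import Data.Vec.Properties using ([]=⇒lookup; lookup⇒[]=; lookup∘tabulate)
import Data.Vec.Properties as Vec
open import Data.List using (allFin)
import Data.List as List
open import Data.List.Properties using (map-tabulate)
import Data.Nat.ListAction as ListAction
open import Data.Product using (Σ; ∃-syntax; _×_; _,_; proj₁; proj₂)
open import Data.Sum using (_⊎_; inj₁; inj₂; [_,_]′)
open import Data.Empty using (⊥-elim) renaming (⊥ to False)
open import Function using (_∘_; case_of_; id)
open import Relation.Nullary using (¬_; Dec; yes; no; ¬¬-excluded-middle)
open import Relation.Nullary.Decidable using (does; dec-true; dec-false; ¬?; _×-dec_; _⊎-dec_; _→-dec_; decidable-stable)
open import Relation.Binary.PropositionalEquality hiding ([_])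
open import Algebra.Properties.CommutativeMonoid.Sum +-0-commutativeMonoid
  using (sum-cong-≗; ∑-distrib-+; ∑-comm; sum-remove) renaming (sum to ∑)
open import Data.Nat.Tactic.RingSolver using (solve-∀)

-- Finite sums and subsets

-- A frame representation of a deletion of `M` enters only through `Represents`. Its class of
-- balanced cycles is not kept, because a cycle avoiding the deleted element is balanced exactly
-- when it is a circuit of `M`. What remains is a graph on which edges and vertices can be counted.
--
-- Such a graph says nothing about sets containing the deleted element. For this reason separations
-- of `N` are tested in `M` on independent sets that avoid every `f₂ g 0F`; these are still large
-- enough for the rank inequality.
--
-- No family of circuits is assumed to be decidable. Since most of the argument ends in `False`,
-- decidability of predicates on the finitely many subsets may be assumed there.
--
-- The cases of three and of more elements run through one argument. What it takes from
-- 3-connectivity, apart from the rank inequality, is collected in `Avoiding` and `Crossing`, which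
-- are proved separately in the two cases.

lin⊥ : ∀ {a b} c → a ≤ b → a ≡ suc (b + c) → False
lin⊥ {b = b} c a≤b refl = 1+n≰n (≤-trans (s≤s (m≤m+n b c)) a≤b)

∑-mono : ∀ {n} {f g : Fin n → ℕ} → (∀ i → f i ≤ g i) → ∑ f ≤ ∑ g
∑-mono {zero} h = z≤n
∑-mono {suc n} h = +-mono-≤ (h zero) (∑-mono (h ∘ suc))

∑-mono-< : ∀ {n} {f g : Fin n → ℕ} → (∀ i → f i ≤ g i) → ∀ i → f i < g i → ∑ f < ∑ g
∑-mono-< {suc n} h zero lt = +-mono-<-≤ lt (∑-mono (h ∘ suc))
∑-mono-< {suc n} h (suc i) lt = +-mono-≤-< (h zero) (∑-mono-< (h ∘ suc) i lt)

∑-tight : ∀ {n} {f g : Fin n → ℕ} → (∀ i → f i ≤ g i) → ∑ g ≤ ∑ f → ∀ i → f i ≡ g i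
∑-tight h le i with m≤n⇒m<n∨m≡n (h i)
... | inj₁ lt = ⊥-elim (<⇒≱ (∑-mono-< h i lt) le)
... | inj₂ eq = eq

∑-pigeonhole : ∀ {n} {f g : Fin n → ℕ} → ∑ f < ∑ g → ∃[ i ] f i < g i
∑-pigeonhole {n} {f} {g} lt with any? (λ i → f i <? g i)
... | yes p = p
... | no ¬p = ⊥-elim (<⇒≱ lt (∑-mono λ i → ≮⇒≥ λ q → ¬p (i , q)))

∑-zero : ∀ n → ∑ {n} (λ _ → 0) ≡ 0
∑-zero zero = refl
∑-zero (suc n) = ∑-zero n

∑-*ˡ : ∀ {n} k (f : Fin n → ℕ) → ∑ (λ i → k * f i) ≡ k * ∑ f
∑-*ˡ {zero} k f = sym (*-zeroʳ k)
∑-*ˡ {suc n} k f = trans (cong (k * f zero +_) (∑-*ˡ k (f ∘ suc))) (sym (*-distribˡ-+ k (f zero) _))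

δ : ∀ {v} → Fin v → Fin v → ℕ
δ a b = if does (a ≟F b) then 1 else 0

δ-refl : ∀ {v} (a : Fin v) → δ a a ≡ 1
δ-refl a rewrite dec-true (a ≟F a) refl = refl

δ-≢ : ∀ {v} {a b : Fin v} → a ≢ b → δ a b ≡ 0
δ-≢ {a = a} {b} ne rewrite dec-false (a ≟F b) ne = refl

δ≤1 : ∀ {v} (a b : Fin v) → δ a b ≤ 1
δ≤1 a b with does (a ≟F b)
... | true = ≤-refl
... | false = z≤n

δ-pos : ∀ {v} {a b : Fin v} → 1 ≤ δ a b → a ≡ b
δ-pos {a = a} {b} h with a ≟F b
... | yes p = p

∑δ : ∀ {v} (a : Fin v) → ∑ (δ a) ≡ 1
∑δ {suc v} zero = cong suc (∑-zero v)
∑δ {suc v} (suc a) = ∑δ a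

∑-point : ∀ {n} (a : Fin n) (F : Fin n → ℕ) → ∑ (λ j → δ a j * F j) ≡ F a
∑-point {suc n} zero F = trans (cong₂ _+_ (+-identityʳ _) (∑-zero n)) (+-identityʳ _)
∑-point {suc n} (suc a) F = ∑-point a (F ∘ suc)

∑-two-terms : ∀ {n} (F : Fin n → ℕ) {a b} → a ≢ b → F a + F b ≤ ∑ F
∑-two-terms F {a} {b} ne = ≤-trans (≤-reflexive (sym (trans (∑-distrib-+ (λ j → δ a j * F j) (λ j → δ b j * F j)) (cong₂ _+_ (∑-point a F) (∑-point b F))))) (∑-mono pointwise)
  where
  pointwise : ∀ j → δ a j * F j + δ b j * F j ≤ F j
  pointwise j with a ≟F j | b ≟F j
  ... | yes refl | yes refl = ⊥-elim (ne refl)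
  ... | yes refl | no _ = ≤-reflexive (trans (+-identityʳ _) (+-identityʳ _))
  ... | no _ | yes refl = ≤-reflexive (+-identityʳ _)
  ... | no _ | no _ = z≤n

sum-allFin : ∀ {n} (f : Fin n → ℕ) → ListAction.sum (List.map f (allFin n)) ≡ ∑ f
sum-allFin {zero} f = refl
sum-allFin {suc n} f = cong (f zero +_) (trans (cong ListAction.sum shift) (sum-allFin (f ∘ suc)))
  where
  shift : List.map f (List.tabulate suc) ≡ List.map (f ∘ suc) (allFin n)
  shift = trans (map-tabulate suc f) (sym (map-tabulate id (f ∘ suc)))

-- Characteristic functions, cardinalities and extremal subsets

χ : ∀ {n} → Subset n → Fin n → ℕ
χ S e = if lookup S e then 1 else 0

χ-∈ : ∀ {n} {S : Subset n} {e} → e ∈ S → χ S e ≡ 1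
χ-∈ p rewrite []=⇒lookup p = refl

χ-∉ : ∀ {n} {S : Subset n} {e} → e ∉ S → χ S e ≡ 0
χ-∉ {S = S} {e} p with lookup S e in eq
... | true = ⊥-elim (p (lookup⇒[]= e S eq))
... | false = refl

χ-pos : ∀ {n} {S : Subset n} {e} → 1 ≤ χ S e → e ∈ S
χ-pos {S = S} {e} h with lookup S e in eq
... | true = lookup⇒[]= e S eq

card : ∀ {n} (S : Subset n) → ∣ S ∣ ≡ ∑ (χ S)
card [] = refl
card (true ∷ S) = cong suc (card S)
card (false ∷ S) = card S

opaque
  ⟦_⟧ : ∀ {n} {P : Fin n → Set} → (∀ i → Dec (P i)) → Subset n
  ⟦ P? ⟧ = tabulate (does ∘ P?)

  ∈⟦⟧⁺ : ∀ {n} {P : Fin n → Set} (P? : ∀ i → Dec (P i)) {i} → P i → i ∈ ⟦ P? ⟧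
  ∈⟦⟧⁺ P? {i} p = lookup⇒[]= i _ (trans (lookup∘tabulate _ i) (dec-true (P? i) p))

  ∈⟦⟧⁻ : ∀ {n} {P : Fin n → Set} (P? : ∀ i → Dec (P i)) {i} → i ∈ ⟦ P? ⟧ → P i
  ∈⟦⟧⁻ P? {i} m with P? i | trans (sym (lookup∘tabulate (does ∘ P?) i)) ([]=⇒lookup m)
  ... | yes p | _ = p

infixl 5 _∖_
opaque
  _∖_ : ∀ {n} → Subset n → Subset n → Subset n
  A ∖ B = ⟦ (λ i → (i ∈? A) ×-dec ¬? (i ∈? B)) ⟧

  ∈∖⁺ : ∀ {n} {A B : Subset n} {i} → i ∈ A → i ∉ B → i ∈ A ∖ B
  ∈∖⁺ {A = A} {B} a b = ∈⟦⟧⁺ (λ i → (i ∈? A) ×-dec ¬? (i ∈? B)) (a , b)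

  ∈∖⁻ : ∀ {n} {A B : Subset n} {i} → i ∈ A ∖ B → i ∈ A × i ∉ B
  ∈∖⁻ {A = A} {B} = ∈⟦⟧⁻ (λ i → (i ∈? A) ×-dec ¬? (i ∈? B))

∖⊆ : ∀ {n} {A B : Subset n} → A ∖ B ⊆ A
∖⊆ = proj₁ ∘ ∈∖⁻

∪⊆ : ∀ {n} {A B C : Subset n} → A ⊆ C → B ⊆ C → A ∪ B ⊆ C
∪⊆ {A = A} {B} f g m = [ f , g ]′ (x∈p∪q⁻ A B m)

∪ˡ : ∀ {n} {A B : Subset n} {e} → e ∈ A → e ∈ A ∪ B
∪ˡ = x∈p∪q⁺ ∘ inj₁

∪ʳ : ∀ {n} {A B : Subset n} {e} → e ∈ B → e ∈ A ∪ B
∪ʳ = x∈p∪q⁺ ∘ inj₂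

Disjoint : ∀ {n} → Subset n → Subset n → Set
Disjoint A B = ∀ {e} → e ∈ A → e ∉ B

Disjoint⇒∩≡⊥ : ∀ {n} {A B : Subset n} → Disjoint A B → A ∩ B ≡ ⊥
Disjoint⇒∩≡⊥ {A = A} {B} d =
  ⊆-antisym (λ m → let (a , b) = x∈p∩q⁻ A B m in ⊥-elim (d a b)) (λ m → ⊥-elim (∉⊥ m))

∩≡⊥⇒Disjoint : ∀ {n} {A B : Subset n} → A ∩ B ≡ ⊥ → Disjoint A B
∩≡⊥⇒Disjoint {A = A} {B} eq a b = ∉⊥ (subst (_ ∈_) eq (x∈p∩q⁺ (a , b)))

∖-disjoint : ∀ {n} {A B : Subset n} → Disjoint A (B ∖ A)
∖-disjoint a m = proj₂ (∈∖⁻ m) a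

∪∖ : ∀ {n} {A B : Subset n} → A ⊆ B → A ∪ (B ∖ A) ≡ B
∪∖ {A = A} {B} A⊆B = ⊆-antisym (∪⊆ A⊆B ∖⊆) λ {e} m → case e ∈? A of λ where
  (yes p) → ∪ˡ p
  (no p) → ∪ʳ (∈∖⁺ m p)

χ-∪ : ∀ {n} {A B : Subset n} → Disjoint A B → ∀ e → χ (A ∪ B) e ≡ χ A e + χ B e
χ-∪ {A = A} {B} d e with e ∈? A | e ∈? B
... | yes a | yes b = ⊥-elim (d a b)
... | yes a | no b rewrite χ-∈ (∪ˡ {A = A} {B} a) | χ-∈ a | χ-∉ b = refl
... | no a | yes b rewrite χ-∈ (∪ʳ {A = A} {B} b) | χ-∉ a | χ-∈ b = refl
... | no a | no b rewrite χ-∉ {S = A ∪ B} (λ m → [ a , b ]′ (x∈p∪q⁻ A B m)) | χ-∉ a | χ-∉ b = refl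

card-∪ : ∀ {n} {A B : Subset n} → Disjoint A B → ∣ A ∪ B ∣ ≡ ∣ A ∣ + ∣ B ∣
card-∪ {A = A} {B} d = begin
  ∣ A ∪ B ∣                ≡⟨ card (A ∪ B) ⟩
  ∑ (χ (A ∪ B))            ≡⟨ sum-cong-≗ (χ-∪ d) ⟩
  ∑ (λ e → χ A e + χ B e)  ≡⟨ ∑-distrib-+ (χ A) (χ B) ⟩
  ∑ (χ A) + ∑ (χ B)        ≡⟨ cong₂ _+_ (sym (card A)) (sym (card B)) ⟩
  ∣ A ∣ + ∣ B ∣            ∎
  where open ≡-Reasoning

card-∖ : ∀ {n} {A B : Subset n} → A ⊆ B → ∣ B ∣ ≡ ∣ A ∣ + ∣ B ∖ A ∣
card-∖ {A = A} A⊆B = trans (cong ∣_∣ (sym (∪∖ A⊆B))) (card-∪ (∖-disjoint {A = A}))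

card-pos : ∀ {n} {S : Subset n} → Nonempty S → 1 ≤ ∣ S ∣
card-pos {S = S} (e , m) = ≤-trans (≤-reflexive (sym (∣⁅x⁆∣≡1 e)))
  (p⊆q⇒∣p∣≤∣q∣ λ k → subst (_∈ S) (sym (x∈⁅y⁆⇒x≡y e k)) m)

empty-card : ∀ {n} {S : Subset n} → ¬ Nonempty S → ∣ S ∣ ≡ 0
empty-card {n} {S} ne = trans (cong ∣_∣ {S} {⊥} (⊆-antisym (λ m → ⊥-elim (ne (_ , m))) (λ m → ⊥-elim (∉⊥ m)))) (∣⊥∣≡0 n)

opaque
  _≟S_ : ∀ {n} (A B : Subset n) → Dec (A ≡ B)
  _≟S_ = Vec.≡-dec Bool._≟_

  ⊈-witness : ∀ {n} {A B : Subset n} → ¬ (A ⊆ B) → ∃[ e ] (e ∈ A × e ∉ B)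
  ⊈-witness {A = A} {B} h with any? (λ e → (e ∈? A) ×-dec ¬? (e ∈? B))
  ... | yes p = p
  ... | no ¬p = ⊥-elim (h λ {e} m → decidable-stable (e ∈? B) λ k → ¬p (e , m , k))

  proper : ∀ {n} {A B : Subset n} → A ⊆ B → A ≢ B → ∃[ e ] (e ∈ B × e ∉ A)
  proper s ne = ⊈-witness λ s' → ne (⊆-antisym s s')

  proper-card : ∀ {n} {A B : Subset n} → A ⊆ B → A ≢ B → ∣ A ∣ < ∣ B ∣
  proper-card s ne = p⊂q⇒∣p∣<∣q∣ (s , proper s ne)

  minimal-subset : ∀ {n} {P : Subset n → Set} → (∀ X → Dec (P X)) → ∀ S → P S →
    ∃[ Y ] (Y ⊆ S × P Y × (∀ Z → Z ⊆ Y → P Z → Z ≡ Y))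
  minimal-subset {n} {P} P? S₀ p₀ = go _ S₀ ≤-refl p₀
    where
    go : ∀ k S → ∣ S ∣ ≤ k → P S → ∃[ Y ] (Y ⊆ S × P Y × (∀ Z → Z ⊆ Y → P Z → Z ≡ Y))
    go k S le p with anySubset? (λ Z → (Z ⊆? S) ×-dec P? Z ×-dec ¬? (Z ≟S S))
    ... | no ¬q = S , ⊆-refl , p , λ Z s pz → decidable-stable (Z ≟S S) λ ne → ¬q (Z , s , pz , ne)
    go zero S le p | yes (Z , s , pz , ne) = ⊥-elim (<⇒≱ (proper-card s ne) (≤-trans le z≤n))
    go (suc k) S le p | yes (Z , s , pz , ne) =
      let (Y , sY , r) = go k Z (≤-pred (≤-trans (proper-card s ne) le)) pz in Y , ⊆-trans sY s , r

  largest-subset : ∀ {n} {P : Subset n → Set} → (∀ X → Dec (P X)) → ∀ S → P S →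
    ∃[ Y ] (P Y × (∀ Z → P Z → ∣ Z ∣ ≤ ∣ Y ∣))
  largest-subset {n} {P} P? S₀ p₀ = go n S₀ (m≤m+n n _) p₀
    where
    go : ∀ k S → n ≤ k + ∣ S ∣ → P S → ∃[ Y ] (P Y × (∀ Z → P Z → ∣ Z ∣ ≤ ∣ Y ∣))
    go k S le p with anySubset? (λ Z → P? Z ×-dec (∣ S ∣ <? ∣ Z ∣))
    ... | no ¬q = S , p , λ Z pz → ≮⇒≥ λ lt → ¬q (Z , pz , lt)
    go zero S le p | yes (Z , pz , lt) = ⊥-elim (<⇒≱ lt (≤-trans (∣p∣≤n Z) le))
    go (suc k) S le p | yes (Z , pz , lt) = go k Z (≤-trans le (≤-trans (≤-reflexive (sym (+-suc k _))) (+-monoʳ-≤ k lt))) pz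

  -- Excluded middle is used once for each of the finitely many subsets. A proof of `False` may
  -- therefore treat any predicate on subsets as decidable.
  ¬¬-decidable : ∀ {n} (P : Subset n → Set) → ¬ ¬ (∀ X → Dec (P X))
  ¬¬-decidable {zero} P k = ¬¬-excluded-middle λ d → k λ { [] → d }
  ¬¬-decidable {suc n} P k = ¬¬-decidable (P ∘ (true ∷_)) λ d₁ → ¬¬-decidable (P ∘ (false ∷_)) λ d₀ →
    k λ { (true ∷ X) → d₁ X ; (false ∷ X) → d₀ X }

-- Counting edges against vertices

sg : ℕ → ℕ
sg zero = 0
sg (suc _) = 1

sg≤1 : ∀ k → sg k ≤ 1
sg≤1 zero = z≤n
sg≤1 (suc k) = ≤-refl

sg-pos : ∀ {k} → 1 ≤ k → sg k ≡ 1
sg-pos (s≤s _) = refl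

sg-mono : ∀ {a b} → a ≤ b → sg a ≤ sg b
sg-mono z≤n = z≤n
sg-mono (s≤s _) = ≤-refl

1≰⇒≡0 : ∀ {k} → ¬ (1 ≤ k) → k ≡ 0
1≰⇒≡0 {zero} h = refl
1≰⇒≡0 {suc k} h = ⊥-elim (h (s≤s z≤n))

one-of : ∀ {v} {z u w : Fin v} → (z ≢ u → z ≢ w → False) → z ≡ u ⊎ z ≡ w
one-of {z = z} {u} {w} h with z ≟F u | z ≟F w
... | yes e | _ = inj₁ e
... | no _ | yes e = inj₂ e
... | no a | no b = ⊥-elim (h a b)

module Counting {v n : ℕ} (G : Graph v n) where

  opaque
    inc : Fin n → Fin v → ℕ
    inc e x = δ (proj₁ (G e)) x + δ (proj₂ (G e)) x

    inc≡ : ∀ e x → inc e x ≡ δ (proj₁ (G e)) x + δ (proj₂ (G e)) x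
    inc≡ e x = refl

    d : Subset n → Fin v → ℕ
    d = deg G

    d≡deg : ∀ S x → d S x ≡ deg G S x
    d≡deg S x = refl

  -- The edge weights inside deg involve a private function of Defs; they are recovered by unification.
  module _ (S : Subset n) (x : Fin v) where
    private
      weights : Σ (Fin n → ℕ) λ f → deg G S x ≡ ListAction.sum (List.map f (allFin n))
      weights = _ , refl

      weight : ∀ e → proj₁ weights e ≡ χ S e * (δ (proj₁ (G e)) x + δ (proj₂ (G e)) x)
      weight e with lookup S e | does (proj₁ (G e) ≟F x) | does (proj₂ (G e) ≟F x)
      ... | false | _ | _ = refl
      ... | true | false | false = refl
      ... | true | false | true = refl
      ... | true | true | false = refl
      ... | true | true | true = refl

    deg≡ : d S x ≡ ∑ (λ e → χ S e * inc e x)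
    deg≡ = trans (d≡deg S x) (trans (sum-allFin (proj₁ weights))
      (sum-cong-≗ λ e → trans (weight e) (cong (χ S e *_) (sym (inc≡ e x)))))

  V : Subset n → Fin v → Set
  V S x = 1 ≤ d S x

  V? : ∀ S x → Dec (V S x)
  V? S x = 1 ≤? d S x

  nv : Subset n → ℕ
  nv S = ∑ (λ x → sg (d S x))

  VDisjoint : Subset n → Subset n → Set
  VDisjoint A B = ∀ x → V A x → ¬ V B x

  -- An edge count in place of the absence of cycles: by `cycle-in` and `cycle-card` a set fails the
  -- condition exactly when it contains a cycle.
  Forest : Subset n → Set
  Forest S = ∀ Z → Z ⊆ S → Nonempty Z → ∣ Z ∣ < nv Z

  NoLeaf : Subset n → Set
  NoLeaf S = ∀ x → d S x ≢ 1

  Bicycle : Subset n → Set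
  Bicycle X = Connected G X × NoLeaf X × ∣ X ∣ ≡ suc (nv X)

  opaque
    deg-∪ : ∀ {A B} → Disjoint A B → ∀ x → d (A ∪ B) x ≡ d A x + d B x
    deg-∪ {A} {B} dis x = begin
      d (A ∪ B) x                                         ≡⟨ deg≡ (A ∪ B) x ⟩
      ∑ (λ e → χ (A ∪ B) e * inc e x)                     ≡⟨ sum-cong-≗ (λ e → trans (cong (_* inc e x) (χ-∪ dis e)) (*-distribʳ-+ (inc e x) (χ A e) (χ B e))) ⟩
      ∑ (λ e → χ A e * inc e x + χ B e * inc e x)         ≡⟨ ∑-distrib-+ (λ e → χ A e * inc e x) (λ e → χ B e * inc e x) ⟩
      ∑ (λ e → χ A e * inc e x) + ∑ (λ e → χ B e * inc e x) ≡⟨ sym (cong₂ _+_ (deg≡ A x) (deg≡ B x)) ⟩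
      d A x + d B x                                       ∎
      where open ≡-Reasoning

    deg-split : ∀ {A S} → A ⊆ S → ∀ x → d S x ≡ d A x + d (S ∖ A) x
    deg-split {A} {S} A⊆S x = trans (cong (λ T → d T x) (sym (∪∖ A⊆S))) (deg-∪ (∖-disjoint {A = A}) x)

    deg-mono : ∀ {A S} → A ⊆ S → ∀ x → d A x ≤ d S x
    deg-mono A⊆S x = ≤-trans (m≤m+n _ _) (≤-reflexive (sym (deg-split A⊆S x)))

    deg-pos : ∀ {S x} → V S x → ∃[ e ] (e ∈ S × 1 ≤ inc e x)
    deg-pos {S} {x} p
      with ∑-pigeonhole {f = λ _ → 0} {g = λ e → χ S e * inc e x}
             (≤-trans (s≤s (≤-reflexive (∑-zero n))) (≤-trans p (≤-reflexive (deg≡ S x))))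
    ... | e , q with χ S e in eq | inc e x in eq'
    ... | suc a | suc b = e , χ-pos {S = S} (subst (1 ≤_) (sym eq) (s≤s z≤n)) , subst (1 ≤_) (sym eq') (s≤s z≤n)
    ... | suc a | zero = ⊥-elim (n≮n 0 (≤-trans q (≤-reflexive (*-zeroʳ (suc a)))))

    deg-⁅⁆ : ∀ e x → d ⁅ e ⁆ x ≡ inc e x
    deg-⁅⁆ e x = trans (deg≡ ⁅ e ⁆ x) (go e (λ i → inc i x))
      where
      go : ∀ {m} (e : Fin m) (f : Fin m → ℕ) → ∑ (λ i → χ ⁅ e ⁆ i * f i) ≡ f e
      go {suc m} zero f = trans (cong₂ _+_ (+-identityʳ (f zero)) (trans (sum-cong-≗ (λ i → cong (_* f (suc i)) (χ-∉ {S = ⊥} (∉⊥ {x = i})))) (∑-zero m))) (+-identityʳ _)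
      go (suc e) f = go e (f ∘ suc)

    ⁅⁆⊆ : ∀ {e} {S : Subset n} → e ∈ S → ⁅ e ⁆ ⊆ S
    ⁅⁆⊆ {e} {S} m k = subst (_∈ S) (sym (x∈⁅y⁆⇒x≡y e k)) m

    deg-∈ : ∀ {e S} → e ∈ S → ∀ x → d S x ≡ inc e x + d (S ∖ ⁅ e ⁆) x
    deg-∈ {e} {S} m x = trans (deg-split (⁅⁆⊆ m) x) (cong (_+ d (S ∖ ⁅ e ⁆) x) (deg-⁅⁆ e x))

    deg-inc : ∀ {e S} → e ∈ S → ∀ x → inc e x ≤ d S x
    deg-inc m x = ≤-trans (m≤m+n _ _) (≤-reflexive (sym (deg-∈ m x)))

    inc-sum : ∀ e → ∑ (inc e) ≡ 2
    inc-sum e = trans (sum-cong-≗ (inc≡ e)) (trans (∑-distrib-+ (δ (proj₁ (G e))) (δ (proj₂ (G e)))) (cong₂ _+_ (∑δ (proj₁ (G e))) (∑δ (proj₂ (G e)))))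

    inc-end : ∀ {e x} → proj₁ (G e) ≡ x ⊎ proj₂ (G e) ≡ x → 1 ≤ inc e x
    inc-end {e} {x} h = ≤-trans (end h) (≤-reflexive (sym (inc≡ e x)))
      where
      end : proj₁ (G e) ≡ x ⊎ proj₂ (G e) ≡ x → 1 ≤ δ (proj₁ (G e)) x + δ (proj₂ (G e)) x
      end (inj₁ refl) = ≤-trans (≤-reflexive (sym (δ-refl x))) (m≤m+n _ _)
      end (inj₂ refl) = ≤-trans (≤-reflexive (sym (δ-refl x))) (m≤n+m _ (δ (proj₁ (G e)) x))

    inc-touch : ∀ {e x} → 1 ≤ inc e x → proj₁ (G e) ≡ x ⊎ proj₂ (G e) ≡ x
    inc-touch {e} {x} h with proj₁ (G e) ≟F x | ≤-trans h (≤-reflexive (inc≡ e x))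
    ... | yes q | _ = inj₁ q
    ... | no q | h' = inj₂ (δ-pos h')

    inc-ends : ∀ {e x y z} → x ≢ y → 1 ≤ inc e x → 1 ≤ inc e y → 1 ≤ inc e z → z ≡ x ⊎ z ≡ y
    inc-ends ne p q r with inc-touch p | inc-touch q | inc-touch r
    ... | inj₁ refl | inj₁ refl | _ = ⊥-elim (ne refl)
    ... | inj₂ refl | inj₂ refl | _ = ⊥-elim (ne refl)
    ... | inj₁ refl | inj₂ refl | inj₁ refl = inj₁ refl
    ... | inj₁ refl | inj₂ refl | inj₂ refl = inj₂ refl
    ... | inj₂ refl | inj₁ refl | inj₁ refl = inj₂ refl
    ... | inj₂ refl | inj₁ refl | inj₂ refl = inj₁ refl

    inc-vertex : ∀ e → ∃[ x ] 1 ≤ inc e x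
    inc-vertex e = proj₁ (G e) , inc-end (inj₁ refl)

    nonempty-vertex : ∀ {S} → Nonempty S → ∃[ x ] V S x
    nonempty-vertex (e , m) = let (x , p) = inc-vertex e in x , ≤-trans p (deg-inc m x)

    handshake : ∀ S → ∑ (d S) ≡ 2 * ∣ S ∣
    handshake S = begin
      ∑ (d S)                                   ≡⟨ sum-cong-≗ (deg≡ S) ⟩
      ∑ (λ x → ∑ (λ e → χ S e * inc e x))       ≡⟨ ∑-comm (λ x e → χ S e * inc e x) ⟩
      ∑ (λ e → ∑ (λ x → χ S e * inc e x))       ≡⟨ sum-cong-≗ (λ e → trans (∑-*ˡ (χ S e) (inc e)) (trans (cong (χ S e *_) (inc-sum e)) (*-comm (χ S e) 2))) ⟩
      ∑ (λ e → 2 * χ S e)                       ≡⟨ ∑-*ˡ 2 (χ S) ⟩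
      2 * ∑ (χ S)                               ≡⟨ cong (2 *_) (sym (card S)) ⟩
      2 * ∣ S ∣                                 ∎
      where open ≡-Reasoning

    nv-mono-V : ∀ {A B} → (∀ x → V A x → V B x) → nv A ≤ nv B
    nv-mono-V {A} {B} h = ∑-mono pointwise
      where
      pointwise : ∀ x → sg (d A x) ≤ sg (d B x)
      pointwise x with V? A x
      ... | yes p = ≤-trans (≤-reflexive (sg-pos p)) (≤-reflexive (sym (sg-pos (h x p))))
      ... | no p = subst (λ k → sg k ≤ sg (d B x)) (sym (1≰⇒≡0 p)) z≤n

    V-mono : ∀ {A B} → A ⊆ B → ∀ x → V A x → V B x
    V-mono s x p = ≤-trans p (deg-mono s x)

    nv-mono : ∀ {A B} → A ⊆ B → nv A ≤ nv B
    nv-mono s = nv-mono-V (V-mono s)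

    V-∪ : ∀ {A B x} → V (A ∪ B) x → V A x ⊎ V B x
    V-∪ {A} {B} {x} p =
      let (e , m , q) = deg-pos p
      in [ (λ a → inj₁ (≤-trans q (deg-inc a x))) , (λ b → inj₂ (≤-trans q (deg-inc b x))) ]′ (x∈p∪q⁻ A B m)

    V⇒nonempty : ∀ {S x} → V S x → Nonempty S
    V⇒nonempty p = let (e , m , _) = deg-pos p in e , m

    V-∪ˡ : ∀ {A B x} → V A x → V (A ∪ B) x
    V-∪ˡ {A} {B} = V-mono (∪ˡ {B = B}) _

    V-∪ʳ : ∀ {A B x} → V B x → V (A ∪ B) x
    V-∪ʳ {A} {B} = V-mono (∪ʳ {A = A}) _

    -- `C` and `I` stand for a union and a common part. Only their vertices matter, so the
    -- inequality also applies when no edge is shared.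
    nv-submodular : ∀ {A B C I} → (∀ x → V C x → V A x ⊎ V B x) → (∀ x → V I x → V A x × V B x) →
      nv C + nv I ≤ nv A + nv B
    nv-submodular {A} {B} {C} {I} h k =
      subst₂ _≤_ (∑-distrib-+ (sg ∘ d C) (sg ∘ d I)) (∑-distrib-+ (sg ∘ d A) (sg ∘ d B)) (∑-mono pointwise)
      where
      pointwise : ∀ x → sg (d C x) + sg (d I x) ≤ sg (d A x) + sg (d B x)
      pointwise x with V? I x
      ... | yes p rewrite sg-pos (proj₁ (k x p)) | sg-pos (proj₂ (k x p)) = +-mono-≤ (sg≤1 (d C x)) (sg≤1 (d I x))
      ... | no p rewrite 1≰⇒≡0 p | +-identityʳ (sg (d C x)) with V? C x
      ...   | no q rewrite 1≰⇒≡0 q = z≤n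
      ...   | yes q with h x q
      ...     | inj₁ a rewrite sg-pos a = ≤-trans (sg≤1 _) (s≤s z≤n)
      ...     | inj₂ b rewrite sg-pos b = ≤-trans (sg≤1 _) (m≤n+m 1 _)

    nv-∪ : ∀ A B → nv (A ∪ B) ≤ nv A + nv B
    nv-∪ A B = ≤-trans (m≤m+n _ _) (nv-submodular {A} {B} {A ∪ B} {⊥} (λ x → V-∪)
      λ x p → ⊥-elim (∉⊥ (proj₁ (proj₂ (deg-pos {⊥} {x} p)))))

    nv≡2-ends : ∀ {S w} → nv S ≡ 2 → V S w → ∃[ p ] (p ≢ w × V S p × (∀ x → V S x → x ≡ w ⊎ x ≡ p))
    nv≡2-ends {S} {w} two pw =
      let (p , lt) = ∑-pigeonhole {f = δ w} {g = λ x → sg (d S x)} (≤-reflexive (trans (cong suc (∑δ w)) (sym two)))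
          p≢w : p ≢ w
          p≢w eq = <⇒≱ lt (≤-trans (sg≤1 (d S p)) (≤-reflexive (sym (trans (cong (δ w) eq) (δ-refl w)))))
          pp : V S p
          pp = ≮⇒≥ λ z → n≮0 (≤-trans lt (≤-reflexive (cong sg (n≤0⇒n≡0 (≤-pred z)))))
      in p , p≢w , pp , λ x px → one-of λ a b → <⇒≱ (three a b p≢w px pp) (≤-reflexive two)
      where
      three : ∀ {x p} → x ≢ w → x ≢ p → p ≢ w → V S x → V S p → 3 ≤ nv S
      three {x} {p} a b c px pp = subst (_≤ nv S)
        (trans (∑-distrib-+ (λ z → δ w z + δ p z) (δ x)) (cong₂ _+_ (trans (∑-distrib-+ (δ w) (δ p)) (cong₂ _+_ (∑δ w) (∑δ p))) (∑δ x)))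
        (∑-mono pointwise)
        where
        pointwise : ∀ z → δ w z + δ p z + δ x z ≤ sg (d S z)
        pointwise z with w ≟F z | p ≟F z | x ≟F z
        ... | yes refl | yes refl | _ = ⊥-elim (c refl)
        ... | yes refl | no _ | yes refl = ⊥-elim (a refl)
        ... | no _ | yes refl | yes refl = ⊥-elim (b refl)
        ... | yes refl | no _ | no _ rewrite sg-pos pw = ≤-refl
        ... | no _ | yes refl | no _ rewrite sg-pos pp = ≤-refl
        ... | no _ | no _ | yes refl rewrite sg-pos px = ≤-refl
        ... | no _ | no _ | no _ = z≤n

    VDisjoint⇒Disjoint : ∀ {A B} → VDisjoint A B → Disjoint A B
    VDisjoint⇒Disjoint h {e} a b =
      let (x , p) = inc-vertex e in h x (≤-trans p (deg-inc a x)) (≤-trans p (deg-inc b x))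

    nv-VDisjoint : ∀ {A B C} → VDisjoint A B → (∀ x → V A x ⊎ V B x → V C x) → nv A + nv B ≤ nv C
    nv-VDisjoint {A} {B} {C} dis h =
      subst (_≤ nv C) (∑-distrib-+ (sg ∘ d A) (sg ∘ d B)) (∑-mono pointwise)
      where
      pointwise : ∀ x → sg (d A x) + sg (d B x) ≤ sg (d C x)
      pointwise x with V? A x
      ... | yes p rewrite 1≰⇒≡0 (dis x p) | sg-pos (h x (inj₁ p)) | +-identityʳ (sg (d A x)) = sg≤1 _
      ... | no p rewrite 1≰⇒≡0 p with V? B x
      ...   | yes q rewrite sg-pos (h x (inj₂ q)) = sg≤1 _
      ...   | no q rewrite 1≰⇒≡0 q = z≤n

    nv-extra : ∀ {A B} → (∀ x → V A x → V B x) → ∀ y → ¬ V A y → V B y → nv A < nv B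
    nv-extra {A} {B} h y na b = ∑-mono-< pointwise y strict
      where
      pointwise : ∀ x → sg (d A x) ≤ sg (d B x)
      pointwise x with V? A x
      ... | yes p = ≤-trans (≤-reflexive (sg-pos p)) (≤-reflexive (sym (sg-pos (h x p))))
      ... | no p = subst (λ k → sg k ≤ sg (d B x)) (sym (1≰⇒≡0 p)) z≤n
      strict : sg (d A y) < sg (d B y)
      strict rewrite 1≰⇒≡0 na | sg-pos b = ≤-refl

    nv-add-edge : ∀ {I f x y} → f ∉ I → x ≢ y → V I x → 1 ≤ inc f x → 1 ≤ inc f y → nv (I ∪ ⁅ f ⁆) ≤ suc (nv I)
    nv-add-edge {I} {f} {x} {y} f∉I x≢y px fx fy =
      ≤-trans (∑-mono pointwise) (≤-reflexive (trans (∑-distrib-+ (λ z → sg (d I z)) (δ y)) (trans (cong (nv I +_) (∑δ y)) (+-comm (nv I) 1))))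
      where
      ends : ∀ {z} → z ≢ y → V (I ∪ ⁅ f ⁆) z → V I z
      ends {z} ne p = [ id , (λ q → [ (λ { refl → px }) , (λ { refl → ⊥-elim (ne refl) }) ]′ (inc-ends x≢y fx fy (≤-trans q (≤-reflexive (deg-⁅⁆ f z))))) ]′ (V-∪ p)
      pointwise : ∀ z → sg (d (I ∪ ⁅ f ⁆) z) ≤ sg (d I z) + δ y z
      pointwise z with y ≟F z | V? (I ∪ ⁅ f ⁆) z
      ... | yes refl | _ = ≤-trans (sg≤1 _) (m≤n+m 1 _)
      ... | no _ | no q = ≤-trans (≤-reflexive (cong sg (1≰⇒≡0 q))) z≤n
      ... | no ne | yes q = ≤-trans (sg≤1 _) (≤-trans (≤-reflexive (sym (sg-pos (ends (ne ∘ sym) q)))) (m≤m+n _ _))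

    nv-one : ∀ {S x} → V S x → 1 ≤ nv S
    nv-one {S} {x} p = subst (_≤ nv S) (∑δ x) (∑-mono pointwise)
      where
      pointwise : ∀ z → δ x z ≤ sg (d S z)
      pointwise z with x ≟F z
      ... | yes refl rewrite sg-pos p = ≤-refl
      ... | no _ = z≤n

    nv-two : ∀ {S x y} → x ≢ y → V S x → V S y → 2 ≤ nv S
    nv-two {S} {x} {y} ne p q =
      subst (_≤ nv S) (trans (∑-distrib-+ (δ x) (δ y)) (cong₂ _+_ (∑δ x) (∑δ y))) (∑-mono pointwise)
      where
      pointwise : ∀ z → δ x z + δ y z ≤ sg (d S z)
      pointwise z with x ≟F z | y ≟F z
      ... | yes refl | yes refl = ⊥-elim (ne refl)
      ... | yes refl | no _ rewrite sg-pos p = ≤-refl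
      ... | no _ | yes refl rewrite sg-pos q = ≤-refl
      ... | no _ | no _ = z≤n

    VertexOf⇒V : ∀ {S x} → VertexOf G S x → V S x
    VertexOf⇒V {S} {x} (e , m , p) = ≤-trans (inc-end p) (deg-inc m x)

    V⇒VertexOf : ∀ {S x} → V S x → VertexOf G S x
    V⇒VertexOf p = let (e , m , q) = deg-pos p in e , m , inc-touch q

    connected-intro : ∀ {S} → (∀ A B → A ∪ B ≡ S → Disjoint A B → Nonempty A → Nonempty B → VDisjoint A B → False) → Connected G S
    connected-intro h A B eq dis neA neB with any? (λ x → V? A x ×-dec V? B x)
    ... | yes (x , p , q) = x , V⇒VertexOf p , V⇒VertexOf q
    ... | no ¬p = ⊥-elim (h A B eq (∩≡⊥⇒Disjoint dis) neA neB λ x a b → ¬p (x , a , b))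

    connected-share : ∀ {A S} → Connected G S → A ⊆ S → Nonempty A → Nonempty (S ∖ A) → ∃[ x ] (V A x × V (S ∖ A) x)
    connected-share {A} {S} con s neA neB =
      let (x , p , q) = con A (S ∖ A) (∪∖ s) (Disjoint⇒∩≡⊥ (∖-disjoint {A = A})) neA neB in x , VertexOf⇒V p , VertexOf⇒V q

    -- Otherwise the part of `S` in `A` and the rest of `S` would share a vertex. Applied to
    -- circuits, this is the main use of connectivity.
    connected-side : ∀ {S A B} → Connected G S → (∀ {e} → e ∈ S → e ∈ A ⊎ e ∈ B) → VDisjoint A B → S ⊆ A ⊎ S ⊆ B
    connected-side {S} {A} {B} con cover dis with nonempty? (S ∩ A) | nonempty? (S ∖ (S ∩ A))
    ... | yes p | yes q =
      let (x , a , b) = connected-share con (proj₁ ∘ x∈p∩q⁻ S A) p q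
      in ⊥-elim (dis x (V-mono (proj₂ ∘ x∈p∩q⁻ S A) x a) (V-mono rest x b))
      where
      rest : S ∖ (S ∩ A) ⊆ B
      rest m = let (s , k) = ∈∖⁻ m in [ (λ a → ⊥-elim (k (x∈p∩q⁺ (s , a)))) , id ]′ (cover s)
    ... | no p | _ = inj₂ λ m → [ (λ a → ⊥-elim (p (_ , x∈p∩q⁺ (m , a)))) , id ]′ (cover m)
    ... | yes _ | no q = inj₁ λ {e} m → case e ∈? A of λ where
      (yes a) → a
      (no a) → ⊥-elim (q (e , ∈∖⁺ m λ k → a (proj₂ (x∈p∩q⁻ S A k))))

    connected-∪ : ∀ {A B x} → Connected G A → Connected G B → V A x → V B x → Connected G (A ∪ B)
    connected-∪ {A} {B} {x} cA cB a b = connected-intro λ S T eq dis neS neT vdis →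
      let cover : ∀ {e} → e ∈ A ∪ B → e ∈ S ⊎ e ∈ T
          cover m = x∈p∪q⁻ S T (subst (_ ∈_) (sym eq) m)
          back : ∀ {e} → e ∈ S ∪ T → e ∈ A ⊎ e ∈ B
          back m = x∈p∪q⁻ A B (subst (_ ∈_) eq m)
      in case (connected-side cA (λ m → cover (∪ˡ m)) vdis , connected-side cB (λ m → cover (∪ʳ {A = A} m)) vdis) of λ where
        (inj₁ p , inj₁ q) → let (e , m) = neT in dis ([ p , q ]′ (back (∪ʳ {A = S} m))) m
        (inj₁ p , inj₂ q) → vdis x (V-mono p x a) (V-mono q x b)
        (inj₂ p , inj₁ q) → vdis x (V-mono q x b) (V-mono p x a)
        (inj₂ p , inj₂ q) → let (e , m) = neS in dis m ([ p , q ]′ (back (∪ˡ m)))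

    leaf-edge : ∀ {S x} → d S x ≡ 1 → ∃[ e ] (e ∈ S × suc (nv (S ∖ ⁅ e ⁆)) ≤ nv S)
    leaf-edge {S} {x} eq =
      let (e , m , p) = deg-pos {S} {x} (≤-reflexive (sym eq))
          gone : d (S ∖ ⁅ e ⁆) x ≡ 0
          gone = n≤0⇒n≡0 (≤-pred (≤-trans (+-monoˡ-≤ (d (S ∖ ⁅ e ⁆) x) p) (≤-reflexive (trans (sym (deg-∈ m x)) eq))))
      in e , m , nv-extra (V-mono ∖⊆) x (λ q → n≮n 0 (≤-trans q (≤-reflexive gone))) (≤-reflexive (sym eq))

    card-∈ : ∀ {e} {S : Subset n} → e ∈ S → ∣ S ∣ ≡ suc ∣ S ∖ ⁅ e ⁆ ∣
    card-∈ {e} {S} m = trans (card-∖ (⁅⁆⊆ m)) (cong (_+ ∣ S ∖ ⁅ e ⁆ ∣) (∣⁅x⁆∣≡1 e))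

    no-leaf-≥2 : ∀ {S} → NoLeaf S → ∀ x → 2 * sg (d S x) ≤ d S x
    no-leaf-≥2 {S} h x with d S x in eq
    ... | 0 = z≤n
    ... | 1 = ⊥-elim (h x eq)
    ... | suc (suc k) = s≤s (s≤s z≤n)

    -- A minimal nonempty set with at least as many edges as vertices has equally many of both. A
    -- leaf could be removed with its edge, so all degrees are at least two, and the handshake sum
    -- makes them exactly two. Vertex-disjoint parts would by minimality each have fewer edges than
    -- vertices.
    cycle-in : ∀ {S} → Nonempty S → nv S ≤ ∣ S ∣ → ∃[ D ] (D ⊆ S × IsCycle G D)
    cycle-in {S} ne le with minimal-subset (λ X → nonempty? X ×-dec (nv X ≤? ∣ X ∣)) S (ne , le)
    ... | Y , Y⊆S , (neY , leY) , min = Y , Y⊆S , neY , con , λ x → subst (λ k → k ≡ 0 ⊎ k ≡ 2) (d≡deg Y x) (degrees x (tight x))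
      where
      smaller : ∀ {e} → e ∈ Y → Nonempty (Y ∖ ⁅ e ⁆) → ∣ Y ∖ ⁅ e ⁆ ∣ < nv (Y ∖ ⁅ e ⁆)
      smaller {e} m ne' = ≰⇒> λ h → proj₂ (∈∖⁻ (subst (e ∈_) (sym (min (Y ∖ ⁅ e ⁆) ∖⊆ (ne' , h))) m)) (x∈⁅x⁆ e)
      upper : ∣ Y ∣ ≤ nv Y
      upper with nonempty? (Y ∖ ⁅ proj₁ neY ⁆)
      ... | yes ne' = ≤-trans (≤-reflexive (card-∈ (proj₂ neY))) (≤-trans (smaller (proj₂ neY) ne') (nv-mono ∖⊆))
      ... | no ¬ne = ≤-trans (≤-reflexive (trans (card-∈ (proj₂ neY)) (cong suc (empty-card ¬ne)))) (nv-one (proj₂ (nonempty-vertex neY)))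
      noleaf : NoLeaf Y
      noleaf x eq = let (e , m , lt) = leaf-edge {Y} {x} eq in case nonempty? (Y ∖ ⁅ e ⁆) of λ where
        (yes ne') → <⇒≱ (smaller m ne') (≤-pred (≤-trans lt (≤-trans leY (≤-reflexive (card-∈ m)))))
        -- `Y` is a single edge with only one end at `x`, so it has a second vertex: two vertices
        -- against one edge.
        (no ¬ne) → let
            size : ∣ Y ∣ ≡ 1
            size = trans (card-∈ m) (cong suc (empty-card ¬ne))
            (y , q) = ∑-pigeonhole {f = δ x} {g = d Y} (≤-reflexive (trans (cong suc (∑δ x)) (sym (trans (handshake Y) (cong (2 *_) size)))))
          in <⇒≱ (nv-two (λ x≡y → n≮n 1 (subst₂ _<_ (trans (cong (δ x) (sym x≡y)) (δ-refl x)) (trans (cong (d Y) (sym x≡y)) eq) q))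
                    (≤-reflexive (sym eq)) (≤-trans (s≤s z≤n) q))
                 (≤-trans leY (≤-reflexive size))
      tight : ∀ x → 2 * sg (d Y x) ≡ d Y x
      tight = ∑-tight (no-leaf-≥2 noleaf) (≤-trans (≤-reflexive (handshake Y)) (≤-trans (*-monoʳ-≤ 2 upper) (≤-reflexive (sym (∑-*ˡ 2 (sg ∘ d Y))))))
      degrees : ∀ x → 2 * sg (d Y x) ≡ d Y x → d Y x ≡ 0 ⊎ d Y x ≡ 2
      degrees x eq with d Y x
      ... | zero = inj₁ refl
      ... | suc k = inj₂ (sym eq)
      con : Connected G Y
      con = connected-intro λ A B eq dis neA neB vdis → let
          A⊆Y : A ⊆ Y
          A⊆Y m = subst (_ ∈_) eq (∪ˡ m)
          B⊆Y : B ⊆ Y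
          B⊆Y m = subst (_ ∈_) eq (∪ʳ {A = A} m)
          A≢Y : A ≢ Y
          A≢Y q = let (e , m) = neB in dis (subst (e ∈_) (sym q) (B⊆Y m)) m
          B≢Y : B ≢ Y
          B≢Y q = let (e , m) = neA in dis m (subst (e ∈_) (sym q) (A⊆Y m))
          smallA : ∣ A ∣ < nv A
          smallA = ≰⇒> λ h → A≢Y (min A A⊆Y (neA , h))
          smallB : ∣ B ∣ < nv B
          smallB = ≰⇒> λ h → B≢Y (min B B⊆Y (neB , h))
        in <⇒≱ (≤-trans (+-mono-< smallA smallB) (nv-VDisjoint vdis λ x → [ V-mono A⊆Y x , V-mono B⊆Y x ]′))
               (≤-trans leY (≤-reflexive (trans (cong ∣_∣ (sym eq)) (card-∪ {A = A} dis))))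

    cycle-degrees : ∀ {D} → IsCycle G D → ∀ x → d D x ≡ 0 ⊎ d D x ≡ 2
    cycle-degrees {D} (_ , _ , h) x = subst (λ k → k ≡ 0 ⊎ k ≡ 2) (sym (d≡deg D x)) (h x)

    deg-cycle : ∀ {D x} → IsCycle G D → V D x → d D x ≡ 2
    deg-cycle {D} {x} cyc p with cycle-degrees cyc x
    ... | inj₁ q = ⊥-elim (n≮n 0 (subst (1 ≤_) q p))
    ... | inj₂ q = q

    cycle-no-leaf : ∀ {D} → IsCycle G D → NoLeaf D
    cycle-no-leaf cyc x eq with cycle-degrees cyc x
    ... | inj₁ q = case trans (sym eq) q of λ ()
    ... | inj₂ q = case trans (sym eq) q of λ ()

    cycle-card : ∀ {D} → IsCycle G D → ∣ D ∣ ≡ nv D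
    cycle-card {D} cyc = *-cancelˡ-≡ ∣ D ∣ (nv D) 2
      (trans (sym (handshake D)) (trans (sum-cong-≗ pointwise) (∑-*ˡ 2 (sg ∘ d D))))
      where
      pointwise : ∀ x → d D x ≡ 2 * sg (d D x)
      pointwise x with cycle-degrees cyc x
      ... | inj₁ q rewrite q = refl
      ... | inj₂ q rewrite q = refl

    -- Connectivity yields a vertex shared by the cycle, where it has degree two, and the rest,
    -- which adds at least one.
    cycle-branch : ∀ {D S} → Connected G S → IsCycle G D → D ⊆ S → D ≢ S → ∃[ x ] (V D x × V (S ∖ D) x × 3 ≤ d S x)
    cycle-branch {D} {S} con cyc s ne =
      let (e , m , k) = proper s ne
          (x , p , q) = connected-share con s (proj₁ cyc) (e , ∈∖⁺ m k)
      in x , p , q , ≤-trans (+-mono-≤ (≤-reflexive (sym (deg-cycle cyc p))) q) (≤-reflexive (sym (deg-split s x)))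

    cycle-⊆ : ∀ {D C} → IsCycle G D → IsCycle G C → D ⊆ C → D ≡ C
    cycle-⊆ {D} {C} cD cC s = decidable-stable (D ≟S C) λ ne →
      let (x , p , _ , h) = cycle-branch (proj₁ (proj₂ cC)) cD s ne
      in <⇒≱ h (≤-reflexive (deg-cycle cC (V-mono s x p)))

    cycle-proper-forest : ∀ {Q C} → IsCycle G C → Q ⊆ C → Q ≢ C → Forest Q
    cycle-proper-forest cC s ne Z Z⊆Q neZ = ≰⇒> λ le →
      let (D , D⊆Z , cD) = cycle-in neZ le
          eq = cycle-⊆ cD cC (s ∘ Z⊆Q ∘ D⊆Z)
      in ne (⊆-antisym s λ m → Z⊆Q (D⊆Z (subst (_ ∈_) (sym eq) m)))

    cycle-subset-card : ∀ {Q C} → IsCycle G C → Q ⊆ C → ∣ Q ∣ ≤ nv Q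
    cycle-subset-card {Q} {C} cC s with Q ≟S C | nonempty? Q
    ... | yes refl | _ = ≤-reflexive (cycle-card cC)
    ... | no ne | yes ne' = <⇒≤ (cycle-proper-forest cC s ne Q ⊆-refl ne')
    ... | no _ | no em = ≤-trans (≤-reflexive (empty-card em)) z≤n

    -- The minimality argument of `cycle-in` with one more edge: a minimal set with more edges than
    -- vertices has no leaf and cannot be split.
    bicycle-in : ∀ {S} → nv S < ∣ S ∣ → ∃[ Y ] (Y ⊆ S × Bicycle Y)
    bicycle-in {S} lt with minimal-subset (λ X → nv X <? ∣ X ∣) S lt
    ... | Y , Y⊆S , ltY , min = Y , Y⊆S , con , noleaf , ≤-antisym upper ltY
      where
      smaller : ∀ {e} → e ∈ Y → ∣ Y ∖ ⁅ e ⁆ ∣ ≤ nv (Y ∖ ⁅ e ⁆)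
      smaller {e} m = ≮⇒≥ λ h → proj₂ (∈∖⁻ (subst (e ∈_) (sym (min (Y ∖ ⁅ e ⁆) ∖⊆ h)) m)) (x∈⁅x⁆ e)
      upper : ∣ Y ∣ ≤ suc (nv Y)
      upper with nonempty? Y
      ... | yes (e , m) = ≤-trans (≤-reflexive (card-∈ m)) (s≤s (≤-trans (smaller m) (nv-mono ∖⊆)))
      ... | no em = ≤-trans (≤-reflexive (empty-card em)) z≤n
      noleaf : NoLeaf Y
      noleaf x eq = let (e , m , le) = leaf-edge {Y} {x} eq in <⇒≱ ltY (≤-trans (≤-reflexive (card-∈ m)) (≤-trans (s≤s (smaller m)) le))
      con : Connected G Y
      con = connected-intro λ A B eq dis neA neB vdis → let
          A⊆Y : A ⊆ Y
          A⊆Y m = subst (_ ∈_) eq (∪ˡ m)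
          B⊆Y : B ⊆ Y
          B⊆Y m = subst (_ ∈_) eq (∪ʳ {A = A} m)
          smallA : ∣ A ∣ ≤ nv A
          smallA = ≮⇒≥ λ h → let (e , m) = neB in dis (subst (e ∈_) (sym (min A A⊆Y h)) (B⊆Y m)) m
          smallB : ∣ B ∣ ≤ nv B
          smallB = ≮⇒≥ λ h → let (e , m) = neA in dis m (subst (e ∈_) (sym (min B B⊆Y h)) (A⊆Y m))
        in <⇒≱ ltY (≤-trans (≤-reflexive (trans (cong ∣_∣ (sym eq)) (card-∪ {A = A} dis)))
             (≤-trans (+-mono-≤ smallA smallB) (nv-VDisjoint vdis λ x → [ V-mono A⊆Y x , V-mono B⊆Y x ]′)))

    -- Vertices of `X` outside `Q` have degree at least two in the rest of `X`, and by connectivity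
    -- the rest also meets `Q`. Hence `2 * nv X` is smaller than `2 * nv Q` plus twice the size of
    -- the rest, which together with `∣ X ∣ ≡ suc (nv X)` leaves no surplus of edges in `Q`.
    bicycle-proper : ∀ {X Q} → Bicycle X → Q ⊆ X → Q ≢ X → ∣ Q ∣ ≤ nv Q
    bicycle-proper {X} {Q} (con , noleaf , size) s ne with nonempty? Q
    ... | no em = ≤-trans (≤-reflexive (empty-card em)) z≤n
    ... | yes neQ = ≮⇒≥ λ h →
      let (e , m , k) = proper s ne
          (y , p , q) = connected-share con s neQ (e , ∈∖⁺ m k)
      in lin⊥ 0 (≤-trans (+-mono-≤ (*-monoʳ-≤ 2 h) (∑-mono-< {f = λ x → 2 * sg (d X x)} {g = λ x → 2 * sg (d Q x) + d (X ∖ Q) x} pointwise y (strict y p q)))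
            (≤-reflexive (cong (2 * ∣ Q ∣ +_) (trans (∑-distrib-+ (λ x → 2 * sg (d Q x)) (d (X ∖ Q))) (cong₂ _+_ (∑-*ˡ 2 (sg ∘ d Q)) (handshake (X ∖ Q)))))))
          (trans (cong (λ k → 2 * suc (nv Q) + suc k) (∑-*ˡ 2 (sg ∘ d X))) (trans (ar (nv Q) (nv X)) (cong (λ k → suc (k + 0)) (trans (cong (λ k → 2 * nv Q + 2 * k) (trans (sym size) (card-∖ s))) (ar' (nv Q) (∣ Q ∣) (∣ X ∖ Q ∣))))))
      where
      ar : ∀ a b → 2 * suc a + suc (2 * b) ≡ suc (2 * a + 2 * suc b + 0)
      ar = solve-∀
      ar' : ∀ a q w → 2 * a + 2 * (q + w) ≡ 2 * q + (2 * a + 2 * w)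
      ar' = solve-∀
      pointwise : ∀ x → 2 * sg (d X x) ≤ 2 * sg (d Q x) + d (X ∖ Q) x
      pointwise x with V? Q x
      ... | yes p rewrite sg-pos p = ≤-trans (*-monoʳ-≤ 2 (sg≤1 (d X x))) (m≤m+n 2 _)
      ... | no p = ≤-trans (no-leaf-≥2 noleaf x) (≤-trans (≤-reflexive (trans (deg-split s x) (cong (_+ d (X ∖ Q) x) (1≰⇒≡0 p)))) (m≤n+m _ _))
      strict : ∀ y → V Q y → V (X ∖ Q) y → 2 * sg (d X y) < 2 * sg (d Q y) + d (X ∖ Q) y
      strict y p q rewrite sg-pos p = ≤-trans (s≤s (*-monoʳ-≤ 2 (sg≤1 (d X y)))) (+-monoʳ-≤ 2 q)

    bicycle-⊆ : ∀ {Y X} → Bicycle Y → Bicycle X → Y ⊆ X → Y ≡ X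
    bicycle-⊆ {Y} {X} (_ , _ , size) bX s = decidable-stable (Y ≟S X) λ ne →
      <⇒≱ (≤-reflexive (sym size)) (bicycle-proper bX s ne)

    -- A nonempty overlap is a proper part of a cycle, hence a forest, with more vertices than
    -- edges. If the overlap is empty, the common vertex `x` still gives the surplus of one.
    cycles-union : ∀ {C D x} → IsCycle G C → IsCycle G D → C ≢ D → V C x → V D x → nv (C ∪ D) < ∣ C ∪ D ∣
    cycles-union {C} {D} {x} cC cD ne p q = ≰⇒> λ le →
      1+n≰n (≤-trans (≤-reflexive (sym (+-suc ∣ C ∪ D ∣ ∣ I ∣))) (≤-trans (+-monoˡ-≤ (suc ∣ I ∣) le) (≤-trans common (≤-reflexive size))))
      where
      I R : Subset n
      I = C ∩ D
      R = D ∖ C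
      I⊆C : I ⊆ C
      I⊆C = proj₁ ∘ x∈p∩q⁻ C D
      I⊆D : I ⊆ D
      I⊆D = proj₂ ∘ x∈p∩q⁻ C D
      union : C ∪ R ≡ C ∪ D
      union = ⊆-antisym (∪⊆ ∪ˡ λ m → ∪ʳ {A = C} (∖⊆ m)) (∪⊆ ∪ˡ λ {e} m → case e ∈? C of λ where
        (yes a) → ∪ˡ a
        (no a) → ∪ʳ {A = C} (∈∖⁺ m a))
      meet : R ≡ D ∖ I
      meet = ⊆-antisym (λ m → ∈∖⁺ (∖⊆ m) λ k → proj₂ (∈∖⁻ m) (I⊆C k))
                       (λ m → ∈∖⁺ (∖⊆ m) λ k → proj₂ (∈∖⁻ m) (x∈p∩q⁺ (k , ∖⊆ m)))
      size : nv C + nv D ≡ ∣ C ∪ D ∣ + ∣ I ∣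
      size = trans (cong₂ _+_ (sym (cycle-card cC)) (trans (sym (cycle-card cD)) (trans (card-∖ I⊆D) (cong (λ T → ∣ I ∣ + ∣ T ∣) (sym meet)))))
        (trans (ar (∣ C ∣) (∣ I ∣) (∣ R ∣)) (cong (_+ ∣ I ∣) (trans (sym (card-∪ (∖-disjoint {A = C}))) (cong ∣_∣ union))))
        where
        ar : ∀ a i r → a + (i + r) ≡ a + r + i
        ar = solve-∀
      common : nv (C ∪ D) + suc ∣ I ∣ ≤ nv C + nv D
      common with nonempty? I
      ... | yes neI = ≤-trans (+-monoʳ-≤ (nv (C ∪ D)) (cycle-proper-forest cD I⊆D (λ eq → ne (sym (cycle-⊆ cD cC λ m → I⊆C (subst (_ ∈_) (sym eq) m)))) I ⊆-refl neI))
                      (nv-submodular (λ y → V-∪) λ y r → V-mono I⊆C y r , V-mono I⊆D y r)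
      ... | no em = subst (λ k → nv (C ∪ D) + suc k ≤ nv C + nv D) (sym (empty-card em))
                      (subst₂ _≤_ (trans (∑-distrib-+ (sg ∘ d (C ∪ D)) (δ x)) (cong (nv (C ∪ D) +_) (∑δ x))) (∑-distrib-+ (sg ∘ d C) (sg ∘ d D)) (∑-mono pointwise))
        where
        pointwise : ∀ y → sg (d (C ∪ D) y) + δ x y ≤ sg (d C y) + sg (d D y)
        pointwise y with x ≟F y
        ... | yes refl rewrite sg-pos p | sg-pos q = +-monoˡ-≤ 1 (sg≤1 (d (C ∪ D) x))
        ... | no _ = ≤-trans (≤-reflexive (+-identityʳ _)) (case V? (C ∪ D) y of λ where
          (no h) → ≤-trans (≤-reflexive (cong sg (1≰⇒≡0 h))) z≤n
          (yes h) → ≤-trans (sg≤1 (d (C ∪ D) y)) (case V-∪ {C} {D} h of λ where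
            (inj₁ a) → ≤-trans (≤-reflexive (sym (sg-pos a))) (m≤m+n _ _)
            (inj₂ b) → ≤-trans (≤-reflexive (sym (sg-pos b))) (m≤n+m _ (sg (d C y)))))

-- Handcuffs and thetas are exactly the connected leafless sets with one more edge than vertices

zero-or-two-+ : ∀ {a b c} → a ≡ b + c → a ≡ 0 ⊎ a ≡ 2 → b ≡ 0 ⊎ b ≡ 2 → c ≡ 0 ⊎ c ≡ 2
zero-or-two-+ eq (inj₁ refl) (inj₁ refl) = inj₁ (sym eq)
zero-or-two-+ eq (inj₂ refl) (inj₁ refl) = inj₂ (sym eq)
zero-or-two-+ () (inj₁ refl) (inj₂ refl)
zero-or-two-+ {c = c} eq (inj₂ refl) (inj₂ refl) = inj₁ (sym (+-cancelˡ-≡ 2 0 c eq))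

module Shapes {v n : ℕ} (G : Graph v n) where
  open Counting G

  ¬V⇒≡0 : ∀ {S x} → ¬ V S x → d S x ≡ 0
  ¬V⇒≡0 = 1≰⇒≡0

  ≡suc⇒V : ∀ {S x k} → d S x ≡ suc k → V S x
  ≡suc⇒V eq = ≤-trans (s≤s z≤n) (≤-reflexive (sym eq))

  ≡0⇒¬V : ∀ {S x} → d S x ≡ 0 → ¬ V S x
  ≡0⇒¬V eq p = n≮n 0 (≤-trans p (≤-reflexive eq))

  opaque
    ∑-excess : ∀ X (f : Fin v → ℕ) → ∑ (λ z → 2 * sg (d X z) + f z) ≡ 2 * nv X + ∑ f
    ∑-excess X f = trans (∑-distrib-+ (λ z → 2 * sg (d X z)) f) (cong (_+ ∑ f) (∑-*ˡ 2 (sg ∘ d X)))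

    ∑δδ : (a b : Fin v) → ∑ (λ z → δ a z + δ b z) ≡ 2
    ∑δδ a b = trans (∑-distrib-+ (δ a) (δ b)) (cong₂ _+_ (∑δ a) (∑δ b))

    bicycle-sum : ∀ {X} → Bicycle X → ∑ (d X) ≡ 2 * nv X + 2
    bicycle-sum {X} (_ , _ , size) = trans (handshake X) (trans (cong (2 *_) size) (ar (nv X)))
      where
      ar : ∀ a → 2 * suc a ≡ 2 * a + 2
      ar = solve-∀

    -- By the handshake sum, the degrees of a bicycle exceed two per vertex by two in total. Every
    -- local demand for extra degree is charged against this budget.
    excess : ∀ {X} → Bicycle X → (f : Fin v → ℕ) → (∀ z → 2 * sg (d X z) + f z ≤ d X z) → ∑ f ≤ 2
    excess {X} b f h = +-cancelˡ-≤ (2 * nv X) _ _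
      (≤-trans (≤-reflexive (sym (∑-excess X f))) (≤-trans (∑-mono h) (≤-reflexive (bicycle-sum b))))

    -- Two vertices of degree three use up the whole excess, so all degree bounds become equalities.
    exact-excess : ∀ {X u w} → Bicycle X → u ≢ w → 3 ≤ d X u → 3 ≤ d X w →
      ∀ z → 2 * sg (d X z) + (δ u z + δ w z) ≡ d X z
    exact-excess {X} {u} {w} b@(_ , nl , _) ne p q = ∑-tight pointwise
      (≤-reflexive (trans (bicycle-sum b) (sym (trans (∑-excess X _) (cong (2 * nv X +_) (∑δδ u w))))))
      where
      pointwise : ∀ z → 2 * sg (d X z) + (δ u z + δ w z) ≤ d X z
      pointwise z with u ≟F z | w ≟F z
      ... | yes refl | yes refl = ⊥-elim (ne refl)
      ... | yes refl | no _ = ≤-trans (+-monoˡ-≤ 1 (*-monoʳ-≤ 2 (sg≤1 (d X z)))) p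
      ... | no _ | yes refl = ≤-trans (+-monoˡ-≤ 1 (*-monoʳ-≤ 2 (sg≤1 (d X z)))) q
      ... | no _ | no _ = ≤-trans (≤-reflexive (+-identityʳ _)) (no-leaf-≥2 nl z)

  module Exact {X u w} (b : Bicycle X) (ne : u ≢ w) (p : 3 ≤ d X u) (q : 3 ≤ d X w) where
    at-u : d X u ≡ 3
    at-u = trans (sym (exact-excess b ne p q u)) (cong₂ _+_ (cong (2 *_) (sg-pos (≤-trans (s≤s z≤n) p))) (cong₂ _+_ (δ-refl u) (δ-≢ (ne ∘ sym))))
    at-w : d X w ≡ 3
    at-w = trans (sym (exact-excess b ne p q w)) (cong₂ _+_ (cong (2 *_) (sg-pos (≤-trans (s≤s z≤n) q))) (cong₂ _+_ (δ-≢ ne) (δ-refl w)))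
    elsewhere : ∀ {z} → z ≢ u → z ≢ w → d X z ≡ 0 ⊎ d X z ≡ 2
    elsewhere {z} zu zw with V? X z
    ... | no h = inj₁ (¬V⇒≡0 h)
    ... | yes h = inj₂ (trans (sym (exact-excess b ne p q z)) (cong₂ _+_ (cong (2 *_) (sg-pos h)) (cong₂ _+_ (δ-≢ (zu ∘ sym)) (δ-≢ (zw ∘ sym)))))

  -- `s` and `t` may coincide: tight handcuffs have one vertex of degree four, loose handcuffs and
  -- thetas two of degree three.
  bicycle-intro : ∀ {X} s t → Connected G X → (∀ z → 2 * sg (d X z) + (δ s z + δ t z) ≡ d X z) → V X s → V X t → Bicycle X
  bicycle-intro {X} s t con h ps pt = con , noleaf , *-cancelˡ-≡ (∣ X ∣) (suc (nv X)) 2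
    (trans (sym (handshake X)) (trans (sum-cong-≗ (sym ∘ h)) (trans (∑-excess X _) (trans (cong (2 * nv X +_) (∑δδ s t)) (ar (nv X))))))
    where
    ar : ∀ a → 2 * a + 2 ≡ 2 * suc a
    ar = solve-∀
    noleaf : NoLeaf X
    noleaf z eq = n≮n 1 (≤-trans (≤-trans (≤-reflexive (cong (2 *_) (sym (sg-pos (≤-reflexive (sym eq)))))) (m≤m+n _ _)) (≤-reflexive (trans (h z) eq)))

  module Path {u w P} (path : IsPath G u w P) where
    ends≢ : u ≢ w
    ends≢ = proj₁ path
    nonempty : Nonempty P
    nonempty = proj₁ (proj₂ path)
    connected : Connected G P
    connected = proj₁ (proj₂ (proj₂ path))
    start : d P u ≡ 1
    start = trans (d≡deg P u) (proj₁ (proj₂ (proj₂ (proj₂ path))))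
    end : d P w ≡ 1
    end = trans (d≡deg P w) (proj₁ (proj₂ (proj₂ (proj₂ (proj₂ path)))))
    interior : ∀ {z} → z ≢ u → z ≢ w → d P z ≡ 0 ⊎ d P z ≡ 2
    interior {z} zu zw = subst (λ k → k ≡ 0 ⊎ k ≡ 2) (sym (d≡deg P z)) (proj₂ (proj₂ (proj₂ (proj₂ (proj₂ path)))) z zu zw)
    V-start : V P u
    V-start = ≡suc⇒V start
    V-end : V P w
    V-end = ≡suc⇒V end
    deg≤2 : ∀ z → d P z ≤ 2
    deg≤2 z with z ≟F u | z ≟F w
    ... | yes refl | _ = ≤-trans (≤-reflexive start) (s≤s z≤n)
    ... | no _ | yes refl = ≤-trans (≤-reflexive end) (s≤s z≤n)
    ... | no a | no b = [ (λ e → ≤-trans (≤-reflexive e) z≤n) , ≤-reflexive ]′ (interior a b)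
    acyclic : ∀ {D} → D ⊆ P → ¬ IsCycle G D
    acyclic s cyc =
      let (x , _ , _ , h) = cycle-branch connected cyc s (λ eq → cycle-no-leaf cyc u (trans (cong (λ T → d T u) eq) start))
      in <⇒≱ h (deg≤2 x)

  -- The degrees force exactly one more vertex than edges. Two vertex-disjoint parts of a forest
  -- would have a surplus of at least two, so `P` is connected.
  path-intro : ∀ {u w P} → u ≢ w → d P u ≡ 1 → d P w ≡ 1 → (∀ {z} → z ≢ u → z ≢ w → d P z ≡ 0 ⊎ d P z ≡ 2) →
    Forest P → IsPath G u w P
  path-intro {u} {w} {P} ne du dw dz forest =
    ne , V⇒nonempty (≡suc⇒V {x = u} du) , con , trans (sym (d≡deg P u)) du , trans (sym (d≡deg P w)) dw ,
    λ z zu zw → subst (λ k → k ≡ 0 ⊎ k ≡ 2) (d≡deg P z) (dz zu zw)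
    where
    pointwise : ∀ z → d P z + (δ u z + δ w z) ≡ 2 * sg (d P z)
    pointwise z with u ≟F z | w ≟F z
    ... | yes refl | yes refl = ⊥-elim (ne refl)
    ... | yes refl | no _ rewrite du = refl
    ... | no _ | yes refl rewrite dw = refl
    ... | no a | no b with dz (a ∘ sym) (b ∘ sym)
    ...   | inj₁ q rewrite q = refl
    ...   | inj₂ q rewrite q = refl
    size : 2 * ∣ P ∣ + 2 ≡ 2 * nv P
    size = trans (cong₂ _+_ (sym (handshake P)) (sym (∑δδ u w)))
      (trans (sym (∑-distrib-+ (d P) (λ z → δ u z + δ w z))) (trans (sum-cong-≗ pointwise) (∑-*ˡ 2 (sg ∘ d P))))
    con : Connected G P
    con = connected-intro λ A B eq dis neA neB vdis →
      let A⊆ : A ⊆ P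
          A⊆ m = subst (_ ∈_) eq (∪ˡ m)
          B⊆ : B ⊆ P
          B⊆ m = subst (_ ∈_) eq (∪ʳ {A = A} m)
          few = ≤-trans (+-mono-≤ (forest A A⊆ neA) (forest B B⊆ neB)) (nv-VDisjoint vdis λ x → [ V-mono A⊆ x , V-mono B⊆ x ]′)
      in lin⊥ 1 (*-monoʳ-≤ 2 few) (trans (ar (∣ A ∣) (∣ B ∣)) (cong (λ k → suc (k + 1)) (trans (cong (λ k → 2 * k + 2) (trans (sym (card-∪ {A = A} dis)) (cong ∣_∣ eq))) size)))
      where
      ar : ∀ a b → 2 * (suc a + suc b) ≡ suc (2 * (a + b) + 2 + 1)
      ar = solve-∀

  opaque
    InternallyDisjoint-V : ∀ {u w P Q} → InternallyDisjoint G u w P Q → ∀ {z} → z ≢ u → z ≢ w → V P z → ¬ V Q z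
    InternallyDisjoint-V (_ , h) {z} zu zw p q = [ zu , zw ]′ (h z (V⇒VertexOf p) (V⇒VertexOf q))

    cycle-of-paths : ∀ {u w P Q} → IsPath G u w P → IsPath G u w Q → InternallyDisjoint G u w P Q → IsCycle G (P ∪ Q)
    cycle-of-paths {u} {w} {P} {Q} pP pQ dis =
      (let (e , m) = 𝑷.nonempty in e , ∪ˡ m) ,
      connected-∪ 𝑷.connected 𝑸.connected 𝑷.V-start 𝑸.V-start ,
      λ z → subst (λ k → k ≡ 0 ⊎ k ≡ 2) (trans (sym (deg-∪ (∩≡⊥⇒Disjoint (proj₁ dis)) z)) (d≡deg (P ∪ Q) z)) (sum z)
      where
      module 𝑷 = Path pP
      module 𝑸 = Path pQ
      sum : ∀ z → d P z + d Q z ≡ 0 ⊎ d P z + d Q z ≡ 2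
      sum z with z ≟F u | z ≟F w
      ... | yes refl | _ = inj₂ (cong₂ _+_ 𝑷.start 𝑸.start)
      ... | no _ | yes refl = inj₂ (cong₂ _+_ 𝑷.end 𝑸.end)
      ... | no a | no b with V? P z
      ...   | no h rewrite ¬V⇒≡0 h = 𝑸.interior a b
      ...   | yes h rewrite ¬V⇒≡0 (InternallyDisjoint-V dis a b h) | +-identityʳ (d P z) = 𝑷.interior a b

    cycles-cover : ∀ {X C D x} → Bicycle X → IsCycle G C → IsCycle G D → C ⊆ X → D ⊆ X → C ≢ D → V C x → V D x → C ∪ D ≡ X
    cycles-cover {X} {C} {D} b cC cD sC sD ne p q = decidable-stable ((C ∪ D) ≟S X) λ k →
      <⇒≱ (cycles-union cC cD ne p q) (bicycle-proper b (∪⊆ sC sD) k)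

    -- A cycle missing all vertices of `C` lies in the complement `R`; one that meets `C` covers the
    -- bicycle together with it and so contains `R`. Used for several `C`, this lists all cycles of
    -- a handcuff or theta.
    cycle-meets : ∀ {X C D R} → Bicycle X → IsCycle G C → IsCycle G D → C ⊆ X → D ⊆ X → Disjoint C R → R ⊆ X →
      (∀ {e} → e ∈ X → e ∈ C ⊎ e ∈ R) → D ≡ C ⊎ D ⊆ R ⊎ R ⊆ D
    cycle-meets {X} {C} {D} {R} b cC cD sC sD dis sR cover with D ≟S C | any? (λ x → V? C x ×-dec V? D x)
    ... | yes eq | _ = inj₁ eq
    ... | no ne | yes (x , p , q) = inj₂ (inj₂ λ {e} m →
      [ (λ a → ⊥-elim (dis a m)) , id ]′ (x∈p∪q⁻ C D (subst (e ∈_) (sym (cycles-cover b cC cD sC sD (ne ∘ sym) p q)) (sR m))))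
    ... | no ne | no ¬p = inj₂ (inj₁ λ m →
      [ (λ a → ⊥-elim (VDisjoint⇒Disjoint {C} {D} (λ x p q → ¬p (x , p , q)) a m)) , id ]′ (cover (sD m)))

  module Tight {C₁ C₂ x} (c₁ : IsCycle G C₁) (c₂ : IsCycle G C₂) (dis : Disjoint C₁ C₂)
    (p₁ : V C₁ x) (p₂ : V C₂ x) (only : ∀ y → V C₁ y → V C₂ y → y ≡ x) where

    bicycle : Bicycle (C₁ ∪ C₂)
    bicycle = bicycle-intro x x (connected-∪ (proj₁ (proj₂ c₁)) (proj₁ (proj₂ c₂)) p₁ p₂)
      (λ z → trans (cong (λ k → 2 * sg k + (δ x z + δ x z)) (deg-∪ dis z)) (trans (degrees z) (sym (deg-∪ dis z))))
      (V-∪ˡ p₁) (V-∪ˡ p₁)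
      where
      degrees : ∀ z → 2 * sg (d C₁ z + d C₂ z) + (δ x z + δ x z) ≡ d C₁ z + d C₂ z
      degrees z with V? C₁ z | V? C₂ z
      ... | yes a | yes b rewrite deg-cycle c₁ a | deg-cycle c₂ b | only z a b | δ-refl x = refl
      ... | yes a | no b rewrite deg-cycle c₁ a | ¬V⇒≡0 b | δ-≢ {a = x} {z} (λ eq → b (subst (V C₂) eq p₂)) = refl
      ... | no a | yes b rewrite deg-cycle c₂ b | ¬V⇒≡0 a | δ-≢ {a = x} {z} (λ eq → a (subst (V C₁) eq p₁)) = refl
      ... | no a | no b rewrite ¬V⇒≡0 b | ¬V⇒≡0 a | δ-≢ {a = x} {z} (λ eq → a (subst (V C₁) eq p₁)) = refl

    cycles : ∀ {D} → IsCycle G D → D ⊆ C₁ ∪ C₂ → D ≡ C₁ ⊎ D ≡ C₂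
    cycles cD s with cycle-meets bicycle c₁ cD ∪ˡ s dis (∪ʳ {A = C₁}) (x∈p∪q⁻ C₁ C₂)
    ... | inj₁ eq = inj₁ eq
    ... | inj₂ (inj₁ s') = inj₂ (cycle-⊆ cD c₂ s')
    ... | inj₂ (inj₂ s') = inj₂ (sym (cycle-⊆ c₂ cD s'))

  module Loose {C₁ C₂ u w P} (c₁ : IsCycle G C₁) (c₂ : IsCycle G C₂) (vdis : VDisjoint C₁ C₂)
    (path : IsPath G u w P) (p₁ : V C₁ u) (p₂ : V C₂ w)
    (only₁ : ∀ y → V P y → V C₁ y → y ≡ u) (only₂ : ∀ y → V P y → V C₂ y → y ≡ w) where

    open Path path

    disjoint-end : ∀ {C x} → d P x ≡ 1 → (∀ y → V P y → V C y → y ≡ x) → Disjoint C P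
    disjoint-end {C} {x} dx only {e} a b =
      let (y , q) = ∑-pigeonhole {f = δ x} {g = inc e} (≤-reflexive (trans (cong suc (∑δ x)) (sym (inc-sum e))))
          r = ≤-trans (s≤s z≤n) q
          y≡x = only y (≤-trans r (deg-inc b y)) (≤-trans r (deg-inc a y))
      in <⇒≱ (subst₂ _<_ (trans (cong (δ x) y≡x) (δ-refl x)) (cong (inc e) y≡x) q) (≤-trans (deg-inc b x) (≤-reflexive dx))

    dis₂ : Disjoint C₂ P
    dis₂ = disjoint-end end only₂

    dis₁ : Disjoint C₁ (C₂ ∪ P)
    dis₁ a m = [ VDisjoint⇒Disjoint vdis a , disjoint-end start only₁ a ]′ (x∈p∪q⁻ C₂ P m)

    deg-sum : ∀ z → d (C₁ ∪ C₂ ∪ P) z ≡ d C₁ z + (d C₂ z + d P z)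
    deg-sum z = trans (deg-∪ dis₁ z) (cong (d C₁ z +_) (deg-∪ dis₂ z))

    bicycle : Bicycle (C₁ ∪ C₂ ∪ P)
    bicycle = bicycle-intro u w
      (connected-∪ (proj₁ (proj₂ c₁)) (connected-∪ (proj₁ (proj₂ c₂)) connected p₂ V-end) p₁ (V-∪ʳ {C₂} V-start))
      (λ z → trans (cong (λ k → 2 * sg k + (δ u z + δ w z)) (deg-sum z)) (trans (degrees z) (sym (deg-sum z))))
      (V-∪ˡ p₁) (V-∪ʳ {C₁} (V-∪ˡ p₂))
      where
      degrees : ∀ z → 2 * sg (d C₁ z + (d C₂ z + d P z)) + (δ u z + δ w z) ≡ d C₁ z + (d C₂ z + d P z)
      degrees z with z ≟F u | z ≟F w
      ... | yes refl | yes refl = ⊥-elim (ends≢ refl)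
      ... | yes refl | no b rewrite deg-cycle c₁ p₁ | ¬V⇒≡0 (vdis z p₁) | start | δ-refl z | δ-≢ {a = w} {z} (b ∘ sym) = refl
      ... | no a | yes refl rewrite deg-cycle c₂ p₂ | ¬V⇒≡0 {C₁} (λ q → vdis z q p₂) | end | δ-refl z | δ-≢ {a = u} {z} (a ∘ sym) = refl
      ... | no a | no b rewrite δ-≢ {a = u} {z} (a ∘ sym) | δ-≢ {a = w} {z} (b ∘ sym) with V? P z
      ...   | yes p rewrite ¬V⇒≡0 {C₁} (λ q → a (only₁ z p q)) | ¬V⇒≡0 {C₂} (λ q → b (only₂ z p q)) =
              [ (λ e → ⊥-elim (≡0⇒¬V e p)) , (λ e → trans (cong (λ k → 2 * sg k + 0) e) (sym e)) ]′ (interior a b)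
      ...   | no p rewrite ¬V⇒≡0 p with V? C₁ z
      ...     | yes q rewrite deg-cycle c₁ q | ¬V⇒≡0 (vdis z q) = refl
      ...     | no q rewrite ¬V⇒≡0 q with cycle-degrees c₂ z
      ...       | inj₁ e rewrite e = refl
      ...       | inj₂ e rewrite e = refl

    cycles : ∀ {D} → IsCycle G D → D ⊆ C₁ ∪ C₂ ∪ P → D ≡ C₁ ⊎ D ≡ C₂
    cycles {D} cD s = resolve
      (cycle-meets bicycle c₁ cD ∪ˡ s dis₁ (∪ʳ {A = C₁}) (x∈p∪q⁻ C₁ (C₂ ∪ P)))
      (cycle-meets {R = C₁ ∪ P} bicycle c₂ cD (λ m → ∪ʳ {A = C₁} (∪ˡ m)) s
         (λ a m → [ (λ b → VDisjoint⇒Disjoint vdis b a) , dis₂ a ]′ (x∈p∪q⁻ C₁ P m))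
         (∪⊆ ∪ˡ λ m → ∪ʳ {A = C₁} (∪ʳ {A = C₂} m))
         (λ m → [ (λ a → inj₂ (∪ˡ a)) , (λ k → [ inj₁ , (λ b → inj₂ (∪ʳ {A = C₁} b)) ]′ (x∈p∪q⁻ C₂ P k)) ]′ (x∈p∪q⁻ C₁ (C₂ ∪ P) m)))
      where
      resolve : D ≡ C₁ ⊎ D ⊆ (C₂ ∪ P) ⊎ (C₂ ∪ P) ⊆ D → D ≡ C₂ ⊎ D ⊆ (C₁ ∪ P) ⊎ (C₁ ∪ P) ⊆ D → D ≡ C₁ ⊎ D ≡ C₂
      resolve (inj₁ eq) _ = inj₁ eq
      resolve _ (inj₁ eq) = inj₂ eq
      resolve (inj₂ (inj₂ s')) _ = inj₂ (sym (cycle-⊆ c₂ cD (s' ∘ ∪ˡ)))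
      resolve _ (inj₂ (inj₂ s'')) = inj₁ (sym (cycle-⊆ c₁ cD (s'' ∘ ∪ˡ)))
      -- `D` avoids both `C₁` and `C₂`, so it would be a cycle inside the path.
      resolve (inj₂ (inj₁ s')) (inj₂ (inj₁ s'')) = ⊥-elim (acyclic (λ m →
        [ (λ a → ⊥-elim (dis₁ a (s' m))) , id ]′ (x∈p∪q⁻ C₁ P (s'' m))) cD)

  module Theta {u w P₁ P₂ P₃} (θ : IsTheta G u w P₁ P₂ P₃) where
    path₁ : IsPath G u w P₁
    path₁ = proj₁ θ
    path₂ : IsPath G u w P₂
    path₂ = proj₁ (proj₂ θ)
    path₃ : IsPath G u w P₃
    path₃ = proj₁ (proj₂ (proj₂ θ))
    id₁₂ : InternallyDisjoint G u w P₁ P₂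
    id₁₂ = proj₁ (proj₂ (proj₂ (proj₂ θ)))
    id₁₃ : InternallyDisjoint G u w P₁ P₃
    id₁₃ = proj₁ (proj₂ (proj₂ (proj₂ (proj₂ θ))))
    id₂₃ : InternallyDisjoint G u w P₂ P₃
    id₂₃ = proj₂ (proj₂ (proj₂ (proj₂ (proj₂ θ))))
    dis₁₂ : Disjoint P₁ P₂
    dis₁₂ = ∩≡⊥⇒Disjoint (proj₁ id₁₂)
    dis₁₃ : Disjoint P₁ P₃
    dis₁₃ = ∩≡⊥⇒Disjoint (proj₁ id₁₃)
    dis₂₃ : Disjoint P₂ P₃
    dis₂₃ = ∩≡⊥⇒Disjoint (proj₁ id₂₃)
    c₁₂ : IsCycle G (P₁ ∪ P₂)
    c₁₂ = cycle-of-paths path₁ path₂ id₁₂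
    c₁₃ : IsCycle G (P₁ ∪ P₃)
    c₁₃ = cycle-of-paths path₁ path₃ id₁₃
    c₂₃ : IsCycle G (P₂ ∪ P₃)
    c₂₃ = cycle-of-paths path₂ path₃ id₂₃
    module 𝟏 = Path path₁
    module 𝟐 = Path path₂
    module 𝟑 = Path path₃

    dis₁ : Disjoint P₁ (P₂ ∪ P₃)
    dis₁ a m = [ dis₁₂ a , dis₁₃ a ]′ (x∈p∪q⁻ P₂ P₃ m)

    deg-sum : ∀ z → d (P₁ ∪ P₂ ∪ P₃) z ≡ d P₁ z + (d P₂ z + d P₃ z)
    deg-sum z = trans (deg-∪ dis₁ z) (cong (d P₁ z +_) (deg-∪ dis₂₃ z))

    bicycle : Bicycle (P₁ ∪ P₂ ∪ P₃)
    bicycle = bicycle-intro u w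
      (connected-∪ 𝟏.connected (proj₁ (proj₂ c₂₃)) 𝟏.V-start (V-∪ˡ 𝟐.V-start))
      (λ z → trans (cong (λ k → 2 * sg k + (δ u z + δ w z)) (deg-sum z)) (trans (degrees z) (sym (deg-sum z))))
      (V-∪ˡ 𝟏.V-start) (V-∪ˡ 𝟏.V-end)
      where
      degrees : ∀ z → 2 * sg (d P₁ z + (d P₂ z + d P₃ z)) + (δ u z + δ w z) ≡ d P₁ z + (d P₂ z + d P₃ z)
      degrees z with z ≟F u | z ≟F w
      ... | yes refl | yes refl = ⊥-elim (𝟏.ends≢ refl)
      ... | yes refl | no b rewrite 𝟏.start | 𝟐.start | 𝟑.start | δ-refl z | δ-≢ {a = w} {z} (b ∘ sym) = refl
      ... | no a | yes refl rewrite 𝟏.end | 𝟐.end | 𝟑.end | δ-refl z | δ-≢ {a = u} {z} (a ∘ sym) = refl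
      ... | no a | no b rewrite δ-≢ {a = u} {z} (a ∘ sym) | δ-≢ {a = w} {z} (b ∘ sym) with 𝟏.interior a b
      ...   | inj₂ e rewrite ¬V⇒≡0 (InternallyDisjoint-V id₁₂ a b (≡suc⇒V e)) | ¬V⇒≡0 (InternallyDisjoint-V id₁₃ a b (≡suc⇒V e)) | e = refl
      ...   | inj₁ e rewrite e with 𝟐.interior a b
      ...     | inj₂ e' rewrite ¬V⇒≡0 (InternallyDisjoint-V id₂₃ a b (≡suc⇒V e')) | e' = refl
      ...     | inj₁ e' rewrite e' with 𝟑.interior a b
      ...       | inj₁ e'' rewrite e'' = refl
      ...       | inj₂ e'' rewrite e'' = refl

    cycles : ∀ {D} → IsCycle G D → D ⊆ P₁ ∪ P₂ ∪ P₃ → D ≡ P₁ ∪ P₂ ⊎ D ≡ P₁ ∪ P₃ ⊎ D ≡ P₂ ∪ P₃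
    cycles {D} cD s
      with cycle-meets {R = P₃} bicycle c₁₂ cD (∪⊆ ∪ˡ λ m → ∪ʳ {A = P₁} (∪ˡ m)) s
             (λ a m → [ (λ b → dis₁₃ b m) , (λ b → dis₂₃ b m) ]′ (x∈p∪q⁻ P₁ P₂ a)) (λ m → ∪ʳ {A = P₁} (∪ʳ {A = P₂} m))
             (λ m → [ (λ a → inj₁ (∪ˡ a)) , (λ k → [ (λ b → inj₁ (∪ʳ {A = P₁} b)) , inj₂ ]′ (x∈p∪q⁻ P₂ P₃ k)) ]′ (x∈p∪q⁻ P₁ (P₂ ∪ P₃) m))
         | cycle-meets {R = P₂} bicycle c₁₃ cD (∪⊆ ∪ˡ λ m → ∪ʳ {A = P₁} (∪ʳ {A = P₂} m)) s
             (λ a m → [ (λ b → dis₁₂ b m) , (λ b → dis₂₃ m b) ]′ (x∈p∪q⁻ P₁ P₃ a)) (λ m → ∪ʳ {A = P₁} (∪ˡ m))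
             (λ m → [ (λ a → inj₁ (∪ˡ a)) , (λ k → [ inj₂ , (λ b → inj₁ (∪ʳ {A = P₁} b)) ]′ (x∈p∪q⁻ P₂ P₃ k)) ]′ (x∈p∪q⁻ P₁ (P₂ ∪ P₃) m))
    ... | inj₁ eq | _ = inj₁ eq
    ... | _ | inj₁ eq = inj₂ (inj₁ eq)
    ... | inj₂ (inj₁ s') | _ = ⊥-elim (𝟑.acyclic s' cD)
    ... | _ | inj₂ (inj₁ s') = ⊥-elim (𝟐.acyclic s' cD)
    ... | inj₂ (inj₂ s₃) | inj₂ (inj₂ s₂) = inj₂ (inj₂ (sym (cycle-⊆ c₂₃ cD (∪⊆ s₂ s₃))))

  -- The frame circuits name two or three unbalanced cycles; the lists of cycles above show that
  -- there are no others.
  frame⇒bicycle : ∀ {B X} → FrameCircuit G B X →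
    (IsCycle G X × B X) ⊎ (Bicycle X × (∀ D → D ⊆ X → IsCycle G D → ¬ B D))
  frame⇒bicycle (inj₁ p) = inj₁ p
  frame⇒bicycle {B} (inj₂ (inj₁ (C₁ , C₂ , c₁ , c₂ , b₁ , b₂ , dis , (x , p₁ , p₂ , only) , refl))) =
    inj₂ (T.bicycle , λ D s cD → [ (λ { refl → b₁ }) , (λ { refl → b₂ }) ]′ (T.cycles cD s))
    where module T = Tight c₁ c₂ (∩≡⊥⇒Disjoint dis) (VertexOf⇒V p₁) (VertexOf⇒V p₂) (λ y a b → only y (V⇒VertexOf a) (V⇒VertexOf b))
  frame⇒bicycle {B} (inj₂ (inj₂ (inj₁ (C₁ , C₂ , u , w , P , c₁ , c₂ , b₁ , b₂ , dis , path , p₁ , p₂ , o₁ , o₂ , refl)))) =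
    inj₂ (T.bicycle , λ D s cD → [ (λ { refl → b₁ }) , (λ { refl → b₂ }) ]′ (T.cycles cD s))
    where module T = Loose c₁ c₂ (λ y a b → dis y (V⇒VertexOf a) (V⇒VertexOf b)) path (VertexOf⇒V p₁) (VertexOf⇒V p₂)
                       (λ y a b → o₁ y (V⇒VertexOf a) (V⇒VertexOf b)) (λ y a b → o₂ y (V⇒VertexOf a) (V⇒VertexOf b))
  frame⇒bicycle {B} (inj₂ (inj₂ (inj₂ (u , w , P₁ , P₂ , P₃ , θ , b₁ , b₂ , b₃ , refl)))) =
    inj₂ (T.bicycle , λ D s cD → [ (λ { refl → b₁ }) , [ (λ { refl → b₂ }) , (λ { refl → b₃ }) ]′ ]′ (T.cycles cD s))
    where module T = Theta θ

-- Recovering handcuffs and thetas from bicycles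

module Classify {v n : ℕ} (G : Graph v n) {X : Subset n} (b : Counting.Bicycle G X) where
  open Counting G
  open Shapes G

  private
    size : ∣ X ∣ ≡ suc (nv X)
    size = proj₂ (proj₂ b)
    con : Connected G X
    con = proj₁ b

    bicycle≢cycle : ∀ {C} → IsCycle G C → C ≢ X
    bicycle≢cycle cC refl = 1+n≢n (trans (sym size) (cycle-card cC))

    nonempty-X : Nonempty X
    nonempty-X = decidable-stable (nonempty? X) λ em → case trans (sym size) (empty-card em) of λ ()

  Cycles : (Subset n → Set) → Set
  Cycles B = ∀ D → D ⊆ X → IsCycle G D → ¬ B D

  module _ {B : Subset n → Set} (unbalanced : Cycles B) {C₁ : Subset n} (s₁ : C₁ ⊆ X) (c₁ : IsCycle G C₁) where

    disjoint-cycles : ∀ {C₂} → IsCycle G C₂ → C₂ ⊆ X ∖ C₁ → FrameCircuit G B X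
    disjoint-cycles {C₂} c₂ s with any? (λ x → V? C₁ x ×-dec V? C₂ x)
    ... | yes (x , p , q) = inj₂ (inj₁ (C₁ , C₂ , c₁ , c₂ , unbalanced C₁ s₁ c₁ , unbalanced C₂ s₂ c₂ ,
            Disjoint⇒∩≡⊥ dis , (x , V⇒VertexOf p , V⇒VertexOf q , λ y a b → only y (VertexOf⇒V a) (VertexOf⇒V b)) , sym cover))
      where
      s₂ : C₂ ⊆ X
      s₂ = ∖⊆ ∘ s
      dis : Disjoint C₁ C₂
      dis a m = proj₂ (∈∖⁻ (s m)) a
      cover : C₁ ∪ C₂ ≡ X
      cover = cycles-cover b c₁ c₂ s₁ s₂ (λ { refl → let (e , m) = proj₁ c₁ in dis m m }) p q
      four : ∀ {z} → V C₁ z → V C₂ z → d X z ≡ 4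
      four {z} a c = trans (cong (λ T → d T z) (sym cover)) (trans (deg-∪ dis z) (cong₂ _+_ (deg-cycle c₁ a) (deg-cycle c₂ c)))
      only : ∀ y → V C₁ y → V C₂ y → y ≡ x
      -- A common vertex has degree four and thus uses the whole excess of two; a second one would
      -- bring the excess to four.
      only y a c = decidable-stable (y ≟F x) λ ne → <⇒≱ (s≤s (s≤s (s≤s z≤n)))
        (≤-trans (≤-reflexive (sym (trans (∑-distrib-+ (λ z → δ x z + δ x z) (λ z → δ y z + δ y z)) (cong₂ _+_ (∑δδ x x) (∑δδ y y)))))
          (excess b (λ z → (δ x z + δ x z) + (δ y z + δ y z)) (pointwise ne)))
        where
        pointwise : y ≢ x → ∀ z → 2 * sg (d X z) + ((δ x z + δ x z) + (δ y z + δ y z)) ≤ d X z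
        pointwise ne z with x ≟F z | y ≟F z
        ... | yes refl | yes refl = ⊥-elim (ne refl)
        ... | yes refl | no _ rewrite four p q = ≤-refl
        ... | no _ | yes refl rewrite four a c = ≤-refl
        ... | no _ | no _ = ≤-trans (≤-reflexive (+-identityʳ _)) (no-leaf-≥2 (proj₁ (proj₂ b)) z)
    ... | no ¬p = inj₂ (inj₂ (inj₁ (C₁ , C₂ , u , w , P , c₁ , c₂ , unbalanced C₁ s₁ c₁ , unbalanced C₂ s₂ c₂ ,
            (λ y p q → vdis y (VertexOf⇒V p) (VertexOf⇒V q)) , path , V⇒VertexOf u₁ , V⇒VertexOf w₂ ,
            (λ y p q → only₁ (VertexOf⇒V p) (VertexOf⇒V q)) , (λ y p q → only₂ (VertexOf⇒V p) (VertexOf⇒V q)) , cover)))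
      where
      s₂ : C₂ ⊆ X
      s₂ = ∖⊆ ∘ s
      vdis : VDisjoint C₁ C₂
      vdis x p q = ¬p (x , p , q)
      both : C₁ ∪ C₂ ⊆ X
      both = ∪⊆ s₁ s₂
      P : Subset n
      P = X ∖ (C₁ ∪ C₂)
      cover : X ≡ C₁ ∪ C₂ ∪ P
      cover = trans (sym (∪∖ both)) (∪-assoc C₁ C₂ P)
      branch₁ = cycle-branch con c₁ s₁ (bicycle≢cycle c₁)
      branch₂ = cycle-branch con c₂ s₂ (bicycle≢cycle c₂)
      u w : Fin v
      u = proj₁ branch₁
      w = proj₁ branch₂
      u₁ : V C₁ u
      u₁ = proj₁ (proj₂ branch₁)
      w₂ : V C₂ w
      w₂ = proj₁ (proj₂ branch₂)
      u≢w : u ≢ w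
      u≢w eq = vdis u u₁ (subst (V C₂) (sym eq) w₂)
      open Exact b u≢w (proj₂ (proj₂ (proj₂ branch₁))) (proj₂ (proj₂ (proj₂ branch₂)))
      deg-sum : ∀ z → d X z ≡ d C₁ z + d C₂ z + d P z
      deg-sum z = trans (deg-split both z) (cong (_+ d P z) (deg-∪ (VDisjoint⇒Disjoint vdis) z))
      du : d P u ≡ 1
      du = +-cancelˡ-≡ 2 _ 1 (trans (cong (λ k → k + d P u) (sym (cong₂ _+_ (deg-cycle c₁ u₁) (¬V⇒≡0 (vdis u u₁))))) (trans (sym (deg-sum u)) at-u))
      dw : d P w ≡ 1
      dw = +-cancelˡ-≡ 2 _ 1 (trans (cong (λ k → k + d P w) (sym (cong₂ _+_ (¬V⇒≡0 {C₁} (λ p → vdis w p w₂)) (deg-cycle c₂ w₂)))) (trans (sym (deg-sum w)) at-w))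
      off-cycles : ∀ {z} → d C₁ z + d C₂ z ≡ 2 → z ≢ u → z ≢ w → d P z ≡ 0
      off-cycles {z} two zu zw with elsewhere zu zw
      ... | inj₁ e = ⊥-elim (case trans (sym e) (trans (deg-sum z) (cong (_+ d P z) two)) of λ ())
      ... | inj₂ e = +-cancelˡ-≡ 2 _ 0 (trans (cong (_+ d P z) (sym two)) (trans (sym (deg-sum z)) e))
      on₁ : ∀ {z} → V C₁ z → d C₁ z + d C₂ z ≡ 2
      on₁ {z} p = cong₂ _+_ (deg-cycle c₁ p) (¬V⇒≡0 (vdis z p))
      on₂ : ∀ {z} → V C₂ z → d C₁ z + d C₂ z ≡ 2
      on₂ {z} p = cong₂ _+_ (¬V⇒≡0 {C₁} (λ q → vdis z q p)) (deg-cycle c₂ p)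
      dz : ∀ {z} → z ≢ u → z ≢ w → d P z ≡ 0 ⊎ d P z ≡ 2
      dz {z} zu zw with V? C₁ z | V? C₂ z
      ... | yes p | _ = inj₁ (off-cycles (on₁ p) zu zw)
      ... | no _ | yes q = inj₁ (off-cycles (on₂ q) zu zw)
      ... | no p | no q = subst (λ k → k ≡ 0 ⊎ k ≡ 2) (trans (deg-sum z) (cong₂ (λ i j → i + j + d P z) (¬V⇒≡0 p) (¬V⇒≡0 q))) (elsewhere zu zw)
      forest : Forest P
      -- A cycle inside `P` would have a branch vertex of degree three in `X`. This could only be
      -- `u` or `w`, where `P` has degree one.
      forest Z sZ neZ = ≰⇒> λ le →
        let (D , sD , cD) = cycle-in neZ le
            (x , p , _ , h) = cycle-branch con cD (∖⊆ ∘ sZ ∘ sD) (bicycle≢cycle cD)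
            two : 2 ≤ d P x
            two = ≤-trans (≤-reflexive (sym (deg-cycle cD p))) (deg-mono (sZ ∘ sD) x)
            xu : x ≢ u
            xu eq = <⇒≱ two (≤-reflexive (trans (cong (d P) eq) du))
            xw : x ≢ w
            xw eq = <⇒≱ two (≤-reflexive (trans (cong (d P) eq) dw))
        in <⇒≱ h ([ (λ e → ≤-trans (≤-reflexive e) z≤n) , ≤-reflexive ]′ (elsewhere xu xw))
      path : IsPath G u w P
      path = path-intro u≢w du dw dz forest
      only₁ : ∀ {y} → V P y → V C₁ y → y ≡ u
      only₁ {y} p q = decidable-stable (y ≟F u) λ yu →
        ≡0⇒¬V (off-cycles (on₁ q) yu (λ { refl → vdis y q w₂ })) p
      only₂ : ∀ {y} → V P y → V C₂ y → y ≡ w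
      only₂ {y} p q = decidable-stable (y ≟F w) λ yw →
        ≡0⇒¬V (off-cycles (on₂ q) (λ { refl → vdis y u₁ q }) yw) p

    no-disjoint-cycle : Forest (X ∖ C₁) → FrameCircuit G B X
    no-disjoint-cycle forest = inj₂ (inj₂ (inj₂ (u , w , P₁ , P₂ , R , θ ,
      unbalanced _ (∪⊆ (s₁ ∘ P₁⊆) (s₁ ∘ ∖⊆)) (Theta.c₁₂ θ) , unbalanced _ (∪⊆ (s₁ ∘ P₁⊆) ∖⊆) (Theta.c₁₃ θ) ,
      unbalanced _ (∪⊆ (s₁ ∘ ∖⊆) ∖⊆) (Theta.c₂₃ θ) , cover)))
      where
      R : Subset n
      R = X ∖ C₁
      branch₁ = cycle-branch con c₁ s₁ (bicycle≢cycle c₁)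
      u : Fin v
      u = proj₁ branch₁
      u₁ : V C₁ u
      u₁ = proj₁ (proj₂ branch₁)
      uR : V R u
      uR = proj₁ (proj₂ (proj₂ branch₁))
      second : ∃[ w ] (w ≢ u × V C₁ w × V R w)
      -- If `R` met `C₁` only at `u`, its other vertices would keep degree at least two in `R`, so
      -- that `2 * nv R ≤ 2 * ∣ R ∣ + 1`. A forest has more vertices than that.
      second = decidable-stable (any? λ w → ¬? (w ≟F u) ×-dec V? C₁ w ×-dec V? R w) λ none →
        let few : 2 * nv R ≤ 2 * ∣ R ∣ + 1
            few = subst₂ _≤_ (∑-*ˡ 2 (sg ∘ d R)) (trans (∑-distrib-+ (d R) (δ u)) (cong₂ _+_ (handshake R) (∑δ u))) (∑-mono (pointwise none))
            many = forest R ⊆-refl (V⇒nonempty uR)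
        in lin⊥ 0 (≤-trans (*-monoʳ-≤ 2 many) few) (ar (∣ R ∣))
        where
        ar : ∀ a → 2 * suc a ≡ suc (2 * a + 1 + 0)
        ar = solve-∀
        pointwise : ¬ (∃[ w ] (w ≢ u × V C₁ w × V R w)) → ∀ z → 2 * sg (d R z) ≤ d R z + δ u z
        pointwise none z with V? R z
        ... | no h rewrite ¬V⇒≡0 h = z≤n
        ... | yes h with u ≟F z
        ...   | yes refl = ≤-trans (*-monoʳ-≤ 2 (sg≤1 (d R z))) (+-monoˡ-≤ 1 h)
        ...   | no ne = ≤-trans (subst (λ k → 2 * sg k ≤ k) same (no-leaf-≥2 (proj₁ (proj₂ b)) z)) (m≤m+n _ _)
          where
          same : d X z ≡ d R z
          same = trans (deg-split s₁ z) (cong (_+ d R z) (¬V⇒≡0 λ q → none (z , ne ∘ sym , q , h)))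
      w : Fin v
      w = proj₁ second
      u≢w : u ≢ w
      u≢w = proj₁ (proj₂ second) ∘ sym
      w₁ : V C₁ w
      w₁ = proj₁ (proj₂ (proj₂ second))
      open Exact b u≢w (proj₂ (proj₂ (proj₂ branch₁)))
        (≤-trans (+-mono-≤ (≤-reflexive (sym (deg-cycle c₁ w₁))) (proj₂ (proj₂ (proj₂ second)))) (≤-reflexive (sym (deg-split s₁ w))))
      ends : ∀ {z} → V C₁ z → d X z ≡ 3 → d R z ≡ 1
      ends {z} p three = +-cancelˡ-≡ 2 _ 1 (trans (cong (_+ d R z) (sym (deg-cycle c₁ p))) (trans (sym (deg-split s₁ z)) three))
      du : d R u ≡ 1
      du = ends u₁ at-u
      dw : d R w ≡ 1
      dw = ends w₁ at-w
      dz : ∀ {z} → z ≢ u → z ≢ w → d R z ≡ 0 ⊎ d R z ≡ 2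
      dz {z} zu zw = zero-or-two-+ (deg-split s₁ z) (elsewhere zu zw) (cycle-degrees c₁ z)
      off : ∀ {z} → z ≢ u → z ≢ w → V C₁ z → d R z ≡ 0
      off {z} zu zw p with elsewhere zu zw
      ... | inj₁ e = ⊥-elim (≡0⇒¬V e (V-mono s₁ z p))
      ... | inj₂ e = +-cancelˡ-≡ 2 _ 0 (trans (cong (_+ d R z) (sym (deg-cycle c₁ p))) (trans (sym (deg-split s₁ z)) e))
      path₃ : IsPath G u w R
      path₃ = path-intro u≢w du dw dz forest
      -- A second cycle C₂ avoiding an edge f of C₁ contains R, and cuts C₁ into the two other paths of the theta.
      f : Fin n
      f = proj₁ (proj₁ c₁)
      f∈ : f ∈ C₁
      f∈ = proj₂ (proj₁ c₁)
      ne-f : Nonempty (X ∖ ⁅ f ⁆)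
      ne-f = let (e , m , _) = deg-pos uR in e , ∈∖⁺ (∖⊆ m) λ k → proj₂ (∈∖⁻ m) (subst (_∈ C₁) (sym (x∈⁅y⁆⇒x≡y f k)) f∈)
      second-cycle = cycle-in ne-f (≤-trans (nv-mono ∖⊆) (≤-reflexive (suc-injective (trans (sym size) (card-∈ (s₁ f∈))))))
      C₂ : Subset n
      C₂ = proj₁ second-cycle
      s₂ : C₂ ⊆ X ∖ ⁅ f ⁆
      s₂ = proj₁ (proj₂ second-cycle)
      c₂ : IsCycle G C₂
      c₂ = proj₂ (proj₂ second-cycle)
      f∉C₂ : f ∉ C₂
      f∉C₂ m = proj₂ (∈∖⁻ (s₂ m)) (x∈⁅x⁆ f)
      R⊆C₂ : R ⊆ C₂
      R⊆C₂ with cycle-meets {R = R} b c₁ c₂ s₁ (∖⊆ ∘ s₂) (∖-disjoint {A = C₁}) ∖⊆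
                  (λ {e} m → case e ∈? C₁ of λ { (yes a) → inj₁ a ; (no a) → inj₂ (∈∖⁺ m a) })
      ... | inj₁ eq = ⊥-elim (f∉C₂ (subst (f ∈_) (sym eq) f∈))
      ... | inj₂ (inj₁ h) = ⊥-elim (Path.acyclic path₃ h c₂)
      ... | inj₂ (inj₂ h) = h
      P₁ P₂ : Subset n
      P₁ = C₂ ∖ R
      P₂ = C₁ ∖ P₁
      P₁⊆ : P₁ ⊆ C₁
      P₁⊆ {e} m = decidable-stable (e ∈? C₁) λ k → proj₂ (∈∖⁻ m) (∈∖⁺ (∖⊆ (s₂ (∖⊆ m))) k)
      end₁ : ∀ {z} → d R z ≡ 1 → d P₁ z ≡ 1
      end₁ {z} e = suc-injective (trans (cong (_+ d P₁ z) (sym e)) (trans (sym (deg-split R⊆C₂ z)) (deg-cycle c₂ (V-mono R⊆C₂ z (≡suc⇒V e)))))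
      end₂ : ∀ {z} → d P₁ z ≡ 1 → d P₂ z ≡ 1
      end₂ {z} e = suc-injective (trans (cong (_+ d P₂ z) (sym e)) (trans (sym (deg-split P₁⊆ z)) (deg-cycle c₁ (V-mono P₁⊆ z (≡suc⇒V e)))))
      mid₁ : ∀ {z} → z ≢ u → z ≢ w → d P₁ z ≡ 0 ⊎ d P₁ z ≡ 2
      mid₁ {z} zu zw = zero-or-two-+ (deg-split R⊆C₂ z) (cycle-degrees c₂ z) (dz zu zw)
      mid₂ : ∀ {z} → z ≢ u → z ≢ w → d P₂ z ≡ 0 ⊎ d P₂ z ≡ 2
      mid₂ {z} zu zw = zero-or-two-+ (deg-split P₁⊆ z) (cycle-degrees c₁ z) (mid₁ zu zw)
      path₁ : IsPath G u w P₁
      path₁ = path-intro u≢w (end₁ du) (end₁ dw) mid₁ (cycle-proper-forest c₁ P₁⊆ λ eq → f∉C₂ (∖⊆ (subst (f ∈_) (sym eq) f∈)))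
      path₂ : IsPath G u w P₂
      path₂ = path-intro u≢w (end₂ (end₁ du)) (end₂ (end₁ dw)) mid₂ (cycle-proper-forest c₁ ∖⊆ λ eq →
        let (e , m) = Path.nonempty path₁ in proj₂ (∈∖⁻ (subst (e ∈_) (sym eq) (P₁⊆ m))) m)
      two : ∀ {S z} → d S z ≡ 0 ⊎ d S z ≡ 2 → V S z → 2 ≤ d S z
      two (inj₁ e) p = ⊥-elim (≡0⇒¬V e p)
      two (inj₂ e) p = ≤-reflexive (sym e)
      id₁₂ : InternallyDisjoint G u w P₁ P₂
      id₁₂ = Disjoint⇒∩≡⊥ (∖-disjoint {A = P₁}) , λ z p q → one-of λ zu zw → (<⇒≱ (s≤s (s≤s (s≤s z≤n))) (≤-trans
          (+-mono-≤ (two (mid₁ zu zw) (VertexOf⇒V p)) (two (mid₂ zu zw) (VertexOf⇒V q)))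
          (≤-trans (≤-reflexive (sym (deg-split P₁⊆ z))) (≤-reflexive (deg-cycle c₁ (V-mono P₁⊆ z (VertexOf⇒V p)))))))
      with-R : ∀ {Q} → Q ⊆ C₁ → InternallyDisjoint G u w Q R
      with-R {Q} sQ = Disjoint⇒∩≡⊥ (λ m k → proj₂ (∈∖⁻ k) (sQ m)) , λ z p q → one-of λ zu zw → (≡0⇒¬V (off zu zw (V-mono sQ z (VertexOf⇒V p))) (VertexOf⇒V q))
      θ : IsTheta G u w P₁ P₂ R
      θ = path₁ , path₂ , path₃ , id₁₂ , with-R P₁⊆ , with-R ∖⊆
      cover : X ≡ P₁ ∪ P₂ ∪ R
      cover = trans (sym (∪∖ s₁)) (trans (cong (_∪ R) (sym (∪∖ P₁⊆))) (∪-assoc P₁ P₂ R))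

  -- After fixing one cycle, the question is whether another cycle avoids its edges: if so, `X` is a
  -- handcuff, otherwise a theta.
  bicycle⇒frame : ∀ {B} → Cycles B → FrameCircuit G B X
  bicycle⇒frame unb with cycle-in nonempty-X (≤-trans (n≤1+n _) (≤-reflexive (sym size)))
  ... | C₁ , s₁ , c₁ with anySubset? (λ Z → (Z ⊆? (X ∖ C₁)) ×-dec nonempty? Z ×-dec (nv Z ≤? ∣ Z ∣))
  ...   | yes (Z , sZ , ne , le) = let (C₂ , s₂ , c₂) = cycle-in ne le in disjoint-cycles unb s₁ c₁ c₂ (sZ ∘ s₂)
  ...   | no ¬p = no-disjoint-cycle unb s₁ c₁ λ Z sZ ne → ≰⇒> λ le → ¬p (Z , sZ , ne , le)

-- Deleting one element: unlike for contractions, the circuits of a deletion are circuits of M, without any decidability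
-- assumption

─⇒∉ : ∀ {n} (p q : Subset n) {x} → x ∈ p ─ q → x ∉ q
─⇒∉ (_ ∷ p) (true ∷ q) (Data.Vec.there m) (Data.Vec.there k) = ─⇒∉ p q m k
─⇒∉ (_ ∷ p) (false ∷ q) (Data.Vec.there m) (Data.Vec.there k) = ─⇒∉ p q m k

∈-⁺ : ∀ {n} {p : Subset n} {x y} → x ∈ p → x ≢ y → x ∈ p - y
∈-⁺ m ne = x∈p∧x∉q⇒x∈p─q m (ne ∘ x∈⁅y⁆⇒x≡y _)

∈-⁻ : ∀ {n} {p : Subset n} {x y} → x ∈ p - y → x ∈ p × x ≢ y
∈-⁻ {p = p} {y = y} m = p─q⊆p p ⁅ y ⁆ m , λ { refl → ─⇒∉ p ⁅ y ⁆ m (x∈⁅x⁆ y) }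

∪-cong-∈ : ∀ {n} {A B S : Subset n} → (∀ {e} → e ∈ A ⊎ e ∈ B → e ∈ S) → (∀ {e} → e ∈ S → e ∈ A ⊎ e ∈ B) → A ∪ B ≡ S
∪-cong-∈ {A = A} {B} f g = ⊆-antisym (λ m → f (x∈p∪q⁻ A B m)) (λ m → x∈p∪q⁺ (g m))

module Lift {n : ℕ} (j : Fin (suc n)) where

  opaque
    up : Subset n → Subset (suc n)
    up X = insertAt X j false

    down : Subset (suc n) → Subset n
    down X = preimage (punchIn j) X

    down≡ : ∀ X → down X ≡ preimage (punchIn j) X
    down≡ X = refl

    up-∈ : ∀ {X i} → i ∈ X → punchIn j i ∈ up X
    up-∈ {X} {i} m = lookup⇒[]= _ _ (trans (Vec.insertAt-punchIn X j false i) ([]=⇒lookup m))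

    up-∈⁻ : ∀ {X i} → punchIn j i ∈ up X → i ∈ X
    up-∈⁻ {X} {i} m = lookup⇒[]= _ _ (trans (sym (Vec.insertAt-punchIn X j false i)) ([]=⇒lookup m))

    j∉up : ∀ {X} → j ∉ up X
    j∉up {X} m = case trans (sym (Vec.insertAt-lookup X j false)) ([]=⇒lookup m) of λ ()

    down-∈ : ∀ {X i} → punchIn j i ∈ X → i ∈ down X
    down-∈ {X} {i} m = lookup⇒[]= _ _ (trans (lookup∘tabulate _ i) ([]=⇒lookup m))

    down-∈⁻ : ∀ {X i} → i ∈ down X → punchIn j i ∈ X
    down-∈⁻ {X} {i} m = lookup⇒[]= _ _ (trans (sym (lookup∘tabulate _ i)) ([]=⇒lookup m))

  data View : Fin (suc n) → Set where
    this : View j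
    other : ∀ i → View (punchIn j i)

  view : ∀ e → View e
  view e with j ≟F e
  ... | yes refl = this
  ... | no ne = subst View (punchIn-punchOut ne) (other (punchOut ne))

  up-∈-view : ∀ {X e} → e ∈ up X → ∃[ i ] (punchIn j i ≡ e × i ∈ X)
  up-∈-view {X} {e} m with view e
  ... | this = ⊥-elim (j∉up m)
  ... | other i = i , refl , up-∈⁻ m

  down-up : ∀ X → down (up X) ≡ X
  down-up X = ⊆-antisym (up-∈⁻ ∘ down-∈⁻) (down-∈ ∘ up-∈)

  up-down : ∀ {X} → j ∉ X → up (down X) ≡ X
  up-down {X} j∉X = ⊆-antisym
    (λ m → let (i , eq , k) = up-∈-view m in subst (_∈ X) eq (down-∈⁻ k))
    (λ {e} m → back e m)
    where
    back : ∀ e → e ∈ X → e ∈ up (down X)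
    back e m with view e
    ... | this = ⊥-elim (j∉X m)
    ... | other i = up-∈ (down-∈ m)

  up-mono : ∀ {X Y} → X ⊆ Y → up X ⊆ up Y
  up-mono {Y = Y} s m = let (i , eq , k) = up-∈-view m in subst (_∈ up Y) eq (up-∈ (s k))

  up-injective : ∀ {X Y} → up X ≡ up Y → X ≡ Y
  up-injective {X} {Y} eq = trans (sym (down-up X)) (trans (cong down eq) (down-up Y))

  up-nonempty : ∀ {X} → Nonempty X → Nonempty (up X)
  up-nonempty (i , m) = punchIn j i , up-∈ m

  up-nonempty⁻ : ∀ {X} → Nonempty (up X) → Nonempty X
  up-nonempty⁻ (e , m) = let (i , _ , k) = up-∈-view m in i , k

  module _ (M : Matroid (suc n)) where

    delete : Matroid n
    delete .Circuit X = Circuit M (up X)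
    delete .empty-not c = empty-not M (subst (Circuit M) empty c)
      where
      empty : up ⊥ ≡ ⊥
      empty = ⊆-antisym (λ m → let (_ , _ , k) = up-∈-view m in ⊥-elim (∉⊥ k)) (λ m → ⊥-elim (∉⊥ m))
    delete .incomp C D c e s = up-injective (incomp M (up C) (up D) c e (up-mono s))
    delete .elim C D e c c' ne eC eD =
      let (F , cF , sF) = elim M (up C) (up D) (punchIn j e) c c' (ne ∘ up-injective) (up-∈ eC) (up-∈ eD)
          avoid : j ∉ F
          avoid m = [ j∉up , j∉up ]′ (x∈p∪q⁻ (up C) (up D) (proj₁ (∈-⁻ (sF m))))
      in down F , subst (Circuit M) (sym (up-down avoid)) cF , λ {i} m →
           let (u , ne') = ∈-⁻ {p = up C ∪ up D} (sF (down-∈⁻ m))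
           in ∈-⁺ (x∈p∪q⁺ ([ (λ k → inj₁ (up-∈⁻ k)) , (λ k → inj₂ (up-∈⁻ k)) ]′ (x∈p∪q⁻ (up C) (up D) u))) (λ { refl → ne' refl })

    private
      Family : Subset n → Set
      Family X = ∃[ C ] (Circuit M C × (∀ e → e ∈ C → e ∈ ⊥ ⊎ ∃[ i ] (punchIn j i ≡ e)) × X ≡ preimage (punchIn j) (C ─ ⊥))

      ─⊥ : ∀ (C : Subset (suc n)) → C ─ ⊥ ≡ C
      ─⊥ C = ⊆-antisym (p─q⊆p C ⊥) (λ m → x∈p∧x∉q⇒x∈p─q m ∉⊥)

      preimage≡down : ∀ C → preimage (punchIn j) (C ─ ⊥) ≡ down C
      preimage≡down C = trans (cong (preimage (punchIn j)) (─⊥ C)) (sym (down≡ C))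

      to-family : ∀ {X} → Circuit delete X → Family X
      to-family {X} c = up X , c , (λ e m → let (i , eq , _) = up-∈-view m in inj₂ (i , eq)) ,
        trans (sym (down-up X)) (sym (preimage≡down (up X)))

      from-family : ∀ {X} → Family X → Circuit delete X
      from-family {X} (C , c , h , eq) = subst (Circuit M) (sym (trans (cong up (trans eq (preimage≡down C))) (up-down avoid))) c
        where
        avoid : j ∉ C
        avoid m with h j m
        ... | inj₁ k = ∉⊥ k
        ... | inj₂ (i , q) = punchInᵢ≢i j i q

    delete-minor : IsMinorOf delete M
    delete-minor = punchIn j , ⊥ , (λ a b → punchIn-injective j a b) , (λ i → ∉⊥) , λ X →
      (λ c → decidable-stable (nonempty? X) (λ em → empty-not delete (subst (Circuit delete) (⊆-antisym (λ m → ⊥-elim (em (_ , m))) (λ m → ⊥-elim (∉⊥ m))) c)) ,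
             to-family c , λ Y fY _ s → incomp delete Y X (from-family fY) c s) ,
      (λ (_ , f , _) → from-family f)

  -- Adding an edge to a graph

  module _ {v : ℕ} (G : Graph v n) (val : Fin v × Fin v) where

    insert-edge : Graph v (suc n)
    insert-edge e with j ≟F e
    ... | yes _ = val
    ... | no ne = G (punchOut ne)

    insert-edge-other : ∀ i → insert-edge (punchIn j i) ≡ G i
    insert-edge-other i with j ≟F punchIn j i
    ... | yes eq = ⊥-elim (punchInᵢ≢i j i (sym eq))
    ... | no ne = cong G (punchIn-injective j _ _ (punchIn-punchOut ne))

    insert-edge-this : insert-edge j ≡ val
    insert-edge-this with j ≟F j
    ... | yes _ = refl
    ... | no ne = ⊥-elim (ne refl)

    private
      module C = Counting G
      module C⁺ = Counting insert-edge

    χ-up : ∀ X i → χ (up X) (punchIn j i) ≡ χ X i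
    χ-up X i with i ∈? X
    ... | yes m = trans (χ-∈ (up-∈ m)) (sym (χ-∈ m))
    ... | no k = trans (χ-∉ (k ∘ up-∈⁻)) (sym (χ-∉ k))

    card-up : ∀ X → ∣ up X ∣ ≡ ∣ X ∣
    card-up X = trans (card (up X)) (trans (sum-remove {i = j} (χ (up X)))
      (trans (cong₂ _+_ (χ-∉ {S = up X} j∉up) (sum-cong-≗ (χ-up X))) (sym (card X))))

    deg-up : ∀ X x → C⁺.d (up X) x ≡ C.d X x
    deg-up X x = trans (C⁺.deg≡ (up X) x) (trans (sum-remove {i = j} (λ e → χ (up X) e * C⁺.inc e x))
      (trans (cong₂ _+_ (cong (_* C⁺.inc j x) (χ-∉ {S = up X} j∉up)) (sum-cong-≗ λ i → cong₂ _*_ (χ-up X i) (inc-up i))) (sym (C.deg≡ X x))))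
      where
      inc-up : ∀ i → C⁺.inc (punchIn j i) x ≡ C.inc i x
      inc-up i = trans (C⁺.inc≡ _ x) (trans (cong (λ e → δ (proj₁ e) x + δ (proj₂ e) x) (insert-edge-other i)) (sym (C.inc≡ i x)))

    connected-up : ∀ {X} → Connected G X → Connected insert-edge (up X)
    connected-up {X} con = C⁺.connected-intro λ A B eq dis neA neB vdis →
      let jA : j ∉ A
          jA m = j∉up (subst (j ∈_) eq (∪ˡ m))
          jB : j ∉ B
          jB m = j∉up (subst (j ∈_) eq (∪ʳ {A = A} m))
          (x , a , b) = con (down A) (down B)
            (∪-cong-∈ (λ h → up-∈⁻ (subst (_ ∈_) eq (x∈p∪q⁺ ([ inj₁ ∘ down-∈⁻ , inj₂ ∘ down-∈⁻ ]′ h))))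
                      (λ m → [ inj₁ ∘ down-∈ , inj₂ ∘ down-∈ ]′ (x∈p∪q⁻ A B (subst (_ ∈_) (sym eq) (up-∈ m)))))
            (Disjoint⇒∩≡⊥ λ a b → dis (down-∈⁻ a) (down-∈⁻ b))
            (up-nonempty⁻ (subst Nonempty (sym (up-down jA)) neA)) (up-nonempty⁻ (subst Nonempty (sym (up-down jB)) neB))
          transfer : ∀ {S} → j ∉ S → VertexOf G (down S) x → C⁺.V S x
          transfer {S} jS p = subst (λ T → 1 ≤ C⁺.d T x) (up-down jS) (≤-trans (C.VertexOf⇒V p) (≤-reflexive (sym (deg-up (down S) x))))
      in vdis x (transfer jA a) (transfer jB b)

    connected-down : ∀ {X} → Connected insert-edge (up X) → Connected G X
    connected-down {X} con = C.connected-intro λ A B eq dis neA neB vdis →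
      let (x , a , b) = con (up A) (up B)
            (∪-cong-∈ [ up-mono (λ m → subst (_ ∈_) eq (∪ˡ m)) , up-mono (λ m → subst (_ ∈_) eq (∪ʳ {A = A} m)) ]′
                      (λ m → let (i , q , k) = up-∈-view m in [ (λ a → inj₁ (subst (_∈ up A) q (up-∈ a))) , (λ b → inj₂ (subst (_∈ up B) q (up-∈ b))) ]′ (x∈p∪q⁻ A B (subst (i ∈_) (sym eq) k))))
            (Disjoint⇒∩≡⊥ λ a b → let (i , q , k) = up-∈-view a in dis k (up-∈⁻ (subst (_∈ up B) (sym q) b)))
            (up-nonempty neA) (up-nonempty neB)
      in vdis x (≤-trans (C⁺.VertexOf⇒V a) (≤-reflexive (deg-up A x))) (≤-trans (C⁺.VertexOf⇒V b) (≤-reflexive (deg-up B x)))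

    nv-up : ∀ X → C⁺.nv (up X) ≡ C.nv X
    nv-up X = sum-cong-≗ λ x → cong sg (deg-up X x)

    cycle-up : ∀ {X} → IsCycle G X → IsCycle insert-edge (up X)
    cycle-up {X} cyc@(ne , con , _) = up-nonempty ne , connected-up con , λ x →
      subst (λ k → k ≡ 0 ⊎ k ≡ 2) (trans (sym (deg-up X x)) (C⁺.d≡deg (up X) x)) (C.cycle-degrees cyc x)

    bicycle-up : ∀ {X} → C.Bicycle X → C⁺.Bicycle (up X)
    bicycle-up {X} (con , nl , size) = connected-up con , (λ x eq → nl x (trans (sym (deg-up X x)) eq)) ,
      trans (card-up X) (trans size (cong suc (sym (nv-up X))))

    bicycle-down : ∀ {X} → C⁺.Bicycle (up X) → C.Bicycle X
    bicycle-down {X} (con , nl , size) = connected-down con , (λ x eq → nl x (trans (deg-up X x) eq)) ,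
      trans (sym (card-up X)) (trans size (cong suc (nv-up X)))

-- A graph describing the circuits of M that avoid j; the ends of the edge j are irrelevant.
record Represents {m : ℕ} (M : Matroid m) (j : Fin m) {v : ℕ} (G : Graph v m) : Set where
  field
    shape : ∀ {X} → j ∉ X → Circuit M X → IsCycle G X ⊎ Counting.Bicycle G X
    unbalanced-circuit : ∀ {X} → j ∉ X → Counting.Bicycle G X →
      (∀ D → D ⊆ X → IsCycle G D → ¬ Circuit M D) → Circuit M X

-- The ends of `j` remain a parameter: arbitrary ends suffice to study the deletion, and suitable
-- ones are chosen at the end to represent `M` itself. The field `vertex` provides some vertex to
-- start with, since `v` might be zero.
record Representation {m : ℕ} (M : Matroid m) (j : Fin m) : Set where
  field
    v : ℕ
    graph : Fin v × Fin v → Graph v m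
    represents : ∀ val → Represents M j (graph val)
    at-j : ∀ val → graph val j ≡ val
    off-j : ∀ val val' i → i ≢ j → graph val i ≡ graph val' i
    vertex : ∀ i → i ≢ j → Fin v

representation : ∀ {m} (M : Matroid m) → ExcludedMinorFrame M → (j : Fin m) → Representation M j
representation {suc n} M (_ , minors) j = record
  { v = v
  ; graph = insert-edge G
  ; represents = λ val → record { shape = shape val ; unbalanced-circuit = unbalanced-circuit val }
  ; at-j = insert-edge-this G
  ; off-j = λ val val' i → off val val' (view i)
  ; vertex = λ i → ends (view i)
  }
  where
  open Lift j
  frame = minors n (delete M) (delete-minor M) ≤-refl
  v = proj₁ frame
  G = proj₁ (proj₂ frame)
  B = proj₁ (proj₂ (proj₂ frame))
  circuits = proj₂ (proj₂ (proj₂ (proj₂ frame)))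

  shape : ∀ val {X} → j ∉ X → Circuit M X → IsCycle (insert-edge G val) X ⊎ Counting.Bicycle (insert-edge G val) X
  shape val {X} j∉X c = subst (λ Y → IsCycle (insert-edge G val) Y ⊎ Counting.Bicycle (insert-edge G val) Y) (up-down j∉X)
    ([ (λ p → inj₁ (cycle-up G val (proj₁ p))) , (λ p → inj₂ (bicycle-up G val (proj₁ p))) ]′
      (Shapes.frame⇒bicycle G (proj₁ (circuits (down X)) (subst (Circuit M) (sym (up-down j∉X)) c))))

  unbalanced-circuit : ∀ val {X} → j ∉ X → Counting.Bicycle (insert-edge G val) X →
    (∀ D → D ⊆ X → IsCycle (insert-edge G val) D → ¬ Circuit M D) → Circuit M X
  unbalanced-circuit val {X} j∉X b unb = subst (Circuit M) (up-down j∉X)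
    (proj₂ (circuits (down X)) (Classify.bicycle⇒frame G
      (bicycle-down G val (subst (Counting.Bicycle (insert-edge G val)) (sym (up-down j∉X)) b))
      λ D s cD bD → unb (up D) (λ m → subst (_ ∈_) (up-down j∉X) (up-mono s m)) (cycle-up G val cD) (proj₂ (circuits D) (inj₁ (cD , bD)))))

  off : ∀ val val' {i} → View i → i ≢ j → insert-edge G val i ≡ insert-edge G val' i
  off val val' this ne = ⊥-elim (ne refl)
  off val val' (other i) ne = trans (insert-edge-other G val i) (sym (insert-edge-other G val' i))

  ends : ∀ {i} → View i → i ≢ j → Fin v
  ends this ne = ⊥-elim (ne refl)
  ends (other i) ne = proj₁ (G i)

-- The circuits and independent sets of a 2-sum

-- A rotation, so that `next o` and `next (next o)` are the two elements of a triple other than `o`.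
next : Fin 3 → Fin 3
next 0F = 1F
next 1F = 2F
next 2F = 0F

next≢ : ∀ i → next i ≢ i
next≢ 0F ()
next≢ 1F ()
next≢ 2F ()

next²≢ : ∀ i → next (next i) ≢ i
next²≢ 0F ()
next²≢ 1F ()
next²≢ 2F ()

next-cases : ∀ o i → i ≡ o ⊎ i ≡ next o ⊎ i ≡ next (next o)
next-cases 0F 0F = inj₁ refl
next-cases 0F 1F = inj₂ (inj₁ refl)
next-cases 0F 2F = inj₂ (inj₂ refl)
next-cases 1F 1F = inj₁ refl
next-cases 1F 2F = inj₂ (inj₁ refl)
next-cases 1F 0F = inj₂ (inj₂ refl)
next-cases 2F 2F = inj₁ refl
next-cases 2F 0F = inj₂ (inj₁ refl)
next-cases 2F 1F = inj₂ (inj₂ refl)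

count-two⁺ : ∀ (b : Fin 3 → Bool) o → b o ≡ false → (∀ i → i ≢ o → b i ≡ true) → ∣ tabulate b ∣ ≡ 2
count-two⁺ b 0F p q rewrite p | q 1F (λ ()) | q 2F (λ ()) = refl
count-two⁺ b 1F p q rewrite p | q 0F (λ ()) | q 2F (λ ()) = refl
count-two⁺ b 2F p q rewrite p | q 0F (λ ()) | q 1F (λ ()) = refl

opaque
 count-two⁻ : ∀ (b : Fin 3 → Bool) → ∣ tabulate b ∣ ≡ 2 → ∃[ o ] (b o ≡ false × (∀ i → i ≢ o → b i ≡ true))
 count-two⁻ b eq with b 0F in p | b 1F in q | b 2F in r
 ... | true | true | true = case eq of λ ()
 ... | true | false | false = case eq of λ ()
 ... | false | true | false = case eq of λ ()
 ... | false | false | true = case eq of λ ()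
 ... | false | false | false = case eq of λ ()
 ... | false | true | true = 0F , p , λ { 0F n → ⊥-elim (n refl) ; 1F _ → q ; 2F _ → r }
 ... | true | false | true = 1F , q , λ { 1F n → ⊥-elim (n refl) ; 0F _ → p ; 2F _ → r }
 ... | true | true | false = 2F , r , λ { 2F n → ⊥-elim (n refl) ; 1F _ → q ; 0F _ → p }

lookup-true : ∀ {n} {S : Subset n} {e} → e ∈ S → lookup S e ≡ true
lookup-true = []=⇒lookup

lookup-false : ∀ {n} {S : Subset n} {e} → e ∉ S → lookup S e ≡ false
lookup-false {S = S} {e} h with lookup S e in eq
... | true = ⊥-elim (h (lookup⇒[]= e S eq))
... | false = refl

true-lookup : ∀ {n} {S : Subset n} {e} → lookup S e ≡ true → e ∈ S
true-lookup {S = S} {e} = lookup⇒[]= e S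

module TwoSum {k m : ℕ} (N : Matroid k) (L : Subset k) (M : Matroid m)
  (sum₂ : IsTwoSumU24 (Circuit N) L (Circuit M)) where

  f₁ : Fin k → Fin m
  f₁ = proj₁ sum₂

  f₂ : Fin k → Fin 3 → Fin m
  f₂ = proj₁ (proj₂ sum₂)

  locate : ∀ t → (∃[ e ] (e ∉ L × f₁ e ≡ t)) ⊎ (∃[ e ] ∃[ i ] (e ∈ L × f₂ e i ≡ t))
  locate = proj₁ (proj₂ (proj₂ (proj₂ (proj₂ (proj₂ sum₂)))))

  private
    laws = proj₂ (proj₂ sum₂)
    inj₁₁ = proj₁ laws
    inj₂₂ = proj₁ (proj₂ laws)
    inj₁₂ = proj₁ (proj₂ (proj₂ laws))
    surj = proj₁ (proj₂ (proj₂ (proj₂ laws)))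
    circuits = proj₂ (proj₂ (proj₂ (proj₂ laws)))

  -- The ground set of `M` is known only through `f₁` and `f₂`. A subset is therefore prescribed
  -- over each element of `N`, and membership is read back through these maps.
  module Fibrewise (P : Fin k → Set) (P? : ∀ e → Dec (P e)) (Q : Fin k → Fin 3 → Set) (Q? : ∀ e i → Dec (Q e i)) where
    private
      Holds : Fin m → Set
      Holds j with surj j
      ... | inj₁ (e , _) = P e
      ... | inj₂ (e , i , _) = Q e i

      Holds? : ∀ j → Dec (Holds j)
      Holds? j with surj j
      ... | inj₁ (e , _) = P? e
      ... | inj₂ (e , i , _) = Q? e i

    opaque
      set : Subset m
      set = ⟦ Holds? ⟧

      plain⁺ : ∀ {e} → e ∉ L → P e → f₁ e ∈ set
      plain⁺ {e} h p = ∈⟦⟧⁺ Holds? holds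
        where
        holds : Holds (f₁ e)
        holds with surj (f₁ e)
        ... | inj₁ (e' , h' , eq) = subst P (sym (inj₁₁ e' e h' h eq)) p
        ... | inj₂ (e' , i , h' , eq) = ⊥-elim (inj₁₂ e e' i h h' (sym eq))

      piece⁺ : ∀ {e i} → e ∈ L → Q e i → f₂ e i ∈ set
      piece⁺ {e} {i} h q = ∈⟦⟧⁺ Holds? holds
        where
        holds : Holds (f₂ e i)
        holds with surj (f₂ e i)
        ... | inj₁ (e' , h' , eq) = ⊥-elim (inj₁₂ e' e i h' h eq)
        ... | inj₂ (e' , i' , h' , eq) with inj₂₂ e' e i' i h' h eq
        ...   | refl , refl = q

      member : ∀ {j} → j ∈ set → (∃[ e ] (e ∉ L × f₁ e ≡ j × P e)) ⊎ (∃[ e ] ∃[ i ] (e ∈ L × f₂ e i ≡ j × Q e i))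
      member {j} m = go (∈⟦⟧⁻ Holds? m)
        where
        go : Holds j → (∃[ e ] (e ∉ L × f₁ e ≡ j × P e)) ⊎ (∃[ e ] ∃[ i ] (e ∈ L × f₂ e i ≡ j × Q e i))
        go h with surj j
        ... | inj₁ (e , p , q) = inj₁ (e , p , q , h)
        ... | inj₂ (e , i , p , q) = inj₂ (e , i , p , q , h)

    plain⁻ : ∀ {e} → e ∉ L → f₁ e ∈ set → P e
    plain⁻ {e} h m with member m
    ... | inj₁ (e' , h' , eq , p) = subst P (inj₁₁ e' e h' h eq) p
    ... | inj₂ (e' , i , h' , eq , _) = ⊥-elim (inj₁₂ e e' i h h' (sym eq))

    piece⁻ : ∀ {e i} → e ∈ L → f₂ e i ∈ set → Q e i
    piece⁻ {e} {i} h m with member m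
    ... | inj₁ (e' , h' , eq , _) = ⊥-elim (inj₁₂ e' e i h' h eq)
    ... | inj₂ (e' , i' , h' , eq , q) with inj₂₂ e' e i' i h' h eq
    ...   | refl , refl = q

  module Expand (C : Subset k) (o : Fin k → Fin 3) where
    private
      module F = Fibrewise (_∈ C) (_∈? C) (λ e i → e ∈ C × i ≢ o e) (λ e i → (e ∈? C) ×-dec ¬? (i ≟F o e))
    opaque
      set : Subset m
      set = F.set

      plain⁺ : ∀ {e} → e ∉ L → e ∈ C → f₁ e ∈ set
      plain⁺ = F.plain⁺

      piece⁺ : ∀ {e i} → e ∈ L → (e ∈ C × i ≢ o e) → f₂ e i ∈ set
      piece⁺ = F.piece⁺

      plain⁻ : ∀ {e} → e ∉ L → f₁ e ∈ set → e ∈ C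
      plain⁻ = F.plain⁻

      piece⁻ : ∀ {e i} → e ∈ L → f₂ e i ∈ set → (e ∈ C × i ≢ o e)
      piece⁻ = F.piece⁻

      member : ∀ {t} → t ∈ set → (∃[ e ] (e ∉ L × f₁ e ≡ t × e ∈ C)) ⊎ (∃[ e ] ∃[ i ] (e ∈ L × f₂ e i ≡ t × (e ∈ C × i ≢ o e)))
      member = F.member

  -- The circuit of M obtained from the circuit C of N by keeping, over each e ∈ C ∩ L, the two elements other than o e.
  expand : Subset k → (Fin k → Fin 3) → Subset m
  expand C o = Expand.set C o

  module Triple (g : Fin k) where
    private
      module F = Fibrewise (λ _ → False) (λ _ → no λ ()) (λ e _ → e ≡ g) (λ e _ → e ≟F g)
    opaque
      set : Subset m
      set = F.set

      plain⁺ : ∀ {e} → e ∉ L → False → f₁ e ∈ set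
      plain⁺ = F.plain⁺

      piece⁺ : ∀ {e i} → e ∈ L → e ≡ g → f₂ e i ∈ set
      piece⁺ = F.piece⁺

      plain⁻ : ∀ {e} → e ∉ L → f₁ e ∈ set → False
      plain⁻ = F.plain⁻

      piece⁻ : ∀ {e i} → e ∈ L → f₂ e i ∈ set → e ≡ g
      piece⁻ = F.piece⁻

      member : ∀ {t} → t ∈ set → (∃[ e ] (e ∉ L × f₁ e ≡ t × False)) ⊎ (∃[ e ] ∃[ i ] (e ∈ L × f₂ e i ≡ t × e ≡ g))
      member = F.member

  T : Fin k → Subset m
  T g = Triple.set g

  T⁺ : ∀ {g} → g ∈ L → ∀ i → f₂ g i ∈ T g
  T⁺ {g} h i = Triple.piece⁺ g h refl

  T⁻ : ∀ {g j} → j ∈ T g → ∃[ i ] (f₂ g i ≡ j)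
  T⁻ {g} m with Triple.member g m
  ... | inj₂ (e , i , _ , eq , refl) = i , eq

  circuit-T : ∀ {g} → g ∈ L → Circuit M (T g)
  circuit-T {g} h = proj₂ (circuits (T g)) (inj₁ (g , h , λ j → T⁻ , λ { (i , refl) → T⁺ h i }))

  circuit-expand : ∀ {C} o → Circuit N C → Circuit M (expand C o)
  circuit-expand {C} o c = proj₂ (circuits (expand C o)) (inj₂ (C , c ,
    (λ e h → Expand.plain⁻ C o h , Expand.plain⁺ C o h) ,
    (λ e h k i m → k (proj₁ (Expand.piece⁻ C o h m))) ,
    λ e h k → count-two⁺ (λ i → lookup (expand C o) (f₂ e i)) (o e)
      (lookup-false {S = expand C o} λ m → proj₂ (Expand.piece⁻ C o h m) refl)
      (λ i ne → lookup-true (Expand.piece⁺ C o h (k , ne)))))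

  circuit-cases : ∀ {X} → Circuit M X → (∃[ g ] (g ∈ L × X ≡ T g)) ⊎ (∃[ C ] ∃[ o ] (Circuit N C × X ≡ expand C o))
  circuit-cases {X} c with proj₁ (circuits X) c
  ... | inj₁ (g , h , iff) = inj₁ (g , h , ⊆-antisym
        (λ {j} m → let (i , eq) = proj₁ (iff j) m in subst (_∈ T g) eq (T⁺ h i)) (λ {j} m → proj₂ (iff j) (T⁻ m)))
  ... | inj₂ (C , cN , plain , off , two) = inj₂ (C , omitted , cN , ⊆-antisym (λ {j} m → to m (surj j)) from)
    where
    omitted : Fin k → Fin 3
    omitted e with e ∈? L | e ∈? C
    ... | yes h | yes p = proj₁ (count-two⁻ (λ i → lookup X (f₂ e i)) (two e h p))
    -- Any value will do, because `expand` consults it only over elements of `C` that lie in `L`.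
    ... | _ | _ = 0F
    omit : ∀ e → e ∈ L → e ∈ C → ∀ i → f₂ e i ∈ X ⇔ i ≢ omitted e
    omit e h p i with e ∈? L | e ∈? C
    ... | no h' | _ = ⊥-elim (h' h)
    ... | yes _ | no p' = ⊥-elim (p' p)
    ... | yes h' | yes p' =
      let (o , out , rest) = count-two⁻ (λ i → lookup X (f₂ e i)) (two e h' p')
      in (λ m eq → case trans (sym (lookup-true (subst (λ i → f₂ e i ∈ X) eq m))) out of λ ()) , λ ne → true-lookup (rest i ne)
    to : ∀ {j} → j ∈ X → (∃[ e ] (e ∉ L × f₁ e ≡ j)) ⊎ (∃[ e ] ∃[ i ] (e ∈ L × f₂ e i ≡ j)) → j ∈ expand C omitted
    to m (inj₁ (e , h , refl)) = Expand.plain⁺ C omitted h (proj₁ (plain e h) m)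
    to m (inj₂ (e , i , h , refl)) =
      let p = decidable-stable (e ∈? C) λ p → off e h p i m
      in Expand.piece⁺ C omitted h (p , proj₁ (omit e h p i) m)
    from : ∀ {j} → j ∈ expand C omitted → j ∈ X
    from m with Expand.member C omitted m
    ... | inj₁ (e , h , refl , p) = proj₂ (plain e h) p
    ... | inj₂ (e , i , h , refl , p , ne) = proj₂ (omit e h p i) ne

  module Over (A : Subset k) where
    private
      module F = Fibrewise (_∈ A) (_∈? A) (λ e _ → e ∈ A) (λ e _ → e ∈? A)
    opaque
      set : Subset m
      set = F.set

      plain⁺ : ∀ {e} → e ∉ L → e ∈ A → f₁ e ∈ set
      plain⁺ = F.plain⁺

      piece⁺ : ∀ {e i} → e ∈ L → e ∈ A → f₂ e i ∈ set
      piece⁺ = F.piece⁺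

      plain⁻ : ∀ {e} → e ∉ L → f₁ e ∈ set → e ∈ A
      plain⁻ = F.plain⁻

      piece⁻ : ∀ {e i} → e ∈ L → f₂ e i ∈ set → e ∈ A
      piece⁻ = F.piece⁻

      member : ∀ {t} → t ∈ set → (∃[ e ] (e ∉ L × f₁ e ≡ t × e ∈ A)) ⊎ (∃[ e ] ∃[ i ] (e ∈ L × f₂ e i ≡ t × e ∈ A))
      member = F.member

  over : Subset k → Subset m
  over A = Over.set A

  expand⊆over : ∀ {C o} → expand C o ⊆ over C
  expand⊆over {C} {o} m with Expand.member C o m
  ... | inj₁ (e , h , refl , p) = Over.plain⁺ C h p
  ... | inj₂ (e , i , h , refl , p , _) = Over.piece⁺ C h p

  over-mono : ∀ {A B} → A ⊆ B → over A ⊆ over B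
  over-mono {A} {B} s m with Over.member A m
  ... | inj₁ (e , h , refl , p) = Over.plain⁺ B h (s p)
  ... | inj₂ (e , i , h , refl , p) = Over.piece⁺ B h (s p)

  fibre : (Fin m → ℕ) → Fin k → ℕ
  fibre F e with e ∈? L
  ... | yes _ = ∑ (λ i → F (f₂ e i))
  ... | no _ = F (f₁ e)

  -- Each element of `M` lies over exactly one element of `N`, its `owner`; inserting this indicator
  -- and exchanging the two sums regroups the sum by owners.
  reindex : ∀ F → ∑ F ≡ ∑ (fibre F)
  reindex F = begin
    ∑ F                                          ≡⟨ sum-cong-≗ split ⟩
    ∑ (λ j → ∑ (λ e → fibre (λ a → δ a j) e * F j)) ≡⟨ ∑-comm (λ j e → fibre (λ a → δ a j) e * F j) ⟩
    ∑ (λ e → ∑ (λ j → fibre (λ a → δ a j) e * F j)) ≡⟨ sum-cong-≗ collapse ⟩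
    ∑ (fibre F)                                  ∎
    where
    open ≡-Reasoning
    owner : Fin m → Fin k
    owner j with surj j
    ... | inj₁ (e , _) = e
    ... | inj₂ (e , _) = e
    weight : ∀ j e → fibre (λ a → δ a j) e ≡ δ (owner j) e
    weight j e with surj j | e ∈? L
    ... | inj₁ (e' , h , refl) | yes p = trans (sum-cong-≗ (λ i → δ-≢ λ eq → inj₁₂ e' e i h p (sym eq))) (sym (δ-≢ {a = e'} {e} λ { refl → h p }))
    ... | inj₁ (e' , h , refl) | no p with e' ≟F e
    ...   | yes refl = δ-refl (f₁ e)
    ...   | no ne = δ-≢ λ eq → ne (sym (inj₁₁ e e' p h eq))
    weight j e | inj₂ (e' , i , h , refl) | no p = trans (δ-≢ (inj₁₂ e e' i p h)) (sym (δ-≢ {a = e'} {e} λ { refl → p h }))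
    weight j e | inj₂ (e' , i , h , refl) | yes p with e' ≟F e
    ... | yes refl = trans (sum-cong-≗ single) (∑δ i)
      where
      single : ∀ i' → δ (f₂ e i') (f₂ e i) ≡ δ i i'
      single i' with i ≟F i'
      ... | yes refl = δ-refl (f₂ e i)
      ... | no ne = δ-≢ λ eq → ne (sym (proj₂ (inj₂₂ e e i' i p p eq)))
    ... | no ne = sum-cong-≗ {3} {λ i' → δ (f₂ e i') (f₂ e' i)} {λ _ → 0} λ i' → δ-≢ λ eq → ne (sym (proj₁ (inj₂₂ e e' i' i p h eq)))
    split : ∀ j → F j ≡ ∑ (λ e → fibre (λ a → δ a j) e * F j)
    split j = trans (sym (∑-point (owner j) (λ _ → F j))) (sum-cong-≗ λ e → cong (_* F j) (sym (weight j e)))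
    collapse : ∀ e → ∑ (λ j → fibre (λ a → δ a j) e * F j) ≡ fibre F e
    collapse e with e ∈? L
    ... | no _ = ∑-point (f₁ e) F
    ... | yes _ = trans (sum-cong-≗ (λ j → trans (*-comm (∑ (λ i → δ (f₂ e i) j)) (F j)) (trans (sym (∑-*ˡ (F j) (λ i → δ (f₂ e i) j))) (sum-cong-≗ λ i → *-comm (F j) (δ (f₂ e i) j)))))
        (trans (∑-comm (λ j i → δ (f₂ e i) j * F j)) (sum-cong-≗ λ i → ∑-point (f₂ e i) F))

  card-fibres : ∀ X → ∣ X ∣ ≡ ∑ (fibre (χ X))
  card-fibres X = trans (card X) (reindex (χ X))

-- Ranks

Indep? : ∀ {n} (M : Matroid n) → (∀ X → Dec (Circuit M X)) → ∀ I → Dec (Independent M I)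
Indep? M dec I with anySubset? (λ C → dec C ×-dec (C ⊆? I))
... | yes (C , c , s) = no λ ind → ind C c s
... | no h = yes λ C c s → h (C , c , s)

dependent : ∀ {n} (M : Matroid n) → (∀ X → Dec (Circuit M X)) → ∀ {I} → ¬ Independent M I → ∃[ C ] (Circuit M C × C ⊆ I)
dependent M dec {I} h with anySubset? (λ C → dec C ×-dec (C ⊆? I))
... | yes p = p
... | no q = ⊥-elim (h λ C c s → q (C , c , s))

independent-⊆ : ∀ {n} (M : Matroid n) {I J} → I ⊆ J → Independent M J → Independent M I
independent-⊆ M s ind C c s' = ind C c (s ∘ s')

circuit-nonempty : ∀ {n} (M : Matroid n) {C} → Circuit M C → Nonempty C
circuit-nonempty M {C} c = decidable-stable (nonempty? C) λ em →
  empty-not M (subst (Circuit M) (⊆-antisym (λ m → ⊥-elim (em (_ , m))) (λ m → ⊥-elim (∉⊥ m))) c)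

independent-⊥ : ∀ {n} (M : Matroid n) → Independent M ⊥
independent-⊥ M C c s = let (e , m) = circuit-nonempty M c in ∉⊥ (s m)

basis : ∀ {n} (M : Matroid n) → (∀ X → Dec (Circuit M X)) → ∀ A → ∃[ I ]
  (I ⊆ A × Independent M I × (∀ J → J ⊆ A → Independent M J → ∣ J ∣ ≤ ∣ I ∣))
basis M dec A =
  let (I , (s , ind) , max) = largest-subset (λ I → (I ⊆? A) ×-dec Indep? M dec I) ⊥ ((λ m → ⊥-elim (∉⊥ m)) , independent-⊥ M)
  in I , s , ind , λ J sJ iJ → max J (sJ , iJ)

basis-rank : ∀ {n} (M : Matroid n) (dec : ∀ X → Dec (Circuit M X)) A → IsRank M A (∣ proj₁ (basis M dec A) ∣)
basis-rank M dec A = let (I , s , ind , max) = basis M dec A in (I , s , ind , refl) , max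

-- The connectivity inequality with upper bounds in place of the two ranks and the size of an
-- independent set in place of the rank of `M`. In this form vertex counts can be inserted directly.
no-separation : ∀ {n} (M : Matroid n) → (∀ X → Dec (Circuit M X)) → ∀ κ → ¬ HasSeparation M κ →
  ∀ A → κ ≤ ∣ A ∣ → κ ≤ ∣ ∁ A ∣ → ∀ {α β} →
  (∀ I → I ⊆ A → Independent M I → ∣ I ∣ ≤ α) → (∀ I → I ⊆ ∁ A → Independent M I → ∣ I ∣ ≤ β) →
  ∀ J → Independent M J → ∣ J ∣ + κ ≤ α + β
no-separation M dec κ none A kA kB {α} {β} hα hβ J indJ =
  let (I , sI , iI , _) = basis M dec A
      (K , sK , iK , _) = basis M dec (∁ A)
      (_ , _ , _ , max) = basis M dec ⊤
  in ≤-trans (+-monoˡ-≤ κ (max J ⊆⊤ indJ))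
       (≤-trans (≮⇒≥ λ lt → none (A , _ , _ , _ , basis-rank M dec A , basis-rank M dec (∁ A) , basis-rank M dec ⊤ , kA , kB , lt))
         (+-mono-≤ (hα I sI iI) (hβ K sK iK)))

-- A loop has rank zero, so it would be a 1-separation by itself.
loopless : ∀ {n} (M : Matroid n) → (∀ X → Dec (Circuit M X)) → ¬ HasSeparation M 1 → ∀ {h g} → g ≢ h → ¬ Circuit M ⁅ h ⁆
loopless M dec none {h} {g} ne c =
  let (I , sI , iI , max) = basis M dec (∁ ⁅ h ⁆)
  in <⇒≱ (≤-reflexive (+-comm 1 (∣ I ∣))) (no-separation M dec 1 none ⁅ h ⁆ (≤-reflexive (sym (∣⁅x⁆∣≡1 h)))
       (card-pos (g , x∉p⇒x∈∁p (ne ∘ x∈⁅y⁆⇒x≡y h)))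
       {0} (λ K sK iK → ≤-reflexive (empty-card λ (x , m) → iK ⁅ h ⁆ c λ q → subst (_∈ K) (trans (x∈⁅y⁆⇒x≡y h (sK m)) (sym (x∈⁅y⁆⇒x≡y h q))) m))
       max I iI)

-- Without such a circuit, `h` could be added to a basis of the complement of `A`. As `A` has rank
-- at most `∣ A ∣`, it would be a separation of that order.
circuit-through : ∀ {n} (M : Matroid n) → (∀ X → Dec (Circuit M X)) → ∀ {A h} → ¬ HasSeparation M (∣ A ∣) → h ∈ A →
  ∣ A ∣ ≤ ∣ ∁ A ∣ → ∃[ C ] (Circuit M C × h ∈ C × C ⊆ (∁ A ∪ ⁅ h ⁆))
circuit-through M dec {A} {h} none hA le = decidable-stable (anySubset? λ C → dec C ×-dec (h ∈? C) ×-dec (C ⊆? (∁ A ∪ ⁅ h ⁆))) λ no-circuit →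
  let (I , sI , iI , max) = basis M dec (∁ A)
      dis : Disjoint I ⁅ h ⁆
      dis p q = x∈∁p⇒x∉p (sI p) (subst (_∈ A) (sym (x∈⁅y⁆⇒x≡y h q)) hA)
      ind : Independent M (I ∪ ⁅ h ⁆)
      ind C c s = case h ∈? C of λ where
        (yes p) → no-circuit (C , c , p , λ u → [ (λ r → ∪ˡ (sI r)) , ∪ʳ {A = ∁ A} ]′ (x∈p∪q⁻ I ⁅ h ⁆ (s u)))
        (no n) → iI C c λ {x} u → [ id , (λ q → ⊥-elim (n (subst (_∈ C) (x∈⁅y⁆⇒x≡y h q) u))) ]′ (x∈p∪q⁻ I ⁅ h ⁆ (s u))
  in 1+n≰n (≤-trans (≤-reflexive (trans (cong suc (+-comm (∣ A ∣) (∣ I ∣))) (cong (_+ ∣ A ∣) (sym (trans (card-∪ dis) (trans (cong (∣ I ∣ +_) (∣⁅x⁆∣≡1 h)) (+-comm (∣ I ∣) 1)))))))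
       (no-separation M dec (∣ A ∣) none A ≤-refl le (λ K sK _ → p⊆q⇒∣p∣≤∣q∣ sK) max (I ∪ ⁅ h ⁆) ind))

-- Ranks in the 2-sum

module TwoSumRank {k m : ℕ} (N : Matroid k) (L : Subset k) (M : Matroid m)
  (sum₂ : IsTwoSumU24 (Circuit N) L (Circuit M)) (decN : ∀ X → Dec (Circuit N X)) where

  open TwoSum N L M sum₂

  private
    InLift : Subset k → Subset k → Fin k → Fin 3 → Set
    InLift I A e i = (i ≡ 1F × e ∈ A) ⊎ (i ≡ 2F × e ∈ I)

    InLift? : ∀ I A e i → Dec (InLift I A e i)
    InLift? I A e i = ((i ≟F 1F) ×-dec (e ∈? A)) ⊎-dec ((i ≟F 2F) ×-dec (e ∈? I))

  module LiftIndep (I A : Subset k) where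
    private
      module F = Fibrewise (_∈ I) (_∈? I) (InLift I A) (InLift? I A)
    opaque
      set : Subset m
      set = F.set

      plain⁺ : ∀ {e} → e ∉ L → e ∈ I → f₁ e ∈ set
      plain⁺ = F.plain⁺

      piece⁺ : ∀ {e i} → e ∈ L → InLift I A e i → f₂ e i ∈ set
      piece⁺ = F.piece⁺

      plain⁻ : ∀ {e} → e ∉ L → f₁ e ∈ set → e ∈ I
      plain⁻ = F.plain⁻

      piece⁻ : ∀ {e i} → e ∈ L → f₂ e i ∈ set → InLift I A e i
      piece⁻ = F.piece⁻

      member : ∀ {t} → t ∈ set → (∃[ e ] (e ∉ L × f₁ e ≡ t × e ∈ I)) ⊎ (∃[ e ] ∃[ i ] (e ∈ L × f₂ e i ≡ t × InLift I A e i))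
      member = F.member

  -- One piece is taken over every element of `L` in `A`, and a second one over those that also lie
  -- in `I`. The index `0F` is never taken, so that the deleted element is avoided whichever triple
  -- it belongs to.
  lift : Subset k → Subset k → Subset m
  lift I A = LiftIndep.set I A

  lift⊆over : ∀ {I A} → I ⊆ A → lift I A ⊆ over A
  lift⊆over {I} {A} s m with LiftIndep.member I A m
  ... | inj₁ (e , h , refl , p) = Over.plain⁺ A h (s p)
  ... | inj₂ (e , i , h , refl , inj₁ (_ , p)) = Over.piece⁺ A h p
  ... | inj₂ (e , i , h , refl , inj₂ (_ , p)) = Over.piece⁺ A h (s p)

  lift-avoids : ∀ {I A g} → g ∈ L → f₂ g 0F ∉ lift I A
  lift-avoids {I} {A} h m with LiftIndep.piece⁻ I A h m
  ... | inj₁ (() , _)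
  ... | inj₂ (() , _)

  lift-independent : ∀ {I A} → Independent N I → Independent M (lift I A)
  lift-independent {I} {A} ind Y cY s with circuit-cases cY
  ... | inj₁ (g , h , refl) = lift-avoids {I} {A} h (s (T⁺ h 0F))
  ... | inj₂ (C , o , cC , refl) = ind C cC inside-I
    where
    inside-I : C ⊆ I
    inside-I {e} p with e ∈? L
    ... | no h = LiftIndep.plain⁻ I A h (s (Expand.plain⁺ C o h p))
    ... | yes h = pick (o e) refl
      where
      elem : ∀ i → i ≢ o e → InLift I A e i
      elem i ne = LiftIndep.piece⁻ I A h (s (Expand.piece⁺ C o h (p , ne)))
      second : InLift I A e 2F → e ∈ I
      second (inj₁ (() , _))
      second (inj₂ (_ , q)) = q
      zeroth : InLift I A e 0F → e ∈ I
      zeroth (inj₁ (() , _))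
      zeroth (inj₂ (() , _))
      pick : ∀ i → o e ≡ i → e ∈ I
      pick 0F eq = second (elem 2F λ q → case trans q eq of λ ())
      pick 1F eq = second (elem 2F λ q → case trans q eq of λ ())
      pick 2F eq = zeroth (elem 0F λ q → case trans q eq of λ ())

  card-lift : ∀ {I A} → I ⊆ A → ∣ lift I A ∣ ≡ ∣ I ∣ + ∣ A ∩ L ∣
  card-lift {I} {A} s = trans (card-fibres (lift I A))
    (trans (sum-cong-≗ pointwise) (trans (∑-distrib-+ (χ I) (χ (A ∩ L))) (cong₂ _+_ (sym (card I)) (sym (card (A ∩ L))))))
    where
    pointwise : ∀ e → fibre (χ (lift I A)) e ≡ χ I e + χ (A ∩ L) e
    pointwise e with e ∈? L
    ... | no h = trans (plain (e ∈? I)) (sym (trans (cong (χ I e +_) (χ-∉ {S = A ∩ L} (h ∘ proj₂ ∘ x∈p∩q⁻ A L))) (+-identityʳ _)))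
      where
      plain : Dec (e ∈ I) → χ (lift I A) (f₁ e) ≡ χ I e
      plain (yes p) = trans (χ-∈ (LiftIndep.plain⁺ I A h p)) (sym (χ-∈ p))
      plain (no p) = trans (χ-∉ (p ∘ LiftIndep.plain⁻ I A h)) (sym (χ-∉ p))
    ... | yes h = trans (cong₂ _+_ (χ-∉ (lift-avoids {I} {A} h)) (cong₂ _+_ (one (e ∈? A)) (cong (_+ 0) (two (e ∈? I)))))
                    (trans (cong (χ (A ∩ L) e +_) (+-identityʳ _)) (+-comm (χ (A ∩ L) e) (χ I e)))
      where
      one : Dec (e ∈ A) → χ (lift I A) (f₂ e 1F) ≡ χ (A ∩ L) e
      one (yes p) = trans (χ-∈ (LiftIndep.piece⁺ I A h (inj₁ (refl , p)))) (sym (χ-∈ {S = A ∩ L} (x∈p∩q⁺ (p , h))))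
      one (no p) = trans (χ-∉ λ q → [ p ∘ proj₂ , (λ { (() , _) }) ]′ (LiftIndep.piece⁻ I A h q)) (sym (χ-∉ {S = A ∩ L} (p ∘ proj₁ ∘ x∈p∩q⁻ A L)))
      two : Dec (e ∈ I) → χ (lift I A) (f₂ e 2F) ≡ χ I e
      two (yes p) = trans (χ-∈ (LiftIndep.piece⁺ I A h (inj₂ (refl , p)))) (sym (χ-∈ p))
      two (no p) = trans (χ-∉ λ q → [ (λ { (() , _) }) , p ∘ proj₂ ]′ (LiftIndep.piece⁻ I A h q)) (sym (χ-∉ p))

  module _ (J : Subset m) where
    private
      Trace? : ∀ e → Dec ((e ∉ L × f₁ e ∈ J) ⊎ (e ∈ L × 2 ≤ fibre (χ J) e))
      Trace? e = (¬? (e ∈? L) ×-dec (f₁ e ∈? J)) ⊎-dec ((e ∈? L) ×-dec (2 ≤? fibre (χ J) e))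

    -- Two pieces span the basepoint of their copy of the four-point line, so an element of `L` is
    -- recorded as soon as two of its pieces are in `J`.
    trace : Subset k
    trace = ⟦ Trace? ⟧

    private
      fibre-L : ∀ {e} → e ∈ L → fibre (χ J) e ≡ ∑ (λ i → χ J (f₂ e i))
      fibre-L {e} h with e ∈? L
      ... | yes _ = refl
      ... | no h' = ⊥-elim (h' h)

      χ≤1 : ∀ {n} (S : Subset n) e → χ S e ≤ 1
      χ≤1 S e with lookup S e
      ... | true = ≤-refl
      ... | false = z≤n

    omit : ∀ e → ∃[ o ] (e ∈ L → 2 ≤ fibre (χ J) e → ∀ i → i ≢ o → f₂ e i ∈ J)
    omit e with f₂ e 0F ∈? J | f₂ e 1F ∈? J | f₂ e 2F ∈? J
    ... | yes p | yes q | _ = 2F , λ _ _ → λ { 0F _ → p ; 1F _ → q ; 2F n → ⊥-elim (n refl) }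
    ... | yes p | no q | yes r = 1F , λ _ _ → λ { 0F _ → p ; 2F _ → r ; 1F n → ⊥-elim (n refl) }
    ... | no p | yes q | yes r = 0F , λ _ _ → λ { 1F _ → q ; 2F _ → r ; 0F n → ⊥-elim (n refl) }
    ... | yes p | no q | no r = 0F , λ h t → ⊥-elim (<⇒≱ t (≤-trans (≤-reflexive (fibre-L h)) (+-mono-≤ (χ≤1 J (f₂ e 0F)) (≤-reflexive (cong₂ (λ a b → a + (b + 0)) (χ-∉ q) (χ-∉ r))))))
    ... | no p | yes q | no r = 0F , λ h t → ⊥-elim (<⇒≱ t (≤-trans (≤-reflexive (trans (fibre-L h) (cong₂ (λ a b → a + (χ J (f₂ e 1F) + (b + 0))) (χ-∉ p) (χ-∉ r)))) (+-mono-≤ (χ≤1 J (f₂ e 1F)) z≤n)))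
    ... | no p | no q | r = 0F , λ h t → ⊥-elim (<⇒≱ t (≤-trans (≤-reflexive (trans (fibre-L h) (cong₂ (λ a b → a + (b + (χ J (f₂ e 2F) + 0))) (χ-∉ p) (χ-∉ q)))) (+-mono-≤ (χ≤1 J (f₂ e 2F)) z≤n)))

    trace-independent : Independent M J → Independent N trace
    trace-independent ind C cC s = ind (expand C (proj₁ ∘ omit)) (circuit-expand (proj₁ ∘ omit) cC) into
      where
      into : expand C (proj₁ ∘ omit) ⊆ J
      into m with Expand.member C (proj₁ ∘ omit) m
      ... | inj₁ (e , h , refl , p) = [ proj₂ , (λ q → ⊥-elim (h (proj₁ q))) ]′ (∈⟦⟧⁻ Trace? (s p))
      ... | inj₂ (e , i , h , refl , p , ne) =
              [ (λ q → ⊥-elim (proj₁ q h)) , (λ q → proj₂ (omit e) h (proj₂ q) i ne) ]′ (∈⟦⟧⁻ Trace? (s p))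

    -- An independent set has at most two pieces over an element of `L`: one is charged to `L`, the
    -- other to the trace.
    card-trace : Independent M J → ∣ J ∣ ≤ ∣ trace ∣ + ∣ L ∣
    card-trace ind = ≤-trans (≤-reflexive (card-fibres J)) (≤-trans (∑-mono pointwise)
      (≤-reflexive (trans (∑-distrib-+ (χ trace) (χ L)) (cong₂ _+_ (sym (card trace)) (sym (card L))))))
      where
      small : ∀ {e} → e ∈ L → fibre (χ J) e ≤ 2
      small {e} h = ≮⇒≥ λ t → ind (T e) (circuit-T h) λ m → let (i , eq) = T⁻ m in subst (_∈ J) eq (all i (≤-trans t (≤-reflexive (fibre-L h))))
        where
        all : ∀ i → 3 ≤ ∑ (λ i → χ J (f₂ e i)) → f₂ e i ∈ J
        all 0F t = χ-pos (≮⇒≥ λ z → <⇒≱ t (≤-trans (+-mono-≤ (≤-pred z) (+-mono-≤ (χ≤1 J (f₂ e 1F)) (+-monoˡ-≤ 0 (χ≤1 J (f₂ e 2F))))) ≤-refl))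
        all 1F t = χ-pos (≮⇒≥ λ z → <⇒≱ t (+-mono-≤ (χ≤1 J (f₂ e 0F)) (+-mono-≤ (≤-pred z) (+-monoˡ-≤ 0 (χ≤1 J (f₂ e 2F))))))
        all 2F t = χ-pos (≮⇒≥ λ z → <⇒≱ t (+-mono-≤ (χ≤1 J (f₂ e 0F)) (+-mono-≤ (χ≤1 J (f₂ e 1F)) (+-monoˡ-≤ 0 (≤-pred z)))))
      plain : ∀ {e} → e ∉ L → fibre (χ J) e ≤ χ trace e
      plain {e} h with e ∈? L
      ... | yes h' = ⊥-elim (h h')
      ... | no _ with f₁ e ∈? J
      ...   | yes p = ≤-trans (χ≤1 J (f₁ e)) (≤-reflexive (sym (χ-∈ (∈⟦⟧⁺ Trace? (inj₁ (h , p))))))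
      ...   | no p = ≤-trans (≤-reflexive (χ-∉ p)) z≤n
      pointwise : ∀ e → fibre (χ J) e ≤ χ trace e + χ L e
      pointwise e = case e ∈? L of λ where
        (yes h) → case 2 ≤? fibre (χ J) e of λ where
          (yes t) → ≤-trans (small h) (≤-reflexive (sym (cong₂ _+_ (χ-∈ (∈⟦⟧⁺ Trace? (inj₂ (h , t)))) (χ-∈ h))))
          (no t) → ≤-trans (≤-pred (≰⇒> t)) (≤-trans (≤-reflexive (sym (χ-∈ h))) (m≤n+m _ (χ trace e)))
        (no h) → ≤-trans (plain h) (m≤m+n _ _)

  -- Passing from `N` to `M` adds `∣ A ∩ L ∣` on one side, `∣ ∁ A ∩ L ∣` on the other and at most
  -- `∣ L ∣` in total, so the inequality carries over. The bounds are requested only for sets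
  -- without any `f₂ g 0F`, because the graph describes only circuits that avoid the deleted
  -- element.
  no-separation-over : ∀ κ → ¬ HasSeparation N κ → ∀ A → κ ≤ ∣ A ∣ → κ ≤ ∣ ∁ A ∣ → ∀ {α β} →
    (∀ I → I ⊆ over A → (∀ {g} → g ∈ L → f₂ g 0F ∉ I) → Independent M I → ∣ I ∣ ≤ α) →
    (∀ I → I ⊆ over (∁ A) → (∀ {g} → g ∈ L → f₂ g 0F ∉ I) → Independent M I → ∣ I ∣ ≤ β) →
    ∀ J → Independent M J → ∣ J ∣ + κ ≤ α + β
  no-separation-over κ none A kA kB {α} {β} hα hβ J ind =
    let (I , sI , iI , maxI) = basis N decN A
        (K , sK , iK , maxK) = basis N decN (∁ A)
        base = no-separation N decN κ none A kA kB maxI maxK (trace J) (trace-independent J ind)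
        a = ≤-trans (≤-reflexive (sym (card-lift sI))) (hα (lift I A) (lift⊆over sI) (lift-avoids {I} {A}) (lift-independent iI))
        b = ≤-trans (≤-reflexive (sym (card-lift sK))) (hβ (lift K (∁ A)) (lift⊆over sK) (lift-avoids {K} {∁ A}) (lift-independent iK))
    in ≤-trans (+-monoˡ-≤ κ (card-trace J ind)) (≤-trans (≤-reflexive (ar₁ (∣ trace J ∣) (∣ L ∣) κ))
         (≤-trans (+-monoˡ-≤ (∣ L ∣) base) (≤-trans (≤-reflexive (trans (cong (∣ I ∣ + ∣ K ∣ +_) split) (ar₂ (∣ I ∣) (∣ K ∣) (∣ A ∩ L ∣) (∣ ∁ A ∩ L ∣)))) (+-mono-≤ a b))))
    where
    ar₁ : ∀ t l k → t + l + k ≡ t + k + l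
    ar₁ = solve-∀
    ar₂ : ∀ i k a b → i + k + (a + b) ≡ (i + a) + (k + b)
    ar₂ = solve-∀
    split : ∣ L ∣ ≡ ∣ A ∩ L ∣ + ∣ ∁ A ∩ L ∣
    split = trans (cong ∣_∣ (sym (∪-cong-∈ {A = A ∩ L} {∁ A ∩ L} [ proj₂ ∘ x∈p∩q⁻ A L , proj₂ ∘ x∈p∩q⁻ (∁ A) L ]′ (λ {e} m → case e ∈? A of λ where
        (yes p) → inj₁ (x∈p∩q⁺ (p , m))
        (no p) → inj₂ (x∈p∩q⁺ (x∉p⇒x∈∁p p , m))))))
      (card-∪ {A = A ∩ L} λ p q → x∈∁p⇒x∉p (proj₁ (x∈p∩q⁻ (∁ A) L q)) (proj₁ (x∈p∩q⁻ A L p)))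

-- Triples in a frame representation

swap : ∀ {k} → (Fin k → Fin 3) → Fin k → Fin 3 → Fin k → Fin 3
swap o g i e with e ≟F g
... | yes _ = i
... | no _ = o e

swap-at : ∀ {k} (o : Fin k → Fin 3) g i → swap o g i g ≡ i
swap-at o g i with g ≟F g
... | yes _ = refl
... | no ne = ⊥-elim (ne refl)

swap-off : ∀ {k} (o : Fin k → Fin 3) {g} i {e} → e ≢ g → swap o g i e ≡ o e
swap-off o {g} i {e} ne with e ≟F g
... | yes eq = ⊥-elim (ne eq)
... | no _ = refl

module Represented {k m : ℕ} (N : Matroid k) (L : Subset k) (M : Matroid m)
  (sum₂ : IsTwoSumU24 (Circuit N) L (Circuit M)) (j : Fin m) {v : ℕ} (G : Graph v m) (rep : Represents M j G) where

  open TwoSum N L M sum₂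
  open Counting G
  open Shapes G
  open Represents rep

  opaque
    circuit-connected : ∀ {X} → j ∉ X → Circuit M X → Connected G X
    circuit-connected nj c = [ (λ cyc → proj₁ (proj₂ cyc)) , proj₁ ]′ (shape nj c)

  opaque
    circuit-no-leaf : ∀ {X} → j ∉ X → Circuit M X → NoLeaf X
    circuit-no-leaf nj c = [ cycle-no-leaf , (λ b → proj₁ (proj₂ b)) ]′ (shape nj c)

  f₂-injective : ∀ {g i i'} → g ∈ L → f₂ g i ≡ f₂ g i' → i ≡ i'
  f₂-injective {g} {i} {i'} h eq = proj₂ (proj₁ (proj₂ (proj₂ (proj₂ sum₂))) g g i i' h h eq)

  f₂-owner : ∀ {g g' i i'} → g ∈ L → g' ∈ L → f₂ g i ≡ f₂ g' i' → g ≡ g'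
  f₂-owner {g} {g'} {i} {i'} h h' eq = proj₁ (proj₁ (proj₂ (proj₂ (proj₂ sum₂))) g g' i i' h h' eq)

  f₁≢f₂ : ∀ {g e i} → e ∉ L → g ∈ L → f₁ e ≢ f₂ g i
  f₁≢f₂ {g} {e} {i} h h' = proj₁ (proj₂ (proj₂ (proj₂ (proj₂ sum₂)))) e g i h h'

  pair-deg : ∀ {S e f} → e ≢ f → e ∈ S → f ∈ S → ∀ x → d S x ≡ inc e x + inc f x + d (S ∖ ⁅ e ⁆ ∖ ⁅ f ⁆) x
  pair-deg {S} {e} {f} ne p q x = trans (deg-∈ p x)
    (trans (cong (inc e x +_) (deg-∈ (∈∖⁺ q λ k → ne (sym (x∈⁅y⁆⇒x≡y e k))) x)) (sym (+-assoc (inc e x) (inc f x) _)))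

  pair-card : ∀ {S : Subset m} {e f} → e ≢ f → e ∈ S → f ∈ S → ∣ S ∣ ≡ suc (suc ∣ S ∖ ⁅ e ⁆ ∖ ⁅ f ⁆ ∣)
  pair-card {e = e} ne p q = trans (card-∈ p) (cong suc (card-∈ (∈∖⁺ q λ k → ne (sym (x∈⁅y⁆⇒x≡y e k)))))

  triple-rest : ∀ {g} → g ∈ L → ∀ o → T g ∖ ⁅ f₂ g (next o) ⁆ ∖ ⁅ f₂ g (next (next o)) ⁆ ≡ ⁅ f₂ g o ⁆
  triple-rest {g} h o = ⊆-antisym to from
    where
    to : T g ∖ ⁅ f₂ g (next o) ⁆ ∖ ⁅ f₂ g (next (next o)) ⁆ ⊆ ⁅ f₂ g o ⁆
    to m with T⁻ (∖⊆ (∖⊆ m))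
    ... | i , refl with next-cases o i
    ...   | inj₁ refl = x∈⁅x⁆ _
    ...   | inj₂ (inj₁ refl) = ⊥-elim (proj₂ (∈∖⁻ (∖⊆ m)) (x∈⁅x⁆ _))
    ...   | inj₂ (inj₂ refl) = ⊥-elim (proj₂ (∈∖⁻ m) (x∈⁅x⁆ _))
    from : ⁅ f₂ g o ⁆ ⊆ T g ∖ ⁅ f₂ g (next o) ⁆ ∖ ⁅ f₂ g (next (next o)) ⁆
    from m with x∈⁅y⁆⇒x≡y _ m
    ... | refl = ∈∖⁺ (∈∖⁺ (T⁺ h o) λ q → next≢ o (sym (f₂-injective h (x∈⁅y⁆⇒x≡y _ q))))
                   λ q → next²≢ o (sym (f₂-injective h (x∈⁅y⁆⇒x≡y _ q)))

  pair≢ : ∀ {g} → g ∈ L → ∀ o → f₂ g (next o) ≢ f₂ g (next (next o))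
  pair≢ h o eq = next≢ (next o) (sym (f₂-injective h eq))

  deg-T : ∀ {g} → g ∈ L → ∀ o x → d (T g) x ≡ inc (f₂ g (next o)) x + inc (f₂ g (next (next o))) x + inc (f₂ g o) x
  deg-T {g} h o x = trans (pair-deg (pair≢ h o) (T⁺ h _) (T⁺ h _) x) (cong (inc (f₂ g (next o)) x + inc (f₂ g (next (next o))) x +_) (trans (cong (λ S → d S x) (triple-rest h o)) (deg-⁅⁆ _ x)))

  card-T : ∀ {g} → g ∈ L → ∣ T g ∣ ≡ 3
  card-T {g} h = trans (pair-card (pair≢ h 0F) (T⁺ h _) (T⁺ h _)) (cong (λ n → suc (suc n)) (trans (cong ∣_∣ (triple-rest h 0F)) (∣⁅x⁆∣≡1 (f₂ g 0F))))

  module _ {C : Subset k} {g : Fin k} (h : g ∈ L) (p : g ∈ C) where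

    piece₁ : ∀ o → f₂ g (next (o g)) ∈ expand C o
    piece₁ o = Expand.piece⁺ C o h (p , next≢ (o g))

    piece₂ : ∀ o → f₂ g (next (next (o g))) ∈ expand C o
    piece₂ o = Expand.piece⁺ C o h (p , next²≢ (o g))

    expand-rest : ∀ o → expand C o ∖ ⁅ f₂ g (next (o g)) ⁆ ∖ ⁅ f₂ g (next (next (o g))) ⁆ ≡ expand C o ∖ T g
    expand-rest o = ⊆-antisym (λ m → ∈∖⁺ (∖⊆ (∖⊆ m)) (to m))
      (λ m → ∈∖⁺ (∈∖⁺ (∖⊆ m) λ q → proj₂ (∈∖⁻ m) (subst (_∈ T g) (sym (x∈⁅y⁆⇒x≡y _ q)) (T⁺ h _)))
                  λ q → proj₂ (∈∖⁻ m) (subst (_∈ T g) (sym (x∈⁅y⁆⇒x≡y _ q)) (T⁺ h _)))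
      where
      to : ∀ {t} → t ∈ expand C o ∖ ⁅ f₂ g (next (o g)) ⁆ ∖ ⁅ f₂ g (next (next (o g))) ⁆ → t ∉ T g
      to m t with T⁻ {g} t
      ... | i , refl with next-cases (o g) i
      ...   | inj₁ eq = proj₂ (Expand.piece⁻ C o h (∖⊆ (∖⊆ m))) eq
      ...   | inj₂ (inj₁ refl) = proj₂ (∈∖⁻ (∖⊆ m)) (x∈⁅x⁆ _)
      ...   | inj₂ (inj₂ refl) = proj₂ (∈∖⁻ m) (x∈⁅x⁆ _)

    deg-expand : ∀ o x → d (expand C o) x ≡ inc (f₂ g (next (o g))) x + inc (f₂ g (next (next (o g)))) x + d (expand C o ∖ T g) x
    deg-expand o x = trans (pair-deg (pair≢ h (o g)) (piece₁ o) (piece₂ o) x) (cong (λ S → _ + d S x) (expand-rest o))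

    card-expand : ∀ o → ∣ expand C o ∣ ≡ suc (suc ∣ expand C o ∖ T g ∣)
    card-expand o = trans (pair-card (pair≢ h (o g)) (piece₁ o) (piece₂ o)) (cong (λ S → suc (suc ∣ S ∣)) (expand-rest o))

    swap-rest⊆ : ∀ o i → expand C (swap o g i) ∖ T g ⊆ expand C o ∖ T g
    swap-rest⊆ o i m with Expand.member C (swap o g i) (∖⊆ m)
    ... | inj₁ (e , h' , refl , q) = ∈∖⁺ (Expand.plain⁺ C o h' q) (proj₂ (∈∖⁻ m))
    ... | inj₂ (e , i' , h' , refl , q , ne) = ∈∖⁺ (Expand.piece⁺ C o h' (q , λ eq → ne (trans eq (sym (swap-off o i λ { refl → proj₂ (∈∖⁻ m) (T⁺ h i') }))))) (proj₂ (∈∖⁻ m))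

    swap-rest⊇ : ∀ o i → expand C o ∖ T g ⊆ expand C (swap o g i) ∖ T g
    swap-rest⊇ o i m with Expand.member C o (∖⊆ m)
    ... | inj₁ (e , h' , refl , q) = ∈∖⁺ (Expand.plain⁺ C _ h' q) (proj₂ (∈∖⁻ m))
    ... | inj₂ (e , i' , h' , refl , q , ne) = ∈∖⁺ (Expand.piece⁺ C _ h' (q , λ eq → ne (trans eq (swap-off o i λ { refl → proj₂ (∈∖⁻ m) (T⁺ h i') })))) (proj₂ (∈∖⁻ m))

    swap-rest : ∀ o i → expand C (swap o g i) ∖ T g ≡ expand C o ∖ T g
    swap-rest o i = ⊆-antisym (swap-rest⊆ o i) (swap-rest⊇ o i)

    deg-swap : ∀ o i x → d (expand C (swap o g i)) x ≡ inc (f₂ g (next i)) x + inc (f₂ g (next (next i))) x + d (expand C o ∖ T g) x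
    deg-swap o i x = trans (deg-expand (swap o g i) x) (cong₂ (λ a S → inc (f₂ g (next a)) x + inc (f₂ g (next (next a))) x + d S x) (swap-at o g i) (swap-rest o i))

    expand⊈T : Circuit N C → ∀ o → ¬ (expand C o ⊆ T g)
    expand⊈T c o s = proj₂ (Expand.piece⁻ C o h (subst (f₂ g (o g) ∈_) (sym (incomp M _ _ (circuit-expand o c) (circuit-T h) s)) (T⁺ h (o g)))) refl

  opaque
    -- By connectivity the rest of the cycle meets an end of `t`. If `t` were a loop, the degree
    -- there would be at least three.
    cycle-link : ∀ {D t t'} → IsCycle G D → t ∈ D → t' ∈ D → t ≢ t' → ∀ x → inc t x ≤ 1
    cycle-link {D} {t} {t'} cyc p q ne x = ≮⇒≥ λ two →
      let (y , a , b) = connected-share (proj₁ (proj₂ cyc)) (⁅⁆⊆ p) (t , x∈⁅x⁆ t) (t' , ∈∖⁺ q λ k → ne (sym (x∈⁅y⁆⇒x≡y t k)))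
          a' = ≤-trans a (≤-reflexive (deg-⁅⁆ t y))
      in case x ≟F y of λ where
        (yes refl) → <⇒≱ (+-mono-≤ two b) (≤-trans (≤-reflexive (sym (deg-∈ p x))) (≤-reflexive (deg-cycle cyc (≤-trans (≤-trans (s≤s z≤n) two) (deg-inc p x)))))
        (no x≢y) → <⇒≱ (+-mono-≤ two a') (≤-trans (∑-two-terms (inc t) x≢y) (≤-reflexive (inc-sum t)))

  -- A triple is a circuit with three edges: as a cycle it is a triangle, as a bicycle it has two
  -- vertices (`fat-nv`).
  data Kind (g : Fin k) : Set where
    triangle : IsCycle G (T g) → Kind g
    fat : Bicycle (T g) → Kind g

  opaque
    kind : ∀ {g} → g ∈ L → j ∉ T g → Kind g
    kind h nj = [ triangle , fat ]′ (shape nj (circuit-T h))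

  fat-nv : ∀ {g} → g ∈ L → Bicycle (T g) → nv (T g) ≡ 2
  fat-nv h (_ , _ , size) = suc-injective (trans (sym size) (card-T h))

  both-one : ∀ {a b} → a ≤ 1 → b ≤ 1 → 2 ≤ a + b → a ≡ 1 × b ≡ 1
  both-one {0} {0} _ _ ()
  both-one {0} {1} _ _ (s≤s ())
  both-one {1} {0} _ _ (s≤s ())
  both-one {1} {1} _ _ _ = refl , refl
  both-one {0} {suc (suc _)} _ (s≤s ()) _
  both-one {1} {suc (suc _)} _ (s≤s ()) _
  both-one {suc (suc _)} (s≤s ()) _ _

  triangle-link : ∀ {g} → g ∈ L → IsCycle G (T g) → ∀ i x → inc (f₂ g i) x ≤ 1
  triangle-link h cyc i = cycle-link cyc (T⁺ h i) (T⁺ h (next i)) λ eq → next≢ i (sym (f₂-injective h eq))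

  opaque
    -- The two edges other than `o` have four ends on three vertices. Some vertex receives two of
    -- them, one from each edge since neither is a loop.
    triangle-corner : ∀ {g} → g ∈ L → IsCycle G (T g) → ∀ o → ∃[ x ]
      (inc (f₂ g (next o)) x ≡ 1 × inc (f₂ g (next (next o))) x ≡ 1 × inc (f₂ g o) x ≡ 0)
    triangle-corner {g} h cyc o =
      let (x , lt) = ∑-pigeonhole {f = λ x → sg (d (T g) x)} {g = λ x → inc a x + inc b x}
            (≤-reflexive (trans (cong suc (trans (sym (cycle-card cyc)) (card-T h))) (sym (trans (∑-distrib-+ (inc a) (inc b)) (cong₂ _+_ (inc-sum a) (inc-sum b))))))
          V-x : V (T g) x
          V-x = ≤-trans (≤-trans (≤-trans (s≤s z≤n) lt) (m≤m+n _ _)) (≤-reflexive (sym (deg-T h o x)))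
          (p , q) = both-one (triangle-link h cyc _ x) (triangle-link h cyc _ x) (≤-trans (s≤s (≤-reflexive (sym (sg-pos V-x)))) lt)
      in x , p , q , +-cancelˡ-≡ 2 _ 0 (trans (cong₂ (λ s t → s + t + inc (f₂ g o) x) (sym p) (sym q)) (trans (sym (deg-T h o x)) (deg-cycle cyc V-x)))
      where
      a b : Fin m
      a = f₂ g (next o)
      b = f₂ g (next (next o))

  -- Swapping pairs of a triangle would leave a vertex of degree one, unless the circuit branches at the common end of the pair;
  -- a fat triple contains a cycle, and the circuit branches on it.
  opaque
    fork : ∀ {C g} → g ∈ L → g ∈ C → Circuit N C → j ∉ T g → ∀ o → j ∉ expand C o →
      ∃[ x ] (2 ≤ inc (f₂ g (next (o g))) x + inc (f₂ g (next (next (o g)))) x × 3 ≤ d (expand C o) x)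
    fork {C} {g} h p c njT o njX with kind h njT
    ... | triangle cyc =
      let (x , p₁ , p₂ , p₀) = triangle-corner h cyc (o g)
          o' = swap o g (next (o g))
          noleaf : d (expand C o') x ≢ 1
          noleaf = circuit-no-leaf njX' (circuit-expand o' c) x
          third : next (next (next (o g))) ≡ o g
          third = next³ (o g)
          total : d (expand C o') x ≡ suc (d (expand C o ∖ T g) x)
          total = trans (deg-swap h p o (next (o g)) x) (cong₂ (λ s t → s + t + d (expand C o ∖ T g) x) p₂ (trans (cong (λ i → inc (f₂ g i) x) third) p₀))
          positive : 1 ≤ d (expand C o ∖ T g) x
          positive = ≮⇒≥ λ z → noleaf (trans total (cong suc (n≤0⇒n≡0 (≤-pred z))))
          two : 2 ≤ inc (f₂ g (next (o g))) x + inc (f₂ g (next (next (o g)))) x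
          two = ≤-reflexive (sym (cong₂ _+_ p₁ p₂))
      in x , two , ≤-trans (+-mono-≤ two positive) (≤-reflexive (sym (deg-expand h p o x)))
      where
      next³ : ∀ i → next (next (next i)) ≡ i
      next³ 0F = refl
      next³ 1F = refl
      next³ 2F = refl
      njX' : j ∉ expand C (swap o g (next (o g)))
      njX' m = case j ∈? T g of λ where
        (yes t) → njT t
        (no t) → njX (∖⊆ (swap-rest⊆ h p o (next (o g)) (∈∖⁺ m t)))
    ... | fat b =
      -- Any two edges of a fat triple lie on its two vertices, so the pair used by the circuit
      -- already contains a cycle.
      let (D , s , cyc) = cycle-in {P} (a , ∪ˡ (x∈⁅x⁆ a)) (≤-trans (nv-mono P⊆T) (≤-reflexive (trans (fat-nv h b) (sym cardP))))
          (x , q , _ , three) = cycle-branch (circuit-connected njX (circuit-expand o c)) cyc (P⊆X ∘ s)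
            (λ eq → expand⊈T h p c o λ m → P⊆T (s (subst (_ ∈_) (sym eq) m)))
      in x , ≤-trans (≤-reflexive (sym (deg-cycle cyc q))) (≤-trans (deg-mono s x) (≤-reflexive (degP x))) , three
      where
      a b' : Fin m
      a = f₂ g (next (o g))
      b' = f₂ g (next (next (o g)))
      P : Subset m
      P = ⁅ a ⁆ ∪ ⁅ b' ⁆
      dis : Disjoint ⁅ a ⁆ ⁅ b' ⁆
      dis s t = pair≢ h (o g) (trans (sym (x∈⁅y⁆⇒x≡y a s)) (x∈⁅y⁆⇒x≡y b' t))
      P⊆T : P ⊆ T g
      P⊆T = ∪⊆ (⁅⁆⊆ (T⁺ h _)) (⁅⁆⊆ (T⁺ h _))
      P⊆X : P ⊆ expand C o
      P⊆X = ∪⊆ (⁅⁆⊆ (piece₁ h p o)) (⁅⁆⊆ (piece₂ h p o))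
      cardP : ∣ P ∣ ≡ 2
      cardP = trans (card-∪ dis) (cong₂ _+_ (∣⁅x⁆∣≡1 a) (∣⁅x⁆∣≡1 b'))
      degP : ∀ x → d P x ≡ inc a x + inc b' x
      degP x = trans (deg-∪ dis x) (cong₂ _+_ (deg-⁅⁆ a x) (deg-⁅⁆ b' x))

  opaque
    -- The fork has degree at least three, which no cycle allows.
    expand-bicycle : ∀ {C g} → g ∈ L → g ∈ C → Circuit N C → j ∉ T g → ∀ o → j ∉ expand C o → Bicycle (expand C o)
    expand-bicycle h p c njT o njX with shape njX (circuit-expand o c) | fork h p c njT o njX
    ... | inj₂ b | _ = b
    ... | inj₁ cyc | x , _ , three = ⊥-elim (<⇒≱ three (≤-reflexive (deg-cycle cyc (≤-trans (s≤s z≤n) three))))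

  -- Three forks would give a bicycle three units of excess degree.
  opaque
    no-three-triples : ∀ {C a b c} → Circuit N C → a ≢ b → a ≢ c → b ≢ c →
      a ∈ L → b ∈ L → c ∈ L → a ∈ C → b ∈ C → c ∈ C → j ∉ T a → j ∉ T b → j ∉ T c → j ∉ over C → False
    no-three-triples {C} {a} {b} {c} cC ab ac bc aL bL cL aC bC cC' ja jb jc jC =
      let (x , x₂ , x₃) = fork aL aC cC ja o njX
          (y , y₂ , y₃) = fork bL bC cC jb o njX
          (z , z₂ , z₃) = fork cL cC' cC jc o njX
      in <⇒≱ ≤-refl (≤-trans (≤-reflexive (sym (trans (∑-distrib-+ (λ u → δ x u + δ y u) (δ z)) (cong₂ _+_ (∑δδ x y) (∑δ z)))))
           (excess (expand-bicycle aL aC cC ja o njX) (λ u → (δ x u + δ y u) + δ z u) (pointwise x₂ x₃ y₂ y₃ z₂ z₃)))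
      where
      o : Fin k → Fin 3
      o _ = 0F
      X : Subset m
      X = expand C o
      njX : j ∉ X
      njX = jC ∘ expand⊆over
      pair : Fin k → Fin v → ℕ
      pair g u = inc (f₂ g 1F) u + inc (f₂ g 2F) u
      off-T : ∀ {g g' i} → g ≢ g' → g ∈ L → g' ∈ L → f₂ g i ∉ T g'
      off-T ne h h' t = let (i' , eq) = T⁻ t in ne (sym (f₂-owner h' h eq))
      three-pairs : ∀ u → pair a u + (pair b u + pair c u) ≤ d X u
      three-pairs u = ≤-trans (+-monoʳ-≤ (pair a u) (≤-trans
          (≤-trans (+-monoʳ-≤ (pair b u) (≤-trans (m≤m+n (pair c u) _) (≤-reflexive (sym (pair-deg (pair≢ cL 0F)
            (inside₂ (piece₁ cL cC' o)) (inside₂ (piece₂ cL cC' o)) u)))))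
            (≤-reflexive (sym (pair-deg (pair≢ bL 0F) (inside₁ (piece₁ bL bC o)) (inside₁ (piece₂ bL bC o)) u)))) ≤-refl))
        (≤-reflexive (sym (deg-expand aL aC o u)))
        where
        inside₁ : ∀ {i} → f₂ b i ∈ X → f₂ b i ∈ X ∖ T a
        inside₁ p = ∈∖⁺ p (off-T (ab ∘ sym) bL aL)
        inside₂ : ∀ {i} → f₂ c i ∈ X → f₂ c i ∈ X ∖ T a ∖ ⁅ f₂ b 1F ⁆ ∖ ⁅ f₂ b 2F ⁆
        inside₂ p = ∈∖⁺ (∈∖⁺ (∈∖⁺ p (off-T (ac ∘ sym) cL aL)) λ q → bc (sym (f₂-owner cL bL (x∈⁅y⁆⇒x≡y _ q)))) λ q → bc (sym (f₂-owner cL bL (x∈⁅y⁆⇒x≡y _ q)))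
      pointwise : ∀ {x y z} → 2 ≤ pair a x → 3 ≤ d X x → 2 ≤ pair b y → 3 ≤ d X y → 2 ≤ pair c z → 3 ≤ d X z →
        ∀ u → 2 * sg (d X u) + ((δ x u + δ y u) + δ z u) ≤ d X u
      pointwise {x} {y} {z} x₂ x₃ y₂ y₃ z₂ z₃ u with x ≟F u | y ≟F u | z ≟F u
      -- Coinciding forks are paid for by the disjoint pairs: here three pairs give degree six where
      -- five is required.
      ... | yes refl | yes refl | yes refl = ≤-trans (+-monoˡ-≤ 3 (*-monoʳ-≤ 2 (sg≤1 (d X u)))) (≤-trans (≤-trans (n≤1+n 5) (+-mono-≤ x₂ (+-mono-≤ y₂ z₂))) (three-pairs u))
      ... | yes refl | yes refl | no _ = ≤-trans (+-monoˡ-≤ 2 (*-monoʳ-≤ 2 (sg≤1 (d X u)))) (≤-trans (+-mono-≤ x₂ (≤-trans y₂ (m≤m+n _ _))) (three-pairs u))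
      ... | yes refl | no _ | yes refl = ≤-trans (+-monoˡ-≤ 2 (*-monoʳ-≤ 2 (sg≤1 (d X u)))) (≤-trans (+-mono-≤ x₂ (≤-trans z₂ (m≤n+m _ (pair b u)))) (three-pairs u))
      ... | no _ | yes refl | yes refl = ≤-trans (+-monoˡ-≤ 2 (*-monoʳ-≤ 2 (sg≤1 (d X u)))) (≤-trans (≤-trans (+-mono-≤ y₂ z₂) (m≤n+m _ (pair a u))) (three-pairs u))
      ... | yes refl | no _ | no _ = ≤-trans (+-monoˡ-≤ 1 (*-monoʳ-≤ 2 (sg≤1 (d X u)))) x₃
      ... | no _ | yes refl | no _ = ≤-trans (+-monoˡ-≤ 1 (*-monoʳ-≤ 2 (sg≤1 (d X u)))) y₃
      ... | no _ | no _ | yes refl = ≤-trans (+-monoˡ-≤ 1 (*-monoʳ-≤ 2 (sg≤1 (d X u)))) z₃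
      ... | no _ | no _ | no _ = ≤-trans (≤-reflexive (+-identityʳ _)) (no-leaf-≥2 (circuit-no-leaf njX (circuit-expand o cC)) u)

-- Strong circuit elimination and spanning forests

module _ {n : ℕ} (M : Matroid n) where

  opaque
    -- Induction on the size of the union. If ordinary elimination loses `x`, its circuit `F` has an
    -- element `z` outside `C`. Eliminating `z` between `D` and `F` while keeping `y`, and then `y`
    -- between `C` and the result while keeping `x`, involves smaller unions both times.
    strong-elimination : ∀ {C D x y} → Circuit M C → Circuit M D → y ∈ C → y ∈ D → x ∈ C → x ∉ D →
      ∃[ F ] (Circuit M F × x ∈ F × F ⊆ C ∪ D × y ∉ F)
    strong-elimination cC cD = go _ cC cD ≤-refl
      where
      ∪-smaller : ∀ {A B : Subset n} {z} → A ⊆ B → z ∈ B → z ∉ A → ∣ A ∣ < ∣ B ∣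
      ∪-smaller s p q = p⊂q⇒∣p∣<∣q∣ (s , _ , p , q)
      go : ∀ k {C D x y} → Circuit M C → Circuit M D → ∣ C ∪ D ∣ ≤ k → y ∈ C → y ∈ D → x ∈ C → x ∉ D →
        ∃[ F ] (Circuit M F × x ∈ F × F ⊆ C ∪ D × y ∉ F)
      go zero {C} {D} cC cD le yC yD xC xD = ⊥-elim (<⇒≱ (card-pos (_ , ∪ˡ {A = C} {D} xC)) le)
      go (suc k) {C} {D} {x} {y} cC cD le yC yD xC xD
        with elim M C D y cC cD (λ { refl → xD xC }) yC yD
      ... | F , cF , sF with x ∈? F
      ...   | yes xF = F , cF , xF , (λ u → proj₁ (∈-⁻ {p = C ∪ D} (sF u))) , λ u → proj₂ (∈-⁻ {p = C ∪ D} (sF u)) refl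
      ...   | no x∉F =
        let F⊆ : F ⊆ C ∪ D
            F⊆ u = proj₁ (∈-⁻ {p = C ∪ D} (sF u))
            y∉F : y ∉ F
            y∉F u = proj₂ (∈-⁻ {p = C ∪ D} (sF u)) refl
            (z , zF , z∉C) = ⊈-witness {A = F} {C} λ s → x∉F (subst (x ∈_) (sym (incomp M F C cF cC s)) xC)
            zD = [ (λ u → ⊥-elim (z∉C u)) , id ]′ (x∈p∪q⁻ C D (F⊆ zF))
            D∪F⊆ : D ∪ F ⊆ C ∪ D
            D∪F⊆ = ∪⊆ (∪ʳ {A = C}) F⊆
            x∉D∪F : x ∉ D ∪ F
            x∉D∪F u = [ xD , x∉F ]′ (x∈p∪q⁻ D F u)
            (E , cE , yE , sE , z∉E) = go k cD cF (≤-pred (≤-trans (∪-smaller D∪F⊆ (∪ˡ xC) x∉D∪F) le)) zD zF yD y∉F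
            C∪E⊆ : C ∪ E ⊆ C ∪ D
            C∪E⊆ = ∪⊆ ∪ˡ (λ u → D∪F⊆ (sE u))
            (R , cR , xR , sR , y∉R) = go k cC cE (≤-pred (≤-trans (∪-smaller C∪E⊆ (∪ʳ {A = C} zD) λ u → [ z∉C , z∉E ]′ (x∈p∪q⁻ C E u)) le)) yC yE xC (λ u → x∉D∪F (sE u))
        in R , cR , xR , (λ u → C∪E⊆ (sR u)) , y∉R

    -- This is the transitivity of lying on a common circuit. Two strong eliminations replace `C₁`
    -- by a circuit through `w` with fewer elements outside `C`. The new circuit still meets `C`,
    -- since otherwise it would be properly contained in `C₁`.
    common-circuit : ∀ {C C₁ f z w} → Circuit M C → Circuit M C₁ → z ∈ C → f ∈ C → f ∈ C₁ → w ∈ C₁ → w ∉ C →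
      ∃[ F ] (Circuit M F × z ∈ F × w ∈ F × F ⊆ C ∪ C₁)
    common-circuit {C} {C₁₀} {_} {z} {w} cC cC₁ zC fC f₁ w₁ w∉C = go _ cC₁ ≤-refl fC f₁ w₁ (∪ʳ {A = C})
      where
      go : ∀ k {C₁ f} → Circuit M C₁ → ∣ C₁ ∖ C ∣ ≤ k → f ∈ C → f ∈ C₁ → w ∈ C₁ → C₁ ⊆ C ∪ C₁₀ →
        ∃[ F ] (Circuit M F × z ∈ F × w ∈ F × F ⊆ C ∪ C₁₀)
      go zero {C₁} c₁ le fC f₁ w₁ s = ⊥-elim (<⇒≱ (card-pos (w , ∈∖⁺ w₁ w∉C)) le)
      go (suc k) {C₁} {f} c₁ le fC f₁ w₁ s with z ∈? C₁
      ... | yes z₁ = C₁ , c₁ , z₁ , w₁ , s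
      ... | no z∉ with strong-elimination cC c₁ fC f₁ zC z∉
      ...   | C₂ , c₂ , z₂ , s₂ , f∉ with w ∈? C₂
      ...     | yes w₂ = C₂ , c₂ , z₂ , w₂ , λ u → ∪⊆ ∪ˡ s (s₂ u)
      ...     | no w∉ =
        let (y , y₂ , y∉C) = ⊈-witness {A = C₂} {C} λ t → f∉ (subst (f ∈_) (sym (incomp M C₂ C c₂ cC t)) fC)
            y₁ = [ (λ u → ⊥-elim (y∉C u)) , id ]′ (x∈p∪q⁻ C C₁ (s₂ y₂))
            (C₃ , c₃ , w₃ , s₃ , y∉) = strong-elimination c₁ c₂ y₁ y₂ w₁ w∉
            into : ∀ {u} → u ∈ C₃ → u ∉ C → u ∈ C₁
            into u₃ u∉ = [ id , (λ u₂ → [ (λ u → ⊥-elim (u∉ u)) , id ]′ (x∈p∪q⁻ C C₁ (s₂ u₂))) ]′ (x∈p∪q⁻ C₁ C₂ (s₃ u₃))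
            smaller : ∣ C₃ ∖ C ∣ < ∣ C₁ ∖ C ∣
            smaller = p⊂q⇒∣p∣<∣q∣ ((λ u → ∈∖⁺ (into (∖⊆ u) (proj₂ (∈∖⁻ u))) (proj₂ (∈∖⁻ u))) , y , ∈∖⁺ y₁ y∉C , λ u → y∉ (∖⊆ u))
            s₃' : C₃ ⊆ C ∪ C₁₀
            s₃' u = ∪⊆ s (λ t → ∪⊆ ∪ˡ s (s₂ t)) (s₃ u)
        in case any? (λ g → (g ∈? C) ×-dec (g ∈? C₃)) of λ where
             (yes (g , gC , g₃)) → go k c₃ (≤-pred (≤-trans smaller le)) gC g₃ w₃ s₃'
             (no none) → ⊥-elim (none (f , fC , subst (f ∈_) (sym (incomp M C₃ C₁ c₃ c₁ λ {u} u₃ → into u₃ λ uC → none (u , uC , u₃))) f₁))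

-- The cycle matroid of a graph and its spanning trees

module Cycles {v n : ℕ} (G : Graph v n) where
  open Counting G

  cycle-matroid : Subset n → Matroid n
  cycle-matroid S .Circuit X = IsCycle G X × X ⊆ S
  cycle-matroid S .empty-not (((e , m) , _) , _) = ∉⊥ m
  cycle-matroid S .incomp C D (cC , _) (cD , _) s = cycle-⊆ cC cD s
  cycle-matroid S .elim C D e (cC , sC) (cD , sD) ne eC eD =
    let (x , p) = inc-vertex e
        lt = cycles-union cC cD ne (≤-trans p (deg-inc eC x)) (≤-trans p (deg-inc eD x))
        (y , yC , y∉D) = ⊈-witness {A = C} {D} λ s → ne (cycle-⊆ cC cD s)
        Q = (C ∪ D) ∖ ⁅ e ⁆
        (F , sF , cF) = cycle-in {Q} (y , ∈∖⁺ (∪ˡ yC) λ q → y∉D (subst (_∈ D) (sym (x∈⁅y⁆⇒x≡y e q)) eD))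
                          (≤-trans (nv-mono ∖⊆) (≤-pred (≤-trans lt (≤-reflexive (card-∈ (∪ˡ {B = D} eC))))))
    in F , (cF , λ u → ∪⊆ sC sD (∖⊆ (sF u))) , λ {u} k → ∈-⁺ (∖⊆ (sF k)) λ { refl → proj₂ (∈∖⁻ (sF k)) (x∈⁅x⁆ e) }

  opaque
    -- Among the forests with at most one vertex more than edges, of which the link `f₀` is one, a
    -- largest is taken. An edge of `S` leaving its vertices could be added, so connectivity makes
    -- it reach every vertex of `S`.
    spanning-forest : ∀ {S f₀} → (∀ T → Dec (Forest T)) → Connected G S → f₀ ∈ S → (∀ x → inc f₀ x ≤ 1) →
      ∃[ I ] (I ⊆ S × Forest I × nv S ≤ suc ∣ I ∣)
    spanning-forest {S} {f₀} forest? con f₀∈ link = I , sI , fI , ≤-trans (nv-mono-V all) leI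
      where
      Good : Subset n → Set
      Good X = X ⊆ S × Forest X × nv X ≤ suc ∣ X ∣
      single : ∀ {f} → (∀ x → inc f x ≤ 1) → 2 ≤ nv ⁅ f ⁆
      single {f} le = subst (_≤ nv ⁅ f ⁆) (inc-sum f) (∑-mono λ x → ≤-trans (at (inc f x) (le x)) (≤-reflexive (cong sg (sym (deg-⁅⁆ f x)))))
        where
        at : ∀ a → a ≤ 1 → a ≤ sg a
        at 0 _ = z≤n
        at 1 _ = ≤-refl
        at (suc (suc a)) (s≤s ())
      upper : ∀ f → nv ⁅ f ⁆ ≤ 2
      upper f = subst (nv ⁅ f ⁆ ≤_) (inc-sum f) (∑-mono λ x → ≤-trans (≤-reflexive (cong sg (deg-⁅⁆ f x))) (at (inc f x)))
        where
        at : ∀ a → sg a ≤ a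
        at zero = z≤n
        at (suc a) = s≤s z≤n
      start : Good ⁅ f₀ ⁆
      start = ⁅⁆⊆ f₀∈ , (λ Z s (t , m) → ≤-trans (s≤s (≤-trans (p⊆q⇒∣p∣≤∣q∣ s) (≤-reflexive (∣⁅x⁆∣≡1 f₀))))
                (≤-trans (single link) (nv-mono λ q → subst (_∈ Z) (trans (x∈⁅y⁆⇒x≡y f₀ (s m)) (sym (x∈⁅y⁆⇒x≡y f₀ q))) m))) ,
              ≤-trans (upper f₀) (≤-reflexive (cong suc (sym (∣⁅x⁆∣≡1 f₀))))
      largest : ∃[ X ] (Good X × (∀ Z → Good Z → ∣ Z ∣ ≤ ∣ X ∣))
      largest = largest-subset {P = Good} (λ X → (X ⊆? S) ×-dec forest? X ×-dec (nv X ≤? suc ∣ X ∣)) ⁅ f₀ ⁆ start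
      I : Subset n
      I = proj₁ largest
      sI : I ⊆ S
      sI = proj₁ (proj₁ (proj₂ largest))
      fI : Forest I
      fI = proj₁ (proj₂ (proj₁ (proj₂ largest)))
      leI : nv I ≤ suc ∣ I ∣
      leI = proj₂ (proj₂ (proj₁ (proj₂ largest)))
      max : ∀ X → Good X → ∣ X ∣ ≤ ∣ I ∣
      max = proj₂ (proj₂ largest)
      neI : Nonempty I
      neI = decidable-stable (nonempty? I) λ em → <⇒≱ (≤-reflexive (sym (∣⁅x⁆∣≡1 f₀))) (≤-trans (max ⁅ f₀ ⁆ start) (≤-reflexive (empty-card em)))
      closed : ∀ {f x y} → f ∈ S → V I x → 1 ≤ inc f x → 1 ≤ inc f y → V I y
      closed {f} {x} {y} fS px fx fy = decidable-stable (V? I y) λ ny →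
        let f∉I : f ∉ I
            f∉I m = ny (≤-trans fy (deg-inc m y))
            x≢y : x ≢ y
            x≢y = λ { refl → ny px }
            size : ∣ I ∪ ⁅ f ⁆ ∣ ≡ suc ∣ I ∣
            size = trans (card-∪ λ m q → f∉I (subst (_∈ I) (x∈⁅y⁆⇒x≡y f q) m)) (trans (cong (∣ I ∣ +_) (∣⁅x⁆∣≡1 f)) (+-comm (∣ I ∣) 1))
        in <⇒≱ (≤-reflexive (sym size)) (max (I ∪ ⁅ f ⁆) (∪⊆ sI (⁅⁆⊆ fS) , forest⁺ fx fy ny x≢y ,
             ≤-trans (nv-add-edge f∉I x≢y px fx fy) (≤-trans (s≤s leI) (≤-reflexive (cong suc (sym size))))))
        where
        forest⁺ : 1 ≤ inc f x → 1 ≤ inc f y → ¬ V I y → x ≢ y → Forest (I ∪ ⁅ f ⁆)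
        forest⁺ fx fy ny x≢y Z s ne = case f ∈? Z of λ where
          (no n) → fI Z (λ {u} m → [ id , (λ q → ⊥-elim (n (subst (_∈ Z) (x∈⁅y⁆⇒x≡y f q) m))) ]′ (x∈p∪q⁻ I ⁅ f ⁆ (s m))) ne
          (yes p) →
            let rest⊆I : Z ∖ ⁅ f ⁆ ⊆ I
                rest⊆I m = [ id , (λ q → ⊥-elim (proj₂ (∈∖⁻ m) q)) ]′ (x∈p∪q⁻ I ⁅ f ⁆ (s (∖⊆ m)))
            in case nonempty? (Z ∖ ⁅ f ⁆) of λ where
              (yes ne') → ≤-trans (s≤s (≤-trans (≤-reflexive (card-∈ p)) (fI _ rest⊆I ne')))
                            (nv-extra (V-mono ∖⊆) y (λ q → ny (V-mono rest⊆I y q)) (≤-trans fy (deg-inc p y)))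
              (no em) → ≤-trans (s≤s (≤-reflexive (trans (card-∈ p) (cong suc (empty-card em))))) (nv-two x≢y (≤-trans fx (deg-inc p x)) (≤-trans fy (deg-inc p y)))
      Near? : ∀ f → Dec (f ∈ S × ∃[ x ] (V I x × 1 ≤ inc f x))
      Near? f = (f ∈? S) ×-dec (any? λ x → V? I x ×-dec (1 ≤? inc f x))
      near : Subset n
      near = ⟦ Near? ⟧
      all : ∀ x → V S x → V I x
      all x p = decidable-stable (V? I x) λ n →
        let (f , m , q) = deg-pos p
            (y , r , t) = connected-share con (λ u → proj₁ (∈⟦⟧⁻ Near? u))
              (let (g , u) = neI ; (z , i) = inc-vertex g in g , ∈⟦⟧⁺ Near? (sI u , z , ≤-trans i (deg-inc u z) , i))
              (f , ∈∖⁺ m λ u → let (_ , z , pz , iz) = ∈⟦⟧⁻ Near? u in n (closed m pz iz q))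
            (g , u , i) = deg-pos r
            (_ , z , pz , iz) = ∈⟦⟧⁻ Near? u
            (g' , u' , i') = deg-pos t
        in proj₂ (∈∖⁻ u') (∈⟦⟧⁺ Near? (∖⊆ u' , y , closed (proj₁ (∈⟦⟧⁻ Near? u)) pz iz i , i'))

-- Every element of L has a vertex of its own

two-elements : ∀ {n} {S : Subset n} {x y} → x ∈ S → y ∈ S → x ≢ y → 2 ≤ ∣ S ∣
two-elements {S = S} {x} {y} p q ne = ≤-trans
  (≤-reflexive (sym (trans (card-∪ {A = ⁅ x ⁆} {⁅ y ⁆} λ s t → ne (trans (sym (x∈⁅y⁆⇒x≡y x s)) (x∈⁅y⁆⇒x≡y y t))) (cong₂ _+_ (∣⁅x⁆∣≡1 x) (∣⁅x⁆∣≡1 y)))))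
  (p⊆q⇒∣p∣≤∣q∣ (∪⊆ (λ s → subst (_∈ S) (sym (x∈⁅y⁆⇒x≡y x s)) p) (λ s → subst (_∈ S) (sym (x∈⁅y⁆⇒x≡y y s)) q)))

-- The consequences of 3-connectivity whose proofs depend on the number of elements. `Avoiding` says
-- that deleting `g` leaves no coloop. In `Crossing`, the size alternatives settle the case of four
-- or more elements, and the circuit settles the case of three.
Avoiding Crossing : ∀ {k} → Matroid k → Set
Avoiding N = ∀ h g → h ≢ g → ∃[ C ] (Circuit N C × h ∈ C × g ∉ C)
Crossing N = ∀ g A B → (∀ h → h ≡ g ⊎ h ∈ A ⊎ h ∈ B) → (∀ {h} → h ∈ A ⊎ h ∈ B → h ≢ g) → Disjoint A B → Nonempty A → Nonempty B →
  (∃[ C ] (Circuit N C × g ∉ C × (∃[ h ] (h ∈ C × h ∈ A)) × (∃[ h ] (h ∈ C × h ∈ B)))) ⊎ 2 ≤ ∣ A ∣ ⊎ 2 ≤ ∣ B ∣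

record Setting : Set₁ where
  field
    {k m v} : ℕ
    N : Matroid k
    L : Subset k
    M : Matroid m
    sum₂ : IsTwoSumU24 (Circuit N) L (Circuit M)
    decN : ∀ X → Dec (Circuit N X)
    decM : ∀ X → Dec (Circuit M X)
    no-sep₁ : ¬ HasSeparation N 1
    no-sep₂ : ¬ HasSeparation N 2
    avoiding : Avoiding N
    crossing : Crossing N
    {e a b} : Fin k
    eL : e ∈ L
    aL : a ∈ L
    bL : b ∈ L
    a≢b : a ≢ b
    a≢e : a ≢ e
    b≢e : b ≢ e
    G : Graph v m
    rep : Represents M (TwoSum.f₂ N L M sum₂ e 0F) G

module Tame (setting : Setting) where

  open Setting setting
  open TwoSum N L M sum₂
  open TwoSumRank N L M sum₂ decN
  j : Fin m
  j = f₂ e 0F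
  open Represented N L M sum₂ j G rep
  open Counting G
  open Shapes G
  open Represents rep

  -- Omitting `0F` everywhere keeps the expanded circuits away from `j`.
  o₀ : Fin k → Fin 3
  o₀ _ = 0F

  j∉expand : ∀ {C} → j ∉ expand C o₀
  j∉expand {C} m = proj₂ (Expand.piece⁻ C o₀ eL m) refl

  j∉T : ∀ {g} → g ∈ L → g ≢ e → j ∉ T g
  j∉T h ne m = ne (f₂-owner h eL (proj₂ (T⁻ m)))

  U : Subset m
  U = ⊤ ∖ ⁅ j ⁆

  ∈U : ∀ {t} → t ≢ j → t ∈ U
  ∈U ne = ∈∖⁺ ∈⊤ (ne ∘ x∈⁅y⁆⇒x≡y j)

  j∉⇒⊆U : ∀ {S} → j ∉ S → S ⊆ U
  j∉⇒⊆U {S} nj m = ∈U λ eq → nj (subst (_∈ S) eq m)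

  ≢j : ∀ {S t} → j ∉ S → t ∈ S → t ≢ j
  ≢j nj m refl = nj m

  -- The edges that do not come from `g`: a vertex of `U` outside `Y g` belongs to `g` alone.
  Y : Fin k → Subset m
  Y g = over (∁ ⁅ g ⁆) ∖ ⁅ j ⁆

  j∉Y : ∀ {g} → j ∉ Y g
  j∉Y m = proj₂ (∈∖⁻ m) (x∈⁅x⁆ j)

  ∁⁅⁆ : ∀ {h g : Fin k} → h ≢ g → h ∈ ∁ ⁅ g ⁆
  ∁⁅⁆ ne = x∉p⇒x∈∁p (ne ∘ x∈⁅y⁆⇒x≡y _)

  ∁⁅⁆⁻ : ∀ {h g : Fin k} → h ∈ ∁ ⁅ g ⁆ → h ≢ g
  ∁⁅⁆⁻ {g = g} m refl = x∈∁p⇒x∉p m (x∈⁅x⁆ g)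

  plain∈Y : ∀ {h g} → h ∉ L → h ≢ g → f₁ h ∈ Y g
  plain∈Y h ne = ∈∖⁺ (Over.plain⁺ _ h (∁⁅⁆ ne)) λ q → f₁≢f₂ h eL (x∈⁅y⁆⇒x≡y j q)

  piece∈Y : ∀ {h g i} → h ∈ L → h ≢ g → f₂ h i ≢ j → f₂ h i ∈ Y g
  piece∈Y h ne nj = ∈∖⁺ (Over.piece⁺ _ h (∁⁅⁆ ne)) (nj ∘ x∈⁅y⁆⇒x≡y j)

  T⊆Y : ∀ {h g} → h ∈ L → h ≢ g → h ≢ e → T h ⊆ Y g
  T⊆Y {h} hL hg he m with T⁻ {h} m
  ... | i , refl = piece∈Y hL hg λ eq → he (f₂-owner hL eL eq)

  expand⊆Y : ∀ {C g} → g ∉ C → expand C o₀ ⊆ Y g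
  expand⊆Y {C} {g} n m = ∈∖⁺ (over-mono (λ p → ∁⁅⁆ λ { refl → n p }) (expand⊆over m)) λ q → j∉expand (subst (_∈ expand C o₀) (x∈⁅y⁆⇒x≡y j q) m)

  opaque
    -- A connected set tying the pieces over `h` together. For `h` equal to `e` the triple contains
    -- `j`, and a circuit from `Avoiding` is expanded instead.
    block-circuit : ∀ {g h} → h ∈ L → h ≢ g → ∃[ X ] (j ∉ X × Circuit M X × X ⊆ Y g × (∀ i → f₂ h i ≢ j → f₂ h i ∈ X))
    block-circuit {g} {h} hL ne with h ≟F e
    ... | no he = T h , j∉T hL he , circuit-T hL , T⊆Y hL ne he , λ i _ → T⁺ hL i
    ... | yes refl = let (C , cC , p , q) = avoiding e g ne in
          expand C o₀ , j∉expand , circuit-expand o₀ cC , expand⊆Y q , λ i nj → Expand.piece⁺ C o₀ hL (p , λ { refl → nj refl })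

  base : Fin k → Fin m
  base h with h ∈? L
  ... | yes _ = f₂ h 1F
  ... | no _ = f₁ h

  base-plain : ∀ {h} → h ∉ L → base h ≡ f₁ h
  base-plain {h} n with h ∈? L
  ... | yes p = ⊥-elim (n p)
  ... | no _ = refl

  base-piece : ∀ {h} → h ∈ L → base h ≡ f₂ h 1F
  base-piece {h} p with h ∈? L
  ... | yes _ = refl
  ... | no n = ⊥-elim (n p)

  1F≢j : ∀ {h} → h ∈ L → f₂ h 1F ≢ j
  1F≢j p eq with f₂-owner p eL eq
  ... | refl = case f₂-injective eL eq of λ ()

  2F≢j : ∀ {h} → h ∈ L → f₂ h 2F ≢ j
  2F≢j p eq with f₂-owner p eL eq
  ... | refl = case f₂-injective eL eq of λ ()

  base∈Y : ∀ {h g} → h ≢ g → base h ∈ Y g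
  base∈Y {h} ne = case h ∈? L of λ where
    (yes p) → subst (_∈ _) (sym (base-piece p)) (piece∈Y p ne (1F≢j p))
    (no n) → subst (_∈ _) (sym (base-plain n)) (plain∈Y n ne)

  -- By `one-side`, a part that is vertex-disjoint from the rest contains all or none of the
  -- available pieces over an element, so one representative different from `j` decides.
  collect : Subset m → Subset k
  collect A = ⟦ (λ h → base h ∈? A) ⟧

  collect⁺ : ∀ {A h} → base h ∈ A → h ∈ collect A
  collect⁺ {A} = ∈⟦⟧⁺ (λ h → base h ∈? A)

  collect⁻ : ∀ {A h} → h ∈ collect A → base h ∈ A
  collect⁻ {A} = ∈⟦⟧⁻ (λ h → base h ∈? A)

  module _ {A B : Subset m} (vdis : VDisjoint A B) where

    one-side : ∀ {g h} → (∀ {t} → t ∈ Y g → t ∈ A ⊎ t ∈ B) → h ∈ L → h ≢ g →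
      ∀ {i i'} → f₂ h i ≢ j → f₂ h i' ≢ j → f₂ h i ∈ A → f₂ h i' ∈ A
    one-side cover hL ne {i} {i'} n n' p =
      let (X , nj , c , s , all) = block-circuit hL ne
      in [ (λ (s' : X ⊆ A) → s' (all i' n')) , (λ (s' : X ⊆ B) → ⊥-elim (VDisjoint⇒Disjoint vdis p (s' (all i n)))) ]′
           (connected-side (circuit-connected nj c) (cover ∘ s) vdis)

    saturated : ∀ {g} → (∀ {t} → t ∈ Y g → t ∈ A ⊎ t ∈ B) → ∀ {t} → t ∈ Y g → t ∈ over (collect A) → t ∈ A
    saturated {g} cover {t} y m with Over.member (collect A) m
    ... | inj₁ (h , n , refl , p) = subst (_∈ A) (base-plain n) (collect⁻ p)
    ... | inj₂ (h , i , hL , refl , p) = one-side cover hL (∁⁅⁆⁻ (Over.piece⁻ _ hL (∖⊆ y))) (1F≢j hL)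
            (λ eq → proj₂ (∈∖⁻ y) (subst (_∈ ⁅ j ⁆) (sym eq) (x∈⁅x⁆ j))) (subst (_∈ A) (base-piece hL) (collect⁻ p))

    represented : ∀ {g} → (∀ {t} → t ∈ Y g → t ∈ A ⊎ t ∈ B) → ∀ {t} → t ∈ Y g → t ∈ A → ∃[ h ] (h ≢ g × h ∈ collect A)
    represented {g} cover {t} y m with Over.member (∁ ⁅ g ⁆) (∖⊆ y)
    ... | inj₁ (h , n , refl , p) = h , ∁⁅⁆⁻ p , collect⁺ (subst (_∈ A) (sym (base-plain n)) m)
    ... | inj₂ (h , i , hL , refl , p) = h , ∁⁅⁆⁻ p , collect⁺ (subst (_∈ A) (sym (base-piece hL))
            (one-side cover hL (∁⁅⁆⁻ p) (λ eq → proj₂ (∈∖⁻ y) (subst (_∈ ⁅ j ⁆) (sym eq) (x∈⁅x⁆ j))) (1F≢j hL) m))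

    independent-∪ : ∀ {I K} → j ∉ A → j ∉ B → I ⊆ A → K ⊆ B → Independent M I → Independent M K → Independent M (I ∪ K)
    independent-∪ {I} {K} jA jB sI sK iI iK C c s =
      [ (λ (s' : C ⊆ I) → iI C c s') , (λ (s' : C ⊆ K) → iK C c s') ]′ (connected-side
        (circuit-connected (λ p → [ jA ∘ sI , jB ∘ sK ]′ (x∈p∪q⁻ I K (s p))) c) (λ p → x∈p∪q⁻ I K (s p))
        λ x p q → vdis x (V-mono sI x p) (V-mono sK x q))

  -- The preceding lemmas concern a single `Y g`. Choosing `g` different from the owner of an
  -- element lets them reach every element except `j`; the choice between `a` and `b` keeps `g` in
  -- `L` and away from `e`.
  other : Fin k → Fin k
  other h with h ≟F a
  ... | yes _ = b
  ... | no _ = a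

  other≢ : ∀ h → h ≢ other h
  other≢ h with h ≟F a
  ... | yes refl = a≢b
  ... | no ne = ne

  opaque
    in-Y : ∀ t → t ≢ j → ∃[ h ] (t ∈ Y (other h))
    in-Y t ne with locate t
    ... | inj₁ (h , n , refl) = h , plain∈Y n (other≢ h)
    ... | inj₂ (h , i , hL , refl) = h , piece∈Y hL (other≢ h) ne

  Y⊆U : ∀ {g} → Y g ⊆ U
  Y⊆U = j∉⇒⊆U j∉Y

  opaque
    -- Independent sets in vertex-disjoint parts have an independent union. The sizes of bases of
    -- the two parts would then add up, and the collected partition would be a 1-separation of `N`.
    ground-connected : ∀ {A B} → VDisjoint A B → (∀ {t} → t ∈ U → t ∈ A ⊎ t ∈ B) → A ⊆ U → B ⊆ U → Nonempty A → Nonempty B → False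
    ground-connected {A} {B} vdis cover sA sB (t , p) (t' , q) =
      let (I , sI , iI , maxI) = basis M decM A
          (K , sK , iK , maxK) = basis M decM B
          (h , y) = in-Y t (≢j jA p)
          (h' , y') = in-Y t' (≢j jB q)
          (g , _ , gA) = represented vdis (cover ∘ Y⊆U) y p
          (g' , _ , gB) = represented vdis' (cover' ∘ Y⊆U) y' q
          bound = no-separation-over 1 no-sep₁ (collect A) (card-pos (g , gA))
            (card-pos (g' , x∉p⇒x∈∁p λ k → VDisjoint⇒Disjoint vdis (collect⁻ k) (collect⁻ gB)))
            (λ X s av iX → maxI X (λ {u} m → let nj = λ eq → av eL (subst (_∈ X) eq m) ; (h , y) = in-Y u nj in saturated vdis (cover ∘ Y⊆U) y (s m)) iX)
            (λ X s av iX → maxK X (λ {u} m → let nj = λ eq → av eL (subst (_∈ X) eq m) ; (h , y) = in-Y u nj in saturated vdis' (cover' ∘ Y⊆U) y (over-mono (comp) (s m))) iX)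
            (I ∪ K) (independent-∪ vdis jA jB sI sK iI iK)
      in <⇒≱ (≤-reflexive (trans (+-comm 1 _) (cong (_+ 1) (sym (card-∪ {A = I} {K} λ x y → VDisjoint⇒Disjoint vdis (sI x) (sK y)))))) bound
      where
      vdis' : VDisjoint B A
      vdis' x p q = vdis x q p
      cover' : ∀ {t} → t ∈ U → t ∈ B ⊎ t ∈ A
      cover' m = [ inj₂ , inj₁ ]′ (cover m)
      jA : j ∉ A
      jA m = proj₂ (∈∖⁻ (sA m)) (x∈⁅x⁆ j)
      jB : j ∉ B
      jB m = proj₂ (∈∖⁻ (sB m)) (x∈⁅x⁆ j)
      comp : ∁ (collect A) ⊆ collect B
      comp {h} m = [ (λ p → ⊥-elim (x∈∁p⇒x∉p m (collect⁺ p))) , collect⁺ ]′ (cover (Y⊆U (base∈Y (other≢ h))))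

  opaque
    -- More elements than vertices would give a bicycle, which either contains a cycle that is a
    -- circuit or is a circuit itself.
    independent-card : ∀ {I} → j ∉ I → Independent M I → ∣ I ∣ ≤ nv I
    independent-card {I} nj ind = ≮⇒≥ λ lt →
      let (Q , s , bi) = bicycle-in lt
      in ind Q (unbalanced-circuit (nj ∘ s) bi λ D sD _ cD → ind D cD (s ∘ sD)) s

  opaque
    balanced-card : ∀ {K I} → (∀ D → D ⊆ K → IsCycle G D → Circuit M D) → Nonempty K → I ⊆ K → Independent M I → suc ∣ I ∣ ≤ nv K
    balanced-card {K} {I} bal ne s ind with nonempty? I
    ... | no em = ≤-trans (s≤s (≤-reflexive (empty-card em))) (nv-one (proj₂ (nonempty-vertex ne)))
    ... | yes neI = ≤-trans (≰⇒> λ le → let (D , sD , cyc) = cycle-in neI le in ind D (bal D (s ∘ sD) cyc) sD) (nv-mono s)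

  opaque
    unbalanced-independent : ∀ {D} → j ∉ D → IsCycle G D → ¬ Circuit M D → Independent M D
    unbalanced-independent {D} nj cyc nc C c s =
      [ (λ cyc' → nc (subst (Circuit M) (cycle-⊆ cyc' cyc s) c)) ,
        (λ bi → <⇒≱ (≤-reflexive (sym (proj₂ (proj₂ bi)))) (cycle-subset-card cyc s)) ]′ (shape (nj ∘ s) c)

  -- An independent set of full size on the unbalanced components of `S`: by `closed` it covers
  -- whole components, and by `balanced` the others have no unbalanced cycle.
  record Growth (S : Subset m) : Set where
    field
      I : Subset m
      I⊆S : I ⊆ S
      independent : Independent M I
      size : ∣ I ∣ ≡ nv I
      nonempty : Nonempty I
      closed : ∀ {f x y} → f ∈ S → V I x → 1 ≤ inc f x → 1 ≤ inc f y → V I y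
      balanced : ∀ {D} → D ⊆ S → IsCycle G D → VDisjoint D I → Circuit M D

  opaque
    -- A largest independent set with at least as many edges as vertices, the unbalanced cycle being
    -- one. An edge leaving its vertices would be pendant, so no circuit of the enlarged set could
    -- use it; an unbalanced cycle disjoint from its vertices could be added as a whole.
    grow : ∀ {S D₀} → j ∉ S → D₀ ⊆ S → IsCycle G D₀ → ¬ Circuit M D₀ → Growth S
    grow {S} {D₀} jS s₀ cyc₀ nc₀ = record
      { I = I ; I⊆S = sI ; independent = iI ; size = ≤-antisym (independent-card (jS ∘ sI) iI) leI
      ; nonempty = decidable-stable (nonempty? I) λ em → <⇒≱ (card-pos (proj₁ cyc₀)) (≤-trans (max D₀ start) (≤-reflexive (empty-card em)))
      ; closed = closed ; balanced = balanced }
      where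
      Good : Subset m → Set
      Good X = X ⊆ S × Independent M X × nv X ≤ ∣ X ∣
      start : Good D₀
      start = s₀ , unbalanced-independent (jS ∘ s₀) cyc₀ nc₀ , ≤-reflexive (sym (cycle-card cyc₀))
      largest : ∃[ X ] (Good X × (∀ Z → Good Z → ∣ Z ∣ ≤ ∣ X ∣))
      largest = largest-subset {P = Good} (λ X → (X ⊆? S) ×-dec Indep? M decM X ×-dec (nv X ≤? ∣ X ∣)) D₀ start
      I : Subset m
      I = proj₁ largest
      sI : I ⊆ S
      sI = proj₁ (proj₁ (proj₂ largest))
      iI : Independent M I
      iI = proj₁ (proj₂ (proj₁ (proj₂ largest)))
      leI : nv I ≤ ∣ I ∣
      leI = proj₂ (proj₂ (proj₁ (proj₂ largest)))
      max : ∀ X → Good X → ∣ X ∣ ≤ ∣ I ∣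
      max = proj₂ (proj₂ largest)
      closed : ∀ {f x y} → f ∈ S → V I x → 1 ≤ inc f x → 1 ≤ inc f y → V I y
      closed {f} {x} {y} fS px fx fy = decidable-stable (V? I y) λ ny → contra ny
        where
        contra : ¬ V I y → False
        contra ny = <⇒≱ (≤-reflexive (sym size⁺)) (max (I ∪ ⁅ f ⁆) (s⁺ , ind⁺ , ≤-trans nv⁺ (≤-trans (s≤s leI) (≤-reflexive (sym size⁺)))))
          where
          f∉I : f ∉ I
          f∉I m = ny (≤-trans fy (deg-inc m y))
          dis : Disjoint I ⁅ f ⁆
          dis m q = f∉I (subst (_∈ I) (x∈⁅y⁆⇒x≡y f q) m)
          x≢y : x ≢ y
          x≢y refl = ny px
          fy≡1 : inc f y ≡ 1
          fy≡1 = ≤-antisym (≤-pred (≤-trans (+-monoˡ-≤ (inc f y) fx) (≤-trans (∑-two-terms (inc f) x≢y) (≤-reflexive (inc-sum f))))) fy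
          size⁺ : ∣ I ∪ ⁅ f ⁆ ∣ ≡ suc ∣ I ∣
          size⁺ = trans (card-∪ dis) (trans (cong (∣ I ∣ +_) (∣⁅x⁆∣≡1 f)) (+-comm (∣ I ∣) 1))
          s⁺ : I ∪ ⁅ f ⁆ ⊆ S
          s⁺ = ∪⊆ sI (⁅⁆⊆ fS)
          deg-y : d (I ∪ ⁅ f ⁆) y ≡ 1
          deg-y = trans (deg-∪ dis y) (cong₂ _+_ (¬V⇒≡0 ny) (trans (deg-⁅⁆ f y) fy≡1))
          ind⁺ : Independent M (I ∪ ⁅ f ⁆)
          ind⁺ C c s = case f ∈? C of λ where
            (no n) → iI C c λ {u} p → [ id , (λ q → ⊥-elim (n (subst (_∈ C) (x∈⁅y⁆⇒x≡y f q) p))) ]′ (x∈p∪q⁻ I ⁅ f ⁆ (s p))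
            (yes p) → circuit-no-leaf (jS ∘ s⁺ ∘ s) c y (≤-antisym (≤-trans (deg-mono s y) (≤-reflexive deg-y)) (≤-trans fy (deg-inc p y)))
          nv⁺ : nv (I ∪ ⁅ f ⁆) ≤ suc (nv I)
          nv⁺ = nv-add-edge f∉I x≢y px fx fy
      balanced : ∀ {D} → D ⊆ S → IsCycle G D → VDisjoint D I → Circuit M D
      balanced {D} sD cyc vdis = decidable-stable (decM D) λ nc → <⇒≱
        (≤-trans (+-monoˡ-≤ (∣ I ∣) (card-pos (proj₁ cyc))) (≤-reflexive (sym size⁺)))
        (max (D ∪ I) (∪⊆ sD sI , independent-∪ vdis (jS ∘ sD) (jS ∘ sI) ⊆-refl ⊆-refl (unbalanced-independent (jS ∘ sD) cyc nc) iI ,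
          ≤-trans (nv-∪ D I) (≤-trans (+-mono-≤ (≤-reflexive (sym (cycle-card cyc))) leI) (≤-reflexive (sym size⁺)))))
        where
        size⁺ : ∣ D ∪ I ∣ ≡ ∣ D ∣ + ∣ I ∣
        size⁺ = card-∪ (VDisjoint⇒Disjoint vdis)

  opaque
    -- A circuit avoiding `g` expands to a bicycle. A cycle inside it cannot be a circuit, by
    -- incomparability.
    unbalanced-in : ∀ g → ∃[ D ] (D ⊆ Y g × IsCycle G D × ¬ Circuit M D)
    unbalanced-in g =
      let (C , cC , p , q) = avoiding (other g) g (other≢ g ∘ sym)
          X = expand C o₀
          bi = expand-bicycle (other-L g) p cC (j∉T (other-L g) (other≢e g)) o₀ j∉expand
          cX = circuit-expand o₀ cC
          (D , s , cyc) = cycle-in (circuit-nonempty M cX) (≤-trans (n≤1+n _) (≤-reflexive (sym (proj₂ (proj₂ bi)))))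
      in D , (λ m → expand⊆Y q (s m)) , cyc , λ cD → 1+n≢n (trans (sym (proj₂ (proj₂ bi))) (cycle-card (subst (IsCycle G) (incomp M D X cD cX s) cyc)))
      where
      other-L : ∀ g → other g ∈ L
      other-L g with g ≟F a
      ... | yes _ = bL
      ... | no _ = aL
      other≢e : ∀ g → other g ≢ e
      other≢e g with g ≟F a
      ... | yes _ = b≢e
      ... | no _ = a≢e

  -- `K` consists of the components of `S` that the growth does not reach, `K'` of the others.
  module Split {S : Subset m} (gr : Growth S) where
    open Growth gr
    private
      Far? : ∀ f → Dec (f ∈ S × ¬ (∃[ x ] (V I x × 1 ≤ inc f x)))
      Far? f = (f ∈? S) ×-dec ¬? (any? λ x → V? I x ×-dec (1 ≤? inc f x))
    K K' : Subset m
    K = ⟦ Far? ⟧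
    K' = S ∖ K
    K⊆S : K ⊆ S
    K⊆S m = proj₁ (∈⟦⟧⁻ Far? m)
    K-far : ∀ x → V K x → ¬ V I x
    K-far x p q = let (f , m , r) = deg-pos p in proj₂ (∈⟦⟧⁻ Far? m) (x , q , r)
    K'-near : ∀ x → V K' x → V I x
    K'-near x p =
      let (f , m , r) = deg-pos p
          (y , q , s) = decidable-stable (any? λ x → V? I x ×-dec (1 ≤? inc f x)) λ n → proj₂ (∈∖⁻ m) (∈⟦⟧⁺ Far? (∖⊆ m , n))
      in closed (∖⊆ m) q s r
    vdis : VDisjoint K' K
    vdis x p q = K-far x q (K'-near x p)
    cover : ∀ {f} → f ∈ S → f ∈ K' ⊎ f ∈ K
    cover {f} m = case f ∈? K of λ where
      (yes p) → inj₂ p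
      (no p) → inj₁ (∈∖⁺ m p)
    I⊆K' : I ⊆ K'
    I⊆K' {f} m = ∈∖⁺ (I⊆S m) λ p → let (x , q) = inc-vertex f in proj₂ (∈⟦⟧⁻ Far? p) (x , ≤-trans q (deg-inc m x) , q)
    nonempty' : Nonempty K'
    nonempty' = let (f , m) = nonempty in f , I⊆K' m
    far-edge : ∀ {x} → V S x → ¬ V I x → Nonempty K
    far-edge {x} p n = let (f , m , q) = deg-pos p in f , ∈⟦⟧⁺ Far? (m , λ (y , r , s) → n (closed m r s q))
    balanced-K : ∀ D → D ⊆ K → IsCycle G D → Circuit M D
    balanced-K D s cyc = balanced (K⊆S ∘ s) cyc λ x p → K-far x (V-mono s x p)

  j∉U : j ∉ U
  j∉U m = proj₂ (∈∖⁻ m) (x∈⁅x⁆ j)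

  opaque
    -- A vertex missed by the growth would split the connected graph into `K'` and `K`. With
    -- `independent-card`, the deletion of `j` has rank `nv U`, against which all separations below
    -- are measured.
    full : ∃[ J ] (Independent M J × nv U ≤ ∣ J ∣)
    full = I , independent , ≤-trans (nv-mono-V λ x p → decidable-stable (V? I x) λ n →
        ground-connected vdis cover ∖⊆ K⊆S nonempty' (far-edge p n)) (≤-reflexive (sym size))
      where
      cycle : ∃[ D ] (D ⊆ Y e × IsCycle G D × ¬ Circuit M D)
      cycle = unbalanced-in e
      gr : Growth U
      gr = grow j∉U (Y⊆U ∘ proj₁ (proj₂ cycle)) (proj₁ (proj₂ (proj₂ cycle))) (proj₂ (proj₂ (proj₂ cycle)))
      open Growth gr
      open Split gr

  piece∉Y : ∀ {g i} → g ∈ L → f₂ g i ∉ Y g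
  piece∉Y gL m = ∁⁅⁆⁻ (Over.piece⁻ _ gL (∖⊆ m)) refl

  ∈Y⊎∈T : ∀ {g t} → g ∈ L → t ≢ j → t ∈ Y g ⊎ t ∈ T g
  ∈Y⊎∈T {g} {t} gL nj with locate t
  ... | inj₁ (h , n , refl) = inj₁ (plain∈Y n λ { refl → n gL })
  ... | inj₂ (h , i , hL , refl) with h ≟F g
  ...   | yes refl = inj₂ (T⁺ gL i)
  ...   | no ne = inj₁ (piece∈Y hL ne nj)

  opaque
    -- A circuit containing a piece over `g` contains at least two of them, while the enlarged set
    -- has only one.
    add-one : ∀ {g I} → g ∈ L → I ⊆ Y g → Independent M I → Independent M (I ∪ ⁅ f₂ g 1F ⁆)
    add-one {g} {I} gL sI ind C c s = case f₂ g 1F ∈? C of λ where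
        (no n) → ind C c λ {u} p → [ id , (λ q → ⊥-elim (n (subst (_∈ C) (x∈⁅y⁆⇒x≡y _ q) p))) ]′ (x∈p∪q⁻ I ⁅ f₂ g 1F ⁆ (s p))
        (yes p) → second p (circuit-cases c)
      where
      absurd : ∀ {i} → i ≢ 1F → f₂ g i ∉ C
      absurd ne q = [ (λ r → piece∉Y gL (sI r)) , (λ r → ne (f₂-injective gL (x∈⁅y⁆⇒x≡y _ r))) ]′ (x∈p∪q⁻ I ⁅ f₂ g 1F ⁆ (s q))
      second : f₂ g 1F ∈ C → (∃[ h ] (h ∈ L × C ≡ T h)) ⊎ (∃[ D ] ∃[ o ] (Circuit N D × C ≡ expand D o)) → False
      second p (inj₁ (h , hL , refl)) with f₂-owner hL gL (proj₂ (T⁻ {h} p))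
      ... | refl = absurd {2F} (λ ()) (T⁺ hL 2F)
      second p (inj₂ (D , o , cD , refl)) with Expand.piece⁻ D o gL p
      ... | q , ne = both (o g) refl
        where
        both : ∀ i → o g ≡ i → False
        both 0F eq = absurd {2F} (λ ()) (Expand.piece⁺ D o gL (q , λ r → case trans r eq of λ ()))
        both 1F eq = ne (sym eq)
        both 2F eq = absurd {0F} (λ ()) (Expand.piece⁺ D o gL (q , λ r → case trans r eq of λ ()))

  opaque
    triple-bound : ∀ {g I} → g ∈ L → Independent M I → ∣ I ∣ ≤ 2 + ∣ I ∖ T g ∣
    triple-bound {g} {I} gL ind = ≤-trans (≤-reflexive (card-∖ {A = I ∩ T g} (proj₁ ∘ x∈p∩q⁻ I (T g))))
      (+-mono-≤ (≤-pred (≤-trans (proper-card (proj₂ ∘ x∈p∩q⁻ I (T g)) λ eq → ind (T g) (circuit-T gL) λ m → proj₁ (x∈p∩q⁻ I (T g) (subst (_ ∈_) (sym eq) m))) (≤-reflexive (card-T gL))))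
        (p⊆q⇒∣p∣≤∣q∣ λ m → ∈∖⁺ (∖⊆ m) λ t → proj₂ (∈∖⁻ m) (x∈p∩q⁺ (∖⊆ m , t))))

  over-disjoint : ∀ {A t} → t ∈ over A → t ∉ over (∁ A)
  over-disjoint {A} p q with Over.member A p
  ... | inj₁ (h , n , refl , r) = x∈∁p⇒x∉p (Over.plain⁻ _ n q) r
  ... | inj₂ (h , i , hL , refl , r) = x∈∁p⇒x∉p (Over.piece⁻ _ hL q) r

  base≢ : ∀ {h g} → g ∈ L → base h ∈ Y g → h ≢ g
  base≢ gL y refl = piece∉Y gL (subst (_∈ Y _) (base-piece gL) y)

  -- A set K without unbalanced cycles has rank below its number of vertices, so that separating K from the rest of M,
  -- with the triple over g on the larger-rank side, would be a 2-separation.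
  opaque
    no-balanced-split : ∀ {g K K'} → g ∈ L → VDisjoint K' K → (∀ {t} → t ∈ Y g → t ∈ K' ⊎ t ∈ K) → K' ⊆ Y g → K ⊆ Y g →
      Nonempty K' → Nonempty K → (∀ D → D ⊆ K → IsCycle G D → Circuit M D) → False
    no-balanced-split {g} {K} {K'} gL vdis cover sK' sK neK' neK bal
      with crossing g (collect K') (collect K)
             (λ h → case h ≟F g of λ where
               (yes eq) → inj₁ eq
               (no ne) → inj₂ ([ (λ p → inj₁ (collect⁺ p)) , (λ p → inj₂ (collect⁺ p)) ]′ (cover (base∈Y ne))))
             (λ { (inj₁ p) → base≢ gL (sK' (collect⁻ p)) ; (inj₂ p) → base≢ gL (sK (collect⁻ p)) })
             (λ p q → VDisjoint⇒Disjoint vdis (collect⁻ p) (collect⁻ q))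
             (let (h , _ , p) = represented vdis cover (sK' (proj₂ neK')) (proj₂ neK') in h , p)
             (let (h , _ , p) = represented (λ x p q → vdis x q p) (λ y → [ inj₂ , inj₁ ]′ (cover y)) (sK (proj₂ neK)) (proj₂ neK) in h , p)
    ... | inj₁ (C , cC , gC , (h , hC , hK') , (h' , h'C , h'K)) =
      [ (λ (s : expand C o₀ ⊆ K') → VDisjoint⇒Disjoint vdis (s (base∈expand h'C)) (collect⁻ h'K)) ,
        (λ (s : expand C o₀ ⊆ K) → VDisjoint⇒Disjoint vdis (collect⁻ hK') (s (base∈expand hC))) ]′
        (connected-side (circuit-connected j∉expand (circuit-expand o₀ cC)) (cover ∘ expand⊆Y gC) vdis)
      where
      base∈expand : ∀ {h} → h ∈ C → base h ∈ expand C o₀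
      base∈expand {h} p = case h ∈? L of λ where
        (yes hL) → subst (_∈ expand C o₀) (sym (base-piece hL)) (Expand.piece⁺ C o₀ hL (p , λ ()))
        (no n) → subst (_∈ expand C o₀) (sym (base-plain n)) (Expand.plain⁺ C o₀ n p)
    ... | inj₂ sizes = [ (λ two → conclude (separate (collect K') two (g∈∁ {K'} sK') (let (h , p) = h∈K in x∉p⇒x∈∁p λ q → VDisjoint⇒Disjoint vdis (collect⁻ q) (collect⁻ p)) (inj₁ (proj₂ h∈K))
                                (λ I s nj ind → ≤-trans (independent-card nj ind) (nv-mono (in-K' s nj)))
                                (λ I s nj ind → ≤-trans (triple-bound gL ind) (+-monoʳ-≤ 2 (≤-pred' (balanced-card bal neK (rest-K s nj) (independent-⊆ M ∖⊆ ind)))))))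
                       , (λ two → conclude' (separate (collect K) two (g∈∁ {K} sK) (let (h , p) = h∈K' in x∉p⇒x∈∁p λ q → VDisjoint⇒Disjoint vdis (collect⁻ p) (collect⁻ q)) (inj₂ (proj₂ h∈K'))
                                (λ I s nj ind → ≤-pred' (balanced-card bal neK (in-K s nj) ind))
                                (λ I s nj ind → ≤-trans (triple-bound gL ind) (+-monoʳ-≤ 2 (≤-trans (independent-card (nj ∘ ∖⊆) (independent-⊆ M ∖⊆ ind)) (nv-mono (rest-K' s nj))))))) ]′ sizes
      where
      flip' : VDisjoint K K'
      flip' x p q = vdis x q p
      cover' : ∀ {t} → t ∈ Y g → t ∈ K ⊎ t ∈ K'
      cover' y = [ inj₂ , inj₁ ]′ (cover y)
      h∈K : ∃[ h ] h ∈ collect K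
      h∈K = let (h , _ , p) = represented flip' cover' (sK (proj₂ neK)) (proj₂ neK) in h , p
      h∈K' : ∃[ h ] h ∈ collect K'
      h∈K' = let (h , _ , p) = represented vdis cover (sK' (proj₂ neK')) (proj₂ neK') in h , p
      g∈∁ : ∀ {A} → A ⊆ Y g → g ∈ ∁ (collect A)
      g∈∁ s = x∉p⇒x∈∁p λ p → base≢ gL (s (collect⁻ p)) refl
      ≤-pred' : ∀ {x y} → suc x ≤ y → x ≤ pred y
      ≤-pred' (s≤s p) = p
      in-Y' : ∀ {A t} → A ⊆ Y g → t ≢ j → t ∈ over (collect A) → t ∈ Y g
      in-Y' s nj m = ∈∖⁺ (over-mono (λ p → ∁⁅⁆ (base≢ gL (s (collect⁻ p)))) m) (nj ∘ x∈⁅y⁆⇒x≡y j)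
      in-K' : ∀ {I} → I ⊆ over (collect K') → j ∉ I → I ⊆ K'
      in-K' s nj m = saturated vdis cover (in-Y' sK' (≢j nj m) (s m)) (s m)
      in-K : ∀ {I} → I ⊆ over (collect K) → j ∉ I → I ⊆ K
      in-K s nj m = saturated flip' cover' (in-Y' sK (≢j nj m) (s m)) (s m)
      in-over : ∀ {A B} → VDisjoint A B → (∀ {t} → t ∈ Y g → t ∈ A ⊎ t ∈ B) → ∀ {t} → t ∈ Y g → t ∈ A → t ∈ over (collect A)
      in-over {A} vd cov {t} y p with Over.member (∁ ⁅ g ⁆) (∖⊆ y)
      ... | inj₁ (h , n , refl , _) = Over.plain⁺ _ n (collect⁺ (subst (_∈ A) (sym (base-plain n)) p))
      ... | inj₂ (h , i , hL , refl , r) = Over.piece⁺ _ hL (collect⁺ (subst (_∈ A) (sym (base-piece hL))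
              (one-side vd cov hL (∁⁅⁆⁻ r) (λ eq → proj₂ (∈∖⁻ y) (subst (_∈ ⁅ j ⁆) (sym eq) (x∈⁅x⁆ j))) (1F≢j hL) p)))
      rest-K : ∀ {I} → I ⊆ over (∁ (collect K')) → j ∉ I → I ∖ T g ⊆ K
      rest-K s nj m with ∈Y⊎∈T gL (≢j nj (∖⊆ m))
      ... | inj₂ t = ⊥-elim (proj₂ (∈∖⁻ m) t)
      ... | inj₁ y = [ (λ p → ⊥-elim (over-disjoint (in-over vdis cover y p) (s (∖⊆ m)))) , id ]′ (cover y)
      rest-K' : ∀ {I} → I ⊆ over (∁ (collect K)) → j ∉ I → I ∖ T g ⊆ K'
      rest-K' s nj m with ∈Y⊎∈T gL (≢j nj (∖⊆ m))
      ... | inj₂ t = ⊥-elim (proj₂ (∈∖⁻ m) t)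
      ... | inj₁ y = [ id , (λ p → ⊥-elim (over-disjoint (in-over flip' cover' y p) (s (∖⊆ m)))) ]′ (cover y)
      separate : ∀ A → 2 ≤ ∣ A ∣ → g ∈ ∁ A → ∀ {h} → h ∈ ∁ A → h ∈ collect K ⊎ h ∈ collect K' → ∀ {α β} →
        (∀ I → I ⊆ over A → j ∉ I → Independent M I → ∣ I ∣ ≤ α) → (∀ I → I ⊆ over (∁ A) → j ∉ I → Independent M I → ∣ I ∣ ≤ β) →
        nv U + 2 ≤ α + β
      separate A two gA {h} hA hK hα hβ =
        let (J , indJ , le) = full
        in ≤-trans (+-monoˡ-≤ 2 le) (no-separation-over 2 no-sep₂ A two
             (two-elements gA hA λ eq → [ (λ p → base≢ gL (sK (collect⁻ p)) (sym eq)) , (λ p → base≢ gL (sK' (collect⁻ p)) (sym eq)) ]′ hK)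
             (λ I s av → hα I s (av eL)) (λ I s av → hβ I s (av eL)) J indJ)
      total : nv K' + nv K ≤ nv U
      total = nv-VDisjoint vdis λ x → [ V-mono (Y⊆U ∘ sK') x , V-mono (Y⊆U ∘ sK) x ]′
      posK : suc (pred (nv K)) ≡ nv K
      posK = suc-pred (nv K) ⦃ >-nonZero (nv-one (proj₂ (nonempty-vertex neK))) ⦄
      conclude : nv U + 2 ≤ nv K' + (2 + pred (nv K)) → False
      conclude le = lin⊥ 0 (+-mono-≤ le total) (trans (cong (λ q → nv U + 2 + (nv K' + q)) (sym posK)) (ar (nv U) (nv K') (pred (nv K))))
        where
        ar : ∀ u x y → u + 2 + (x + suc y) ≡ suc (x + (2 + y) + u + 0)
        ar = solve-∀
      conclude' : nv U + 2 ≤ pred (nv K) + (2 + nv K') → False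
      conclude' le = conclude (≤-trans le (≤-reflexive (ar (nv K') (pred (nv K)))))
        where
        ar : ∀ x y → y + (2 + x) ≡ x + (2 + y)
        ar = solve-∀

  opaque
    -- Suppose `Y g` met every vertex. Balanced components left over by its growth are excluded by
    -- `no-balanced-split`. Without them the growth has `nv U` elements, and adding a piece over `g`
    -- gives an independent set with more elements than vertices.
    private-vertex : ∀ {g} → g ∈ L → ∃[ w ] (V U w × ¬ V (Y g) w)
    private-vertex {g} gL = decidable-stable (any? λ w → V? U w ×-dec ¬? (V? (Y g) w)) λ none →
      let covered : ∀ w → V U w → V (Y g) w
          covered w p = decidable-stable (V? (Y g) w) λ n → none (w , p , n)
      in case nonempty? K of λ where
        (yes neK) → no-balanced-split gL vdis cover ∖⊆ K⊆S nonempty' neK balanced-K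
        (no em) → let
            all : ∀ x → V U x → V I x
            all x p = decidable-stable (V? I x) λ n → em (far-edge (covered x p) n)
            ind⁺ = add-one gL I⊆S independent
            nj : j ∉ I ∪ ⁅ f₂ g 1F ⁆
            nj m = [ (λ p → j∉Y (I⊆S p)) , (λ p → 1F≢j gL (sym (x∈⁅y⁆⇒x≡y _ p))) ]′ (x∈p∪q⁻ I _ m)
            dis : Disjoint I ⁅ f₂ g 1F ⁆
            dis p q = piece∉Y gL (subst (_∈ Y g) (x∈⁅y⁆⇒x≡y _ q) (I⊆S p))
          in <⇒≱ (≤-trans (s≤s (≤-trans (nv-mono-V all) (≤-reflexive (sym size))))
                    (≤-reflexive (sym (trans (card-∪ dis) (trans (cong (∣ I ∣ +_) (∣⁅x⁆∣≡1 (f₂ g 1F))) (+-comm (∣ I ∣) 1))))))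
                 (≤-trans (independent-card nj ind⁺) (nv-mono (j∉⇒⊆U nj)))
      where
      cycle : ∃[ D ] (D ⊆ Y g × IsCycle G D × ¬ Circuit M D)
      cycle = unbalanced-in g
      gr : Growth (Y g)
      gr = grow j∉Y (proj₁ (proj₂ cycle)) (proj₁ (proj₂ (proj₂ cycle))) (proj₂ (proj₂ (proj₂ cycle)))
      open Growth gr
      open Split gr

  ¬Y⇒T : ∀ {g w} → g ∈ L → V U w → ¬ V (Y g) w → ∃[ i ] (f₂ g i ≢ j × 1 ≤ inc (f₂ g i) w)
  ¬Y⇒T {g} {w} gL p n with deg-pos p
  ... | t , m , q with ∈Y⊎∈T gL (≢j j∉U m)
  ...   | inj₁ y = ⊥-elim (n (≤-trans q (deg-inc y w)))
  ...   | inj₂ y with T⁻ {g} y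
  ...     | i , refl = i , ≢j j∉U m , q

  over∌ : ∀ {C} → e ∉ C → j ∉ over C
  over∌ {C} n m = n (Over.piece⁻ C eL m)

  rest⊆Y : ∀ {C o g} → g ∈ L → j ∉ expand C o → expand C o ∖ T g ⊆ Y g
  rest⊆Y gL nj m = [ id , (λ t → ⊥-elim (proj₂ (∈∖⁻ m) t)) ]′ (∈Y⊎∈T gL (≢j nj (∖⊆ m)))

  opaque
    no-loop : ∀ h → ¬ Circuit N ⁅ h ⁆
    no-loop h = loopless N decN no-sep₁ (other≢ h ∘ sym)

  opaque
    other-end : ∀ {t w} → inc t w ≤ 1 → ∃[ x ] (x ≢ w × 1 ≤ inc t x)
    other-end {t} {w} le =
      let (x , lt) = ∑-pigeonhole {f = δ w} {g = inc t} (≤-reflexive (trans (cong suc (∑δ w)) (sym (inc-sum t))))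
      in x , (λ eq → <⇒≱ lt (≤-trans (≤-reflexive (cong (inc t) eq)) (≤-trans le (≤-reflexive (sym (trans (cong (δ w) eq) (δ-refl w))))))) , ≤-trans (s≤s z≤n) lt

  opaque
    -- In a triangle exactly two edges would meet the private vertex of `g`. A circuit through `g`
    -- can be chosen to use just one of them and then has a leaf there.
    triple-fat : ∀ {g} → g ∈ L → g ≢ e → Bicycle (T g)
    triple-fat {g} gL ne with kind gL (j∉T gL ne)
    ... | fat bi = bi
    ... | triangle cyc = ⊥-elim (circuit-no-leaf nj (circuit-expand (swap o₀ g (next o)) cC) w one)
      where
      w : Fin v
      w = proj₁ (private-vertex gL)
      off : ¬ V (Y g) w
      off = proj₂ (proj₂ (private-vertex gL))
      on : V (T g) w
      on = let (i , _ , q) = ¬Y⇒T gL (proj₁ (proj₂ (private-vertex gL))) off in ≤-trans q (deg-inc (T⁺ gL i) w)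
      x : Fin 3 → ℕ
      x i = inc (f₂ g i) w
      zero-somewhere : ∃[ o ] x o ≡ 0
      zero-somewhere = decidable-stable (any? λ o → x o Data.Nat.≟ 0) λ none →
        let pos : ∀ i → 1 ≤ x i
            pos i = n≢0⇒n>0 λ z → none (i , z)
        in <⇒≱ (+-mono-≤ (+-mono-≤ (pos 1F) (pos 2F)) (pos 0F)) (≤-reflexive (trans (sym (deg-T gL 0F w)) (deg-cycle cyc on)))
      o : Fin 3
      o = proj₁ zero-somewhere
      x-o : x o ≡ 0
      x-o = proj₂ zero-somewhere
      x-nn : x (next (next o)) ≡ 1
      x-nn = proj₂ (both-one (triangle-link gL cyc _ w) (triangle-link gL cyc _ w)
        (≤-reflexive (sym (trans (sym (+-identityʳ _)) (trans (cong (x (next o) + x (next (next o)) +_) (sym x-o)) (trans (sym (deg-T gL o w)) (deg-cycle cyc on)))))))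
      circuit : ∃[ C ] (Circuit N C × g ∈ C × e ∉ C)
      circuit = avoiding g e ne
      C : Subset k
      C = proj₁ circuit
      cC : Circuit N C
      cC = proj₁ (proj₂ circuit)
      gC : g ∈ C
      gC = proj₁ (proj₂ (proj₂ circuit))
      nj : ∀ {o} → j ∉ expand C o
      nj m = over∌ (proj₂ (proj₂ (proj₂ circuit))) (expand⊆over m)
      next³ : ∀ i → next (next (next i)) ≡ i
      next³ 0F = refl
      next³ 1F = refl
      next³ 2F = refl
      one : d (expand C (swap o₀ g (next o))) w ≡ 1
      one = trans (deg-swap gL gC o₀ (next o) w) (cong₂ _+_ (cong₂ _+_ x-nn (trans (cong x (next³ o)) x-o)) (1≰⇒≡0 λ q → off (V-mono (rest⊆Y gL nj) w q)))

  -- The two vertices of a fat triple: `w` is private to `g`, and `p` is the only place where the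
  -- triple can be attached to other edges.
  record Ends (g : Fin k) : Set where
    field
      w p : Fin v
      p≢w : p ≢ w
      V-w : V (T g) w
      V-p : V (T g) p
      only : ∀ x → V (T g) x → x ≡ w ⊎ x ≡ p
      off : ¬ V (Y g) w

  opaque
    ends : ∀ {g} → g ∈ L → g ≢ e → Ends g
    ends {g} gL ne =
      let (w , on , off) = private-vertex gL
          (i , _ , q) = ¬Y⇒T gL on off
          V-w = ≤-trans q (deg-inc (T⁺ gL i) w)
          (p , p≢w , V-p , only) = nv≡2-ends (fat-nv gL (triple-fat gL ne)) V-w
      in record { w = w ; p = p ; p≢w = p≢w ; V-w = V-w ; V-p = V-p ; only = only ; off = off }

  opaque
    small-cycle : ∀ {S n} → Nonempty S → (∀ x → V S x → x ∈ n) → ∣ n ∣ ≤ ∣ S ∣ → ∃[ D ] (D ⊆ S × IsCycle G D)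
    small-cycle {S} {n} ne h le = cycle-in ne (≤-trans (≤-trans (∑-mono pointwise) (≤-reflexive (sym (card n)))) le)
      where
      pointwise : ∀ x → sg (d S x) ≤ χ n x
      pointwise x with V? S x
      ... | yes p = ≤-trans (sg≤1 _) (≤-reflexive (sym (χ-∈ (h x p))))
      ... | no p = ≤-trans (≤-reflexive (cong sg (¬V⇒≡0 p))) z≤n

  two-point : ∀ {n} (x y : Fin n) → ∣ ⁅ x ⁆ ∪ ⁅ y ⁆ ∣ ≤ 2
  two-point x y = ≤-trans (≤-reflexive (card-∖ {A = ⁅ x ⁆} ∪ˡ)) (+-mono-≤ (≤-reflexive (∣⁅x⁆∣≡1 x))
    (≤-trans (p⊆q⇒∣p∣≤∣q∣ λ m → [ (λ q → ⊥-elim (proj₂ (∈∖⁻ m) q)) , id ]′ (x∈p∪q⁻ ⁅ x ⁆ ⁅ y ⁆ (∖⊆ m))) (≤-reflexive (∣⁅x⁆∣≡1 y))))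

  opaque
    -- The triple has degree at least two at `p`. Either it has a loop there, or two of its edges
    -- meet `p`; on the two vertices of the triple these contain a cycle, and each of them passes
    -- through `p`.
    cycle-at-p : ∀ {g} (gL : g ∈ L) (ne : g ≢ e) → ∃[ D ] (D ⊆ T g × IsCycle G D × V D (Ends.p (ends gL ne)))
    cycle-at-p {g} gL ne = choose (any? (λ i → 2 ≤? x i))
      where
      open Ends (ends gL ne)
      x : Fin 3 → ℕ
      x i = inc (f₂ g i) p
      bi : Bicycle (T g)
      bi = triple-fat gL ne
      loop : ∀ {t} → 2 ≤ inc t p → ∀ y → 1 ≤ inc t y → y ∈ ⁅ p ⁆
      loop {t} two y q = case y ≟F p of λ where
        (yes refl) → x∈⁅x⁆ p
        (no n) → ⊥-elim (<⇒≱ (≤-trans (+-mono-≤ q two) (∑-two-terms (inc t) n)) (≤-reflexive (inc-sum t)))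
      two-at-p : 2 ≤ d (T g) p
      two-at-p = ≤∧≢⇒< V-p λ eq → proj₁ (proj₂ bi) p (sym eq)
      pick : (∀ i → x i ≤ 1) → ∀ o → x o ≡ 0 → 1 ≤ x (next o) × 1 ≤ x (next (next o))
      pick le o z = let (s , t) = both-one (le (next o)) (le (next (next o))) (≤-trans two-at-p (≤-reflexive (trans (deg-T gL o p) (trans (cong (x (next o) + x (next (next o)) +_) z) (+-identityʳ _)))))
                   in ≤-reflexive (sym s) , ≤-reflexive (sym t)
      links : (∀ i → x i ≤ 1) → ∃[ o ] (1 ≤ x (next o) × 1 ≤ x (next (next o)))
      links le = case (x 0F Data.Nat.≟ 0) of λ where
        (yes z) → 0F , pick le 0F z
        (no n₀) → case (x 1F Data.Nat.≟ 0) of λ where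
          (yes z) → 1F , pick le 1F z
          (no n₁) → 2F , n≢0⇒n>0 n₀ , n≢0⇒n>0 n₁
      Goal : Set
      Goal = ∃[ D ] (D ⊆ T g × IsCycle G D × V D p)
      from-loop : ∀ i → 2 ≤ x i → Goal
      from-loop i two =
        let (D , s , cyc) = small-cycle {⁅ f₂ g i ⁆} {⁅ p ⁆} (_ , x∈⁅x⁆ _) (λ y q → loop two y (≤-trans q (≤-reflexive (deg-⁅⁆ _ y))))
                              (≤-reflexive (trans (∣⁅x⁆∣≡1 p) (sym (∣⁅x⁆∣≡1 (f₂ g i)))))
            (t , m) = proj₁ cyc
        in D , (λ u → ⁅⁆⊆ (T⁺ gL i) (s u)) , cyc , ≤-trans (≤-trans (s≤s z≤n) two) (deg-inc (subst (_∈ D) (x∈⁅y⁆⇒x≡y _ (s m)) m) p)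
      from-links : ∀ o → 1 ≤ x (next o) → 1 ≤ x (next (next o)) → Goal
      from-links o q₁ q₂ = D , (λ u → s₀ (s u)) , cyc , ≤-trans ([ (λ u → subst (λ t → 1 ≤ inc t p) (sym (x∈⁅y⁆⇒x≡y t₁ u)) q₁) , (λ u → subst (λ t → 1 ≤ inc t p) (sym (x∈⁅y⁆⇒x≡y t₂ u)) q₂) ]′
             (x∈p∪q⁻ ⁅ t₁ ⁆ ⁅ t₂ ⁆ (s (proj₂ (proj₁ cyc))))) (deg-inc (proj₂ (proj₁ cyc)) p)
        where
        t₁ t₂ : Fin m
        t₁ = f₂ g (next o)
        t₂ = f₂ g (next (next o))
        P : Subset m
        P = ⁅ t₁ ⁆ ∪ ⁅ t₂ ⁆
        s₀ : P ⊆ T g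
        s₀ = ∪⊆ (⁅⁆⊆ (T⁺ gL (next o))) (⁅⁆⊆ (T⁺ gL (next (next o))))
        found : ∃[ D ] (D ⊆ P × IsCycle G D)
        found = small-cycle {P} {⁅ w ⁆ ∪ ⁅ p ⁆} (_ , ∪ˡ (x∈⁅x⁆ t₁))
              (λ y q → [ (λ eq → ∪ˡ (subst (_∈ ⁅ w ⁆) (sym eq) (x∈⁅x⁆ w))) , (λ eq → ∪ʳ {A = ⁅ w ⁆} (subst (_∈ ⁅ p ⁆) (sym eq) (x∈⁅x⁆ p))) ]′ (only y (V-mono s₀ y q)))
              (≤-trans (two-point w p) (≤-reflexive (sym (trans (card-∪ λ u u' → pair≢ gL o (trans (sym (x∈⁅y⁆⇒x≡y t₁ u)) (x∈⁅y⁆⇒x≡y t₂ u'))) (cong₂ _+_ (∣⁅x⁆∣≡1 t₁) (∣⁅x⁆∣≡1 t₂))))))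
        D : Subset m
        D = proj₁ found
        s : D ⊆ P
        s = proj₁ (proj₂ found)
        cyc : IsCycle G D
        cyc = proj₂ (proj₂ found)
      choose : Dec (∃[ i ] 2 ≤ x i) → Goal
      choose (yes (i , two)) = from-loop i two
      choose (no none) = let (o , q₁ , q₂) = links λ i → ≤-pred (≰⇒> λ two → none (i , two)) in from-links o q₁ q₂

  -- The two remaining elements over e

  e₁ e₂ : Fin m
  e₁ = f₂ e 1F
  e₂ = f₂ e 2F

  e₁≢e₂ : e₁ ≢ e₂
  e₁≢e₂ = pair≢ eL 0F

  through-e : ∃[ C ] (Circuit N C × e ∈ C × b ∉ C)
  through-e = avoiding e b (b≢e ∘ sym)

  wₑ : Fin v
  wₑ = proj₁ (private-vertex eL)

  wₑ∈U : V U wₑ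
  wₑ∈U = proj₁ (proj₂ (private-vertex eL))

  wₑ-off : ¬ V (Y e) wₑ
  wₑ-off = proj₂ (proj₂ (private-vertex eL))

  data Shape : Set where
    link-link : ∀ {x₁ x₂} → x₁ ≢ wₑ → x₂ ≢ wₑ → inc e₁ wₑ ≡ 1 → inc e₂ wₑ ≡ 1 → 1 ≤ inc e₁ x₁ → 1 ≤ inc e₂ x₂ → Shape
    loop-link : ∀ {x₂} → x₂ ≢ wₑ → inc e₁ wₑ ≡ 2 → inc e₂ wₑ ≡ 1 → 1 ≤ inc e₂ x₂ → Shape
    link-loop : ∀ {x₁} → x₁ ≢ wₑ → inc e₁ wₑ ≡ 1 → inc e₂ wₑ ≡ 2 → 1 ≤ inc e₁ x₁ → Shape

  inc≤2 : ∀ t x → inc t x ≤ 2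
  inc≤2 t x = ≤-trans (≤-reflexive (sym (∑-point x (inc t)))) (≤-trans (∑-mono λ y → ≤-trans (*-monoˡ-≤ (inc t y) (δ≤1 x y)) (≤-reflexive (+-identityʳ _))) (≤-reflexive (inc-sum t)))

  opaque
    -- In a circuit through `e` avoiding `j`, only `e₁` and `e₂` can meet `wₑ`. A single end there
    -- would be a leaf, a lone loop would be cut off from the other edge, and two loops would be
    -- dependent on one vertex and make `e` a loop of `N`.
    shape-e : Shape
    shape-e = cases (inc e₁ wₑ) (inc e₂ wₑ) refl refl
      where
      C : Subset k
      C = proj₁ through-e
      cC : Circuit N C
      cC = proj₁ (proj₂ through-e)
      eC : e ∈ C
      eC = proj₁ (proj₂ (proj₂ through-e))
      X : Subset m
      X = expand C o₀
      cX : Circuit M X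
      cX = circuit-expand o₀ cC
      con : Connected G X
      con = circuit-connected j∉expand cX
      m₁ : e₁ ∈ X
      m₁ = piece₁ eL eC o₀
      m₂ : e₂ ∈ X
      m₂ = piece₂ eL eC o₀
      deg-w : d X wₑ ≡ inc e₁ wₑ + inc e₂ wₑ
      deg-w = trans (deg-expand eL eC o₀ wₑ) (trans (cong (inc e₁ wₑ + inc e₂ wₑ +_) (1≰⇒≡0 λ q → wₑ-off (V-mono (rest⊆Y eL j∉expand) wₑ q))) (+-identityʳ _))
      positive : 1 ≤ inc e₁ wₑ + inc e₂ wₑ
      positive with ¬Y⇒T eL wₑ∈U wₑ-off
      ... | 0F , nj , q = ⊥-elim (nj refl)
      ... | 1F , nj , q = ≤-trans q (m≤m+n _ _)
      ... | 2F , nj , q = ≤-trans q (m≤n+m _ (inc e₁ wₑ))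
      not-one : inc e₁ wₑ + inc e₂ wₑ ≢ 1
      not-one eq = circuit-no-leaf j∉expand cX wₑ (trans deg-w eq)
      at-w : ∀ {t y} → inc t wₑ ≡ 2 → 1 ≤ inc t y → y ≡ wₑ
      at-w {t} {y} two q = decidable-stable (y ≟F wₑ) λ n → <⇒≱ (+-mono-≤ q (≤-reflexive (sym two))) (≤-trans (∑-two-terms (inc t) n) (≤-reflexive (inc-sum t)))
      isolated-loop : ∀ {t t'} → t ∈ X → t' ∈ X → t' ≢ t → inc t wₑ ≡ 2 → d X wₑ ≡ 2 → False
      isolated-loop {t} {t'} tX t'X ne two total =
        let (y , p , q) = connected-share con (⁅⁆⊆ tX) (t , x∈⁅x⁆ t) (t' , ∈∖⁺ t'X λ u → ne (x∈⁅y⁆⇒x≡y t u))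
            y≡w = at-w two (≤-trans p (≤-reflexive (deg-⁅⁆ t y)))
        in <⇒≱ (+-mono-≤ (≤-reflexive (sym two)) (subst (V (X ∖ ⁅ t ⁆)) y≡w q)) (≤-trans (≤-reflexive (sym (deg-∈ tX wₑ))) (≤-reflexive total))
      two-loops : inc e₁ wₑ ≡ 2 → inc e₂ wₑ ≡ 2 → False
      two-loops p q = no-loop e (subst (Circuit N) single (proj₁ (proj₂ inside)))
        where
        P : Subset m
        P = ⁅ e₁ ⁆ ∪ ⁅ e₂ ⁆
        njP : j ∉ P
        njP u = [ (λ r → 1F≢j eL (sym (x∈⁅y⁆⇒x≡y e₁ r))) , (λ r → 2F≢j eL (sym (x∈⁅y⁆⇒x≡y e₂ r))) ]′ (x∈p∪q⁻ ⁅ e₁ ⁆ ⁅ e₂ ⁆ u)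
        few : nv P ≤ 1
        few = ≤-trans (nv-mono-V {P} {⁅ e₁ ⁆} λ x r → case x ≟F wₑ of λ where
              (yes refl) → ≤-trans (≤-trans (s≤s z≤n) (≤-reflexive (sym p))) (≤-reflexive (sym (deg-⁅⁆ e₁ wₑ)))
              (no n) → ⊥-elim (n ([ (λ s → at-w p (≤-trans s (≤-reflexive (deg-⁅⁆ e₁ x)))) , (λ s → at-w q (≤-trans s (≤-reflexive (deg-⁅⁆ e₂ x)))) ]′ (V-∪ {⁅ e₁ ⁆} {⁅ e₂ ⁆} r))))
            (≤-trans (∑-mono λ x → ≤-trans (one x) ≤-refl) (≤-reflexive (∑δ wₑ)))
          where
          one : ∀ x → sg (d ⁅ e₁ ⁆ x) ≤ δ wₑ x
          one x with wₑ ≟F x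
          ... | yes refl = sg≤1 _
          ... | no n = ≤-trans (≤-reflexive (cong sg (1≰⇒≡0 λ s → n (sym (at-w p (≤-trans s (≤-reflexive (deg-⁅⁆ e₁ x)))))))) z≤n
        sizeP : ∣ P ∣ ≡ 2
        sizeP = trans (card-∪ λ u u' → e₁≢e₂ (trans (sym (x∈⁅y⁆⇒x≡y e₁ u)) (x∈⁅y⁆⇒x≡y e₂ u'))) (cong₂ _+_ (∣⁅x⁆∣≡1 e₁) (∣⁅x⁆∣≡1 e₂))
        dep : ∃[ Z ] (Circuit M Z × Z ⊆ P)
        dep = dependent M decM λ ind → <⇒≱ (≤-trans (s≤s few) (≤-reflexive (sym sizeP))) (independent-card njP ind)
        P∌ : ∀ {h i} → h ∈ L → h ≢ e → f₂ h i ∉ P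
        P∌ hL ne u = [ (λ r → ne (f₂-owner hL eL (x∈⁅y⁆⇒x≡y e₁ r))) , (λ r → ne (f₂-owner hL eL (x∈⁅y⁆⇒x≡y e₂ r))) ]′ (x∈p∪q⁻ ⁅ e₁ ⁆ ⁅ e₂ ⁆ u)
        inside : ∃[ Z ] (Circuit N Z × Z ⊆ ⁅ e ⁆)
        inside with dep
        ... | Z , cZ , s with circuit-cases cZ
        ...   | inj₁ (h , hL , refl) = ⊥-elim (case h ≟F e of λ where
                  (yes refl) → njP (s (T⁺ hL 0F))
                  (no ne) → P∌ hL ne (s (T⁺ hL 0F)))
        ...   | inj₂ (Q , o , cQ , refl) = Q , cQ , λ {h} hQ → subst (_∈ ⁅ e ⁆) (sym (owner h hQ)) (x∈⁅x⁆ e)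
          where
          owner : ∀ h → h ∈ Q → h ≡ e
          owner h hQ = decidable-stable (h ≟F e) λ ne → case h ∈? L of λ where
            (yes hL) → P∌ hL ne (s (piece₁ hL hQ o))
            (no n) → [ (λ r → f₁≢f₂ n eL (x∈⁅y⁆⇒x≡y e₁ r)) , (λ r → f₁≢f₂ n eL (x∈⁅y⁆⇒x≡y e₂ r)) ]′ (x∈p∪q⁻ ⁅ e₁ ⁆ ⁅ e₂ ⁆ (s (Expand.plain⁺ Q o n hQ)))
        single : proj₁ inside ≡ ⁅ e ⁆
        single = ⊆-antisym (proj₂ (proj₂ inside)) λ u →
          let (h , hQ) = circuit-nonempty N (proj₁ (proj₂ inside))
          in subst (_∈ proj₁ inside) (trans (x∈⁅y⁆⇒x≡y e (proj₂ (proj₂ inside) hQ)) (sym (x∈⁅y⁆⇒x≡y e u))) hQ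
      cases : ∀ x y → inc e₁ wₑ ≡ x → inc e₂ wₑ ≡ y → Shape
      cases 0 0 p q = ⊥-elim (n≮0 (≤-trans positive (≤-reflexive (cong₂ _+_ p q))))
      cases 0 1 p q = ⊥-elim (not-one (cong₂ _+_ p q))
      cases 1 0 p q = ⊥-elim (not-one (cong₂ _+_ p q))
      cases 0 2 p q = ⊥-elim (isolated-loop m₂ m₁ e₁≢e₂ q (trans deg-w (cong₂ _+_ p q)))
      cases 2 0 p q = ⊥-elim (isolated-loop m₁ m₂ (e₁≢e₂ ∘ sym) p (trans deg-w (cong₂ _+_ p q)))
      cases 2 2 p q = ⊥-elim (two-loops p q)
      cases 1 1 p q = let (x₁ , n₁ , r₁) = other-end {e₁} (≤-reflexive p) ; (x₂ , n₂ , r₂) = other-end {e₂} (≤-reflexive q)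
                      in link-link n₁ n₂ p q r₁ r₂
      cases 2 1 p q = let (x₂ , n₂ , r₂) = other-end {e₂} (≤-reflexive q) in loop-link n₂ p q r₂
      cases 1 2 p q = let (x₁ , n₁ , r₁) = other-end {e₁} (≤-reflexive p) in link-loop n₁ p q r₁
      cases (suc (suc (suc x))) y p q = ⊥-elim (<⇒≱ (s≤s (s≤s (s≤s z≤n))) (subst (_≤ 2) p (inc≤2 e₁ wₑ)))
      cases x (suc (suc (suc y))) p q = ⊥-elim (<⇒≱ (s≤s (s≤s (s≤s z≤n))) (subst (_≤ 2) q (inc≤2 e₂ wₑ)))

  private-distinct : ∀ {g h} (gL : g ∈ L) (g≢e : g ≢ e) (hL : h ∈ L) (h≢e : h ≢ e) → g ≢ h → ¬ V (T h) (Ends.w (ends gL g≢e))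
  private-distinct gL g≢e hL h≢e ne p = Ends.off (ends gL g≢e) (V-mono (T⊆Y hL (ne ∘ sym) h≢e) _ p)

  opaque
    -- Otherwise the two triples span three vertices, and the remaining elements miss both private
    -- vertices. The bounds three and `nv U` minus two would make `a` and `b` a 2-separation, whose
    -- other side has two elements by `4 ≤ k`.
    ends-differ : 4 ≤ k → Ends.p (ends aL a≢e) ≢ Ends.p (ends bL b≢e)
    ends-differ big same = lin⊥ 0 (+-mono-≤ sep (≤-reflexive two-less)) (ar (nv U) (pred (pred (nv U))))
      where
      module A = Ends (ends aL a≢e)
      module B = Ends (ends bL b≢e)
      ar : ∀ u x → u + 2 + suc (suc x) ≡ suc (3 + x + u + 0)
      ar = solve-∀
      w≢w : A.w ≢ B.w
      w≢w eq = private-distinct aL a≢e bL b≢e a≢b (subst (V (T b)) (sym eq) B.V-w)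
      A∪B : Subset k
      A∪B = ⁅ a ⁆ ∪ ⁅ b ⁆
      in-U : ∀ {g} → g ∈ L → g ≢ e → T g ⊆ U
      in-U gL ne = j∉⇒⊆U (j∉T gL ne)
      few : ∀ S → (∀ x → V S x → V U x) → ¬ V S A.w → ¬ V S B.w → nv S + 2 ≤ nv U
      few S sub na nb = subst (_≤ nv U) (trans (∑-distrib-+ (λ x → sg (d S x)) (λ x → δ A.w x + δ B.w x)) (cong (nv S +_) (∑δδ A.w B.w))) (∑-mono pointwise)
        where
        pointwise : ∀ x → sg (d S x) + (δ A.w x + δ B.w x) ≤ sg (d U x)
        pointwise x with A.w ≟F x | B.w ≟F x
        ... | yes refl | yes q = ⊥-elim (w≢w (sym q))
        ... | yes refl | no _ rewrite 1≰⇒≡0 na | sg-pos (V-mono (in-U aL a≢e) x A.V-w) = ≤-refl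
        ... | no _ | yes refl rewrite 1≰⇒≡0 nb | sg-pos (V-mono (in-U bL b≢e) x B.V-w) = ≤-refl
        ... | no _ | no _ with V? S x
        ...   | yes p rewrite sg-pos p | sg-pos (sub x p) = ≤-refl
        ...   | no p rewrite 1≰⇒≡0 p = z≤n
      two-less : suc (suc (pred (pred (nv U)))) ≡ nv U
      -- `few` applied to the empty set shows `2 ≤ nv U`, so the truncated predecessors are exact.
      two-less with nv U | few ⊥ (λ x p → ⊥-elim (∉⊥ (proj₁ (proj₂ (deg-pos {⊥} {x} p))))) (λ p → ∉⊥ (proj₁ (proj₂ (deg-pos {⊥} p)))) (λ p → ∉⊥ (proj₁ (proj₂ (deg-pos {⊥} p))))
      ... | suc (suc u) | _ = refl
      ... | 0 | le = ⊥-elim (n≮0 (≤-trans (m≤n+m 1 (nv ⊥)) (≤-trans (+-monoʳ-≤ (nv ⊥) (s≤s z≤n)) le)))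
      ... | 1 | le = ⊥-elim (n≮0 (≤-pred (≤-trans (m≤n+m 2 (nv ⊥)) le)))
      near : ∀ {I} → I ⊆ over A∪B → j ∉ I → Independent M I → ∣ I ∣ ≤ 3
      near {I} s nj ind = ≤-trans (independent-card nj ind) (≤-trans (∑-mono pointwise) (≤-reflexive
          (trans (∑-distrib-+ (λ x → δ A.w x + δ B.w x) (δ A.p)) (cong₂ _+_ (∑δδ A.w B.w) (∑δ A.p)))))
        where
        I⊆ : I ⊆ T a ∪ T b
        I⊆ u with Over.member A∪B (s u)
        ... | inj₁ (h , n , refl , q) = ⊥-elim ([ (λ r → n (subst (_∈ L) (sym (x∈⁅y⁆⇒x≡y a r)) aL)) , (λ r → n (subst (_∈ L) (sym (x∈⁅y⁆⇒x≡y b r)) bL)) ]′ (x∈p∪q⁻ ⁅ a ⁆ ⁅ b ⁆ q))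
        ... | inj₂ (h , i , hL , refl , q) with x∈p∪q⁻ ⁅ a ⁆ ⁅ b ⁆ q
        ...   | inj₁ r with x∈⁅y⁆⇒x≡y a r
        ...     | refl = ∪ˡ (T⁺ aL i)
        I⊆ u | inj₂ (h , i , hL , refl , q) | inj₂ r with x∈⁅y⁆⇒x≡y b r
        ...     | refl = ∪ʳ {A = T a} (T⁺ bL i)
        pointwise : ∀ x → sg (d I x) ≤ δ A.w x + δ B.w x + δ A.p x
        pointwise x with V? I x
        ... | no p = ≤-trans (≤-reflexive (cong sg (1≰⇒≡0 p))) z≤n
        ... | yes p = ≤-trans (sg≤1 _) ([ (λ r → [ (λ eq → ≤-trans (at eq) (≤-trans (m≤m+n _ _) (m≤m+n _ _))) , (λ eq → ≤-trans (at eq) (m≤n+m _ _)) ]′ (A.only x r)) ,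
                (λ r → [ (λ eq → ≤-trans (at eq) (≤-trans (m≤n+m _ (δ A.w x)) (m≤m+n _ _))) , (λ eq → ≤-trans (at (trans eq (sym same))) (m≤n+m _ _)) ]′ (B.only x r)) ]′ (V-∪ {T a} {T b} (V-mono I⊆ x p)))
          where
          at : ∀ {y} → x ≡ y → 1 ≤ δ y x
          at refl = ≤-reflexive (sym (δ-refl x))
      far : ∀ {I} → I ⊆ over (∁ A∪B) → j ∉ I → Independent M I → ∣ I ∣ ≤ pred (pred (nv U))
      far {I} s nj ind = ≤-trans (independent-card nj ind) (≤-pred (≤-pred (≤-trans (≤-trans (≤-reflexive (+-comm 2 (nv I)))
          (few I (V-mono (j∉⇒⊆U nj)) (λ p → A.off (V-mono (avoid a (∪ˡ (x∈⁅x⁆ a))) _ p)) (λ p → B.off (V-mono (avoid b (∪ʳ {A = ⁅ a ⁆} (x∈⁅x⁆ b))) _ p)))) (≤-reflexive (sym two-less)))))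
        where
        avoid : ∀ g → g ∈ A∪B → I ⊆ Y g
        avoid g gA u = ∈∖⁺ (over-mono (λ {h} q → ∁⁅⁆ λ { refl → x∈∁p⇒x∉p q gA }) (s u)) λ q → nj (subst (_∈ I) (x∈⁅y⁆⇒x≡y j q) u)
      sep : nv U + 2 ≤ 3 + pred (pred (nv U))
      sep = ≤-trans (+-monoˡ-≤ 2 (proj₂ (proj₂ full))) (no-separation-over 2 no-sep₂ A∪B
        (two-elements (∪ˡ (x∈⁅x⁆ a)) (∪ʳ {A = ⁅ a ⁆} (x∈⁅x⁆ b)) a≢b)
        (≤-trans (∸-mono big (two-point a b)) (≤-reflexive (sym (∣∁p∣≡n∸∣p∣ A∪B))))
        (λ I s av → near s (av eL)) (λ I s av → far s (av eL)) (proj₁ full) (proj₁ (proj₂ full)))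

  -- A link-like pair over e yields a circuit through a, b and e, by Menger's theorem for two paths:
  -- in the graph H, the edge a₀ is redirected to join the attachment vertices of the triples over a and b,
  -- and cycles through a₀ are the paths between them.
  module Linked (big : 4 ≤ k) (none : ∀ C → Circuit N C → a ∈ C → b ∈ C → e ∈ C → False)
    {x₁ x₂ : Fin v} (x₁≢w : x₁ ≢ wₑ) (x₂≢w : x₂ ≢ wₑ) (one₁ : inc e₁ wₑ ≡ 1) (one₂ : inc e₂ wₑ ≡ 1)
    (at₁ : 1 ≤ inc e₁ x₁) (at₂ : 1 ≤ inc e₂ x₂) (x₁≢x₂ : x₁ ≢ x₂) where

    module A = Ends (ends aL a≢e)
    module B = Ends (ends bL b≢e)

    a₀ : Fin m
    a₀ = f₂ a 0F

    H : Graph v m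
    H t with t ≟F a₀
    ... | yes _ = A.p , B.p
    ... | no _ = G t

    module 𝑯 = Counting H
    module 𝑯c = Cycles H

    opaque
      p≢q : A.p ≢ B.p
      p≢q = ends-differ big

    H-other : ∀ {t} → t ≢ a₀ → H t ≡ G t
    H-other {t} ne with t ≟F a₀
    ... | yes eq = ⊥-elim (ne eq)
    ... | no _ = refl

    H-a₀ : H a₀ ≡ (A.p , B.p)
    H-a₀ with a₀ ≟F a₀
    ... | yes _ = refl
    ... | no ne = ⊥-elim (ne refl)

    inc-H : ∀ {t} → t ≢ a₀ → ∀ x → 𝑯.inc t x ≡ inc t x
    inc-H {t} ne x = trans (𝑯.inc≡ t x) (trans (cong (λ z → δ (proj₁ z) x + δ (proj₂ z) x) (H-other ne)) (sym (inc≡ t x)))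

    inc-a₀ : ∀ x → 𝑯.inc a₀ x ≡ δ A.p x + δ B.p x
    inc-a₀ x = trans (𝑯.inc≡ a₀ x) (cong (λ z → δ (proj₁ z) x + δ (proj₂ z) x) H-a₀)

    opaque
      deg-H : ∀ {S} → a₀ ∉ S → ∀ x → 𝑯.d S x ≡ d S x
      deg-H {S} n x = trans (𝑯.deg≡ S x) (trans (sum-cong-≗ pointwise) (sym (deg≡ S x)))
        where
        pointwise : ∀ t → χ S t * 𝑯.inc t x ≡ χ S t * inc t x
        pointwise t with t ≟F a₀
        ... | yes refl rewrite χ-∉ n = refl
        ... | no ne = cong (χ S t *_) (inc-H ne x)

    to-H : ∀ {S x} → a₀ ∉ S → V S x → 𝑯.V S x
    to-H n p = ≤-trans p (≤-reflexive (sym (deg-H n _)))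

    -- The two triples over `a` and `b` are removed, except for the redirected edge `a₀` that takes
    -- their place.
    S₀ : Subset m
    S₀ = ⟦ (λ t → ¬? (t ≟F j) ×-dec ¬? (t ∈? T b) ×-dec ¬? ((t ∈? T a) ×-dec ¬? (t ≟F a₀))) ⟧

    S₀⁺ : ∀ {t} → t ≢ j → t ∉ T b → (t ∈ T a → t ≡ a₀) → t ∈ S₀
    S₀⁺ {t} p q r = ∈⟦⟧⁺ (λ t → ¬? (t ≟F j) ×-dec ¬? (t ∈? T b) ×-dec ¬? ((t ∈? T a) ×-dec ¬? (t ≟F a₀))) (p , q , λ (u , n) → n (r u))

    S₀⁻ : ∀ {t} → t ∈ S₀ → t ≢ j × t ∉ T b × (t ∈ T a → t ≡ a₀)
    S₀⁻ {t} u = let (p , q , r) = ∈⟦⟧⁻ (λ t → ¬? (t ≟F j) ×-dec ¬? (t ∈? T b) ×-dec ¬? ((t ∈? T a) ×-dec ¬? (t ≟F a₀))) u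
                in p , q , λ s → decidable-stable (t ≟F a₀) λ n → r (s , n)

    T-disjoint : ∀ {g h i} → g ∈ L → h ∈ L → g ≢ h → f₂ g i ∉ T h
    T-disjoint gL hL ne u = ne (sym (f₂-owner hL gL (proj₂ (T⁻ u))))

    a₀∈S₀ : a₀ ∈ S₀
    a₀∈S₀ = S₀⁺ (λ eq → a≢e (f₂-owner aL eL eq)) (T-disjoint aL bL a≢b) (λ _ → refl)

    piece∈S₀ : ∀ {h i} → h ∈ L → h ≢ a → h ≢ b → f₂ h i ≢ j → f₂ h i ∈ S₀
    piece∈S₀ hL ha hb nj = S₀⁺ nj (T-disjoint hL bL hb) (λ u → ⊥-elim (T-disjoint hL aL ha u))

    e₁∈S₀ : e₁ ∈ S₀
    e₁∈S₀ = piece∈S₀ eL (a≢e ∘ sym) (b≢e ∘ sym) (1F≢j eL)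

    e₂∈S₀ : e₂ ∈ S₀
    e₂∈S₀ = piece∈S₀ eL (a≢e ∘ sym) (b≢e ∘ sym) (2F≢j eL)

    ≢a₀ : ∀ {h i} → h ∈ L → h ≢ a → f₂ h i ≢ a₀
    ≢a₀ hL ne eq = ne (f₂-owner hL aL eq)

    opaque
      fat-not-circuit : ∀ {g D} → (gL : g ∈ L) → g ≢ e → D ⊆ T g → IsCycle G D → ¬ Circuit M D
      fat-not-circuit {g} {D} gL ne s cyc c = 1+n≢n (trans (sym (proj₂ (proj₂ (triple-fat gL ne)))) (cycle-card (subst (IsCycle G) (incomp M D (T g) c (circuit-T gL) s) cyc)))

    opaque
      -- Without `a₀` the cycle is a path of `G` between the attachment vertices. With an unbalanced
      -- cycle from each of the two triples it forms a loose handcuff, hence a circuit of `M`, and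
      -- this comes from a circuit of `N` through `a`, `b` and `e`.
      path-impossible : ∀ {Z} → IsCycle H Z → Z ⊆ S₀ → a₀ ∈ Z → e₁ ∈ Z → False
      path-impossible {Z} cyc s aZ eZ = conclude (circuit-cases cX)
        where
        P : Subset m
        P = Z ∖ ⁅ a₀ ⁆
        a₀∉P : a₀ ∉ P
        a₀∉P u = proj₂ (∈∖⁻ u) (x∈⁅x⁆ a₀)
        deg-P : ∀ x → 𝑯.d Z x ≡ δ A.p x + δ B.p x + d P x
        deg-P x = trans (𝑯.deg-∈ aZ x) (cong₂ _+_ (inc-a₀ x) (deg-H a₀∉P x))
        two : ∀ {x} → 1 ≤ δ A.p x + δ B.p x → 𝑯.d Z x ≡ 2
        two {x} q = 𝑯.deg-cycle cyc (≤-trans q (≤-trans (≤-reflexive (sym (inc-a₀ x))) (𝑯.deg-inc aZ x)))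
        at-p : d P A.p ≡ 1
        at-p = suc-injective (trans (cong (_+ d P A.p) (sym ends-p)) (trans (sym (deg-P A.p)) (two (≤-reflexive (sym ends-p)))))
          where
          ends-p : δ A.p A.p + δ B.p A.p ≡ 1
          ends-p = cong₂ _+_ (δ-refl A.p) (δ-≢ (p≢q ∘ sym))
        at-q : d P B.p ≡ 1
        at-q = suc-injective (trans (cong (_+ d P B.p) (sym ends-q)) (trans (sym (deg-P B.p)) (two (≤-reflexive (sym ends-q)))))
          where
          ends-q : δ A.p B.p + δ B.p B.p ≡ 1
          ends-q = cong₂ _+_ (δ-≢ p≢q) (δ-refl B.p)
        mid : ∀ {z} → z ≢ A.p → z ≢ B.p → d P z ≡ 0 ⊎ d P z ≡ 2
        mid {z} n n' = subst (λ q → q ≡ 0 ⊎ q ≡ 2) (trans (deg-P z) (cong (_+ d P z) (cong₂ _+_ (δ-≢ (n ∘ sym)) (δ-≢ (n' ∘ sym))))) (𝑯.cycle-degrees cyc z)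
        forest : Forest P
        forest Q sQ neQ = ≤-trans (𝑯.cycle-proper-forest cyc ∖⊆ (λ eq → a₀∉P (subst (a₀ ∈_) (sym eq) aZ)) Q sQ neQ)
          (≤-reflexive (sum-cong-≗ λ x → cong sg (deg-H (λ u → a₀∉P (sQ u)) x)))
        path : IsPath G A.p B.p P
        path = path-intro p≢q at-p at-q mid forest
        P⊆Y : ∀ {g} → (g ≡ a ⊎ g ≡ b) → P ⊆ Y g
        P⊆Y (inj₁ refl) u = [ id , (λ t → ⊥-elim (proj₂ (∈∖⁻ u) (subst (_∈ ⁅ a₀ ⁆) (sym (proj₂ (proj₂ (S₀⁻ (s (∖⊆ u)))) t)) (x∈⁅x⁆ a₀)))) ]′ (∈Y⊎∈T aL (proj₁ (S₀⁻ (s (∖⊆ u)))))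
        P⊆Y (inj₂ refl) u = [ id , (λ t → ⊥-elim (proj₁ (proj₂ (S₀⁻ (s (∖⊆ u)))) t)) ]′ (∈Y⊎∈T bL (proj₁ (S₀⁻ (s (∖⊆ u)))))
        cycleA : ∃[ D ] (D ⊆ T a × IsCycle G D × V D A.p)
        cycleA = cycle-at-p aL a≢e
        cycleB : ∃[ D ] (D ⊆ T b × IsCycle G D × V D B.p)
        cycleB = cycle-at-p bL b≢e
        D₁ D₂ : Subset m
        D₁ = proj₁ cycleA
        D₂ = proj₁ cycleB
        s₁ : D₁ ⊆ T a
        s₁ = proj₁ (proj₂ cycleA)
        s₂ : D₂ ⊆ T b
        s₂ = proj₁ (proj₂ cycleB)
        c₁ : IsCycle G D₁
        c₁ = proj₁ (proj₂ (proj₂ cycleA))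
        c₂ : IsCycle G D₂
        c₂ = proj₁ (proj₂ (proj₂ cycleB))
        only₁ : ∀ y → V P y → V D₁ y → y ≡ A.p
        only₁ y p q = [ (λ { refl → ⊥-elim (A.off (V-mono (P⊆Y (inj₁ refl)) y p)) }) , id ]′ (A.only y (V-mono s₁ y q))
        only₂ : ∀ y → V P y → V D₂ y → y ≡ B.p
        only₂ y p q = [ (λ { refl → ⊥-elim (B.off (V-mono (P⊆Y (inj₂ refl)) y p)) }) , id ]′ (B.only y (V-mono s₂ y q))
        vdis : VDisjoint D₁ D₂
        vdis y p q with A.only y (V-mono s₁ y p) | B.only y (V-mono s₂ y q)
        ... | inj₁ refl | _ = private-distinct aL a≢e bL b≢e a≢b (V-mono s₂ y q)
        ... | inj₂ _ | inj₁ refl = private-distinct bL b≢e aL a≢e (a≢b ∘ sym) (V-mono s₁ y p)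
        ... | inj₂ eq | inj₂ eq' = p≢q (trans (sym eq) eq')
        X : Subset m
        X = D₁ ∪ D₂ ∪ P
        njX : j ∉ X
        njX u = [ (λ t → j∉T aL a≢e (s₁ t)) , (λ t → [ (λ r → j∉T bL b≢e (s₂ r)) , (λ r → proj₁ (S₀⁻ (s (∖⊆ r))) refl) ]′ (x∈p∪q⁻ D₂ P t)) ]′ (x∈p∪q⁻ D₁ (D₂ ∪ P) u)
        cX : Circuit M X
        cX = [ proj₂ , (λ (bi , unb) → unbalanced-circuit njX bi unb) ]′ (frame⇒bicycle {Circuit M}
          (inj₂ (inj₂ (inj₁ (D₁ , D₂ , A.p , B.p , P , c₁ , c₂ , fat-not-circuit aL a≢e s₁ c₁ , fat-not-circuit bL b≢e s₂ c₂ ,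
            (λ y p q → vdis y (VertexOf⇒V p) (VertexOf⇒V q)) , path , V⇒VertexOf (proj₂ (proj₂ (proj₂ cycleA))) , V⇒VertexOf (proj₂ (proj₂ (proj₂ cycleB))) ,
            (λ y p q → only₁ y (VertexOf⇒V p) (VertexOf⇒V q)) , (λ y p q → only₂ y (VertexOf⇒V p) (VertexOf⇒V q)) , refl)))))
        e₁X : e₁ ∈ X
        e₁X = ∪ʳ {A = D₁} (∪ʳ {A = D₂} (∈∖⁺ eZ λ q → ≢a₀ eL (a≢e ∘ sym) (x∈⁅y⁆⇒x≡y a₀ q)))
        conclude : (∃[ g ] (g ∈ L × X ≡ T g)) ⊎ (∃[ C ] ∃[ o ] (Circuit N C × X ≡ expand C o)) → False
        conclude (inj₁ (g , gL , eq)) with T⁻ {g} (subst (e₁ ∈_) eq e₁X)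
        ... | i , q with f₂-owner gL eL q
        ...   | refl = njX (subst (j ∈_) (sym eq) (T⁺ gL 0F))
        conclude (inj₂ (C , o , cC , eq)) = none C cC (meets aL s₁ (λ u → ∪ˡ u) (proj₁ c₁)) (meets bL s₂ (λ u → ∪ʳ {A = D₁} (∪ˡ u)) (proj₁ c₂))
            (proj₁ (Expand.piece⁻ C o eL (subst (e₁ ∈_) eq e₁X)))
          where
          meets : ∀ {g D} → g ∈ L → D ⊆ T g → (∀ {t} → t ∈ D → t ∈ X) → Nonempty D → g ∈ C
          meets {g} gL sD into (t , u) with T⁻ {g} (sD u)
          ... | i , refl = proj₁ (Expand.piece⁻ C o gL (subst (_ ∈_) eq (into u)))

    module _ (cycleH? : ∀ X → Dec (IsCycle H X)) (forestH? : ∀ X → Dec (𝑯.Forest X)) where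
      CM : Matroid m
      CM = 𝑯c.cycle-matroid S₀

      Joined : Fin m → Set
      Joined t = ∃[ Z ] (IsCycle H Z × Z ⊆ S₀ × a₀ ∈ Z × t ∈ Z)

      opaque
        joined? : ∀ t → Dec (Joined t)
        joined? t = anySubset? λ Z → cycleH? Z ×-dec (Z ⊆? S₀) ×-dec (a₀ ∈? Z) ×-dec (t ∈? Z)

      Block? : ∀ t → Dec (t ∈ S₀ × (t ≡ a₀ ⊎ Joined t))
      Block? t = (t ∈? S₀) ×-dec ((t ≟F a₀) ⊎-dec joined? t)

      -- The block of `a₀` in `H` restricted to `S₀`: by `common-circuit` no cycle contains edges
      -- both of it and of the rest.
      A° : Subset m
      A° = ⟦ Block? ⟧

      A°⊆ : A° ⊆ S₀
      A°⊆ u = proj₁ (∈⟦⟧⁻ Block? u)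

      a₀∈A° : a₀ ∈ A°
      a₀∈A° = ∈⟦⟧⁺ Block? (a₀∈S₀ , inj₁ refl)

      rest : Subset m
      rest = S₀ ∖ A°

      rest-not-joined : ∀ {t} → t ∈ rest → ¬ Joined t
      rest-not-joined u h = proj₂ (∈∖⁻ u) (∈⟦⟧⁺ Block? (∖⊆ u , inj₂ h))

      a₀∉rest : a₀ ∉ rest
      a₀∉rest u = proj₂ (∈∖⁻ u) a₀∈A°

      not-joined-e₁ : ¬ Joined e₁
      not-joined-e₁ (Z , cyc , s , p , q) = path-impossible cyc s p q

      e₁∈rest : e₁ ∈ rest
      e₁∈rest = ∈∖⁺ e₁∈S₀ λ u → [ (λ eq → ≢a₀ eL (a≢e ∘ sym) eq) , not-joined-e₁ ]′ (proj₂ (∈⟦⟧⁻ Block? u))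

      opaque
        no-crossing : ∀ {Z t u} → IsCycle H Z → Z ⊆ S₀ → t ∈ Z → t ∈ A° → u ∈ Z → u ∈ rest → False
        no-crossing {Z} {t} {u} cyc s tZ tA uZ uR with a₀ ∈? Z
        ... | yes aZ = rest-not-joined uR (Z , cyc , s , aZ , uZ)
        ... | no a∉ with proj₂ (∈⟦⟧⁻ Block? tA)
        ...   | inj₁ refl = a∉ tZ
        ...   | inj₂ (Z' , cyc' , s' , aZ' , tZ') =
          let (F , (cF , sF) , uF , aF , _) = common-circuit CM (cyc , s) (cyc' , s') uZ tZ tZ' aZ' a∉
          in rest-not-joined uR (F , cF , sF , aF , uF)

      joined⊆A° : ∀ {Z} → IsCycle H Z → Z ⊆ S₀ → a₀ ∈ Z → Z ⊆ A°
      joined⊆A° cyc s p u = ∈⟦⟧⁺ Block? (s u , inj₂ (_ , cyc , s , p , u))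

      opaque
        A°-connected : Connected H A°
        A°-connected = 𝑯.connected-intro λ S S' eq dis (t , tS) (t' , tS') vdis →
          let side : ∀ {u} → u ∈ A° → u ∈ S ⊎ u ∈ S'
              side u = x∈p∪q⁻ S S' (subst (_ ∈_) (sym eq) u)
              same : ∀ {u} → u ∈ A° → (a₀ ∈ S → u ∈ S) × (a₀ ∈ S' → u ∈ S')
              same {u} uA = case proj₂ (∈⟦⟧⁻ Block? uA) of λ where
                (inj₁ refl) → id , id
                (inj₂ (Z , cyc , s , aZ , uZ)) → case 𝑯.connected-side (proj₁ (proj₂ cyc)) (λ z → side (joined⊆A° cyc s aZ z)) vdis of λ where
                  (inj₁ sZ) → (λ _ → sZ uZ) , (λ aS' → ⊥-elim (dis (sZ aZ) aS'))
                  (inj₂ sZ) → (λ aS → ⊥-elim (dis aS (sZ aZ))) , (λ _ → sZ uZ)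
          in [ (λ aS → dis (proj₁ (same (subst (t' ∈_) eq (∪ʳ {A = S} tS'))) aS) tS') ,
               (λ aS' → dis tS (proj₂ (same (subst (t ∈_) eq (∪ˡ tS))) aS')) ]′ (side a₀∈A°)

      -- A union of components of `rest` containing `e₁`; a minimal one is the component of `e₁`.
      Closed : Subset m → Set
      Closed Q = e₁ ∈ Q × Q ⊆ rest × (∀ x → 𝑯.V Q x → ¬ 𝑯.V (rest ∖ Q) x)

      opaque
        component : ∃[ Q ] (Q ⊆ rest × Closed Q × (∀ Z → Z ⊆ Q → Closed Z → Z ≡ Q))
        component = minimal-subset {P = Closed}
          (λ Q → (e₁ ∈? Q) ×-dec (Q ⊆? rest) ×-dec all? (λ x → 𝑯.V? Q x →-dec ¬? (𝑯.V? (rest ∖ Q) x))) rest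
          (e₁∈rest , id , λ x _ q → let (t , u , _) = 𝑯.deg-pos q in proj₂ (∈∖⁻ u) (∖⊆ u))

      B₁ : Subset m
      B₁ = proj₁ component
      e₁∈B₁ : e₁ ∈ B₁
      e₁∈B₁ = proj₁ (proj₁ (proj₂ (proj₂ component)))
      B₁⊆ : B₁ ⊆ rest
      B₁⊆ = proj₁ (proj₂ (proj₁ (proj₂ (proj₂ component))))
      B₁-apart : ∀ x → 𝑯.V B₁ x → ¬ 𝑯.V (rest ∖ B₁) x
      B₁-apart = proj₂ (proj₂ (proj₁ (proj₂ (proj₂ component))))
      B₁-minimal : ∀ Z → Z ⊆ B₁ → Closed Z → Z ≡ B₁
      B₁-minimal = proj₂ (proj₂ (proj₂ component))

      opaque
        B₁-connected : Connected H B₁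
        B₁-connected = 𝑯.connected-intro λ S S' eq dis neS neS' vdis →
          [ (λ p → part S S' eq dis neS' vdis p) ,
            (λ p → part S' S (trans (∪-cong-∈ {A = S'} {S} [ ∪ʳ {A = S} , ∪ˡ ]′ (λ u → [ inj₂ , inj₁ ]′ (x∈p∪q⁻ S S' u))) eq) (λ p q → dis q p) neS (λ x p q → vdis x q p) p) ]′
          (x∈p∪q⁻ S S' (subst (e₁ ∈_) (sym eq) e₁∈B₁))
          where
          part : ∀ S S' → S ∪ S' ≡ B₁ → Disjoint S S' → Nonempty S' → 𝑯.VDisjoint S S' → e₁ ∈ S → False
          part S S' eq dis (t , u) vdis p = dis (subst (t ∈_) (sym (B₁-minimal S S⊆ (p , (λ q → B₁⊆ (S⊆ q)) , apart))) (subst (t ∈_) eq (∪ʳ {A = S} u))) u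
            where
            S⊆ : S ⊆ B₁
            S⊆ q = subst (_ ∈_) eq (∪ˡ q)
            apart : ∀ x → 𝑯.V S x → ¬ 𝑯.V (rest ∖ S) x
            apart x q r =
              let (f , uf , i) = 𝑯.deg-pos r
              in case f ∈? S' of λ where
                (yes f') → vdis x q (≤-trans i (𝑯.deg-inc f' x))
                (no n) → B₁-apart x (𝑯.V-mono S⊆ x q) (≤-trans i (𝑯.deg-inc (∈∖⁺ (∖⊆ uf) λ fB → [ (λ fS → proj₂ (∈∖⁻ uf) fS) , n ]′ (x∈p∪q⁻ S S' (subst (f ∈_) (sym eq) fB))) x))

      link-a₀ : ∀ x → 𝑯.inc a₀ x ≤ 1
      link-a₀ x = ≤-trans (≤-reflexive (inc-a₀ x)) (bound x)
        where
        bound : ∀ x → δ A.p x + δ B.p x ≤ 1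
        bound x with A.p ≟F x | B.p ≟F x
        ... | yes refl | yes q = ⊥-elim (p≢q (sym q))
        ... | yes _ | no _ = ≤-refl
        ... | no _ | yes _ = ≤-refl
        ... | no _ | no _ = z≤n

      opaque
        link-e : ∀ {t x} → inc t wₑ ≡ 1 → inc t x ≤ 1
        link-e {t} {x} one = case x ≟F wₑ of λ where
          (yes refl) → ≤-reflexive one
          (no n) → +-cancelʳ-≤ 1 (inc t x) 1 (≤-trans (≤-reflexive (cong (inc t x +_) (sym one))) (≤-trans (∑-two-terms (inc t) n) (≤-reflexive (inc-sum t))))

      B₁⊆S₀ : B₁ ⊆ S₀
      B₁⊆S₀ u = ∖⊆ (B₁⊆ u)

      a₀∉B₁ : a₀ ∉ B₁
      a₀∉B₁ u = a₀∉rest (B₁⊆ u)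

      opaque
        forests-unite : ∀ {IA IB} → IA ⊆ A° → IB ⊆ B₁ → 𝑯.Forest IA → 𝑯.Forest IB → 𝑯.Forest (IA ∪ IB)
        forests-unite {IA} {IB} sA sB fA fB Z sZ neZ = ≰⇒> λ le →
          let (D , sD , cyc) = 𝑯.cycle-in neZ le
              side : ∀ {t} → t ∈ D → t ∈ IA ⊎ t ∈ IB
              side u = x∈p∪q⁻ IA IB (sZ (sD u))
              sS : D ⊆ S₀
              sS u = [ (λ t → A°⊆ (sA t)) , (λ t → B₁⊆S₀ (sB t)) ]′ (side u)
          in case any? (λ t → (t ∈? D) ×-dec (t ∈? A°)) of λ where
               (yes (t , tD , tA)) → <⇒≱ (fA D (λ u → [ id , (λ r → ⊥-elim (no-crossing cyc sS tD tA u (B₁⊆ (sB r)))) ]′ (side u)) (proj₁ cyc)) (≤-reflexive (sym (𝑯.cycle-card cyc)))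
               (no n) → <⇒≱ (fB D (λ u → [ (λ r → ⊥-elim (n (_ , u , sA r))) , id ]′ (side u)) (proj₁ cyc)) (≤-reflexive (sym (𝑯.cycle-card cyc)))

      opaque
        -- Spanning trees of the two parts unite to a forest, as no cycle crosses between the parts.
        -- Its vertices outnumber its edges, which allows only one common vertex.
        forests-bound : 𝑯.nv A° + 𝑯.nv B₁ ≤ suc (𝑯.nv (A° ∪ B₁))
        forests-bound =
          let (IA , sA , fA , leA) = 𝑯c.spanning-forest forestH? A°-connected a₀∈A° link-a₀
              (IB , sB , fB , leB) = 𝑯c.spanning-forest forestH? B₁-connected e₁∈B₁ (λ x → ≤-trans (≤-reflexive (inc-H (≢a₀ eL (a≢e ∘ sym)) x)) (link-e one₁))
              dis : Disjoint IA IB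
              dis p q = proj₂ (∈∖⁻ (B₁⊆ (sB q))) (sA p)
              few : suc (∣ IA ∣ + ∣ IB ∣) ≤ 𝑯.nv (A° ∪ B₁)
              few = case nonempty? (IA ∪ IB) of λ where
                (yes ne) → ≤-trans (≤-trans (s≤s (≤-reflexive (sym (card-∪ dis)))) (forests-unite sA sB fA fB (IA ∪ IB) id ne))
                             (𝑯.nv-mono (∪⊆ (λ u → ∪ˡ (sA u)) (λ u → ∪ʳ {A = A°} (sB u))))
                (no em) → ≤-trans (s≤s (≤-reflexive (trans (sym (card-∪ dis)) (empty-card em)))) (𝑯.nv-one (proj₂ (𝑯.nonempty-vertex (a₀ , ∪ˡ a₀∈A°))))
          in ≤-trans (+-mono-≤ leA leB) (≤-trans (≤-reflexive (ar (∣ IA ∣) (∣ IB ∣))) (s≤s few))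
          where
          ar : ∀ x y → suc x + suc y ≡ suc (suc (x + y))
          ar = solve-∀

        one-common : ∀ {x y} → x ≢ y → 𝑯.V A° x → 𝑯.V B₁ x → 𝑯.V A° y → 𝑯.V B₁ y → False
        one-common {x} {y} ne xA xB yA yB = <⇒≱ (≤-reflexive (+-comm 2 (𝑯.nv (A° ∪ B₁)))) (≤-trans
            (subst₂ _≤_ (trans (∑-distrib-+ (λ z → sg (𝑯.d (A° ∪ B₁) z)) (λ z → δ x z + δ y z)) (cong (𝑯.nv (A° ∪ B₁) +_) (∑δδ x y)))
              (∑-distrib-+ (λ z → sg (𝑯.d A° z)) (λ z → sg (𝑯.d B₁ z))) (∑-mono pointwise)) forests-bound)
          where
          pointwise : ∀ z → sg (𝑯.d (A° ∪ B₁) z) + (δ x z + δ y z) ≤ sg (𝑯.d A° z) + sg (𝑯.d B₁ z)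
          pointwise z with x ≟F z | y ≟F z
          ... | yes refl | yes q = ⊥-elim (ne (sym q))
          ... | yes refl | no _ rewrite sg-pos xA | sg-pos xB = +-monoˡ-≤ 1 (sg≤1 _)
          ... | no _ | yes refl rewrite sg-pos yA | sg-pos yB = +-monoˡ-≤ 1 (sg≤1 _)
          ... | no _ | no _ = ≤-trans (≤-reflexive (+-identityʳ _)) (bound (𝑯.V? (A° ∪ B₁) z))
            where
            bound : Dec (𝑯.V (A° ∪ B₁) z) → sg (𝑯.d (A° ∪ B₁) z) ≤ sg (𝑯.d A° z) + sg (𝑯.d B₁ z)
            bound (no n) = ≤-trans (≤-reflexive (cong sg (1≰⇒≡0 n))) z≤n
            bound (yes p) = ≤-trans (sg≤1 _) ([ (λ q → ≤-trans (≤-reflexive (sym (sg-pos q))) (m≤m+n _ _)) , (λ q → ≤-trans (≤-reflexive (sym (sg-pos q))) (m≤n+m _ (sg (𝑯.d A° z)))) ]′ (𝑯.V-∪ p))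

      opaque
        a₀-misses : ∀ {h w} → h ∈ L → h ≢ a → h ≢ b → ¬ V (Y h) w → 1 ≤ 𝑯.inc a₀ w → False
        a₀-misses {h} {w} hL ha hb off q = [ (λ { refl → off (V-mono (T⊆Y aL (ha ∘ sym) a≢e) w A.V-p) }) , (λ { refl → off (V-mono (T⊆Y bL (hb ∘ sym) b≢e) w B.V-p) }) ]′ (split (≤-trans q (≤-reflexive (inc-a₀ w))))
          where
          split : 1 ≤ δ A.p w + δ B.p w → A.p ≡ w ⊎ B.p ≡ w
          split r with A.p ≟F w
          ... | yes eq = inj₁ eq
          ... | no _ = inj₂ (δ-pos r)

      opaque
        off-private : ∀ {h w f} → h ∈ L → h ≢ a → h ≢ b → ¬ V (Y h) w → f ∈ S₀ → f ∉ T h → 𝑯.inc f w ≡ 0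
        off-private {h} {w} {f} hL ha hb off fS fT = 1≰⇒≡0 λ q → case f ≟F a₀ of λ where
          (yes refl) → a₀-misses hL ha hb off q
          (no n) → off (≤-trans q (≤-trans (≤-reflexive (inc-H n w)) (deg-inc ([ id , (λ t → ⊥-elim (fT t)) ]′ (∈Y⊎∈T hL (proj₁ (S₀⁻ fS)))) w)))

      opaque
        -- A cycle through `a₀` would meet the triple over `h` in a proper part, thus a forest on
        -- two vertices, that is, one link. At the private vertex of `h` the cycle has no other
        -- edges, so its degree there could not be two.
        triple-not-joined : ∀ {h i} → (hL : h ∈ L) → h ≢ a → h ≢ b → (h≢e : h ≢ e) → ¬ Joined (f₂ h i)
        triple-not-joined {h} {i} hL ha hb h≢e (Z , cyc , s , aZ , tZ) =
          lin⊥ 0 (≤-trans (+-mono-≤ (≤-reflexive (sym deg-w)) V-p) (≤-trans (∑-two-terms (𝑯.d W) (Ends.p≢w en ∘ sym)) (≤-reflexive (trans (𝑯.handshake W) (cong (2 *_) oneW))))) refl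
          where
          en : Ends h
          en = ends hL h≢e
          w p : Fin v
          w = Ends.w en
          p = Ends.p en
          W : Subset m
          W = Z ∩ T h
          W⊆T : W ⊆ T h
          W⊆T u = proj₂ (x∈p∩q⁻ Z (T h) u)
          W⊆Z : W ⊆ Z
          W⊆Z u = proj₁ (x∈p∩q⁻ Z (T h) u)
          a₀∉T : a₀ ∉ T h
          a₀∉T = T-disjoint aL hL (ha ∘ sym)
          neW : Nonempty W
          neW = f₂ h i , x∈p∩q⁺ (tZ , T⁺ hL i)
          nvT : 𝑯.nv (T h) ≡ 2
          nvT = trans (sum-cong-≗ λ x → cong sg (deg-H a₀∉T x)) (fat-nv hL (triple-fat hL h≢e))
          lt : ∣ W ∣ < 𝑯.nv W
          lt = 𝑯.cycle-proper-forest cyc W⊆Z (λ eq → a₀∉T (W⊆T (subst (a₀ ∈_) (sym eq) aZ))) W id neW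
          oneW : ∣ W ∣ ≡ 1
          oneW = ≤-antisym (≤-pred (≤-trans lt (≤-trans (𝑯.nv-mono W⊆T) (≤-reflexive nvT)))) (card-pos neW)
          touches : ∀ {x} → V (T h) x → 𝑯.V W x
          touches {x} q = decidable-stable (𝑯.V? W x) λ n → <⇒≱ (≤-trans (s≤s (s≤s (card-pos neW))) (s≤s lt))
            (≤-trans (𝑯.nv-extra (𝑯.V-mono W⊆T) x n (to-H a₀∉T q)) (≤-reflexive nvT))
          V-p : 𝑯.V W p
          V-p = touches (Ends.V-p en)
          deg-w : 𝑯.d W w ≡ 2
          deg-w = trans (sym (trans (𝑯.deg-split W⊆Z w) (trans (cong (𝑯.d W w +_) (1≰⇒≡0 λ q →
              let (f , u , r) = 𝑯.deg-pos q in n≮0 (≤-trans r (≤-reflexive (off-private hL ha hb (Ends.off en) (s (∖⊆ u)) λ t → proj₂ (∈∖⁻ u) (x∈p∩q⁺ (∖⊆ u , t)))))))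
              (+-identityʳ _)))) (𝑯.deg-cycle cyc (𝑯.V-mono W⊆Z w (touches (Ends.V-w en))))

        -- A cycle through `a₀` and `e₂` that misses `e₁` has a leaf at `wₑ`.
        e₂-not-joined : ¬ Joined e₂
        e₂-not-joined (Z , cyc , s , aZ , eZ) with e₁ ∈? Z
        ... | yes p = path-impossible cyc s aZ p
        ... | no n = 𝑯.cycle-no-leaf cyc wₑ (trans (𝑯.deg-∈ eZ wₑ) (cong₂ _+_ (trans (inc-H (≢a₀ eL (a≢e ∘ sym)) wₑ) one₂)
            (1≰⇒≡0 λ q → let (f , u , r) = 𝑯.deg-pos q in n≮0 (≤-trans r (≤-reflexive (off-private eL (a≢e ∘ sym) (b≢e ∘ sym) wₑ-off (s (∖⊆ u)) (not-T u)))))))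
          where
          not-T : ∀ {f} → f ∈ Z ∖ ⁅ e₂ ⁆ → f ∉ T e
          not-T u t with T⁻ {e} t
          ... | 0F , refl = proj₁ (S₀⁻ (s (∖⊆ u))) refl
          ... | 1F , refl = n (∖⊆ u)
          ... | 2F , refl = proj₂ (∈∖⁻ u) (x∈⁅x⁆ e₂)

      not-A° : ∀ {t} → t ∈ S₀ → t ≢ a₀ → ¬ Joined t → t ∈ rest
      not-A° u ne nj = ∈∖⁺ u λ q → [ ne , nj ]′ (proj₂ (∈⟦⟧⁻ Block? q))

      opaque
        e₂∈B₁ : e₂ ∈ B₁
        e₂∈B₁ = decidable-stable (e₂ ∈? B₁) λ n → B₁-apart wₑ
          (to-H' e₁∈B₁ (≢a₀ eL (a≢e ∘ sym)) (≤-reflexive (sym one₁)))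
          (to-H' (∈∖⁺ (not-A° e₂∈S₀ (≢a₀ eL (a≢e ∘ sym)) e₂-not-joined) n) (≢a₀ eL (a≢e ∘ sym)) (≤-reflexive (sym one₂)))
          where
          to-H' : ∀ {S t x} → t ∈ S → t ≢ a₀ → 1 ≤ inc t x → 𝑯.V S x
          to-H' u ne q = ≤-trans q (≤-trans (≤-reflexive (sym (inc-H ne _))) (𝑯.deg-inc u _))

      opaque
        -- A full triple is connected and lies outside the block of `a₀`, hence in one component.
        -- Over `e` the two remaining pieces meet at `wₑ`.
        block : ∀ {h i i'} → h ∈ L → f₂ h i ∈ B₁ → f₂ h i' ≢ j → f₂ h i' ∈ B₁
        block {h} {i} {i'} hL u nj = case (h ≟F e) of λ where
            (yes refl) → last i' nj
            (no he) → case (h ≟F a) of λ where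
              (yes refl) → ⊥-elim (a₀∉B₁ (subst (_∈ B₁) (proj₂ (proj₂ (S₀⁻ (B₁⊆S₀ u))) (T⁺ aL i)) u))
              (no ha) → case (h ≟F b) of λ where
                (yes refl) → ⊥-elim (proj₁ (proj₂ (S₀⁻ (B₁⊆S₀ u))) (T⁺ bL i))
                (no hb) → general he ha hb
          where
          last : ∀ i → f₂ e i ≢ j → f₂ e i ∈ B₁
          last 0F n = ⊥-elim (n refl)
          last 1F n = e₁∈B₁
          last 2F n = e₂∈B₁
          general : h ≢ e → h ≢ a → h ≢ b → f₂ h i' ∈ B₁
          general he ha hb = [ (λ (s : T h ⊆ B₁) → s (T⁺ hL i')) , (λ (s : T h ⊆ (rest ∖ B₁)) → ⊥-elim (proj₂ (∈∖⁻ (s (T⁺ hL i))) u)) ]′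
            (connected-side (circuit-connected (j∉T hL he) (circuit-T hL)) cover λ x p q → B₁-apart x (to-H a₀∉B₁ p) (to-H (λ r → a₀∉rest (∖⊆ r)) q))
            where
            cover : ∀ {t} → t ∈ T h → t ∈ B₁ ⊎ t ∈ rest ∖ B₁
            cover {t} r with t ∈? B₁
            ... | yes q = inj₁ q
            ... | no n with T⁻ {h} r
            ...   | i'' , refl = inj₂ (∈∖⁺ (not-A° (piece∈S₀ hL ha hb λ eq → he (f₂-owner hL eL eq)) (≢a₀ hL ha) (triple-not-joined hL ha hb he)) n)

      A' : Subset m
      A' = U ∖ B₁

      opaque
        -- The removed triples over `a` and `b` can meet `B₁` only at their attachment vertices,
        -- which in `H` are the ends of `a₀`. Thus what is known about `H` also bounds the overlap
        -- in `G`.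
        shared : ∀ {x} → V A' x → V B₁ x → 𝑯.V A° x
        shared {x} p q with deg-pos p
        ... | t , u , r with t ∈? T a | t ∈? T b
        ...   | yes ta | _ = [ (λ { refl → ⊥-elim (A.off (V-mono B₁⊆Ya x q)) }) , (λ { refl → at-a₀ (≤-trans (≤-reflexive (sym (δ-refl x))) (m≤m+n _ _)) }) ]′ (A.only x (≤-trans r (deg-inc ta x)))
          where
          at-a₀ : 1 ≤ δ A.p x + δ B.p x → 𝑯.V A° x
          at-a₀ s = ≤-trans s (≤-trans (≤-reflexive (sym (inc-a₀ x))) (𝑯.deg-inc a₀∈A° x))
          B₁⊆Ya : B₁ ⊆ Y a
          B₁⊆Ya b₁ = [ id , (λ s → ⊥-elim (a₀∉B₁ (subst (_∈ B₁) (proj₂ (proj₂ (S₀⁻ (B₁⊆S₀ b₁))) s) b₁))) ]′ (∈Y⊎∈T aL (proj₁ (S₀⁻ (B₁⊆S₀ b₁))))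
        ...   | no _ | yes tb = [ (λ { refl → ⊥-elim (B.off (V-mono B₁⊆Yb x q)) }) , (λ { refl → at-a₀ (≤-trans (≤-reflexive (sym (δ-refl x))) (m≤n+m _ (δ A.p x))) }) ]′ (B.only x (≤-trans r (deg-inc tb x)))
          where
          at-a₀ : 1 ≤ δ A.p x + δ B.p x → 𝑯.V A° x
          at-a₀ s = ≤-trans s (≤-trans (≤-reflexive (sym (inc-a₀ x))) (𝑯.deg-inc a₀∈A° x))
          B₁⊆Yb : B₁ ⊆ Y b
          B₁⊆Yb b₁ = [ id , (λ s → ⊥-elim (proj₁ (proj₂ (S₀⁻ (B₁⊆S₀ b₁))) s)) ]′ (∈Y⊎∈T bL (proj₁ (S₀⁻ (B₁⊆S₀ b₁))))
        ...   | no na | no nb = case t ∈? A° of λ where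
            (yes tA) → ≤-trans r (≤-trans (≤-reflexive (sym (inc-H ne x))) (𝑯.deg-inc tA x))
            (no n) → ⊥-elim (B₁-apart x (to-H a₀∉B₁ q) (≤-trans r (≤-trans (≤-reflexive (sym (inc-H ne x)))
                       (𝑯.deg-inc (∈∖⁺ (∈∖⁺ (S₀⁺ (≢j j∉U (∖⊆ u)) nb (λ ta → ⊥-elim (na ta))) n) (proj₂ (∈∖⁻ u))) x))))
          where
          ne : t ≢ a₀
          ne refl = na (T⁺ aL 0F)

      common : ∀ {x y} → V A' x → V B₁ x → V A' y → V B₁ y → x ≡ y
      common {x} {y} p q p' q' = decidable-stable (x ≟F y) λ ne → one-common ne (shared p q) (to-H a₀∉B₁ q) (shared p' q') (to-H a₀∉B₁ q')

      opaque
        in-B₁ : ∀ {I} → I ⊆ over (collect B₁) → j ∉ I → I ⊆ B₁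
        in-B₁ s nj u with Over.member (collect B₁) (s u)
        ... | inj₁ (h , n , refl , q) = subst (_∈ B₁) (base-plain n) (collect⁻ q)
        ... | inj₂ (h , i , hL , refl , q) = block hL (subst (_∈ B₁) (base-piece hL) (collect⁻ q)) (≢j nj u)

      opaque
        B₁-over : ∀ {t} → t ∈ B₁ → t ∈ over (collect B₁)
        B₁-over {t} u with locate t
        ... | inj₁ (h , n , refl) = Over.plain⁺ _ n (collect⁺ (subst (_∈ B₁) (sym (base-plain n)) u))
        ... | inj₂ (h , i , hL , refl) = Over.piece⁺ _ hL (collect⁺ (subst (_∈ B₁) (sym (base-piece hL)) (block hL u (1F≢j hL))))

      in-A' : ∀ {I} → I ⊆ over (∁ (collect B₁)) → j ∉ I → I ⊆ A'
      in-A' s nj u = ∈∖⁺ (j∉⇒⊆U nj u) λ q → over-disjoint (B₁-over q) (s u)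

      e∈collect : e ∈ collect B₁
      e∈collect = collect⁺ (subst (_∈ B₁) (sym (base-piece eL)) e₁∈B₁)

      opaque
        not-collected : ∀ {g} → g ≡ a ⊎ g ≡ b → g ∈ ∁ (collect B₁)
        not-collected (inj₁ refl) = x∉p⇒x∈∁p λ q → let u = subst (_∈ B₁) (base-piece aL) (collect⁻ q)
          in a₀∉B₁ (subst (_∈ B₁) (proj₂ (proj₂ (S₀⁻ (B₁⊆S₀ u))) (T⁺ aL 1F)) u)
        not-collected (inj₂ refl) = x∉p⇒x∈∁p λ q → proj₁ (proj₂ (S₀⁻ (B₁⊆S₀ (subst (_∈ B₁) (base-piece bL) (collect⁻ q))))) (T⁺ bL 1F)

      opaque
        -- If `B₁` had only pieces over `e`, a circuit through `e` would have to continue outside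
        -- `B₁` at both `x₁` and `x₂`, giving two vertices common to `A'` and `B₁`.
        another : ∃[ h ] (h ≢ e × h ∈ collect B₁)
        another = decidable-stable (any? λ h → ¬? (h ≟F e) ×-dec (h ∈? collect B₁)) λ none' →
          let only-e : ∀ {t} → t ∈ B₁ → t ∈ T e
              only-e {t} u = case Over.member (collect B₁) (B₁-over u) of λ where
                (inj₁ (h , n , refl , q)) → ⊥-elim (none' (h , (λ { refl → n eL }) , q))
                (inj₂ (h , i , hL , refl , q)) → subst (λ g → f₂ h i ∈ T g) (decidable-stable (h ≟F e) λ ne → none' (h , ne , q)) (T⁺ hL i)
              (C , cC , eC , _) = through-e
              inB : ∀ {x} → 1 ≤ inc e₁ x → V B₁ x
              inB q = ≤-trans q (deg-inc e₁∈B₁ _)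
              inB' : ∀ {x} → 1 ≤ inc e₂ x → V B₁ x
              inB' q = ≤-trans q (deg-inc e₂∈B₁ _)
              rest⊆A' : expand C o₀ ∖ T e ⊆ A'
              rest⊆A' u = ∈∖⁺ (j∉⇒⊆U j∉expand (∖⊆ u)) λ q → proj₂ (∈∖⁻ u) (only-e q)
              leaf : ∀ x → inc e₁ x + inc e₂ x ≡ 1 → V A' x
              leaf x eq = decidable-stable (V? A' x) λ n → circuit-no-leaf j∉expand (circuit-expand o₀ cC) x
                (trans (deg-expand eL eC o₀ x) (trans (cong (inc e₁ x + inc e₂ x +_) (1≰⇒≡0 λ q → n (V-mono rest⊆A' x q))) (trans (+-identityʳ _) eq)))
              zero₁ : inc e₁ x₂ ≡ 0
              zero₁ = 1≰⇒≡0 λ q → [ x₂≢w , (λ eq → x₁≢x₂ (sym eq)) ]′ (inc-ends (x₁≢w ∘ sym) (≤-reflexive (sym one₁)) at₁ q)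
              zero₂ : inc e₂ x₁ ≡ 0
              zero₂ = 1≰⇒≡0 λ q → [ x₁≢w , x₁≢x₂ ]′ (inc-ends (x₂≢w ∘ sym) (≤-reflexive (sym one₂)) at₂ q)
          in x₁≢x₂ (common (leaf x₁ (cong₂ _+_ (≤-antisym (link-e one₁) at₁) zero₂)) (inB at₁)
                          (leaf x₂ (cong₂ _+_ zero₁ (≤-antisym (link-e one₂) at₂))) (inB' at₂))

        -- With at most one common vertex, `nv B₁ + nv A' ≤ suc (nv U)`. Then `collect B₁`, which
        -- contains `e` and another element but neither `a` nor `b`, would be a 2-separation.
        impossible : False
        impossible =
          let (h , h≢e , hB) = another
              (J , indJ , leJ) = full
              sep = no-separation-over 2 no-sep₂ (collect B₁) (two-elements hB e∈collect h≢e)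
                      (two-elements (not-collected (inj₁ refl)) (not-collected (inj₂ refl)) a≢b)
                      (λ I s av ind → ≤-trans (independent-card (av eL) ind) (nv-mono (in-B₁ s (av eL))))
                      (λ I s av ind → ≤-trans (independent-card (av eL) ind) (nv-mono (in-A' s (av eL)))) J indJ
          in <⇒≱ (≤-reflexive (+-comm 2 (nv U))) (≤-trans (+-monoˡ-≤ 2 leJ) (≤-trans sep bound))
          where
          with-common : ∀ s → (∀ {x} → V A' x → V B₁ x → x ≡ s) → nv B₁ + nv A' ≤ nv U + 1
          with-common s h = subst₂ _≤_ (∑-distrib-+ (λ z → sg (d B₁ z)) (λ z → sg (d A' z))) (trans (∑-distrib-+ (λ z → sg (d U z)) (δ s)) (cong (nv U +_) (∑δ s))) (∑-mono pointwise)
            where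
            U-at : ∀ {S} → j ∉ S → ∀ {z} → V S z → 1 ≤ sg (d U z)
            U-at nj p = ≤-reflexive (sym (sg-pos (V-mono (j∉⇒⊆U nj) _ p)))
            jB : j ∉ B₁
            jB u = proj₁ (S₀⁻ (B₁⊆S₀ u)) refl
            jA : j ∉ A'
            jA u = j∉U (∖⊆ u)
            pointwise : ∀ z → sg (d B₁ z) + sg (d A' z) ≤ sg (d U z) + δ s z
            pointwise z = case ((V? B₁ z) ) of λ where
              (no n) → ≤-trans (≤-reflexive (cong (_+ sg (d A' z)) (cong sg (1≰⇒≡0 n)))) (≤-trans (sg-mono (deg-mono (j∉⇒⊆U jA) z)) (m≤m+n _ _))
              (yes p) → case (V? A' z) of λ where
                (no n) → ≤-trans (≤-reflexive (trans (cong (sg (d B₁ z) +_) (cong sg (1≰⇒≡0 n))) (+-identityʳ _))) (≤-trans (sg-mono (deg-mono (j∉⇒⊆U jB) z)) (m≤m+n _ _))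
                (yes q) → ≤-trans (+-mono-≤ (≤-trans (sg≤1 (d B₁ z)) (U-at jB p)) (sg≤1 (d A' z))) (+-monoʳ-≤ (sg (d U z)) (≤-reflexive (sym (trans (cong (λ y → δ y z) (sym (h q p))) (δ-refl z)))))
          bound : nv B₁ + nv A' ≤ suc (nv U)
          bound = ≤-trans (case any? (λ s → V? A' s ×-dec V? B₁ s) of λ where
              (yes (s , p , q)) → with-common s λ p' q' → common p' q' p q
              -- Without a common vertex the allowance of one can be placed at any vertex.
              (no n) → with-common wₑ λ p q → ⊥-elim (n (_ , p , q)))
            (≤-reflexive (+-comm (nv U) 1))

  -- The target is a triple with one loop at `wₑ` and two links from `wₑ` to `x`. The field `types`
  -- lists what is left of it when one element is deleted.
  record Pendant : Set where
    field
      x : Fin v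
      x≢w : x ≢ wₑ
      ends₁ : ∀ y → 1 ≤ inc e₁ y → y ≡ wₑ ⊎ y ≡ x
      ends₂ : ∀ y → 1 ≤ inc e₂ y → y ≡ wₑ ⊎ y ≡ x
      types : (inc e₁ wₑ ≡ 1 × inc e₂ wₑ ≡ 1) ⊎ (inc e₁ wₑ ≡ 2 × inc e₂ wₑ ≡ 1) ⊎ (inc e₁ wₑ ≡ 1 × inc e₂ wₑ ≡ 2)

  link-ends : ∀ {t x} → x ≢ wₑ → inc t wₑ ≡ 1 → 1 ≤ inc t x → ∀ y → 1 ≤ inc t y → y ≡ wₑ ⊎ y ≡ x
  link-ends ne one q y r = inc-ends (ne ∘ sym) (≤-reflexive (sym one)) q r

  loop-ends : ∀ {t x} → inc t wₑ ≡ 2 → ∀ y → 1 ≤ inc t y → y ≡ wₑ ⊎ y ≡ x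
  loop-ends {t} two y q = inj₁ (decidable-stable (y ≟F wₑ) λ n → <⇒≱ (+-mono-≤ q (≤-reflexive (sym two))) (≤-trans (∑-two-terms (inc t) n) (≤-reflexive (inc-sum t))))

  opaque
    -- The circuit through `e` avoiding `b` has only pieces over `a` besides those over `e`, and it
    -- must continue at both `x₁` and `x₂`. These are touched by pieces over `e`, so neither is the
    -- private vertex of `a`; both are its attachment vertex.
    short-link-impossible : ∀ {x₁ x₂} → (∀ h → h ≡ a ⊎ h ≡ b ⊎ h ≡ e) → x₁ ≢ wₑ → x₂ ≢ wₑ →
      inc e₁ wₑ ≡ 1 → inc e₂ wₑ ≡ 1 → 1 ≤ inc e₁ x₁ → 1 ≤ inc e₂ x₂ → x₁ ≢ x₂ → False
    short-link-impossible {x₁} {x₂} three n₁ n₂ one₁ one₂ at₁ at₂ ne = ne (trans (at-p n₁ one-at₁) (sym (at-p n₂ one-at₂)))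
      where
      C : Subset k
      C = proj₁ through-e
      cC : Circuit N C
      cC = proj₁ (proj₂ through-e)
      eC : e ∈ C
      eC = proj₁ (proj₂ (proj₂ through-e))
      bC : b ∉ C
      bC = proj₂ (proj₂ (proj₂ through-e))
      module A = Ends (ends aL a≢e)
      le : ∀ {t x} → x ≢ wₑ → inc t wₑ ≡ 1 → inc t x ≤ 1
      le {t} {x} n one = +-cancelʳ-≤ 1 (inc t x) 1 (≤-trans (≤-reflexive (cong (inc t x +_) (sym one))) (≤-trans (∑-two-terms (inc t) n) (≤-reflexive (inc-sum t))))
      zero₁ : inc e₁ x₂ ≡ 0
      zero₁ = 1≰⇒≡0 λ q → [ n₂ , (λ eq → ne (sym eq)) ]′ (link-ends n₁ one₁ at₁ x₂ q)
      zero₂ : inc e₂ x₁ ≡ 0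
      zero₂ = 1≰⇒≡0 λ q → [ n₁ , ne ]′ (link-ends n₂ one₂ at₂ x₁ q)
      one-at₁ : inc e₁ x₁ + inc e₂ x₁ ≡ 1
      one-at₁ = cong₂ _+_ (≤-antisym (le n₁ one₁) at₁) zero₂
      one-at₂ : inc e₁ x₂ + inc e₂ x₂ ≡ 1
      one-at₂ = cong₂ _+_ zero₁ (≤-antisym (le n₂ one₂) at₂)
      rest⊆Ta : expand C o₀ ∖ T e ⊆ T a
      rest⊆Ta {t} u = case Expand.member C o₀ (∖⊆ u) of λ where
        (inj₁ (h , n , refl , q)) → ⊥-elim (n ([ (λ { refl → aL }) , [ (λ { refl → bL }) , (λ { refl → eL }) ]′ ]′ (three h)))
        (inj₂ (h , i , hL , refl , q , _)) → [ (λ { refl → T⁺ aL i }) , [ (λ { refl → ⊥-elim (bC q) }) , (λ { refl → ⊥-elim (proj₂ (∈∖⁻ u) (T⁺ eL i)) }) ]′ ]′ (three h)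
      at-p : ∀ {x} → x ≢ wₑ → inc e₁ x + inc e₂ x ≡ 1 → x ≡ A.p
      at-p {x} n one =
        let positive : 1 ≤ d (expand C o₀ ∖ T e) x
            positive = ≮⇒≥ λ z → circuit-no-leaf j∉expand (circuit-expand o₀ cC) x
              (trans (deg-expand eL eC o₀ x) (trans (cong (inc e₁ x + inc e₂ x +_) (n≤0⇒n≡0 (≤-pred z))) (trans (+-identityʳ _) one)))
        in [ (λ { refl → ⊥-elim (A.off (edge one)) }) , id ]′ (A.only x (V-mono rest⊆Ta x positive))
        where
        edge : inc e₁ x + inc e₂ x ≡ 1 → V (Y a) x
        edge one = case 1 ≤? inc e₁ x of λ where
          (yes q) → ≤-trans q (deg-inc (piece∈Y eL (a≢e ∘ sym) (1F≢j eL)) x)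
          (no q) → ≤-trans (≤-reflexive (sym (trans (cong (_+ inc e₂ x) (sym (1≰⇒≡0 q))) one))) (deg-inc (piece∈Y eL (a≢e ∘ sym) (2F≢j eL)) x)

  -- Only two links with different far ends need an argument. The double negation comes from the
  -- Menger argument, which assumes that cycles and forests of the auxiliary graph are decidable.
  pendant : (∀ C → Circuit N C → a ∈ C → b ∈ C → e ∈ C → False) → (∀ h → h ≡ a ⊎ h ≡ b ⊎ h ≡ e) ⊎ 4 ≤ k →
    (∀ H → ¬ ¬ ((∀ X → Dec (IsCycle {v} H X)) × (∀ X → Dec (Counting.Forest H X)))) → ¬ ¬ Pendant
  pendant none small decide no-pendant = go shape-e
    where
    go : Shape → False
    go (loop-link n p q r) = no-pendant record { x≢w = n ; ends₁ = loop-ends p ; ends₂ = link-ends n q r ; types = inj₂ (inj₁ (p , q)) }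
    go (link-loop n p q r) = no-pendant record { x≢w = n ; ends₁ = link-ends n p r ; ends₂ = loop-ends q ; types = inj₂ (inj₂ (p , q)) }
    go (link-link {x₁} {x₂} n₁ n₂ p q r₁ r₂) = case x₁ ≟F x₂ of λ where
      (yes refl) → no-pendant record { x≢w = n₁ ; ends₁ = link-ends n₁ p r₁ ; ends₂ = link-ends n₁ q r₂ ; types = inj₁ (p , q) }
      (no ne) → [ (λ three → short-link-impossible three n₁ n₂ p q r₁ r₂ ne) ,
                  (λ big → decide (Linked.H big none n₁ n₂ p q r₁ r₂ ne)
                     λ (c? , f?) → Linked.impossible big none n₁ n₂ p q r₁ r₂ ne c? f?) ]′ small

-- Completing a pendant pair to a pendant triple represents M

module Extend {k m : ℕ} (N : Matroid k) (L : Subset k) (M : Matroid m)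
  (sum₂ : IsTwoSumU24 (Circuit N) L (Circuit M)) (decM : ∀ X → Dec (Circuit M X))
  {e : Fin k} (eL : e ∈ L) {v : ℕ} (G : Graph v m) (rep : Represents M (TwoSum.f₂ N L M sum₂ e 0F) G)
  {w x : Fin v}
  (ends : ∀ i y → 1 ≤ Counting.inc G (TwoSum.f₂ N L M sum₂ e i) y → y ≡ w ⊎ y ≡ x)
  (touch : ∀ o y → y ≡ w ⊎ y ≡ x → ∃[ i ] (i ≢ o × 1 ≤ Counting.inc G (TwoSum.f₂ N L M sum₂ e i) y))
  (j-at-w : 1 ≤ Counting.inc G (TwoSum.f₂ N L M sum₂ e 0F) w)
  (private-w : ∀ {t} → t ∉ TwoSum.T N L M sum₂ e → ¬ 1 ≤ Counting.inc G t w) where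

  open TwoSum N L M sum₂
  j : Fin m
  j = f₂ e 0F
  open Represented N L M sum₂ j G rep
  open Counting G
  open Shapes G
  open Represents rep

  off-T : ∀ {h i} → h ∈ L → h ≢ e → f₂ h i ∉ T e
  off-T hL ne u = ne (sym (f₂-owner eL hL (proj₂ (T⁻ u))))

  few-vertices : ∀ {S} → S ⊆ T e → nv S ≤ 2
  few-vertices {S} s = subst (nv S ≤_) (∑δδ w x) (∑-mono pointwise)
    where
    at : ∀ y → V S y → 1 ≤ δ w y + δ x y
    at y p with deg-pos p
    ... | t , u , q with T⁻ {e} (s u)
    ...   | i , refl = [ (λ { refl → ≤-trans (≤-reflexive (sym (δ-refl y))) (m≤m+n _ _) }) , (λ { refl → ≤-trans (≤-reflexive (sym (δ-refl y))) (m≤n+m _ (δ w y)) }) ]′ (ends i y q)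
    pointwise : ∀ y → sg (d S y) ≤ δ w y + δ x y
    pointwise y = case V? S y of λ where
      (no n) → ≤-trans (≤-reflexive (cong sg (1≰⇒≡0 n))) z≤n
      (yes p) → ≤-trans (sg≤1 _) (at y p)

  dependent-avoiding : ∀ {S} → j ∉ S → nv S < ∣ S ∣ → ∃[ Z ] (Circuit M Z × Z ⊆ S)
  dependent-avoiding {S} nj lt = choose (anySubset? (λ D → decM D ×-dec (D ⊆? Y)))
    where
    found : ∃[ Y ] (Y ⊆ S × Bicycle Y)
    found = bicycle-in lt
    Y : Subset m
    Y = proj₁ found
    s : Y ⊆ S
    s = proj₁ (proj₂ found)
    choose : Dec (∃[ D ] (Circuit M D × D ⊆ Y)) → ∃[ Z ] (Circuit M Z × Z ⊆ S)
    choose (yes (D , c , sD)) = D , c , λ u → s (sD u)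
    choose (no n) = Y , unbalanced-circuit (λ u → nj (s u)) (proj₂ (proj₂ found)) (λ D sD _ c → n (D , c , sD)) , s

  -- If S contains j and one more element of the triple over e, then trading j for the third element neither changes the
  -- vertices nor the number of edges, and a circuit of M avoiding j is traded back to one inside S.
  module Swap {S : Subset m} (lt : nv S < ∣ S ∣) (jS : j ∈ S) (i : Fin 3) (i≢0 : i ≢ 0F)
    (out : f₂ e i ∉ S) (rest-in : ∀ i' → i' ≢ i → f₂ e i' ∈ S) where
    t : Fin m
    t = f₂ e i
    S* : Subset m
    S* = (S ∖ ⁅ j ⁆) ∪ ⁅ t ⁆
    j∉S* : j ∉ S*
    j∉S* u = [ (λ r → proj₂ (∈∖⁻ r) (x∈⁅x⁆ j)) , (λ r → i≢0 (sym (f₂-injective eL (x∈⁅y⁆⇒x≡y t r)))) ]′ (x∈p∪q⁻ (S ∖ ⁅ j ⁆) ⁅ t ⁆ u)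
    size : ∣ S* ∣ ≡ ∣ S ∣
    size = trans (card-∪ λ p q → out (∖⊆ (subst (_∈ S ∖ ⁅ j ⁆) (x∈⁅y⁆⇒x≡y t q) p)))
      (trans (cong (∣ S ∖ ⁅ j ⁆ ∣ +_) (∣⁅x⁆∣≡1 t)) (trans (+-comm _ 1) (sym (card-∈ jS))))
    same-vertices : ∀ y → V S* y → V S y
    same-vertices y p = [ V-mono ∖⊆ y , (λ q → let (i' , ne , r) = touch i y (ends i y (≤-trans q (≤-reflexive (deg-⁅⁆ t y)))) in ≤-trans r (deg-inc (rest-in i' ne) y)) ]′ (V-∪ {S ∖ ⁅ j ⁆} {⁅ t ⁆} p)
    back : ∀ {Z} → Z ⊆ S* → ∀ {u} → u ∈ Z → u ≢ t → u ∈ S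
    back s u ne = [ ∖⊆ , (λ r → ⊥-elim (ne (x∈⁅y⁆⇒x≡y t r))) ]′ (x∈p∪q⁻ (S ∖ ⁅ j ⁆) ⁅ t ⁆ (s u))
    circuit : ∃[ Z ] (Circuit M Z × Z ⊆ S)
    circuit = resolve (dependent-avoiding j∉S* (≤-trans (s≤s (nv-mono-V same-vertices)) (≤-trans lt (≤-reflexive (sym size)))))
      where
      swapped : ∀ {Z} → Circuit M Z → Z ⊆ S* → t ∈ Z → (∃[ g ] (g ∈ L × Z ≡ T g)) ⊎ (∃[ C ] ∃[ o ] (Circuit N C × Z ≡ expand C o)) → ∃[ Z ] (Circuit M Z × Z ⊆ S)
      swapped c s tZ (inj₁ (g , gL , refl)) = ⊥-elim (j∉S* (s (subst (λ h → f₂ h 0F ∈ T g) (f₂-owner gL eL (proj₂ (T⁻ {g} tZ))) (T⁺ gL 0F))))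
      swapped c s tZ (inj₂ (C , o , cC , refl)) = expand C (swap o e i) , circuit-expand _ cC , into
        where
        eC : e ∈ C
        eC = proj₁ (Expand.piece⁻ C o eL tZ)
        into : expand C (swap o e i) ⊆ S
        into {u} m with u ∈? T e
        ... | no n = back s (∖⊆ (swap-rest⊆ eL eC o i (∈∖⁺ m n))) λ { refl → n (T⁺ eL i) }
        ... | yes q with T⁻ {e} q
        ...   | i' , refl = rest-in i' λ eq → proj₂ (Expand.piece⁻ C (swap o e i) eL m) (trans eq (sym (swap-at o e i)))
      resolve : ∃[ Z ] (Circuit M Z × Z ⊆ S*) → ∃[ Z ] (Circuit M Z × Z ⊆ S)
      resolve (Z , c , s) with t ∈? Z
      ... | yes tZ = swapped c s tZ (circuit-cases c)
      ... | no n = Z , c , λ u → back s u λ { refl → n u }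

  opaque
    -- The cases go by the pieces over `e` in `S`. If `j` is the only one, deleting it also loses
    -- the vertex `w`, so edges still outnumber vertices.
    dependent-set : ∀ {S} → nv S < ∣ S ∣ → ∃[ Z ] (Circuit M Z × Z ⊆ S)
    dependent-set {S} lt with j ∈? S | f₂ e 1F ∈? S | f₂ e 2F ∈? S
    ... | no nj | _ | _ = dependent-avoiding nj lt
    ... | yes p₀ | yes p₁ | yes p₂ = T e , circuit-T eL , λ u → case T⁻ {e} u of λ where
          (0F , refl) → p₀
          (1F , refl) → p₁
          (2F , refl) → p₂
    ... | yes p₀ | yes p₁ | no n₂ = Swap.circuit lt p₀ 2F (λ ()) n₂ λ where
          0F _ → p₀
          1F _ → p₁
          2F ne → ⊥-elim (ne refl)
    ... | yes p₀ | no n₁ | yes p₂ = Swap.circuit lt p₀ 1F (λ ()) n₁ λ where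
          0F _ → p₀
          2F _ → p₂
          1F ne → ⊥-elim (ne refl)
    ... | yes p₀ | no n₁ | no n₂ =
      let (Z , c , s) = dependent-avoiding {S ∖ ⁅ j ⁆} (λ u → proj₂ (∈∖⁻ u) (x∈⁅x⁆ j)) (≤-pred (≤-trans (s≤s (nv-extra (V-mono ∖⊆) w unseen (≤-trans j-at-w (deg-inc p₀ w)))) (≤-trans lt (≤-reflexive (card-∈ p₀)))))
      in Z , c , λ u → ∖⊆ (s u)
      where
      not-T : ∀ {t} → t ∈ S ∖ ⁅ j ⁆ → t ∉ T e
      not-T u r with T⁻ {e} r
      ... | 0F , refl = proj₂ (∈∖⁻ u) (x∈⁅x⁆ j)
      ... | 1F , refl = n₁ (∖⊆ u)
      ... | 2F , refl = n₂ (∖⊆ u)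
      unseen : ¬ V (S ∖ ⁅ j ⁆) w
      unseen q = let (t , u , r) = deg-pos q in private-w (not-T u) r

    -- Omitting `j` instead gives a circuit of the same size that misses no vertex of `X`. It
    -- contains two edges on two vertices, hence a smaller cycle, so it must be a bicycle.
    many-edges : ∀ {X} → Circuit M X → j ∈ X → nv X < ∣ X ∣
    many-edges {X} c jX = go (circuit-cases c)
      where
      go : (∃[ g ] (g ∈ L × X ≡ T g)) ⊎ (∃[ C ] ∃[ o ] (Circuit N C × X ≡ expand C o)) → nv X < ∣ X ∣
      go (inj₁ (g , gL , eq)) with f₂-owner gL eL (proj₂ (T⁻ {g} (subst (j ∈_) eq jX)))
      ... | refl = ≤-trans (s≤s (few-vertices (λ u → subst (_ ∈_) eq u))) (≤-reflexive (sym (trans (cong ∣_∣ eq) (card-T eL))))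
      go (inj₂ (C , o , cC , refl)) =
        [ (λ cyc → ⊥-elim (expand⊈T eL eC cC o' λ {u} q → pair⊆T (small (cycle-⊆ pair-cyc cyc (λ r → pair⊆X* (pair-s r))) q))) ,
          (λ bi → ≤-trans (s≤s (nv-mono-V same)) (≤-trans (≤-reflexive (sym (proj₂ (proj₂ bi)))) (≤-reflexive sizes))) ]′ (shape njX* (circuit-expand o' cC))
        where
        eC : e ∈ C
        eC = proj₁ (Expand.piece⁻ C o eL jX)
        o' : Fin k → Fin 3
        o' = swap o e 0F
        X* : Subset m
        X* = expand C o'
        in-X* : ∀ i → i ≢ 0F → f₂ e i ∈ X*
        in-X* i ne = Expand.piece⁺ C o' eL (eC , λ eq → ne (trans eq (swap-at o e 0F)))
        njX* : j ∉ X*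
        njX* u = proj₂ (Expand.piece⁻ C o' eL u) (sym (swap-at o e 0F))
        P : Subset m
        P = ⁅ f₂ e 1F ⁆ ∪ ⁅ f₂ e 2F ⁆
        pair⊆T : P ⊆ T e
        pair⊆T = ∪⊆ (⁅⁆⊆ (T⁺ eL 1F)) (⁅⁆⊆ (T⁺ eL 2F))
        pair⊆X* : P ⊆ X*
        pair⊆X* = ∪⊆ (⁅⁆⊆ (in-X* 1F λ ())) (⁅⁆⊆ (in-X* 2F λ ()))
        found : ∃[ D ] (D ⊆ P × IsCycle G D)
        found = cycle-in (f₂ e 1F , ∪ˡ (x∈⁅x⁆ _)) (≤-trans (few-vertices pair⊆T) (≤-reflexive (sym (trans (card-∪ λ p q → pair≢ eL 0F (trans (sym (x∈⁅y⁆⇒x≡y _ p)) (x∈⁅y⁆⇒x≡y _ q))) (cong₂ _+_ (∣⁅x⁆∣≡1 (f₂ e 1F)) (∣⁅x⁆∣≡1 (f₂ e 2F)))))))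
        pair-s : proj₁ found ⊆ P
        pair-s = proj₁ (proj₂ found)
        pair-cyc : IsCycle G (proj₁ found)
        pair-cyc = proj₂ (proj₂ found)
        small : proj₁ found ≡ X* → ∀ {u} → u ∈ X* → u ∈ P
        small eq q = pair-s (subst (_ ∈_) (sym eq) q)
        sizes : ∣ X* ∣ ≡ ∣ expand C o ∣
        sizes = trans (card-expand eL eC o') (trans (cong (λ S → suc (suc ∣ S ∣)) (swap-rest eL eC o 0F)) (sym (card-expand eL eC o)))
        same : ∀ y → V (expand C o) y → V X* y
        same y p with deg-pos p
        ... | t , u , q with t ∈? T e
        ...   | no n = ≤-trans q (deg-inc (∖⊆ (swap-rest⊇ eL eC o 0F (∈∖⁺ u n))) y)
        ...   | yes r with T⁻ {e} r
        ...     | i , refl = let (i' , ne , s) = touch 0F y (ends i y q) in ≤-trans s (deg-inc (in-X* i' ne) y)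

    -- A circuit through `j` contains a bicycle, which contains a circuit by `dependent-set`;
    -- incomparability makes all three equal.
    circuit-shape : ∀ {X} → Circuit M X → IsCycle G X ⊎ Bicycle X
    circuit-shape {X} c with j ∈? X
    ... | no n = shape n c
    ... | yes p =
      let (Y , s , bi) = bicycle-in (many-edges c p)
          (Z , cZ , sZ) = dependent-set (≤-reflexive (sym (proj₂ (proj₂ bi))))
          eq = incomp M Z X cZ c (λ u → s (sZ u))
      in inj₂ (subst Bicycle (⊆-antisym s (λ u → sZ (subst (_ ∈_) (sym eq) u))) bi)

  Balanced : Subset m → Set
  Balanced X = IsCycle G X × Circuit M X

  cycle≢bicycle : ∀ {X} → IsCycle G X → ¬ Bicycle X
  cycle≢bicycle cyc (_ , _ , size) = 1+n≢n (trans (sym size) (cycle-card cyc))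

  circuit⇒frame : ∀ {X} → Circuit M X → FrameCircuit G Balanced X
  circuit⇒frame {X} c = [ (λ cyc → inj₁ (cyc , cyc , c)) ,
    (λ bi → Classify.bicycle⇒frame G bi λ D s cyc (_ , cD) → cycle≢bicycle cyc (subst Bicycle (sym (incomp M D X cD c s)) bi)) ]′ (circuit-shape c)

  frame⇒circuit : ∀ {X} → FrameCircuit G Balanced X → Circuit M X
  frame⇒circuit {X} f with frame⇒bicycle f
  ... | inj₁ (_ , _ , c) = c
  ... | inj₂ (bi , unb) =
    let (Z , c , s) = dependent-set (≤-reflexive (sym (proj₂ (proj₂ bi))))
    in [ (λ cyc → ⊥-elim (unb Z s cyc (cyc , c))) , (λ bi' → subst (Circuit M) (bicycle-⊆ bi' bi s) c) ]′ (circuit-shape c)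

  -- Eliminating an edge of the path common to two balanced cycles leaves a circuit in the theta
  -- that misses this edge. It is neither the whole theta nor one of the two cycles, so it is the
  -- third.
  biased : IsBiased G Balanced
  biased = (λ C → proj₁) , λ u u' P₁ P₂ P₃ θ (c₁₂ , m₁₂) (c₁₃ , m₁₃) not →
    let module Θ = Theta θ
        (z , z₁) = Θ.𝟏.nonempty
        (y , y₂) = Θ.𝟐.nonempty
        (F , cF , sF) = elim M (P₁ ∪ P₂) (P₁ ∪ P₃) z m₁₂ m₁₃
          (λ eq → [ (λ y₁ → Θ.dis₁₂ y₁ y₂) , (λ y₃ → Θ.dis₂₃ y₂ y₃) ]′ (x∈p∪q⁻ P₁ P₃ (subst (y ∈_) eq (∪ʳ {A = P₁} y₂)))) (∪ˡ z₁) (∪ˡ z₁)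
        z∉F : z ∉ F
        z∉F u = proj₂ (∈-⁻ {p = (P₁ ∪ P₂) ∪ (P₁ ∪ P₃)} (sF u)) refl
        F⊆ : F ⊆ P₁ ∪ P₂ ∪ P₃
        F⊆ u = ∪⊆ (∪⊆ ∪ˡ (λ r → ∪ʳ {A = P₁} (∪ˡ r))) (∪⊆ ∪ˡ (λ r → ∪ʳ {A = P₁} (∪ʳ {A = P₂} r))) (proj₁ (∈-⁻ {p = (P₁ ∪ P₂) ∪ (P₁ ∪ P₃)} (sF u)))
    in case circuit-shape cF of λ where
         (inj₂ bi) → z∉F (subst (z ∈_) (sym (bicycle-⊆ bi Θ.bicycle F⊆)) (∪ˡ z₁))
         (inj₁ cyc) → case Θ.cycles cyc F⊆ of λ where
           (inj₁ eq) → z∉F (subst (z ∈_) (sym eq) (∪ˡ z₁))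
           (inj₂ (inj₁ eq)) → z∉F (subst (z ∈_) (sym eq) (∪ˡ z₁))
           (inj₂ (inj₂ eq)) → not (subst Balanced eq (cyc , cF))

  is-frame : IsFrame M
  is-frame = v , G , Balanced , biased , λ X → circuit⇒frame , frame⇒circuit

-- The case of no circuit of N through three elements of L

card-∪≤ : ∀ {n} (A B : Subset n) → ∣ A ∪ B ∣ ≤ ∣ A ∣ + ∣ B ∣
card-∪≤ A B = ≤-trans (≤-reflexive (card-∖ {A = A} ∪ˡ)) (+-monoʳ-≤ (∣ A ∣)
  (p⊆q⇒∣p∣≤∣q∣ λ m → [ (λ q → ⊥-elim (proj₂ (∈∖⁻ m) q)) , id ]′ (x∈p∪q⁻ A B (∖⊆ m))))

three-elements : ∀ {n} (S : Subset n) → 3 ≤ ∣ S ∣ → ∃[ a ] ∃[ b ] ∃[ e ] (a ∈ S × b ∈ S × e ∈ S × a ≢ b × a ≢ e × b ≢ e)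
three-elements S le =
  let (a , aS , le₁) = pick S le
      (b , bS , le₂) = pick (S ∖ ⁅ a ⁆) le₁
      (e , eS , _) = pick (S ∖ ⁅ a ⁆ ∖ ⁅ b ⁆) le₂
  in a , b , e , aS , ∖⊆ bS , ∖⊆ (∖⊆ eS) , differ bS , differ' eS , differ eS
  where
  pick : ∀ {n k} (S : Subset n) → suc k ≤ ∣ S ∣ → ∃[ a ] (a ∈ S × k ≤ ∣ S ∖ ⁅ a ⁆ ∣)
  pick S le with nonempty? S
  ... | yes (a , m) = a , m , ≤-pred (≤-trans le (≤-reflexive (trans (card-∖ {A = ⁅ a ⁆} λ q → subst (_∈ S) (sym (x∈⁅y⁆⇒x≡y a q)) m) (cong (_+ ∣ S ∖ ⁅ a ⁆ ∣) (∣⁅x⁆∣≡1 a)))))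
  ... | no em = ⊥-elim (n≮0 (≤-trans le (≤-reflexive (empty-card em))))
  differ : ∀ {n} {S : Subset n} {a b} → b ∈ S ∖ ⁅ a ⁆ → a ≢ b
  differ m refl = proj₂ (∈∖⁻ m) (x∈⁅x⁆ _)
  differ' : ∀ {n} {S : Subset n} {a b e} → e ∈ S ∖ ⁅ a ⁆ ∖ ⁅ b ⁆ → a ≢ e
  differ' m = differ (∖⊆ m)

module _ {k m : ℕ} (N : Matroid k) (L : Subset k) (M : Matroid m)
  (sum₂ : IsTwoSumU24 (Circuit N) L (Circuit M)) (three : ThreeConnected N) (excluded : ExcludedMinorFrame M)
  (avoiding : (∀ X → Dec (Circuit N X)) → Avoiding N) (crossing : (∀ X → Dec (Circuit N X)) → Crossing N)
  {a b e : Fin k} (aL : a ∈ L) (bL : b ∈ L) (eL : e ∈ L) (a≢b : a ≢ b) (a≢e : a ≢ e) (b≢e : b ≢ e)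
  (small : (∀ h → h ≡ a ⊎ h ≡ b ⊎ h ≡ e) ⊎ 4 ≤ k)
  (none : ∀ C → Circuit N C → a ∈ C → b ∈ C → e ∈ C → False) where

  open TwoSum N L M sum₂

  no-excluded-minor : False
  no-excluded-minor = ¬¬-decidable (Circuit N) λ decN → ¬¬-decidable (Circuit M) λ decM → classical decN decM
    where
    open Representation (representation M excluded (f₂ e 0F))
    injective : ∀ {h i i'} → h ∈ L → f₂ h i ≡ f₂ h i' → i ≡ i'
    injective {h} {i} {i'} hL eq = proj₂ (proj₁ (proj₂ (proj₂ (proj₂ sum₂))) h h i i' hL hL eq)
    start : Fin v
    start = vertex (f₂ e 1F) λ eq → case injective eL eq of λ ()
    module _ (decN : ∀ X → Dec (Circuit N X)) (decM : ∀ X → Dec (Circuit M X)) where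
      G₀ : Graph v m
      G₀ = graph (start , start)
      setting : Setting
      setting = record
        { N = N ; L = L ; M = M ; sum₂ = sum₂ ; decN = decN ; decM = decM
        ; no-sep₁ = proj₁ three ; no-sep₂ = proj₂ three ; avoiding = avoiding decN ; crossing = crossing decN
        ; eL = eL ; aL = aL ; bL = bL ; a≢b = a≢b ; a≢e = a≢e ; b≢e = b≢e
        ; G = G₀ ; rep = represents (start , start) }

      -- The deleted element becomes a loop at `w` if the other two are links, and otherwise a link
      -- from `w` to `x`, so that the triple always has one loop and two links.
      extend : Tame.Pendant setting → IsFrame M
      extend pend = [ (λ (p , q) → complete (w , w) (inj₁ (refl , p , q))) ,
                      [ (λ (p , q) → complete (w , x) (inj₂ (refl , inj₁ (p , q)))) , (λ (p , q) → complete (w , x) (inj₂ (refl , inj₂ (p , q)))) ]′ ]′ types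
        where
        open Tame.Pendant pend
        w : Fin v
        w = (Tame.wₑ setting)
        module C₀ = Counting G₀
        Val : Fin v × Fin v → Set
        Val val = (val ≡ (w , w) × C₀.inc (Tame.e₁ setting) w ≡ 1 × C₀.inc (Tame.e₂ setting) w ≡ 1) ⊎
                  (val ≡ (w , x) × ((C₀.inc (Tame.e₁ setting) w ≡ 2 × C₀.inc (Tame.e₂ setting) w ≡ 1) ⊎ (C₀.inc (Tame.e₁ setting) w ≡ 1 × C₀.inc (Tame.e₂ setting) w ≡ 2)))
        module _ (val : Fin v × Fin v) (is : Val val) where
          module C₁ = Counting (graph val)
          same : ∀ {t} → t ≢ (Tame.j setting) → ∀ y → C₁.inc t y ≡ C₀.inc t y
          same {t} ne y = trans (C₁.inc≡ t y) (trans (cong (λ z → δ (proj₁ z) y + δ (proj₂ z) y) (off-j val (start , start) t ne)) (sym (C₀.inc≡ t y)))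
          at-j' : ∀ y → C₁.inc (Tame.j setting) y ≡ δ (proj₁ val) y + δ (proj₂ val) y
          at-j' y = trans (C₁.inc≡ (Tame.j setting) y) (cong (λ z → δ (proj₁ z) y + δ (proj₂ z) y) (at-j val))
          end-val : ∀ y → 1 ≤ δ (proj₁ val) y + δ (proj₂ val) y → proj₁ val ≡ y ⊎ proj₂ val ≡ y
          end-val y p with proj₁ val ≟F y
          ... | yes eq = inj₁ eq
          ... | no _ = inj₂ (δ-pos p)
          first : proj₁ val ≡ w
          first = [ (λ r → cong proj₁ (proj₁ r)) , (λ r → cong proj₁ (proj₁ r)) ]′ is
          second : proj₂ val ≡ w ⊎ proj₂ val ≡ x
          second = [ (λ r → inj₁ (cong proj₂ (proj₁ r))) , (λ r → inj₂ (cong proj₂ (proj₁ r))) ]′ is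
          ends : ∀ i y → 1 ≤ C₁.inc (f₂ e i) y → y ≡ w ⊎ y ≡ x
          ends 0F y p = [ (λ r → inj₁ (trans (sym r) first)) , (λ r → [ (λ s → inj₁ (trans (sym r) s)) , (λ s → inj₂ (trans (sym r) s)) ]′ second) ]′ (end-val y (≤-trans p (≤-reflexive (at-j' y))))
          ends 1F y p = ends₁ y (≤-trans p (≤-reflexive (same (Tame.1F≢j setting eL) y)))
          ends 2F y p = ends₂ y (≤-trans p (≤-reflexive (same (Tame.2F≢j setting eL) y)))
          j-at-w : 1 ≤ C₁.inc (Tame.j setting) w
          j-at-w = ≤-trans (≤-trans (≤-reflexive (sym (trans (cong (λ y → δ y w) first) (δ-refl w)))) (m≤m+n _ _)) (≤-reflexive (sym (at-j' w)))
          Both : Fin 3 → Set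
          Both i = 1 ≤ C₁.inc (f₂ e i) w × 1 ≤ C₁.inc (f₂ e i) x
          -- With two links in the triple, leaving out any one piece `o` still leaves a link.
          two-links : ∀ o → ∃[ i ] (i ≢ o × Both i)
          two-links o = [ (λ (_ , p , q) → case o ≟F 1F of λ where
                (yes refl) → 2F , (λ ()) , link₂ q
                (no ne) → 1F , ne ∘ sym , link₁ p) ,
              (λ (r , t) → case o ≟F 0F of λ where
                (no ne) → 0F , ne ∘ sym , j-at-w , ≤-trans (≤-trans (≤-reflexive (sym (trans (cong (λ z → δ (proj₂ z) x) r) (δ-refl x)))) (m≤n+m _ (δ (proj₁ val) x))) (≤-reflexive (sym (at-j' x)))
                (yes refl) → [ (λ (_ , q) → 2F , (λ ()) , link₂ q) , (λ (p , _) → 1F , (λ ()) , link₁ p) ]′ t) ]′ is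
            where
            far : ∀ {t} → (∀ y → 1 ≤ C₀.inc t y → y ≡ w ⊎ y ≡ x) → C₀.inc t w ≡ 1 → 1 ≤ C₀.inc t x
            far {t} h one = let (y , ne , q) = Tame.other-end setting {t} (≤-reflexive one) in [ (λ r → ⊥-elim (ne r)) , (λ r → subst (λ z → 1 ≤ C₀.inc t z) r q) ]′ (h y q)
            link₁ : C₀.inc (Tame.e₁ setting) w ≡ 1 → Both 1F
            link₁ p = ≤-reflexive (sym (trans (same (Tame.1F≢j setting eL) w) p)) , ≤-trans (far ends₁ p) (≤-reflexive (sym (same (Tame.1F≢j setting eL) x)))
            link₂ : C₀.inc (Tame.e₂ setting) w ≡ 1 → Both 2F
            link₂ p = ≤-reflexive (sym (trans (same (Tame.2F≢j setting eL) w) p)) , ≤-trans (far ends₂ p) (≤-reflexive (sym (same (Tame.2F≢j setting eL) x)))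
          touch : ∀ o y → y ≡ w ⊎ y ≡ x → ∃[ i ] (i ≢ o × 1 ≤ C₁.inc (f₂ e i) y)
          touch o y h = let (i , ne , p , q) = two-links o in i , ne , [ (λ { refl → p }) , (λ { refl → q }) ]′ h
          private-w : ∀ {t} → t ∉ T e → ¬ 1 ≤ C₁.inc t w
          private-w {t} n p = Tame.wₑ-off setting (≤-trans p (≤-trans (≤-reflexive (same nj w)) (C₀.deg-inc ([ id , (λ r → ⊥-elim (n r)) ]′ (Tame.∈Y⊎∈T setting eL nj)) w)))
            where
            nj : t ≢ (Tame.j setting)
            nj refl = n (T⁺ eL 0F)
          complete : IsFrame M
          complete = Extend.is-frame N L M sum₂ decM eL (graph val) (represents val) ends touch j-at-w private-w

      decide : ∀ (H : Graph v m) → ¬ ¬ ((∀ X → Dec (IsCycle H X)) × (∀ X → Dec (Counting.Forest H X)))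
      decide H q = ¬¬-decidable (IsCycle H) λ c? → ¬¬-decidable (Counting.Forest H) λ f? → q (c? , f?)

      classical : False
      classical = Tame.pendant setting none small decide λ pend → proj₁ excluded (extend pend)

-- Matroids with at least four elements

two-element-set : ∀ {n} {h g : Fin n} → h ≢ g → ∣ ⁅ h ⁆ ∪ ⁅ g ⁆ ∣ ≡ 2
two-element-set {h = h} {g} ne = trans (card-∪ λ p q → ne (trans (sym (x∈⁅y⁆⇒x≡y h p)) (x∈⁅y⁆⇒x≡y g q))) (cong₂ _+_ (∣⁅x⁆∣≡1 h) (∣⁅x⁆∣≡1 g))

-- Since `h` and `g` together are no 2-separation, some circuit through `h` has all its other
-- elements outside this pair.
large-avoiding : ∀ {k} (N : Matroid k) → 4 ≤ k → ¬ HasSeparation N 2 → (∀ X → Dec (Circuit N X)) → Avoiding N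
large-avoiding {k} N big none dec h g ne =
  let (C , c , hC , s) = circuit-through N dec {⁅ h ⁆ ∪ ⁅ g ⁆} {h} (subst (λ i → ¬ HasSeparation N i) (sym size) none) (∪ˡ (x∈⁅x⁆ h))
        (≤-trans (≤-reflexive size) (≤-trans (∸-mono big (≤-reflexive size)) (≤-reflexive (sym (∣∁p∣≡n∸∣p∣ (⁅ h ⁆ ∪ ⁅ g ⁆))))))
  in C , c , hC , λ gC → [ (λ p → x∈∁p⇒x∉p p (∪ʳ {A = ⁅ h ⁆} (x∈⁅x⁆ g))) , (λ p → ne (sym (x∈⁅y⁆⇒x≡y h p))) ]′ (x∈p∪q⁻ _ ⁅ h ⁆ (s gC))
  where
  size : ∣ ⁅ h ⁆ ∪ ⁅ g ⁆ ∣ ≡ 2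
  size = two-element-set ne

large-crossing : ∀ {k} (N : Matroid k) → 4 ≤ k → Crossing N
large-crossing {k} N big g A B cover _ _ _ _ with 2 ≤? ∣ A ∣ | 2 ≤? ∣ B ∣
... | yes p | _ = inj₂ (inj₁ p)
... | no _ | yes q = inj₂ (inj₂ q)
... | no p | no q = ⊥-elim (<⇒≱ big (≤-trans (≤-reflexive (sym (∣⊤∣≡n k))) (≤-trans (p⊆q⇒∣p∣≤∣q∣ all)
      (≤-trans (card-∪≤ ⁅ g ⁆ (A ∪ B)) (+-mono-≤ (≤-reflexive (∣⁅x⁆∣≡1 g)) (≤-trans (card-∪≤ A B) (+-mono-≤ (≤-pred (≰⇒> p)) (≤-pred (≰⇒> q)))))))))
  where
  all : ⊤ ⊆ ⁅ g ⁆ ∪ (A ∪ B)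
  all {h} _ = [ (λ { refl → ∪ˡ (x∈⁅x⁆ g) }) , (λ r → ∪ʳ {A = ⁅ g ⁆} (x∈p∪q⁺ r)) ]′ (cover h)

large-impossible : ∀ {k m} (N : Matroid k) (L : Subset k) (M : Matroid m) → ThreeConnected N →
  IsTwoSumU24 (Circuit N) L (Circuit M) → ExcludedMinorFrame M → 3 ≤ ∣ L ∣ → 4 ≤ k → False
large-impossible {k} N L M three sum₂ excluded le big = ¬¬-decidable (Circuit N) λ decN →
  let (a , b , e , aL , bL , eL , a≢b , a≢e , b≢e) = three-elements L le
      avoid = large-avoiding N big (proj₂ three)
  in case anySubset? (λ C → decN C ×-dec (a ∈? C) ×-dec (b ∈? C) ×-dec (e ∈? C)) of λ where
       (no none) → no-excluded-minor N L M sum₂ three excluded avoid (λ _ → large-crossing N big) aL bL eL a≢b a≢e b≢e (inj₂ big)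
         λ C c p q r → none (C , c , p , q , r)
       (yes (C , c , aC , bC , eC)) →
         -- A circuit avoiding `b` shows that `C` is not the whole ground set. Deleting an element
         -- over some `y` outside `C` leaves the expansions of `C` and its triples intact.
         let (C' , c' , _ , b∉) = avoid decN a b a≢b
             (y , _ , y∉) = proper {A = C} {⊤} ⊆⊤ λ { refl → b∉ (subst (b ∈_) (sym (incomp N C' ⊤ c' c ⊆⊤)) ∈⊤) }
         in spanned decN c a≢b a≢e b≢e aL bL eL aC bC eC y∉
  where
  open TwoSum N L M sum₂
  injective : ∀ {h h' i i'} → h ∈ L → h' ∈ L → f₂ h i ≡ f₂ h' i' → h ≡ h'
  injective {h} {h'} {i} {i'} p q eq = proj₁ (proj₁ (proj₂ (proj₂ (proj₂ sum₂))) h h' i i' p q eq)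
  spanned : ∀ (decN : ∀ X → Dec (Circuit N X)) {C a b e y} → Circuit N C → a ≢ b → a ≢ e → b ≢ e → a ∈ L → b ∈ L → e ∈ L → a ∈ C → b ∈ C → e ∈ C → y ∉ C → False
  spanned decN {C} {a} {b} {e} {y} c a≢b a≢e b≢e aL bL eL aC bC eC y∉ with y ∈? L
  ... | yes yL = Represented.no-three-triples N L M sum₂ (f₂ y 0F) _ (represents (val , val)) c a≢b a≢e b≢e aL bL eL aC bC eC
          (off aL aC) (off bL bC) (off eL eC) (λ u → y∉ (Over.piece⁻ C yL u))
    where
    open Representation (representation M excluded (f₂ y 0F))
    val : Fin v
    val = vertex (f₂ a 0F) λ eq → y∉ (subst (_∈ C) (injective aL yL eq) aC)
    off : ∀ {g} → g ∈ L → g ∈ C → f₂ y 0F ∉ T g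
    off gL gC u = y∉ (subst (_∈ C) (injective gL yL (proj₂ (T⁻ u))) gC)
  ... | no yL = Represented.no-three-triples N L M sum₂ (f₁ y) _ (represents (val , val)) c a≢b a≢e b≢e aL bL eL aC bC eC
          (off aL) (off bL) (off eL) (λ u → y∉ (Over.plain⁻ C yL u))
    where
    open Representation (representation M excluded (f₁ y))
    differ : ∀ {g i} → g ∈ L → f₁ y ≢ f₂ g i
    differ {g} {i} gL = proj₁ (proj₂ (proj₂ (proj₂ (proj₂ sum₂)))) y g i yL gL
    val : Fin v
    val = vertex (f₂ a 0F) (differ aL ∘ sym)
    off : ∀ {g} → g ∈ L → f₁ y ∉ T g
    off gL u = differ gL (sym (proj₂ (T⁻ u)))

-- The case |E(N)| = 3

only-three : ∀ (g h l : Fin 3) → g ≢ h → g ≢ l → h ≢ l → ∀ x → x ≡ g ⊎ x ≡ h ⊎ x ≡ l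
only-three g h l gh gl hl x = decidable-stable ((x ≟F g) ⊎-dec ((x ≟F h) ⊎-dec (x ≟F l))) λ none →
  <⇒≱ {3} {∣ ⁅ x ⁆ ∪ (⁅ g ⁆ ∪ (⁅ h ⁆ ∪ ⁅ l ⁆)) ∣}
    (≤-reflexive (sym (trans (card-∪ λ p q → apart p q none) (cong₂ _+_ (∣⁅x⁆∣≡1 x) (trans (card-∪ λ p q → apart₂ p q) (cong₂ _+_ (∣⁅x⁆∣≡1 g) (two-element-set hl)))))))
    (∣p∣≤n (⁅ x ⁆ ∪ (⁅ g ⁆ ∪ (⁅ h ⁆ ∪ ⁅ l ⁆))))
  where
  apart₂ : ∀ {u} → u ∈ ⁅ g ⁆ → u ∉ ⁅ h ⁆ ∪ ⁅ l ⁆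
  apart₂ p q with x∈⁅y⁆⇒x≡y g p
  ... | refl = [ (λ r → gh (x∈⁅y⁆⇒x≡y h r)) , (λ r → gl (x∈⁅y⁆⇒x≡y l r)) ]′ (x∈p∪q⁻ ⁅ h ⁆ ⁅ l ⁆ q)
  apart : ∀ {u} → u ∈ ⁅ x ⁆ → u ∈ ⁅ g ⁆ ∪ (⁅ h ⁆ ∪ ⁅ l ⁆) → ¬ (x ≡ g ⊎ x ≡ h ⊎ x ≡ l) → False
  apart p q none with x∈⁅y⁆⇒x≡y x p
  ... | refl = [ (λ r → none (inj₁ (x∈⁅y⁆⇒x≡y g r))) , (λ q' → [ (λ r → none (inj₂ (inj₁ (x∈⁅y⁆⇒x≡y h r)))) , (λ r → none (inj₂ (inj₂ (x∈⁅y⁆⇒x≡y l r)))) ]′ (x∈p∪q⁻ ⁅ h ⁆ ⁅ l ⁆ q')) ]′ (x∈p∪q⁻ ⁅ g ⁆ (⁅ h ⁆ ∪ ⁅ l ⁆) q)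

third : ∀ (h g : Fin 3) → h ≢ g → ∃[ l ] (g ≢ l × h ≢ l)
third 0F 0F ne = ⊥-elim (ne refl)
third 1F 1F ne = ⊥-elim (ne refl)
third 2F 2F ne = ⊥-elim (ne refl)
third 0F 1F _ = 2F , (λ ()) , (λ ())
third 0F 2F _ = 1F , (λ ()) , (λ ())
third 1F 0F _ = 2F , (λ ()) , (λ ())
third 1F 2F _ = 0F , (λ ()) , (λ ())
third 2F 0F _ = 1F , (λ ()) , (λ ())
third 2F 1F _ = 0F , (λ ()) , (λ ())

module ThreeElements (N : Matroid 3) (no-sep₁ : ¬ HasSeparation N 1) (no-top : ¬ Circuit N ⊤) (dec : ∀ X → Dec (Circuit N X)) where

  inside-one : ∀ {C h g} → g ≢ h → Circuit N C → C ⊆ ⁅ h ⁆ → False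
  inside-one {C} {h} ne c s = loopless N dec no-sep₁ ne (subst (Circuit N) (⊆-antisym s λ p →
    let (x , q) = circuit-nonempty N c in subst (_∈ C) (trans (x∈⁅y⁆⇒x≡y h (s q)) (sym (x∈⁅y⁆⇒x≡y h p))) q) c)

  covering : ∀ h → ∃[ C ] (Circuit N C × h ∈ C)
  covering h = let (C , c , p , _) = circuit-through N dec {⁅ h ⁆} {h} (subst (λ i → ¬ HasSeparation N i) (sym (∣⁅x⁆∣≡1 h)) no-sep₁) (x∈⁅x⁆ h)
                     (≤-trans (≤-reflexive (∣⁅x⁆∣≡1 h)) (≤-trans (∸-mono (s≤s (s≤s z≤n)) (≤-reflexive (∣⁅x⁆∣≡1 h))) (≤-reflexive (sym (∣∁p∣≡n∸∣p∣ ⁅ h ⁆)))))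
               in C , c , p

  not-all : ∀ {C g h l} → g ≢ h → g ≢ l → h ≢ l → Circuit N C → g ∈ C → h ∈ C → l ∉ C
  not-all gh gl hl c p q r = no-top (subst (Circuit N) (⊆-antisym ⊆⊤ λ {x} _ →
    [ (λ { refl → p }) , [ (λ { refl → q }) , (λ { refl → r }) ]′ ]′ (only-three _ _ _ gh gl hl x)) c)

  -- Suppose every circuit through `h` contains `g`. As there are no loops and no circuit on all
  -- three elements, a circuit through the third element `l` contains `g` but not `h`. Eliminating
  -- `g` from it and a circuit through `h` then leaves a loop.
  avoiding : Avoiding N
  avoiding h g ne = decidable-stable (anySubset? λ C → dec C ×-dec (h ∈? C) ×-dec ¬? (g ∈? C)) λ none →
    let (l , gl , hl) = third h g ne
        (C₁ , c₁ , h₁) = covering h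
        (C₂ , c₂ , l₂) = covering l
        always : ∀ {C} → Circuit N C → h ∈ C → g ∈ C
        always {C} c p = decidable-stable (g ∈? C) λ n → none (C , c , p , n)
        g₁ = always c₁ h₁
        h∉C₂ : h ∉ C₂
        h∉C₂ p = not-all (ne ∘ sym) gl hl c₂ (always c₂ p) p l₂
        g₂ : g ∈ C₂
        g₂ = decidable-stable (g ∈? C₂) λ n → inside-one hl c₂ λ {x} p → [ (λ { refl → ⊥-elim (n p) }) , [ (λ { refl → ⊥-elim (h∉C₂ p) }) , (λ { refl → x∈⁅x⁆ l }) ]′ ]′ (only-three g h l (ne ∘ sym) gl hl x)
        (F , cF , s) = elim N C₁ C₂ g c₁ c₂ (λ eq → h∉C₂ (subst (h ∈_) eq h₁)) g₁ g₂
        g∉F : g ∉ F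
        g∉F p = proj₂ (∈-⁻ {p = C₁ ∪ C₂} (s p)) refl
    in inside-one hl cF λ {x} p → [ (λ { refl → ⊥-elim (g∉F p) }) , [ (λ { refl → ⊥-elim (g∉F (always cF p)) }) , (λ { refl → x∈⁅x⁆ l }) ]′ ]′ (only-three g h l (ne ∘ sym) gl hl x)

  -- Besides `g` there are just two elements, one on each side. A circuit through one of them that
  -- avoids `g` is no loop, so it contains the other.
  crossing : Crossing N
  crossing g A B cover off dis (h , hA) (h' , hB) =
    let g≢h = off (inj₁ hA) ∘ sym
        g≢h' = off (inj₂ hB) ∘ sym
        h≢h' : h ≢ h'
        h≢h' = λ { refl → dis hA hB }
        (C , c , hC , gC) = avoiding h g (g≢h ∘ sym)
        h'C : h' ∈ C
        h'C = decidable-stable (h' ∈? C) λ n → inside-one g≢h c λ {x} p → [ (λ { refl → ⊥-elim (gC p) }) , [ (λ { refl → x∈⁅x⁆ h }) , (λ { refl → ⊥-elim (n p) }) ]′ ]′ (only-three g h h' g≢h g≢h' h≢h' x)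
    in inj₁ (C , c , gC , (h , hC , hA) , (h' , h'C , hB))

module _ {m : ℕ} (N : Matroid 3) (M : Matroid m) (three : ThreeConnected N)
  (sum₂ : IsTwoSumU24 (Circuit N) ⊤ (Circuit M)) (excluded : ExcludedMinorFrame M) where

  open TwoSum N ⊤ M sum₂

  -- If `⊤` were no circuit, no circuit would contain three elements of `L`, and the case already
  -- excluded would apply.
  ¬¬top-circuit : ¬ ¬ Circuit N ⊤
  ¬¬top-circuit no-top = no-excluded-minor N ⊤ M sum₂ three excluded
    (ThreeElements.avoiding N (proj₁ three) no-top) (ThreeElements.crossing N (proj₁ three) no-top)
    {0F} {1F} {2F} ∈⊤ ∈⊤ ∈⊤ (λ ()) (λ ()) (λ ())
    (inj₁ (only-three 0F 1F 2F (λ ()) (λ ()) (λ ()))) λ C c p q r → no-top (subst (Circuit N) (⊆-antisym ⊆⊤ λ {x} _ → all p q r x) c)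
    where
    all : ∀ {C : Subset 3} → 0F ∈ C → 1F ∈ C → 2F ∈ C → ∀ x → x ∈ C
    all p q r 0F = p
    all p q r 1F = q
    all p q r 2F = r

  -- Constructively, the hypotheses only refute ¬ Circuit N ⊤.  In a representation of M \ f₂ 0 0, however, a 6-element
  -- circuit is never a cycle, and bicycles are found by comparing the numbers of edges and vertices, which is decidable.
  top-circuit : Circuit N ⊤
  top-circuit = extract (circuit-cases circuit-X)
    where
    j : Fin m
    j = f₂ 0F 0F
    open Representation (representation M excluded j)
    injective : ∀ {h h' i i'} → f₂ h i ≡ f₂ h' i' → h ≡ h' × i ≡ i'
    injective {h} {h'} {i} {i'} = proj₁ (proj₂ (proj₂ (proj₂ sum₂))) h h' i i' ∈⊤ ∈⊤
    val : Fin v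
    val = vertex (f₂ 0F 1F) λ eq → case proj₂ (injective eq) of λ ()
    G : Graph v m
    G = graph (val , val)
    open Counting G
    module R = Represented N ⊤ M sum₂ j G (represents (val , val))
    X : Subset m
    X = expand ⊤ (λ _ → 0F)
    j∉X : j ∉ X
    j∉X p = proj₂ (Expand.piece⁻ ⊤ _ ∈⊤ p) refl
    bicycle-X : Circuit N ⊤ → Bicycle X
    bicycle-X c = R.expand-bicycle {⊤} {1F} ∈⊤ ∈⊤ c (λ p → case proj₁ (injective (proj₂ (T⁻ {1F} p))) of λ ()) _ j∉X
    inside : ∃[ Q ] (Q ⊆ X × Bicycle Q)
    inside = bicycle-in (decidable-stable (nv X <? ∣ X ∣) λ n → ¬¬top-circuit λ c → n (≤-reflexive (sym (proj₂ (proj₂ (bicycle-X c))))))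
    Q : Subset m
    Q = proj₁ inside
    s : Q ⊆ X
    s = proj₁ (proj₂ inside)
    circuit-Q : Circuit M Q
    circuit-Q = Represents.unbalanced-circuit (represents (val , val)) (λ p → j∉X (s p)) (proj₂ (proj₂ inside)) λ D sD cyc cD →
      ¬¬top-circuit λ c → 1+n≢n (trans (sym (proj₂ (proj₂ (bicycle-X c))))
        (cycle-card (subst (IsCycle G) (incomp M D X cD (circuit-expand _ c) (λ p → s (sD p))) cyc)))
    circuit-X : Circuit M X
    circuit-X = subst (Circuit M) (decidable-stable (Q ≟S X) λ n → ¬¬top-circuit λ c → n (incomp M Q X circuit-Q (circuit-expand _ c) s)) circuit-Q
    extract : (∃[ g ] (g ∈ ⊤ × X ≡ T g)) ⊎ (∃[ C ] ∃[ o ] (Circuit N C × X ≡ expand C o)) → Circuit N ⊤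
    extract (inj₁ (g , _ , eq)) = ⊥-elim (case trans (sym (owner 0F)) (owner 1F) of λ ())
      where
      owner : ∀ h → g ≡ h
      owner h = proj₁ (injective (proj₂ (T⁻ {g} (subst (f₂ h 1F ∈_) eq (Expand.piece⁺ ⊤ _ ∈⊤ (∈⊤ , λ ()))))))
    extract (inj₂ (C , o , c , eq)) = subst (Circuit N) (⊆-antisym ⊆⊤ λ {h} _ →
      proj₁ (Expand.piece⁻ C o ∈⊤ (subst (f₂ h 1F ∈_) eq (Expand.piece⁺ ⊤ _ ∈⊤ (∈⊤ , λ ()))))) c

  uniform : ∀ C → (Circuit N C → UniformCircuit 2 C) × (UniformCircuit 2 C → Circuit N C)
  uniform C = (λ c → cong ∣_∣ (incomp N C ⊤ c top-circuit ⊆⊤)) , λ eq → subst (Circuit N) (sym (∣p∣≡n⇒p≡⊤ eq)) top-circuit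

  is-N₉ : IsTwoSumU24 {3} (UniformCircuit 2) ⊤ (Circuit M)
  is-N₉ = let (f₁ , f₂ , inj₁₁ , inj₂₂ , inj₁₂ , surj , circuits) = sum₂ in
    f₁ , f₂ , inj₁₁ , inj₂₂ , inj₁₂ , surj , λ X →
      (λ c → [ inj₁ , (λ (C , cC , r) → inj₂ (C , proj₁ (uniform C) cC , r)) ]′ (proj₁ (circuits X) c)) ,
      (λ h → proj₂ (circuits X) ([ inj₁ , (λ (C , u , r) → inj₂ (C , proj₂ (uniform C) u , r)) ]′ h))

theorem3p12 : ∀ {k m} (N : Matroid k) (L : Subset k) (M : Matroid m) →
    ThreeConnected N →
    IsTwoSumU24 (Circuit N) L (Circuit M) →
    ExcludedMinorFrame M →
    3 ≤ ∣ L ∣ →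
    IsTwoSumU24 {3} (UniformCircuit 2) ⊤ (Circuit M)
theorem3p12 {0} N L M three sum₂ excluded le = ⊥-elim (<⇒≱ (s≤s z≤n) (≤-trans le (∣p∣≤n L)))
theorem3p12 {1} N L M three sum₂ excluded le = ⊥-elim (<⇒≱ (s≤s (s≤s z≤n)) (≤-trans le (∣p∣≤n L)))
theorem3p12 {2} N L M three sum₂ excluded le = ⊥-elim (<⇒≱ ≤-refl (≤-trans le (∣p∣≤n L)))
theorem3p12 {3} N L M three sum₂ excluded le with ∣p∣≡n⇒p≡⊤ {p = L} (≤-antisym (∣p∣≤n L) le)
... | refl = is-N₉ N M three sum₂ excluded
theorem3p12 {suc (suc (suc (suc k)))} N L M three sum₂ excluded le =
  ⊥-elim (large-impossible N L M three sum₂ excluded le (s≤s (s≤s (s≤s (s≤s z≤n)))))
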